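{- Given a vertex-weighted graph $G=(V,E,w)$ with $n$ vertices and two non-negative integers $l$ and $u$ with $l\leq u$, the MinNum-$(l,u)$-partition problem and the MaxNum-$(l,u)$-partition problem can each be solved in $\mathcal{O}(n^5)$ time if $G$ is a tree and in $\mathcal{O}(n^6)$ time if $G$ is a cactus graph.
   Context: Graphs are finite, simple and connected. A cactus graph is a graph in which any two simple cycles have at most one vertex in common (equivalently, every edge belongs to at most one simple cycle). Every vertex $v$ has a non-negative integer weight $w(v)$. A partition of $G=(V,E)$ is a partition of $V$ into disjoint non-empty subsets (clusters), each inducing a connected subgraph of $G$. The weight of a cluster $V_i$ is $w(V_i)=\sum_{v\in V_i}w(v)$. An $(l,u)$-partition of $G$ is a partition of $G$ in which every cluster $V_i$ satisfies $l\leq w(V_i)\leq u$. The MinNum- (respectively MaxNum-) $(l,u)$-partition problem is to find an $(l,u)$-partition of $G$ with the minimum (respectively maximum) number of clusters among all $(l,u)$-partitions of $G$, or to determine that no $(l,u)$-partition exists. Running time counts elementary operations, where arithmetic operations on and comparisons of integers have unit cost. -}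

module Defs where

open import Data.Bool.Base using (Bool; T; if_then_else_)
open import Data.Fin.Base using (Fin; zero; suc; toℕ; fromℕ; fromℕ<; inject₁; remQuot)
open import Data.Fin.Subset using (Subset; _∈_; _∩_; ⊤; Nonempty; Empty)
open import Data.Fin.Subset.Properties using (_∈?_)
open import Data.List.Base using (allFin; filter; map)
open import Data.Nat.Base
  using (ℕ; suc; _+_; _*_; _∸_; _^_; _≤_; _≥_; _≤ᵇ_; _≡ᵇ_; NonZero)
open import Data.Nat.ListAction using (sum)
open import Data.Nat.Properties using (_≟_; _<?_)
open import Data.Product.Base using (Σ-syntax; ∃-syntax; _×_; uncurry)
open import Data.Sum.Base using (_⊎_)
open import Function.Base using (_∘_)
open import Function.Bundles using (_⇔_)
open import Function.Definitions using (Injective)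
open import Level using (0ℓ)
open import Relation.Binary.Construct.Closure.ReflexiveTransitive using (Star)
open import Relation.Binary.Construct.Closure.Symmetric using (SymClosure)
open import Relation.Binary.Core using (Rel)
open import Relation.Binary.Definitions using (Symmetric)
open import Relation.Binary.PropositionalEquality.Core using (_≡_; _≢_)
open import Relation.Nullary.Decidable.Core using (yes; no; does)
open import Relation.Nullary.Negation.Core using (¬_)

record Graph (n : ℕ) : Set where
  field
    edge : Fin n → Fin n → Bool

  Adj : Rel (Fin n) 0ℓ
  Adj x y = T (edge x y)

  field
    symmetric   : Symmetric Adj
    irreflexive : ∀ x → ¬ Adj x x

open Graph public using (edge; Adj)

InducedAdj : ∀ {n} → Graph n → Subset n → Rel (Fin n) 0ℓ
InducedAdj G S x y = x ∈ S × y ∈ S × Adj G x y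

InducesConnected : ∀ {n} → Graph n → Subset n → Set
InducesConnected G S = ∀ {x y} → x ∈ S → y ∈ S → Star (InducedAdj G S) x y

Connected : ∀ {n} → Graph n → Set
Connected G = InducesConnected G ⊤

data Consecutive {n k} (v : Fin (suc k) → Fin n) : Rel (Fin n) 0ℓ where
  step  : ∀ i → Consecutive v (v (inject₁ i)) (v (suc i))
  close : Consecutive v (v (fromℕ k)) (v zero)

-- The cycle v₀ v₁ … v_last v₀, of length last + 1 ≥ 3.
record SimpleCycle {n} (G : Graph n) : Set where
  field
    last      : ℕ
    last≥2    : last ≥ 2
    vertex    : Fin (suc last) → Fin n
    injective : Injective _≡_ _≡_ vertex
    adjacent  : ∀ {x y} → Consecutive vertex x y → Adj G x y

  CycleEdge : Rel (Fin n) 0ℓ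
  CycleEdge = SymClosure (Consecutive vertex)

  _OnCycle : Fin n → Set
  x OnCycle = ∃[ i ] vertex i ≡ x

-- Cycles are subgraphs: the starting point and the direction of traversal
-- are irrelevant.
SameCycle : ∀ {n} {G : Graph n} → Rel (SimpleCycle G) 0ℓ
SameCycle C D = ∀ x y → SimpleCycle.CycleEdge C x y ⇔ SimpleCycle.CycleEdge D x y

IsTree : ∀ {n} → Graph n → Set
IsTree G = Connected G × ¬ SimpleCycle G

IsCactus : ∀ {n} → Graph n → Set
IsCactus G = Connected G ×
  (∀ (C D : SimpleCycle G) → ¬ SameCycle C D →
   let open SimpleCycle in
   ∀ {x y} → (C OnCycle) x → (D OnCycle) x → (C OnCycle) y → (D OnCycle) y → x ≡ y)

clusterWeight : ∀ {n} → (Fin n → ℕ) → Subset n → ℕ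
clusterWeight {n} w S = sum (map w (filter (_∈? S) (allFin n)))

record LUPartition {n} (G : Graph n) (w : Fin n → ℕ) (l u k : ℕ) : Set where
  field
    cluster   : Fin k → Subset n
    nonempty  : ∀ i → Nonempty (cluster i)
    disjoint  : ∀ {i j} → i ≢ j → Empty (cluster i ∩ cluster j)
    covering  : ∀ x → ∃[ i ] x ∈ cluster i
    connected : ∀ i → InducesConnected G (cluster i)
    lower     : ∀ i → l ≤ clusterWeight w (cluster i)
    upper     : ∀ i → clusterWeight w (cluster i) ≤ u

data Objective : Set where
  MinNum MaxNum : Objective

AtLeastAsGood : Objective → ℕ → ℕ → Set
AtLeastAsGood MinNum k k′ = k ≤ k′
AtLeastAsGood MaxNum k k′ = k ≥ k′

Optimal : Objective → ∀ {n} → Graph n → (Fin n → ℕ) → (l u k : ℕ) → Set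
Optimal obj G w l u k = ∀ {k′} → LUPartition G w l u k′ → AtLeastAsGood obj k k′

-- A unit-cost random access machine, in structured form: finitely many
-- registers and random access arrays of unbounded length can be named in a
-- program; every register access, array access, constant, arithmetic
-- operation, comparison, assignment and branch costs one unit.

data Op : Set where
  add sub mul leq equ : Op

data Expr : Set where
  lit : ℕ → Expr
  reg : ℕ → Expr
  arr : ℕ → Expr → Expr
  op  : Op → Expr → Expr → Expr

infixr 5 _⨾_

data Program : Set where
  skip          : Program
  setReg        : ℕ → Expr → Program
  setArr        : ℕ → Expr → Expr → Program
  _⨾_           : Program → Program → Program
  ifNonZero     : Expr → Program → Program → Program
  whileNonZero  : Expr → Program → Program

record State : Set where
  constructor state
  field
    regs : ℕ → ℕ
    arrs : ℕ → ℕ → ℕ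

open State public

update : ∀ {A : Set} → (ℕ → A) → ℕ → A → ℕ → A
update f i a j = if does (i ≟ j) then a else f j

bit : Bool → ℕ
bit b = if b then 1 else 0

⟦_⟧ᵒ : Op → ℕ → ℕ → ℕ
⟦ add ⟧ᵒ = _+_
⟦ sub ⟧ᵒ = _∸_
⟦ mul ⟧ᵒ = _*_
⟦ leq ⟧ᵒ a b = bit (a ≤ᵇ b)
⟦ equ ⟧ᵒ a b = bit (a ≡ᵇ b)

⟦_⟧ : Expr → State → ℕ
⟦ lit a     ⟧ s = a
⟦ reg x     ⟧ s = regs s x
⟦ arr a e   ⟧ s = arrs s a (⟦ e ⟧ s)
⟦ op o e e′ ⟧ s = ⟦ o ⟧ᵒ (⟦ e ⟧ s) (⟦ e′ ⟧ s)

cost : Expr → ℕ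
cost (lit _)     = 1
cost (reg _)     = 1
cost (arr _ e)   = 1 + cost e
cost (op _ e e′) = 1 + cost e + cost e′

writeReg : ℕ → ℕ → State → State
writeReg x b s = state (update (regs s) x b) (arrs s)

writeArr : ℕ → ℕ → ℕ → State → State
writeArr a i b s = state (regs s) (update (arrs s) a (update (arrs s a) i b))

-- ⟨ p , s ⟩⇓⟨ t , s′ ⟩: started in s, the program p halts in s′ after
-- exactly t elementary operations.
infix 4 ⟨_,_⟩⇓⟨_,_⟩

data ⟨_,_⟩⇓⟨_,_⟩ : Program → State → ℕ → State → Set where

  ⇓skip : ∀ {s} → ⟨ skip , s ⟩⇓⟨ 1 , s ⟩

  ⇓setReg : ∀ {s x e} →
    ⟨ setReg x e , s ⟩⇓⟨ 1 + cost e , writeReg x (⟦ e ⟧ s) s ⟩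

  ⇓setArr : ∀ {s a i e} →
    ⟨ setArr a i e , s ⟩⇓⟨ 1 + cost i + cost e , writeArr a (⟦ i ⟧ s) (⟦ e ⟧ s) s ⟩

  ⇓seq : ∀ {p q s s′ s″ t t′} →
    ⟨ p , s ⟩⇓⟨ t , s′ ⟩ → ⟨ q , s′ ⟩⇓⟨ t′ , s″ ⟩ →
    ⟨ p ⨾ q , s ⟩⇓⟨ t + t′ , s″ ⟩

  ⇓ifTrue : ∀ {e p q s s′ t} → ⟦ e ⟧ s ≢ 0 →
    ⟨ p , s ⟩⇓⟨ t , s′ ⟩ →
    ⟨ ifNonZero e p q , s ⟩⇓⟨ 1 + cost e + t , s′ ⟩

  ⇓ifFalse : ∀ {e p q s s′ t} → ⟦ e ⟧ s ≡ 0 →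
    ⟨ q , s ⟩⇓⟨ t , s′ ⟩ →
    ⟨ ifNonZero e p q , s ⟩⇓⟨ 1 + cost e + t , s′ ⟩

  ⇓whileTrue : ∀ {e p s s′ s″ t t′} → ⟦ e ⟧ s ≢ 0 →
    ⟨ p , s ⟩⇓⟨ t , s′ ⟩ → ⟨ whileNonZero e p , s′ ⟩⇓⟨ t′ , s″ ⟩ →
    ⟨ whileNonZero e p , s ⟩⇓⟨ 1 + cost e + t + t′ , s″ ⟩

  ⇓whileFalse : ∀ {e p s} → ⟦ e ⟧ s ≡ 0 →
    ⟨ whileNonZero e p , s ⟩⇓⟨ 1 + cost e , s ⟩

padded : ∀ {m} → (Fin m → ℕ) → ℕ → ℕ
padded {m} f i with i <? m
... | yes i<m = f (fromℕ< i<m)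
... | no  _   = 0

-- Registers 0, 1, 2 hold n, l, u; array 0 holds the weights and array 1 the
-- adjacency matrix, with entry (x , y) at position n * x + y.  Everything
-- else is initially 0.
inputRegs : (n l u : ℕ) → ℕ → ℕ
inputRegs n l u 0 = n
inputRegs n l u 1 = l
inputRegs n l u 2 = u
inputRegs n l u _ = 0

inputArrs : ∀ {n} → Graph n → (Fin n → ℕ) → ℕ → ℕ → ℕ
inputArrs     G w 0 = padded w
inputArrs {n} G w 1 = padded (bit ∘ uncurry (edge G) ∘ remQuot {n} n)
inputArrs     G w _ = λ _ → 0

input : ∀ {n} → Graph n → (Fin n → ℕ) → (l u : ℕ) → State
input {n} G w l u = state (inputRegs n l u) (inputArrs G w)

outputCount : State → ℕ
outputCount s = regs s 0

outputLabel : State → ℕ → ℕ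
outputLabel s = arrs s 0

Represents : ∀ {n} {G : Graph n} {w l u k} → State → LUPartition G w l u k → Set
Represents {k = k} s P =
  outputCount s ≡ k ×
  (∀ x i → x ∈ LUPartition.cluster P i → outputLabel s (toℕ x) ≡ toℕ i)

-- The count 0 reports infeasibility; it is unambiguous, since a partition of
-- a non-empty vertex set has at least one cluster.
CorrectOutput : Objective → ∀ {n} → Graph n → (Fin n → ℕ) → (l u : ℕ) → State → Set
CorrectOutput obj G w l u s =
    (∃[ k ] Σ[ P ∈ LUPartition G w l u k ] Represents s P × Optimal obj G w l u k)
  ⊎ ((∀ {k} → ¬ LUPartition G w l u k) × outputCount s ≡ 0)

SolvesWithin : Objective → Program → ∀ {n} → Graph n → (Fin n → ℕ) → (l u bound : ℕ) → Set
SolvesWithin obj p G w l u bound =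
  ∃[ t ] ∃[ s ] ⟨ p , input G w l u ⟩⇓⟨ t , s ⟩ × t ≤ bound × CorrectOutput obj G w l u s

-- Graphs have at least one vertex, so O(nᵈ) can be stated as a bound c * nᵈ
-- valid for every n.
SolvableInTime : Objective → (∀ {n} → Graph n → Set) → (degree : ℕ) → Set
SolvableInTime obj Class d =
  ∃[ p ] ∃[ c ] ∀ n → .{{_ : NonZero n}} →
  (G : Graph n) (w : Fin n → ℕ) (l u : ℕ) → l ≤ u → Class G →
  SolvesWithin obj p G w l u (c * n ^ d)

{-# OPTIONS --safe #-}

-- Depth-first search numbers the vertices so that every edge joins a vertex to
-- an ancestor.  In a cactus each tree edge is covered by at most one back edge,
-- so the tree edges fall into ears: single bridges and the paths that a back
-- edge closes to a cycle.  The ears are contracted into their top vertices from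
-- the leaves to the root.  A partition into connected clusters stays connected
-- after the removal of a suitable edge of each cycle, so it suffices to try
-- every edge of an ear and to attach the two remaining paths to the top.
--
-- Let d = u − l.  A partial partition with k closed clusters is summarised by
-- the excess e of their total weight over k l, which lies between 0 and k d.
-- Whether it can be completed depends on e only through conditions of the form
-- e ≤ c ≤ e + d.  If e₁ ≤ e ≤ e₂ ≤ e₁ + d, then one of e₁ and e₂ meets every
-- such condition that e meets; so for each k it is enough to keep the extreme
-- excesses in each of the at most k + 1 intervals of length d + 1.  Tables of
-- size O(n²) are combined in O(n⁴) steps.  A tree needs O(n) combinations.  In a
-- cactus the lengths m of the ears add up to at most n, and an ear needs O(m²).
--
-- The clusters themselves are carried along as numbers in base n + 1.

module Submission where

open import Defs
open import Data.Bool.Base using (Bool; true; false; T; not; _∧_; if_then_else_)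
open import Data.Bool.Properties using (T-∧)
open import Data.Empty using (⊥)
open import Data.Fin.Base
  using (Fin; toℕ; fromℕ<; inject₁; combine; remQuot) renaming (zero to fzero; suc to fsuc)
open import Data.Fin.Properties
  using (toℕ-injective; toℕ-fromℕ<; toℕ-fromℕ; toℕ-inject₁; toℕ-combine; toℕ<n; toℕ≤pred[n];
         fromℕ<-toℕ; remQuot-combine; any?; injective⇒≤)
  renaming (_≟_ to _≟ᶠ_)
open import Data.Fin.Subset using (Subset) renaming (_∈_ to _∈ₛ_; ⊤ to allV)
open import Data.Fin.Subset.Properties using (_∈?_; ∈⊤; x∈p∩q⁺; x∈p∩q⁻)
open import Data.List.Base
  using (List; []; _∷_; _++_; map; concat; length; filter; allFin; lookup; tabulate)
open import Data.List.Properties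
  using (map-++; map-cong; map-tabulate; length-++; length-filter; length-tabulate; concat-++)
import Data.List.Properties as List
import Data.List.Membership.DecPropositional as DecMembership
open import Data.List.Membership.Propositional using (_∈_; _∉_)
open import Data.List.Membership.Propositional.Properties
  using (∈-++⁺ˡ; ∈-++⁺ʳ; ∈-++⁻; ∈-allFin; ∈-filter⁺; ∈-filter⁻; ∈-map⁺; ∈-map⁻; ∈-concat⁺′; ∈-concat⁻′; ∈-lookup)
open import Data.List.Membership.Propositional.Properties.WithK using (unique∧set⇒bag)
open import Data.List.Relation.Binary.BagAndSetEquality using (∼bag⇒↭)
open import Data.List.Relation.Binary.Permutation.Propositional
  using (_↭_; ↭-refl; ↭-sym; ↭-trans; ↭-reflexive; ↭⇒↭ₛ; module PermutationReasoning)
open import Data.List.Relation.Binary.Permutation.Propositional.Properties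
  using (∈-resp-↭; ↭-length; shifts)
  renaming (map⁺ to ↭-map⁺; ++⁺ to ↭-++⁺; ++-comm to ↭-++-comm; ++⁺ˡ to ↭-++⁺ˡ)
import Data.List.Relation.Binary.Permutation.Setoid.Properties as Permutationₛ
open import Data.List.Relation.Unary.All as All using (All; []; _∷_)
open import Data.List.Relation.Unary.All.Properties using () renaming (++⁺ to All-++⁺)
open import Data.List.Relation.Unary.AllPairs as AllPairs using ([]; _∷_)
open import Data.List.Relation.Unary.AllPairs.Properties using () renaming (map⁺ to AllPairs-map⁺)
open import Data.List.Relation.Unary.Any using (here; there)
open import Data.List.Relation.Unary.Unique.Propositional using (Unique)
open import Data.List.Relation.Unary.Unique.Propositional.Properties
  using (allFin⁺) renaming (++⁺ to Unique-++⁺; filter⁺ to Unique-filter⁺; concat⁺ to Unique-concat⁺)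
open import Data.Nat.Base
open import Data.Nat.DivMod using (_mod_; m<n⇒m%n≡m; m%n<n)
open import Data.Nat.ListAction using (sum)
open import Data.Nat.ListAction.Properties using (sum-++; sum-↭)
open import Data.Nat.Properties
open import Data.Nat.Tactic.RingSolver using (solve-∀)
open import Data.Product.Base
  using (Σ; ∃-syntax; _×_; _,_; proj₁; proj₂; map₁; map₂; uncurry)
open import Data.Sum.Base using (_⊎_; inj₁; inj₂)
open import Data.Unit.Base using (tt) renaming (⊤ to Unit)
import Data.Vec.Base as Vec
import Data.Vec.Properties as Vec
open import Function.Base using (_∘_; _$_; case_of_)
open import Function.Bundles using (Equivalence; mk⇔)
open import Relation.Binary.Construct.Closure.ReflexiveTransitive as Star using (Star; ε; _◅_; _◅◅_)
open import Relation.Binary.Construct.Closure.Symmetric using (fwd; bwd)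
open import Relation.Binary.Definitions using (tri<; tri≈; tri>)
open import Relation.Binary.PropositionalEquality
open import Relation.Nullary using (¬_; Dec; yes; no; contradiction; does)
open import Relation.Nullary.Decidable using (dec-true; dec-false; decidable-stable; _×-dec_)

-- Programs with bounded loops

infixr 5 _⨟_

-- The counter of a for-loop runs downwards: it is i − 1, …, 1, 0 in the i
-- passes through the body.
data Cmd : Set where
  set   : ℕ → Expr → Cmd
  store : ℕ → Expr → Expr → Cmd
  _⨟_   : Cmd → Cmd → Cmd
  when  : Expr → Cmd → Cmd
  for   : ℕ → Expr → Cmd → Cmd

compile : Cmd → Program
compile (set r e)     = setReg r e
compile (store a i e) = setArr a i e
compile (c ⨟ c′)      = compile c ⨾ compile c′
compile (when e c)    = ifNonZero e (compile c) skip
compile (for r e c)   =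
  setReg r e ⨾ whileNonZero (reg r) (setReg r (op sub (reg r) (lit 1)) ⨾ compile c)

choose : ∀ {A : Set} → ℕ → A → A → A
choose zero    a b = b
choose (suc _) a b = a

loop : (State → State) → ℕ → ℕ → State → State
loop f r zero    s = s
loop f r (suc i) s = loop f r i (f (writeReg r i s))

exec : Cmd → State → State
exec (set r e)     s = writeReg r (⟦ e ⟧ s) s
exec (store a i e) s = writeArr a (⟦ i ⟧ s) (⟦ e ⟧ s) s
exec (c ⨟ c′)      s = exec c′ (exec c s)
exec (when e c)    s = choose (⟦ e ⟧ s) (exec c s) s
exec (for r e c)   s = loop (exec c) r (⟦ e ⟧ s) (writeReg r (⟦ e ⟧ s) s)

loopTime : (State → State) → (State → ℕ) → ℕ → ℕ → State → ℕ
loopTime f g r zero    s = 2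
loopTime f g r (suc i) s = 6 + g (writeReg r i s) + loopTime f g r i (f (writeReg r i s))

time : Cmd → State → ℕ
time (set r e)     s = 1 + cost e
time (store a i e) s = 1 + cost i + cost e
time (c ⨟ c′)      s = time c s + time c′ (exec c s)
time (when e c)    s = 1 + cost e + choose (⟦ e ⟧ s) (time c s) 1
time (for r e c)   s =
  1 + cost e + loopTime (exec c) (time c) r (⟦ e ⟧ s) (writeReg r (⟦ e ⟧ s) s)

keepsReg keepsArr : ℕ → Cmd → Bool
keepsReg x (set r e)     = not (r ≡ᵇ x)
keepsReg x (store a i e) = true
keepsReg x (c ⨟ c′)      = keepsReg x c ∧ keepsReg x c′
keepsReg x (when e c)    = keepsReg x c
keepsReg x (for r e c)   = not (r ≡ᵇ x) ∧ keepsReg x c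
keepsArr x (set r e)     = true
keepsArr x (store a i e) = not (a ≡ᵇ x)
keepsArr x (c ⨟ c′)      = keepsArr x c ∧ keepsArr x c′
keepsArr x (when e c)    = keepsArr x c
keepsArr x (for r e c)   = keepsArr x c

wellFormed : Cmd → Bool
wellFormed (c ⨟ c′)    = wellFormed c ∧ wellFormed c′
wellFormed (when e c)  = wellFormed c
wellFormed (for r e c) = keepsReg r c ∧ wellFormed c
wellFormed _           = true

update-same : ∀ {A : Set} (f : ℕ → A) i a → update f i a i ≡ a
update-same f i a rewrite dec-true (i ≟ i) refl = refl

update-other : ∀ {A : Set} (f : ℕ → A) i a {j} → i ≢ j → update f i a j ≡ f j
update-other f i a {j} i≢j rewrite dec-false (i ≟ j) i≢j = refl

∧-split : ∀ {a b} → T (a ∧ b) → T a × T b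
∧-split = Equivalence.to T-∧

differs : ∀ r x → T (not (r ≡ᵇ x)) → r ≢ x
differs r .r p refl with r ≡ᵇ r in eq
... | true  = p
... | false = subst T eq (≡⇒≡ᵇ r r refl)

Outside : Cmd → State → State → Set
Outside c s s′ = (∀ x → T (keepsReg x c) → regs s′ x ≡ regs s x)
               × (∀ a → T (keepsArr a c) → arrs s′ a ≡ arrs s a)

opaque
  outside : ∀ c s → Outside c s (exec c s)
  outside-pass : ∀ r e c i s → Outside (for r e c) s (exec c (writeReg r i s))
  outside-loop : ∀ r e c i s → Outside (for r e c) s (loop (exec c) r i s)

  outside (set r e) s = (λ x p → update-other (regs s) r _ (differs r x p)) , λ _ _ → refl
  outside (store a i e) s = (λ _ _ → refl) , λ x p → update-other (arrs s) a _ (differs a x p)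
  outside (c ⨟ c′) s with outside c s | outside c′ (exec c s)
  ... | r₁ , a₁ | r₂ , a₂ =
    (λ x p → trans (r₂ x (proj₂ (∧-split p))) (r₁ x (proj₁ (∧-split p)))) ,
    (λ x p → trans (a₂ x (proj₂ (∧-split p))) (a₁ x (proj₁ (∧-split p))))
  outside (when e c) s with ⟦ e ⟧ s
  ... | zero  = (λ _ _ → refl) , λ _ _ → refl
  ... | suc _ = outside c s
  outside (for r e c) s with outside-loop r e c (⟦ e ⟧ s) (writeReg r (⟦ e ⟧ s) s)
  ... | r₁ , a₁ =
    (λ x p → trans (r₁ x p) (update-other (regs s) r _ (differs r x (proj₁ (∧-split p))))) , a₁

  outside-loop r e c zero s = (λ _ _ → refl) , λ _ _ → refl
  outside-loop r e c (suc i) s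
    with outside-pass r e c i s | outside-loop r e c i (exec c (writeReg r i s))
  ... | r₁ , a₁ | r₂ , a₂ =
    (λ x p → trans (r₂ x p) (r₁ x p)) , (λ x p → trans (a₂ x p) (a₁ x p))

  outside-pass r e c i s with outside c (writeReg r i s)
  ... | r₁ , a₁ =
    (λ x p → trans (r₁ x (proj₂ (∧-split {not (r ≡ᵇ x)} p)))
               (update-other (regs s) r i (differs r x (proj₁ (∧-split p))))) , a₁

compile-correct : ∀ c s → T (wellFormed c) → ⟨ compile c , s ⟩⇓⟨ time c s , exec c s ⟩
loop-correct : ∀ r c → T (wellFormed c) → T (keepsReg r c) → ∀ i s → regs s r ≡ i →
  ⟨ whileNonZero (reg r) (setReg r (op sub (reg r) (lit 1)) ⨾ compile c) , s ⟩⇓⟨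
    loopTime (exec c) (time c) r i s , loop (exec c) r i s ⟩
compile-correct (set r e) s wf = ⇓setReg
compile-correct (store a i e) s wf = ⇓setArr
compile-correct (c ⨟ c′) s wf =
  ⇓seq (compile-correct c s (proj₁ (∧-split wf)))
       (compile-correct c′ _ (proj₂ (∧-split {wellFormed c} wf)))
compile-correct (when e c) s wf with ⟦ e ⟧ s in eq
... | zero  = ⇓ifFalse eq ⇓skip
... | suc _ = ⇓ifTrue (λ eq′ → case trans (sym eq) eq′ of λ ()) (compile-correct c s wf)
compile-correct (for r e c) s wf =
  ⇓seq ⇓setReg (loop-correct r c (proj₂ (∧-split {keepsReg r c} wf)) (proj₁ (∧-split wf)) (⟦ e ⟧ s)
    (writeReg r (⟦ e ⟧ s) s) (update-same (regs s) r (⟦ e ⟧ s)))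
loop-correct r c wf kr zero s eq = ⇓whileFalse eq
loop-correct r c wf kr (suc i) s eq =
  ⇓whileTrue (λ eq′ → case trans (sym eq) eq′ of λ ())
    (⇓seq (subst (λ z → ⟨ setReg r (op sub (reg r) (lit 1)) , s ⟩⇓⟨ 4 , writeReg r z s ⟩)
                 (cong (_∸ 1) eq) ⇓setReg)
          (compile-correct c (writeReg r i s) wf))
    (loop-correct r c wf kr i (exec c (writeReg r i s))
      (trans (proj₁ (outside c (writeReg r i s)) r kr) (update-same (regs s) r i)))

for-rule : ∀ r e c (I : ℕ → State → Set) s →
  I (⟦ e ⟧ s) (writeReg r (⟦ e ⟧ s) s) →
  (∀ i s′ → i < ⟦ e ⟧ s → Outside (for r e c) s s′ →
   I (suc i) s′ → I i (exec c (writeReg r i s′))) →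
  I 0 (exec (for r e c) s)
for-rule r e c I s start pass =
  go (⟦ e ⟧ s) (writeReg r (⟦ e ⟧ s) s) ≤-refl
     ((λ x p → update-other (regs s) r _ (differs r x (proj₁ (∧-split p)))) , λ _ _ → refl) start
  where
  go : ∀ i s′ → i ≤ ⟦ e ⟧ s → Outside (for r e c) s s′ → I i s′ → I 0 (loop (exec c) r i s′)
  go zero s′ _ _ x = x
  go (suc i) s′ i< o@(or , oa) x with outside-pass r e c i s′
  ... | r₁ , a₁ = go i _ (<⇒≤ i<)
    ((λ y p → trans (r₁ y p) (or y p)) , λ y p → trans (a₁ y p) (oa y p)) (pass i s′ i< o x)

forUp-rule : ∀ r e c (J : ℕ → State → Set) s →
  J 0 (writeReg r (⟦ e ⟧ s) s) →
  (∀ j i s′ → j + suc i ≡ ⟦ e ⟧ s → Outside (for r e c) s s′ →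
   J j s′ → J (suc j) (exec c (writeReg r i s′))) →
  J (⟦ e ⟧ s) (exec (for r e c) s)
forUp-rule r e c J s start pass =
  for-rule r e c (λ i s′ → ∀ j → j + i ≡ ⟦ e ⟧ s → J j s′) s
    (λ j eq → subst (λ z → J z _) (sym (+-cancelʳ-≡ _ j 0 eq)) start)
    (λ { i s′ i< o I zero eq → contradiction eq (<⇒≢ i<)
       ; i s′ i< o I (suc j) eq →
           let eq′ = trans (+-suc j i) eq in pass j i s′ eq′ o (I j eq′) })
    (⟦ e ⟧ s) (+-identityʳ _)

forAll-rule : ∀ r e c s (Inv : State → Set) (_≼_ : State → State → Set)
  (Goal : ℕ → State → Set) →
  (∀ {s₁ s₂ s₃} → s₁ ≼ s₂ → s₂ ≼ s₃ → s₁ ≼ s₃) →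
  (∀ {i s₁ s₂} → s₁ ≼ s₂ → Goal i s₁ → Goal i s₂) →
  s ≼ writeReg r (⟦ e ⟧ s) s → Inv (writeReg r (⟦ e ⟧ s) s) →
  (∀ i s′ → i < ⟦ e ⟧ s → Outside (for r e c) s s′ → Inv s′ →
   let s″ = exec c (writeReg r i s′) in Inv s″ × s′ ≼ s″ × Goal i s″) →
  let s″ = exec (for r e c) s in Inv s″ × s ≼ s″ × (∀ i → i < ⟦ e ⟧ s → Goal i s″)
forAll-rule r e c s Inv _≼_ Goal ≼-trans mono ≼₀ inv₀ pass =
  map₂ (map₂ λ g i i< → g i z≤n i<) $
  for-rule r e c (λ i s′ → Inv s′ × s ≼ s′ × (∀ j → i ≤ j → j < ⟦ e ⟧ s → Goal j s′)) s
    (inv₀ , ≼₀ , λ j m≤j j<m → contradiction j<m (≤⇒≯ m≤j))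
    λ { i s′ i< o (inv , ≼₁ , goals) → case pass i s′ i< o inv of λ
      { (inv′ , ≼₂ , goal) → inv′ , ≼-trans ≼₁ ≼₂ , λ j i≤j j<m → case m≤n⇒m<n∨m≡n i≤j of λ
        { (inj₁ i<j) → mono ≼₂ (goals j i<j j<m)
        ; (inj₂ refl) → goal } } }

when-rule : ∀ e c s (P : State → Set) →
  (⟦ e ⟧ s ≢ 0 → P (exec c s)) → (⟦ e ⟧ s ≡ 0 → P s) → P (exec (when e c) s)
when-rule e c s P y n with ⟦ e ⟧ s
... | zero  = n refl
... | suc _ = y λ ()

-- K * (u′ − u) is credit for the passes that are more expensive than A.
for-time : ∀ r e c (A K : ℕ) (I : ℕ → ℕ → State → Set) s u →
  I (⟦ e ⟧ s) u (writeReg r (⟦ e ⟧ s) s) →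
  (∀ i u s′ → i < ⟦ e ⟧ s → Outside (for r e c) s s′ → I (suc i) u s′ →
   ∃[ u′ ] I i u′ (exec c (writeReg r i s′)) × time c (writeReg r i s′) + K * u ≤ A + K * u′) →
  ∃[ u′ ] I 0 u′ (exec (for r e c) s) ×
    time (for r e c) s + K * u ≤ 3 + cost e + ⟦ e ⟧ s * (6 + A) + K * u′
for-time r e c A K I s u start pass =
  case go (⟦ e ⟧ s) u (writeReg r (⟦ e ⟧ s) s) ≤-refl
     ((λ x p → update-other (regs s) r _ (differs r x (proj₁ (∧-split p)))) , λ _ _ → refl) start
  of λ { (u′ , x , b) → u′ , x ,
    subst₂ _≤_ (sym (+-assoc (1 + cost e) _ (K * u)))
      (reassoc (cost e) (⟦ e ⟧ s * (6 + A)) (K * u′))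
      (+-monoʳ-≤ (1 + cost e) b) }
  where
  reassoc : ∀ a b c → (1 + a) + (2 + b + c) ≡ 3 + a + b + c
  reassoc = solve-∀
  shuffle : ∀ a b c d → 6 + (a + b) + (2 + c + d) ≡ (2 + ((6 + a) + c) + d) + b
  shuffle = solve-∀
  shuffle′ : ∀ a b c d → (6 + (a + d)) + (b + c) ≡ ((6 + a) + b + d) + c
  shuffle′ = solve-∀
  go : ∀ i u s′ → i ≤ ⟦ e ⟧ s → Outside (for r e c) s s′ → I i u s′ →
    ∃[ u′ ] I 0 u′ (loop (exec c) r i s′) ×
      loopTime (exec c) (time c) r i s′ + K * u ≤ 2 + i * (6 + A) + K * u′
  go zero u s′ _ _ x = u , x , ≤-refl
  go (suc i) u s′ i< o@(or , oa) x
    with pass i u s′ i< o x | outside-pass r e c i s′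
  ... | u₁ , x₁ , b₁ | r₁ , a₁
    with go i u₁ _ (<⇒≤ i<)
      ((λ y p → trans (r₁ y p) (or y p)) , λ y p → trans (a₁ y p) (oa y p)) x₁
  ... | u₂ , x₂ , b₂ = u₂ , x₂ ,
    +-cancelʳ-≤ (K * u₁) _ _
      (subst₂ _≤_
        (shuffle′ (time c (writeReg r i s′)) (loopTime (exec c) (time c) r i _) (K * u₁) (K * u))
        (shuffle A (K * u₁) (i * (6 + A)) (K * u₂))
        (+-mono-≤ (+-monoʳ-≤ 6 b₁) b₂))

for-time-const : ∀ r e c (A : ℕ) s →
  (∀ i s′ → i < ⟦ e ⟧ s → Outside (for r e c) s s′ → time c (writeReg r i s′) ≤ A) →
  time (for r e c) s ≤ 3 + cost e + ⟦ e ⟧ s * (6 + A)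
for-time-const r e c A s pass
  with for-time r e c A 0 (λ _ _ _ → Unit) s 0 tt
         (λ i u s′ i< o _ → 0 , tt , +-monoˡ-≤ 0 (pass i s′ i< o))
... | _ , _ , b = subst₂ _≤_ (+-identityʳ _) (+-identityʳ _) b

-- Loops that run a constant number of times or at most N times, where
-- registers 0 and 3 stay ≤ N.
bounded : Expr → Bool
bounded (lit _)               = true
bounded (reg 0)               = true
bounded (reg 3)               = true
bounded (op sub (reg 0) _)    = true
bounded _                     = false

passes : Expr → ℕ × ℕ
passes (lit k) = k , 0
passes _       = 1 , 1

static : Cmd → Bool
static (set r e)     = true
static (store a i e) = true
static (c ⨟ c′)      = (keepsReg 0 c ∧ keepsReg 3 c) ∧ static c ∧ static c′
static (when e c)    = static c
static (for r e c)   = (keepsReg 0 (for r e c) ∧ keepsReg 3 (for r e c)) ∧ bounded e ∧ static c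

coeff degree : Cmd → ℕ
coeff (set r e)      = 1 + cost e
coeff (store a i e)  = 1 + cost i + cost e
coeff (c ⨟ c′)       = coeff c + coeff c′
coeff (when e c)     = 1 + cost e + (coeff c + 1)
coeff (for r e c)    = 3 + cost e + proj₁ (passes e) * (6 + coeff c)
degree (set r e)     = 0
degree (store a i e) = 0
degree (c ⨟ c′)      = degree c ⊔ degree c′
degree (when e c)    = degree c
degree (for r e c)   = proj₂ (passes e) + degree c

module _ (N : ℕ) .{{_ : NonZero N}} where

  pow≥1 : ∀ d → 1 ≤ N ^ d
  pow≥1 d = m^n>0 N d

  scale : ∀ a d → a ≤ a * N ^ d
  scale a d = subst (_≤ a * N ^ d) (*-identityʳ a) (*-monoʳ-≤ a (pow≥1 d))

  passes-bound : ∀ e s → T (bounded e) → regs s 0 ≤ N → regs s 3 ≤ N →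
    ⟦ e ⟧ s ≤ proj₁ (passes e) * N ^ proj₂ (passes e)
  passes-bound (lit k) s b p q = ≤-reflexive (sym (*-identityʳ k))
  passes-bound (reg 0) s b p q = subst (regs s 0 ≤_) (sym (trans (+-identityʳ _) (*-identityʳ N))) p
  passes-bound (reg 3) s b p q = subst (regs s 3 ≤_) (sym (trans (+-identityʳ _) (*-identityʳ N))) q
  passes-bound (op sub (reg 0) e) s b p q =
    ≤-trans (m∸n≤m (regs s 0) (⟦ e ⟧ s))
      (subst (regs s 0 ≤_) (sym (trans (+-identityʳ _) (*-identityʳ N))) p)

  for-bound : ∀ b m x a k c d → m ≤ a * N ^ k → x ≤ c * N ^ d →
    b + m * (6 + x) ≤ (b + a * (6 + c)) * N ^ (k + d)
  for-bound b m x a k c d m≤ x≤ = begin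
    b + m * (6 + x)
      ≤⟨ +-mono-≤ (scale b (k + d)) (*-mono-≤ m≤ (+-mono-≤ (scale 6 d) x≤)) ⟩
    b * N ^ (k + d) + (a * N ^ k) * (6 * N ^ d + c * N ^ d)
      ≡⟨ cong (λ z → b * N ^ (k + d) + a * N ^ k * z) (sym (*-distribʳ-+ (N ^ d) 6 c)) ⟩
    b * N ^ (k + d) + (a * N ^ k) * ((6 + c) * N ^ d)
      ≡⟨ cong (b * N ^ (k + d) +_) (rearrange a (N ^ k) (6 + c) (N ^ d)) ⟩
    b * N ^ (k + d) + a * (6 + c) * (N ^ k * N ^ d)
      ≡⟨ cong (λ z → b * N ^ (k + d) + a * (6 + c) * z) (sym (^-distribˡ-+-* N k d)) ⟩
    b * N ^ (k + d) + a * (6 + c) * N ^ (k + d)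
      ≡⟨ sym (*-distribʳ-+ (N ^ (k + d)) b (a * (6 + c))) ⟩
    (b + a * (6 + c)) * N ^ (k + d) ∎
    where
    open ≤-Reasoning
    rearrange : ∀ a x b y → (a * x) * (b * y) ≡ (a * b) * (x * y)
    rearrange = solve-∀

  opaque
   static-time : ∀ c s → T (static c) → regs s 0 ≤ N → regs s 3 ≤ N →
    time c s ≤ coeff c * N ^ degree c
   static-time (set r e) s st p q = ≤-reflexive (sym (*-identityʳ _))
   static-time (store a i e) s st p q = ≤-reflexive (sym (*-identityʳ _))
   static-time (c ⨟ c′) s st p q
    with (k0 , k3) ← map₁ (λ z → z) (∧-split {keepsReg 0 c} (proj₁ (∧-split st)))
       | (st₁ , st₂) ← ∧-split {static c} (proj₂ (∧-split {keepsReg 0 c ∧ keepsReg 3 c} st)) =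
    ≤-trans
      (+-mono-≤
        (≤-trans (static-time c s st₁ p q)
          (*-monoʳ-≤ (coeff c) (^-monoʳ-≤ N (m≤m⊔n (degree c) (degree c′)))))
        (≤-trans (static-time c′ (exec c s) st₂
                   (subst (_≤ N) (sym (proj₁ (outside c s) 0 k0)) p)
                   (subst (_≤ N) (sym (proj₁ (outside c s) 3 k3)) q))
          (*-monoʳ-≤ (coeff c′) (^-monoʳ-≤ N (m≤n⊔m (degree c) (degree c′))))))
      (≤-reflexive (sym (*-distribʳ-+ (N ^ (degree c ⊔ degree c′)) (coeff c) (coeff c′))))
   static-time (when e c) s st p q =
    ≤-trans (+-mono-≤ (scale (1 + cost e) (degree c)) (branch (⟦ e ⟧ s)))
      (≤-reflexive (sym (*-distribʳ-+ (N ^ degree c) (1 + cost e) (coeff c + 1))))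
    where
    branch : ∀ b → choose b (time c s) 1 ≤ (coeff c + 1) * N ^ degree c
    branch zero = ≤-trans (m≤n+m 1 (coeff c)) (scale _ (degree c))
    branch (suc b) = ≤-trans (static-time c s st p q) (*-monoˡ-≤ (N ^ degree c) (m≤m+n (coeff c) 1))
   static-time (for r e c) s st p q =
    ≤-trans (for-time-const r e c (coeff c * N ^ degree c) s pass)
      (for-bound (3 + cost e) (⟦ e ⟧ s) (coeff c * N ^ degree c)
        (proj₁ (passes e)) (proj₂ (passes e)) (coeff c) (degree c)
        (passes-bound e s bd p q) ≤-refl)
    where
    keep : T (keepsReg 0 (for r e c)) × T (keepsReg 3 (for r e c))
    keep = ∧-split (proj₁ (∧-split st))
    bd : T (bounded e)
    bd = proj₁ (∧-split (proj₂ (∧-split {keepsReg 0 (for r e c) ∧ keepsReg 3 (for r e c)} st)))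
    stc : T (static c)
    stc = proj₂ (∧-split {bounded e} (proj₂ (∧-split {keepsReg 0 (for r e c) ∧ keepsReg 3 (for r e c)} st)))
    pass : ∀ i s′ → i < ⟦ e ⟧ s → Outside (for r e c) s s′ →
      time c (writeReg r i s′) ≤ coeff c * N ^ degree c
    pass i s′ _ (o , _) = static-time c (writeReg r i s′) stc
      (subst (_≤ N) (sym (trans (update-other (regs s′) r i (differs r 0 (proj₁ (∧-split (proj₁ keep)))))
                                (o 0 (proj₁ keep)))) p)
      (subst (_≤ N) (sym (trans (update-other (regs s′) r i (differs r 3 (proj₁ (∧-split (proj₂ keep)))))
                                (o 3 (proj₂ keep)))) q)

leq-true : ∀ {a b} → ⟦ leq ⟧ᵒ a b ≢ 0 → a ≤ b
leq-true {a} {b} p with a ≤ᵇ b in eq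
... | true  = ≤ᵇ⇒≤ a b (subst T (sym eq) tt)
... | false = contradiction refl p

leq-false : ∀ {a b} → ⟦ leq ⟧ᵒ a b ≡ 0 → b < a
leq-false {a} {b} p with a ≤ᵇ b in eq
... | false = ≰⇒> λ a≤b → subst T eq (≤⇒≤ᵇ a≤b)

equ-true : ∀ {a b} → ⟦ equ ⟧ᵒ a b ≢ 0 → a ≡ b
equ-true {a} {b} p with a ≡ᵇ b in eq
... | true  = ≡ᵇ⇒≡ a b (subst T (sym eq) tt)
... | false = contradiction refl p

equ-false : ∀ {a b} → ⟦ equ ⟧ᵒ a b ≡ 0 → a ≢ b
equ-false {a} {b} p with a ≡ᵇ b in eq
... | false = λ a≡b → subst T eq (≡⇒≡ᵇ a b a≡b)

mul-true : ∀ {a b} → a * b ≢ 0 → a ≢ 0 × b ≢ 0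
mul-true {a} {b} p = (λ { refl → p refl }) , λ { refl → p (*-zeroʳ a) }

mul-false : ∀ {a b} → a * b ≡ 0 → a ≡ 0 ⊎ b ≡ 0
mul-false {a} = m*n≡0⇒m≡0∨n≡0 a

add-true : ∀ {a b} → a + b ≢ 0 → a ≢ 0 ⊎ b ≢ 0
add-true {zero}  p = inj₂ p
add-true {suc a} p = inj₁ λ ()

add-false : ∀ {a b} → a + b ≡ 0 → a ≡ 0 × b ≡ 0
add-false {a} p = m+n≡0⇒m≡0 a p , m+n≡0⇒n≡0 a p

opaque
  -- Injective, since (a + b)² ≤ pair a b < (a + b + 1)².
  pair : ℕ → ℕ → ℕ
  pair a b = (a + b) * (a + b) + a

  private
    pair-< : ∀ a b → pair a b < suc (a + b) * suc (a + b)
    pair-< a b = subst (pair a b <_) (expand (a + b))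
      (s≤s (+-monoʳ-≤ ((a + b) * (a + b)) (≤-trans (m≤m+n a b) (m≤n+m (a + b) (a + b)))))
      where
      expand : ∀ x → suc (x * x + (x + x)) ≡ suc x * suc x
      expand = solve-∀

  pair-injective : ∀ {a b c d} → pair a b ≡ pair c d → a ≡ c × b ≡ d
  pair-injective {a} {b} {c} {d} eq with <-cmp (a + b) (c + d)
  ... | tri< lt _ _ = contradiction eq (<⇒≢ (<-≤-trans (pair-< a b) (≤-trans (*-mono-≤ lt lt) (m≤m+n _ c))))
  ... | tri> _ _ gt = contradiction (sym eq) (<⇒≢ (<-≤-trans (pair-< c d) (≤-trans (*-mono-≤ gt gt) (m≤m+n _ a))))
  ... | tri≈ _ s≡ _ = a≡c , +-cancelˡ-≡ a b d (trans s≡ (cong (_+ d) (sym a≡c)))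
    where
    a≡c : a ≡ c
    a≡c = +-cancelˡ-≡ ((a + b) * (a + b)) a c (trans eq (cong (λ z → z * z + c) (sym s≡)))

when-then-rule : ∀ e c c′ s (P : State → Set) →
  (⟦ e ⟧ s ≢ 0 → P (exec c′ (exec c s))) → (⟦ e ⟧ s ≡ 0 → P (exec c′ s)) →
  P (exec (when e c ⨟ c′) s)
when-then-rule e c c′ s P = when-rule e c s (λ s′ → P (exec c′ s′))

opaque
  wp : Cmd → (State → Set) → State → Set
  wp c P s = P (exec c s)

  exec-wp : ∀ c P s → P (exec c s) → wp c P s
  exec-wp c P s p = p

  wp-set : ∀ {r e P s} → P (writeReg r (⟦ e ⟧ s) s) → wp (set r e) P s
  wp-set p = p

  wp-store : ∀ {a i e P s} → P (writeArr a (⟦ i ⟧ s) (⟦ e ⟧ s) s) → wp (store a i e) P s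
  wp-store p = p

  wp-seq : ∀ {c c′ P s} → wp c (wp c′ P) s → wp (c ⨟ c′) P s
  wp-seq p = p

  wp-set⨟ : ∀ {r e c P s} → wp c P (writeReg r (⟦ e ⟧ s) s) → wp (set r e ⨟ c) P s
  wp-set⨟ p = p

  wp-store⨟ : ∀ {a i e c P s} → wp c P (writeArr a (⟦ i ⟧ s) (⟦ e ⟧ s) s) → wp (store a i e ⨟ c) P s
  wp-store⨟ p = p

  wp-when : ∀ {e c P s} → (⟦ e ⟧ s ≢ 0 → wp c P s) → (⟦ e ⟧ s ≡ 0 → P s) → wp (when e c) P s
  wp-when {e} {c} {P} {s} = when-rule e c s P

  wp-map : ∀ {c P Q s} → (∀ s′ → Outside c s s′ → P s′ → Q s′) → wp c P s → wp c Q s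
  wp-map {c} {s = s} f p = f (exec c s) (outside c s) p

  wp-for : ∀ {r e c P s} (I : ℕ → State → Set) →
    I (⟦ e ⟧ s) (writeReg r (⟦ e ⟧ s) s) →
    (∀ i s′ → i < ⟦ e ⟧ s → Outside (for r e c) s s′ → I (suc i) s′ → wp c (I i) (writeReg r i s′)) →
    (∀ s′ → Outside (for r e c) s s′ → I 0 s′ → P s′) →
    wp (for r e c) P s
  wp-for {r} {e} {c} {P} {s} I start pass end =
    end _ (outside (for r e c) s) (for-rule r e c I s start pass)

  wp-forUp : ∀ {r e c P s} (J : ℕ → State → Set) →
    J 0 (writeReg r (⟦ e ⟧ s) s) →
    (∀ j i s′ → j + suc i ≡ ⟦ e ⟧ s → Outside (for r e c) s s′ → J j s′ → wp c (J (suc j)) (writeReg r i s′)) →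
    (∀ s′ → Outside (for r e c) s s′ → J (⟦ e ⟧ s) s′ → P s′) →
    wp (for r e c) P s
  wp-forUp {r} {e} {c} {P} {s} J start pass end =
    end _ (outside (for r e c) s) (forUp-rule r e c J s start pass)

  wp-forAll : ∀ {r e c P s} (Inv : State → Set) (_≼_ : State → State → Set)
    (Goal : ℕ → State → Set) →
    (∀ {s₁ s₂ s₃} → s₁ ≼ s₂ → s₂ ≼ s₃ → s₁ ≼ s₃) →
    (∀ {i s₁ s₂} → s₁ ≼ s₂ → Goal i s₁ → Goal i s₂) →
    s ≼ writeReg r (⟦ e ⟧ s) s → Inv (writeReg r (⟦ e ⟧ s) s) →
    (∀ i s′ → i < ⟦ e ⟧ s → Outside (for r e c) s s′ → Inv s′ →
     wp c (λ s″ → Inv s″ × s′ ≼ s″ × Goal i s″) (writeReg r i s′)) →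
    (∀ s′ → Outside (for r e c) s s′ → Inv s′ → s ≼ s′ → (∀ i → i < ⟦ e ⟧ s → Goal i s′) → P s′) →
    wp (for r e c) P s
  wp-forAll {r} {e} {c} {P} {s} Inv _≼_ Goal ≼-trans mono ≼₀ inv₀ pass end =
    let inv , le , goals = forAll-rule r e c s Inv _≼_ Goal ≼-trans mono ≼₀ inv₀ pass
    in end _ (outside (for r e c) s) inv le goals

-- Tables.  Cell (t , k , q , m) belongs to table t and describes a partial
-- partition with k closed clusters whose excess e, the total weight of the
-- closed clusters minus k * l, lies in bucket q, i.e. q (d + 1) ≤ e < (q + 1) (d + 1)
-- for d = u − l.  Of each bucket only the members with the least (m = 0) and
-- the largest (m = 1) excess are kept.  Arrays 6 to 9 hold e + 1 (0 for an
-- unused cell) and three codes of the partial partition.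
key : ℕ → ℕ → ℕ → ℕ → ℕ
key t k q m = pair (pair (pair t k) q) m

pairE : Expr → Expr → Expr
pairE a b = op add (op mul (op add a b) (op add a b)) a

keyE : Expr → Expr → Expr → Expr → Expr
keyE t k q m = pairE (pairE (pairE t k) q) m

opaque
  key-injective : ∀ {t k q m t′ k′ q′ m′} → key t k q m ≡ key t′ k′ q′ m′ →
    t ≡ t′ × k ≡ k′ × q ≡ q′ × m ≡ m′
  key-injective {t} {k} {q} {m} {t′} {k′} {q′} {m′} eq =
    let eq₁ , m≡ = pair-injective {pair (pair t k) q} {m} {pair (pair t′ k′) q′} {m′} eq
        eq₂ , q≡ = pair-injective {pair t k} {q} {pair t′ k′} {q′} eq₁
        t≡ , k≡  = pair-injective {t} {k} {t′} {k′} eq₂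
    in t≡ , k≡ , q≡ , m≡

Arrs : Set
Arrs = ℕ → ℕ → ℕ

Family : Set₁
Family = (k e o c δ : ℕ) → Set

Holds : Arrs → ℕ → Family → ℕ → ℕ → Set
Holds A x Φ k e = A 6 x ≡ suc e × Φ k e (A 7 x) (A 8 x) (A 9 x)

SameCell : Arrs → Arrs → ℕ → Set
SameCell B A x = B 6 x ≡ A 6 x × B 7 x ≡ A 7 x × B 8 x ≡ A 8 x × B 9 x ≡ A 9 x

SameTable : Arrs → Arrs → ℕ → Set
SameTable B A t = ∀ k q m → SameCell B A (key t k q m)

sameCell-trans : ∀ {A B C x} → SameCell C B x → SameCell B A x → SameCell C A x
sameCell-trans (a , b , c , d) (a′ , b′ , c′ , d′) =
  trans a a′ , trans b b′ , trans c c′ , trans d d′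

sameCell-holds : ∀ {A B x} Φ k {e} → SameCell B A x → Holds A x Φ k e → Holds B x Φ k e
sameCell-holds Φ k (a , b , c , d) (h , φ)
  rewrite b | c | d = trans a h , φ

putCell : Cmd
putCell = store 6 (reg 27) (op add (lit 1) (reg 22)) ⨟ store 7 (reg 27) (reg 24)
        ⨟ store 8 (reg 27) (reg 25) ⨟ store 9 (reg 27) (reg 26)

opaque
  putCell-here : ∀ {Φ} {k} s → Φ k (regs s 22) (regs s 24) (regs s 25) (regs s 26) →
    Holds (arrs (exec putCell s)) (regs s 27) Φ k (regs s 22)
  putCell-here {Φ} {k} s φ
    rewrite update-same (arrs s 6) (regs s 27) (suc (regs s 22))
          | update-same (arrs s 7) (regs s 27) (regs s 24)
          | update-same (arrs s 8) (regs s 27) (regs s 25)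
          | update-same (arrs s 9) (regs s 27) (regs s 26) = refl , φ

  putCell-there : ∀ s {x} → x ≢ regs s 27 → SameCell (arrs (exec putCell s)) (arrs s) x
  putCell-there s {x} x≢ =
    update-other (arrs s 6) _ _ (x≢ ∘ sym) , update-other (arrs s 7) _ _ (x≢ ∘ sym) ,
    update-other (arrs s 8) _ _ (x≢ ∘ sym) , update-other (arrs s 9) _ _ (x≢ ∘ sym)

toKey : ℕ → Cmd
toKey m = set 27 (keyE (reg 20) (reg 21) (reg 23) (lit m))

lessE moreE nextBucketE : Expr
lessE = op add (op equ (arr 6 (reg 27)) (lit 0))
               (op leq (op add (lit 1) (reg 22)) (arr 6 (reg 27)))
moreE = op leq (arr 6 (reg 27)) (reg 22)
nextBucketE = op leq (op mul (op add (lit 1) (reg 23)) (reg 4)) (reg 22)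

insertMin insertMax insert : Cmd
insertMin = toKey 0 ⨟ when lessE putCell
insertMax = toKey 1 ⨟ when moreE putCell
insert = when nextBucketE (set 23 (op add (lit 1) (reg 23)))
       ⨟ insertMin ⨟ insertMax

sameCell-refl : ∀ {A x} → SameCell A A x
sameCell-refl = refl , refl , refl , refl

module _ (Φ : Family) where

  Candidate : State → Set
  Candidate s = Φ (regs s 21) (regs s 22) (regs s 24) (regs s 25) (regs s 26)

  keyOf : State → ℕ → ℕ
  keyOf s m = key (regs s 20) (regs s 21) (regs s 23) m

  opaque
    unfolding pair

    insertMin-spec : ∀ s (let k = regs s 21; e = regs s 22; x = keyOf s 0; A = arrs s
                              B = arrs (exec insertMin s)) →
      Candidate s → (A 6 x ≡ 0 ⊎ ∃[ e₀ ] Holds A x Φ k e₀) →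
      (∃[ e₀ ] Holds B x Φ k e₀ × e₀ ≤ e × (A 6 x ≡ suc e₀ ⊎ e₀ ≡ e)
        × (∀ e₁ → A 6 x ≡ suc e₁ → e₀ ≤ e₁))
      × (∀ y → y ≢ x → SameCell B A y)
    insertMin-spec s φ old = when-rule lessE putCell (exec (toKey 0) s)
      (λ s′ → let A = arrs s; B = arrs s′; x = keyOf s 0; e = regs s 22; k = regs s 21 in
        (∃[ e₀ ] Holds B x Φ k e₀ × e₀ ≤ e × (A 6 x ≡ suc e₀ ⊎ e₀ ≡ e)
          × (∀ e₁ → A 6 x ≡ suc e₁ → e₀ ≤ e₁)) × (∀ y → y ≢ x → SameCell B A y))
      (λ c → (regs s 22 , putCell-here {Φ} (exec (toKey 0) s) φ , ≤-refl , inj₂ refl ,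
               λ e₁ eq → case add-true {⟦ equ ⟧ᵒ (arrs s 6 (keyOf s 0)) 0} c of λ
                 { (inj₁ z) → case trans (sym (equ-true {arrs s 6 (keyOf s 0)} {0} z)) eq of λ ()
                 ; (inj₂ z) → s≤s⁻¹ (subst (suc (regs s 22) ≤_) eq (leq-true z)) })
             , λ y y≢ → putCell-there (exec (toKey 0) s) y≢)
      (λ c → case old of λ
        { (inj₁ z) → contradiction z (equ-false {arrs s 6 (keyOf s 0)} {0} (proj₁ (add-false {⟦ equ ⟧ᵒ (arrs s 6 (keyOf s 0)) 0} c)))
        ; (inj₂ (e₀ , h)) →
            (e₀ , h , <⇒≤ (s≤s⁻¹ (subst (_< suc (regs s 22)) (proj₁ h)
                       (leq-false (proj₂ (add-false {⟦ equ ⟧ᵒ (arrs s 6 (keyOf s 0)) 0} c))))) ,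
             inj₁ (proj₁ h) ,
             λ e₁ eq → ≤-reflexive (suc-injective (trans (sym (proj₁ h)) eq)))
            , λ y _ → sameCell-refl {arrs s} })

    insertMax-spec : ∀ s (let k = regs s 21; e = regs s 22; x = keyOf s 1; A = arrs s
                              B = arrs (exec insertMax s)) →
      Candidate s → (A 6 x ≡ 0 ⊎ ∃[ e₀ ] Holds A x Φ k e₀) →
      (∃[ e₀ ] Holds B x Φ k e₀ × e ≤ e₀ × (A 6 x ≡ suc e₀ ⊎ e₀ ≡ e)
        × (∀ e₁ → A 6 x ≡ suc e₁ → e₁ ≤ e₀))
      × (∀ y → y ≢ x → SameCell B A y)
    insertMax-spec s φ old = when-rule moreE putCell (exec (toKey 1) s)
      (λ s′ → let A = arrs s; B = arrs s′; x = keyOf s 1; e = regs s 22; k = regs s 21 in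
        (∃[ e₀ ] Holds B x Φ k e₀ × e ≤ e₀ × (A 6 x ≡ suc e₀ ⊎ e₀ ≡ e)
          × (∀ e₁ → A 6 x ≡ suc e₁ → e₁ ≤ e₀)) × (∀ y → y ≢ x → SameCell B A y))
      (λ c → (regs s 22 , putCell-here {Φ} (exec (toKey 1) s) φ , ≤-refl , inj₂ refl ,
               λ e₁ eq → <⇒≤ (subst (_≤ regs s 22) eq (leq-true c)))
             , λ y y≢ → putCell-there (exec (toKey 1) s) y≢)
      (λ c → case old of λ
        { (inj₁ z) → contradiction (subst (regs s 22 <_) z (leq-false c)) λ ()
        ; (inj₂ (e₀ , h)) →
            (e₀ , h , s≤s⁻¹ (subst (regs s 22 <_) (proj₁ h) (leq-false c)) ,
             inj₁ (proj₁ h) ,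
             λ e₁ eq → ≤-reflexive (suc-injective (trans (sym eq) (proj₁ h))))
            , λ y _ → sameCell-refl {arrs s} })

module Buckets (d : ℕ) where

  record Full (A : Arrs) (t : ℕ) (Φ : Family) (k q : ℕ) : Set where
    field
      e₀ e₁ : ℕ
      min : Holds A (key t k q 0) Φ k e₀
      max : Holds A (key t k q 1) Φ k e₁
      lo  : q * suc d ≤ e₀
      mid : e₀ ≤ e₁
      hi  : e₁ < suc q * suc d

  Bucket : Arrs → ℕ → Family → ℕ → ℕ → Set
  Bucket A t Φ k q = (A 6 (key t k q 0) ≡ 0 × A 6 (key t k q 1) ≡ 0) ⊎ Full A t Φ k q

  Good : Arrs → ℕ → Family → Set
  Good A t Φ = ∀ k q → Bucket A t Φ k q

  bucket-same : ∀ {A B t Φ k q} → (∀ m → SameCell B A (key t k q m)) →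
    Bucket A t Φ k q → Bucket B t Φ k q
  bucket-same same (inj₁ (a , b)) = inj₁ (trans (proj₁ (same 0)) a , trans (proj₁ (same 1)) b)
  bucket-same {A} {B} {t} {Φ} {k} same (inj₂ f) = inj₂ record
    { min = sameCell-holds {A} {B} Φ k (same 0) (Full.min f)
    ; max = sameCell-holds {A} {B} Φ k (same 1) (Full.max f)
    ; lo = Full.lo f ; mid = Full.mid f ; hi = Full.hi f }

  Span : Arrs → ℕ → ℕ → ℕ → ℕ → Set
  Span A t k q e = ∃[ e₀ ] ∃[ e₁ ]
    A 6 (key t k q 0) ≡ suc e₀ × A 6 (key t k q 1) ≡ suc e₁ × e₀ ≤ e × e ≤ e₁

  Grows : ℕ → Arrs → Arrs → Set
  Grows t A B = (∀ {t′} → t′ ≢ t → SameTable B A t′) × (∀ k q e → Span A t k q e → Span B t k q e)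

  grows-refl : ∀ {t A} → Grows t A A
  grows-refl {A = A} = (λ _ _ _ _ → sameCell-refl {A}) , λ _ _ _ x → x

  grows-trans : ∀ {t A B C} → Grows t A B → Grows t B C → Grows t A C
  grows-trans {A = A} {B} {C} (a , b) (a′ , b′) =
    (λ t≢ k q m → sameCell-trans {A} {B} {C} (a′ t≢ k q m) (a t≢ k q m)) ,
    λ k q e x → b′ k q e (b k q e x)

  good-same : ∀ {A B t Φ} → SameTable B A t → Good A t Φ → Good B t Φ
  good-same same good k q = bucket-same (same k q) (good k q)

  span-same : ∀ {A B t k q e} → SameTable B A t → Span A t k q e → Span B t k q e
  span-same same (e₀ , e₁ , a , b , c) =
    e₀ , e₁ , trans (proj₁ (same _ _ 0)) a , trans (proj₁ (same _ _ 1)) b , c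

  module _ {A B : Arrs} {t k q : ℕ} {Φ : Family} where

    bucket-replaced : ∀ {e} → Good A t Φ → (F : Full B t Φ k q) →
      (∀ y → y ≢ key t k q 0 → y ≢ key t k q 1 → SameCell B A y) →
      Full.e₀ F ≤ e → e ≤ Full.e₁ F →
      (∀ f → A 6 (key t k q 0) ≡ suc f → Full.e₀ F ≤ f) →
      (∀ f → A 6 (key t k q 1) ≡ suc f → f ≤ Full.e₁ F) →
      Good B t Φ × Grows t A B × (∃[ q′ ] Span B t k q′ e)
    bucket-replaced {e} good F other e₀≤e e≤e₁ below above =
      (λ k′ q′ → good′ (k′ ≟ k) (q′ ≟ q)) , (same , λ k′ q′ e′ → spans (k′ ≟ k) (q′ ≟ q)) , (q , span)
      where
      open Full F
      other-bucket : ∀ {t′ k′ q′} → ¬ (t′ ≡ t × k′ ≡ k × q′ ≡ q) → ∀ m → SameCell B A (key t′ k′ q′ m)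
      other-bucket {t′} {k′} {q′} ne m = other _
        (λ eq → let a , b , c , _ = key-injective {t′} {k′} {q′} {m} {t} {k} {q} {0} eq in ne (a , b , c))
        (λ eq → let a , b , c , _ = key-injective {t′} {k′} {q′} {m} {t} {k} {q} {1} eq in ne (a , b , c))
      good′ : ∀ {k′ q′} → Dec (k′ ≡ k) → Dec (q′ ≡ q) → Bucket B t Φ k′ q′
      good′ (yes refl) (yes refl) = inj₂ F
      good′ (no k≢) _ = bucket-same (other-bucket λ z → k≢ (proj₁ (proj₂ z))) (good _ _)
      good′ (yes _) (no q≢) = bucket-same (other-bucket λ z → q≢ (proj₂ (proj₂ z))) (good _ _)
      same : ∀ {t′} → t′ ≢ t → SameTable B A t′
      same t≢ k′ q′ = other-bucket {_} {k′} {q′} λ z → t≢ (proj₁ z)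
      span : Span B t k q e
      span = e₀ , e₁ , proj₁ min , proj₁ max , e₀≤e , e≤e₁
      spans : ∀ {k′ q′ e′} → Dec (k′ ≡ k) → Dec (q′ ≡ q) → Span A t k′ q′ e′ → Span B t k′ q′ e′
      spans (yes refl) (yes refl) (f₀ , f₁ , a , b , c , c′) =
        e₀ , e₁ , proj₁ min , proj₁ max , ≤-trans (below f₀ a) c , ≤-trans c′ (above f₁ b)
      spans (no k≢) _ (f₀ , f₁ , a , b , c , c′) = f₀ , f₁ ,
        trans (proj₁ (other-bucket (λ z → k≢ (proj₁ (proj₂ z))) 0)) a ,
        trans (proj₁ (other-bucket (λ z → k≢ (proj₁ (proj₂ z))) 1)) b , c , c′
      spans (yes _) (no q≢) (f₀ , f₁ , a , b , c , c′) = f₀ , f₁ ,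
        trans (proj₁ (other-bucket (λ z → q≢ (proj₂ (proj₂ z))) 0)) a ,
        trans (proj₁ (other-bucket (λ z → q≢ (proj₂ (proj₂ z))) 1)) b , c , c′

  insertBoth-spec : ∀ Φ s (let t = regs s 20; k = regs s 21; e = regs s 22; q = regs s 23
                               A = arrs s; B = arrs (exec (insertMin ⨟ insertMax) s)) →
    Candidate Φ s → q * suc d ≤ e → e < suc q * suc d → Good A t Φ →
    Good B t Φ × Grows t A B × (∃[ q′ ] Span B t k q′ e)
  insertBoth-spec Φ s φ lo≤ <hi good =
    bucket-replaced good
      (record { min = min ; max = max ; lo = lo′ ; mid = ≤-trans e₀≤e e≤e₁ ; hi = hi′ })
      other e₀≤e e≤e₁
      (proj₂ (proj₂ (proj₂ (proj₂ (proj₁ Min)))))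
      (λ f₁ eq → proj₂ (proj₂ (proj₂ (proj₂ (proj₁ Max)))) f₁ (trans (proj₁ cell₁) eq))
    where
    s₁ = exec insertMin s
    t = regs s 20
    k = regs s 21
    e = regs s 22
    q = regs s 23
    A = arrs s
    A₁ = arrs s₁
    B = arrs (exec insertMax s₁)
    x₀ = key t k q 0
    x₁ = key t k q 1
    kept : ∀ x → T (keepsReg x insertMin) → regs s₁ x ≡ regs s x
    kept = proj₁ (outside insertMin s)
    slot₀ : A 6 x₀ ≡ 0 ⊎ ∃[ e₀ ] Holds A x₀ Φ k e₀
    slot₀ = case good k q of λ
      { (inj₁ (a , _)) → inj₁ a ; (inj₂ f) → inj₂ (_ , Full.min f) }
    slot₁ : A 6 x₁ ≡ 0 ⊎ ∃[ e₁ ] Holds A x₁ Φ k e₁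
    slot₁ = case good k q of λ
      { (inj₁ (_ , b)) → inj₁ b ; (inj₂ f) → inj₂ (_ , Full.max f) }
    Min = insertMin-spec Φ s φ slot₀
    x₁≢x₀ : x₁ ≢ x₀
    x₁≢x₀ eq with key-injective {t} {k} {q} {1} {t} {k} {q} {0} eq
    ... | _ , _ , _ , ()
    cell₁ : SameCell A₁ A x₁
    cell₁ = proj₂ Min x₁ x₁≢x₀
    keyEq : keyOf Φ s₁ 1 ≡ x₁
    keyEq rewrite kept 20 tt | kept 21 tt | kept 23 tt = refl
    slot₁′ : A₁ 6 (keyOf Φ s₁ 1) ≡ 0 ⊎ ∃[ e₁ ] Holds A₁ (keyOf Φ s₁ 1) Φ (regs s₁ 21) e₁
    slot₁′ rewrite keyEq | kept 21 tt with slot₁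
    ... | inj₁ z = inj₁ (trans (proj₁ cell₁) z)
    ... | inj₂ (e₁ , h) = inj₂ (e₁ , sameCell-holds {A} {A₁} Φ k cell₁ h)
    φ₁ : Candidate Φ s₁
    φ₁ rewrite kept 21 tt | kept 22 tt | kept 24 tt | kept 25 tt | kept 26 tt = φ
    Max : (∃[ e₁ ] Holds B x₁ Φ k e₁ × e ≤ e₁ × (A₁ 6 x₁ ≡ suc e₁ ⊎ e₁ ≡ e)
            × (∀ e₂ → A₁ 6 x₁ ≡ suc e₂ → e₂ ≤ e₁)) × (∀ y → y ≢ x₁ → SameCell B A₁ y)
    Max = subst (λ x → (∃[ e₁ ] Holds B x Φ k e₁ × e ≤ e₁ × (A₁ 6 x ≡ suc e₁ ⊎ e₁ ≡ e)
            × (∀ e₂ → A₁ 6 x ≡ suc e₂ → e₂ ≤ e₁)) × (∀ y → y ≢ x → SameCell B A₁ y)) keyEq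
          (subst₂ (λ k e → (∃[ e₁ ] Holds B (keyOf Φ s₁ 1) Φ k e₁ × e ≤ e₁ × (A₁ 6 (keyOf Φ s₁ 1) ≡ suc e₁ ⊎ e₁ ≡ e)
            × (∀ e₂ → A₁ 6 (keyOf Φ s₁ 1) ≡ suc e₂ → e₂ ≤ e₁)) × (∀ y → y ≢ keyOf Φ s₁ 1 → SameCell B A₁ y))
            (kept 21 tt) (kept 22 tt) (insertMax-spec Φ s₁ φ₁ slot₁′))
    e₀ : ℕ
    e₀ = proj₁ (proj₁ Min)
    e₁ : ℕ
    e₁ = proj₁ (proj₁ Max)
    min : Holds B x₀ Φ k e₀
    min = sameCell-holds {A₁} {B} Φ k (proj₂ Max x₀ (x₁≢x₀ ∘ sym)) (proj₁ (proj₂ (proj₁ Min)))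
    max : Holds B x₁ Φ k e₁
    max = proj₁ (proj₂ (proj₁ Max))
    e₀≤e : e₀ ≤ e
    e₀≤e = proj₁ (proj₂ (proj₂ (proj₁ Min)))
    e≤e₁ : e ≤ e₁
    e≤e₁ = proj₁ (proj₂ (proj₂ (proj₁ Max)))
    lo′ : q * suc d ≤ e₀
    lo′ = case proj₁ (proj₂ (proj₂ (proj₂ (proj₁ Min)))) of λ
      { (inj₂ eq) → subst (q * suc d ≤_) (sym eq) lo≤
      ; (inj₁ eq) → case good k q of λ
        { (inj₁ (z , _)) → case trans (sym eq) z of λ ()
        ; (inj₂ f) → subst (q * suc d ≤_)
            (suc-injective (trans (sym (proj₁ (Full.min f))) eq)) (Full.lo f) } }
    hi′ : e₁ < suc q * suc d
    hi′ = case proj₁ (proj₂ (proj₂ (proj₂ (proj₁ Max)))) of λ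
      { (inj₂ eq) → subst (_< suc q * suc d) (sym eq) <hi
      ; (inj₁ eq) → case good k q of λ
        { (inj₁ (_ , z)) → case trans (sym eq) (trans (proj₁ cell₁) z) of λ ()
        ; (inj₂ f) → subst (_< suc q * suc d)
            (suc-injective (trans (sym (proj₁ (Full.max f))) (trans (sym (proj₁ cell₁)) eq))) (Full.hi f) } }
    other : ∀ y → y ≢ x₀ → y ≢ x₁ → SameCell B A y
    other y y≢₀ y≢₁ = sameCell-trans {A} {A₁} {B} (proj₂ Max y y≢₁) (proj₂ Min y y≢₀)

  insert-spec : ∀ Φ s (let t = regs s 20; k = regs s 21; e = regs s 22; q = regs s 23
                           A = arrs s; B = arrs (exec insert s)) →
    regs s 4 ≡ suc d →
    Candidate Φ s → q * suc d ≤ e → e < suc (suc q) * suc d → Good A t Φ →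
    Good B t Φ × Grows t A B × (∃[ q′ ] Span B t k q′ e)
  insert-spec Φ s Δ φ lo≤ <hi good =
    when-then-rule nextBucketE (set 23 (op add (lit 1) (reg 23))) (insertMin ⨟ insertMax) s
      (λ s′ → Good (arrs s′) (regs s 20) Φ × Grows (regs s 20) (arrs s) (arrs s′)
            × ∃[ q′ ] Span (arrs s′) (regs s 20) (regs s 21) q′ (regs s 22))
      (λ c → insertBoth-spec Φ (exec (set 23 (op add (lit 1) (reg 23))) s) φ
          (subst (λ z → suc (regs s 23) * z ≤ regs s 22) Δ (leq-true c)) <hi good)
      (λ c → insertBoth-spec Φ s φ lo≤
          (subst (λ z → regs s 22 < suc (regs s 23) * z) Δ (leq-false c)) good)

  opaque
    unfolding wp
    wp-insert : ∀ {P s} Φ (let t = regs s 20; k = regs s 21; e = regs s 22; q = regs s 23; A = arrs s) →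
      regs s 4 ≡ suc d →
      Candidate Φ s → q * suc d ≤ e → e < suc (suc q) * suc d → Good A t Φ →
      (∀ s′ → Outside insert s s′ → Good (arrs s′) t Φ → Grows t A (arrs s′) →
        (∃[ q′ ] Span (arrs s′) t k q′ e) → P s′) →
      wp insert P s
    wp-insert {P} {s} Φ Δ φ lo hi good end =
      let g , r , sp = insert-spec Φ s Δ φ lo hi good
      in end _ (outside insert s) g r sp

opaque
  unfolding pair

  key-eval : ∀ t k q m s →
    ⟦ keyE t k q m ⟧ s ≡ key (⟦ t ⟧ s) (⟦ k ⟧ s) (⟦ q ⟧ s) (⟦ m ⟧ s)
  key-eval t k q m s = refl

outside-in : ∀ r e c i {s s′ s″} → Outside (for r e c) s s′ → Outside c (writeReg r i s′) s″ →
  Outside (for r e c) s s″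
outside-in r e c i {s} {s′} (o , a) (o′ , a′) =
  (λ x p → let p₁ , p₂ = ∧-split {not (r ≡ᵇ x)} p in
     trans (o′ x p₂) (trans (update-other (regs s′) r i (differs r x p₁)) (o x p))) ,
  (λ x p → trans (a′ x p) (a x p))

outside-write : ∀ r e c i {s s′} → Outside (for r e c) s s′ → Outside (for r e c) s (writeReg r i s′)
outside-write r e c i {s′ = s′} (o , a) =
  (λ x p → trans (update-other (regs s′) r i (differs r x (proj₁ (∧-split p)))) (o x p)) , a

forEach : (tr kr qr mr : ℕ) → Cmd → Cmd
forEach tr kr qr mr body =
  for kr (reg 3) (for qr (reg 3) (for mr (lit 2)
    (when (arr 6 (keyE (reg tr) (reg kr) (reg qr) (reg mr))) body)))

wp-forEach : ∀ {tr kr qr mr body P s} →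
  let loop₃ = for mr (lit 2) (when (arr 6 (keyE (reg tr) (reg kr) (reg qr) (reg mr))) body)
      loop₂ = for qr (reg 3) loop₃
      loop₁ = for kr (reg 3) loop₂
      t = regs s tr
      N = regs s 3 in
  T (keepsReg 3 loop₁) → T (keepsReg tr loop₁) → T (keepsReg kr loop₂) → T (keepsReg qr loop₃) →
  (Inv : Arrs → Set) (_≼_ : Arrs → Arrs → Set) (Goal : ℕ → ℕ → ℕ → Arrs → Set) →
  (∀ {A} → A ≼ A) → (∀ {A B C} → A ≼ B → B ≼ C → A ≼ C) →
  (∀ {k q m A B} → A ≼ B → Goal k q m A → Goal k q m B) →
  Inv (arrs s) →
  (∀ k q m s′ → k < N → q < N → m < 2 → Outside loop₁ s s′ →
   regs s′ kr ≡ k → regs s′ qr ≡ q → regs s′ mr ≡ m → Inv (arrs s′) →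
   arrs s′ 6 (key t k q m) ≢ 0 →
   wp body (λ s″ → Inv (arrs s″) × arrs s′ ≼ arrs s″ × Goal k q m (arrs s″)) s′) →
  (∀ k q m A → Inv A → A 6 (key t k q m) ≡ 0 → Goal k q m A) →
  (∀ s′ → Outside loop₁ s s′ → Inv (arrs s′) → arrs s ≼ arrs s′ →
   (∀ k q m → k < N → q < N → m < 2 → Goal k q m (arrs s′)) → P s′) →
  wp loop₁ P s
wp-forEach {tr} {kr} {qr} {mr} {body} {P} {s} k3 kt kk kq Inv _≼_ Goal ≼-refl ≼-trans mono inv₀ pass empty end =
  wp-forAll (λ s′ → Inv (arrs s′)) _≼ₛ_ (λ k s′ → ∀ q → q < N → ∀ m → m < 2 → Goal k q m (arrs s′))
    ≼-trans (λ le g q q< m m< → mono le (g q q< m m<)) ≼-refl inv₀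
    (λ k s₁ k< o₁ inv₁ →
      wp-forAll (λ s′ → Inv (arrs s′)) _≼ₛ_ (λ q s′ → ∀ m → m < 2 → Goal k q m (arrs s′))
        ≼-trans (λ le g m m< → mono le (g m m<)) ≼-refl inv₁
        (λ q s₂ q< o₂ inv₂ →
          wp-forAll (λ s′ → Inv (arrs s′)) _≼ₛ_ (λ m s′ → Goal k q m (arrs s′))
            ≼-trans mono ≼-refl inv₂
            (λ m s₃ m< o₃ inv₃ →
              let s₄ = writeReg mr m s₃
                  o′ : Outside loop₃ (writeReg qr q s₂) s₄
                  o′ = outside-write mr (lit 2) (when (arr 6 (keyE (reg tr) (reg kr) (reg qr) (reg mr))) body) m o₃
                  o″ : Outside loop₂ (writeReg kr k s₁) s₄
                  o″ = outside-in qr (reg 3) loop₃ q o₂ o′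
                  o : Outside loop₁ s s₄
                  o = outside-in kr (reg 3) loop₂ k o₁ o″
                  kr≡ : regs s₄ kr ≡ k
                  kr≡ = trans (proj₁ o″ kr kk) (update-same (regs s₁) kr k)
                  qr≡ : regs s₄ qr ≡ q
                  qr≡ = trans (proj₁ o′ qr kq) (update-same (regs s₂) qr q)
                  mr≡ : regs s₄ mr ≡ m
                  mr≡ = update-same (regs s₃) mr m
                  cell≡ : ⟦ arr 6 (keyE (reg tr) (reg kr) (reg qr) (reg mr)) ⟧ s₄ ≡ arrs s₄ 6 (key t k q m)
                  cell≡ = cong (arrs s₄ 6) (trans (key-eval (reg tr) (reg kr) (reg qr) (reg mr) s₄)
                    (keys (proj₁ o tr kt) kr≡ qr≡ mr≡))
              in wp-when
                (λ c → pass k q m s₄ k<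
                   (subst (q <_) (trans (update-other (regs s₁) kr k (differs kr 3 (proj₁ (∧-split k3))))
                                        (proj₁ o₁ 3 k3)) q<)
                   m< o kr≡ qr≡ mr≡ inv₃ (λ z → c (trans cell≡ z)))
                (λ c → inv₃ , ≼-refl , empty k q m (arrs s₄) inv₃ (trans (sym cell≡) c)))
            (λ s′ o inv le goals → inv , le , goals))
        (λ s′ o inv le goals → inv , le , λ q q< → goals q
          (subst (q <_) (sym (trans (update-other (regs s₁) kr k (differs kr 3 (proj₁ (∧-split k3))))
                                    (proj₁ o₁ 3 k3))) q<)))
    (λ s′ o inv le goals → end s′ o inv le (λ k q m k< q< m< → goals k k< q q< m m<))
  where
  _≼ₛ_ : State → State → Set
  a ≼ₛ b = arrs a ≼ arrs b
  loop₃ : Cmd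
  loop₃ = for mr (lit 2) (when (arr 6 (keyE (reg tr) (reg kr) (reg qr) (reg mr))) body)
  loop₂ : Cmd
  loop₂ = for qr (reg 3) loop₃
  loop₁ : Cmd
  loop₁ = for kr (reg 3) loop₂
  t : ℕ
  t = regs s tr
  N : ℕ
  N = regs s 3
  keys : ∀ {t t′ k k′ q q′ m m′} → t ≡ t′ → k ≡ k′ → q ≡ q′ → m ≡ m′ → key t k q m ≡ key t′ k′ q′ m′
  keys refl refl refl refl = refl

module _ (d : ℕ) where
  open Buckets d

  entry : ∀ {A t Φ} → Good A t Φ → ∀ k q m e → m < 2 → A 6 (key t k q m) ≡ suc e →
    let x = key t k q m in
    Φ k e (A 7 x) (A 8 x) (A 9 x) × q * suc d ≤ e × e < suc q * suc d
  entry {A} {t} {Φ} good k q m e m< eq = go m m< eq (good k q)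
    where
    go : ∀ m → m < 2 → A 6 (key t k q m) ≡ suc e → Bucket A t Φ k q →
      Φ k e (A 7 (key t k q m)) (A 8 (key t k q m)) (A 9 (key t k q m))
        × q * suc d ≤ e × e < suc q * suc d
    go 0 _ eq (inj₁ (z , _)) = case trans (sym eq) z of λ ()
    go 1 _ eq (inj₁ (_ , z)) = case trans (sym eq) z of λ ()
    go 0 _ eq (inj₂ F) = subst (λ e → Φ k e _ _ _ × q * suc d ≤ e × e < suc q * suc d)
      (suc-injective (trans (sym (proj₁ min)) eq)) (proj₂ min , lo , ≤-<-trans mid hi)
      where open Full F
    go 1 _ eq (inj₂ F) = subst (λ e → Φ k e _ _ _ × q * suc d ≤ e × e < suc q * suc d)
      (suc-injective (trans (sym (proj₁ max)) eq)) (proj₂ max , ≤-trans lo mid , hi)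
      where open Full F
    go (suc (suc _)) (s≤s (s≤s ())) _ _

  wp-overTable : ∀ {tr kr qr mr body P s} →
    let loop₃ = for mr (lit 2) (when (arr 6 (keyE (reg tr) (reg kr) (reg qr) (reg mr))) body)
        loop₂ = for qr (reg 3) loop₃
        loop₁ = for kr (reg 3) loop₂
        t = regs s tr
        A = arrs s
        N = regs s 3 in
    T (keepsReg 3 loop₁) → T (keepsReg tr loop₁) → T (keepsReg kr loop₂) → T (keepsReg qr loop₃) →
    ∀ z Φ Ψ (Goal : ℕ → ℕ → ℕ → ℕ → Arrs → Set) →
    (∀ {k q m e A B} → Grows z A B → Goal k q m e A → Goal k q m e B) →
    t ≢ z → Good A t Φ → Good A z Ψ →
    (∀ k q m e s′ → k < N → q < N → m < 2 → Outside loop₁ s s′ →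
     regs s′ kr ≡ k → regs s′ qr ≡ q → regs s′ mr ≡ m →
     Good (arrs s′) z Ψ → Grows z A (arrs s′) →
     let x = key t k q m; A′ = arrs s′ in
     A′ 6 x ≡ suc e → Φ k e (A′ 7 x) (A′ 8 x) (A′ 9 x) → q * suc d ≤ e → e < suc q * suc d →
     wp body (λ s″ → Good (arrs s″) z Ψ × Grows z A′ (arrs s″) × Goal k q m e (arrs s″)) s′) →
    (∀ s′ → Outside loop₁ s s′ → Good (arrs s′) z Ψ → Grows z A (arrs s′) →
     (∀ k q m e → k < N → q < N → m < 2 → A 6 (key t k q m) ≡ suc e → Goal k q m e (arrs s′)) → P s′) →
    wp loop₁ P s
  wp-overTable {tr} {s = s} k3 kt kk kq z Φ Ψ Goal mono t≢z goodΦ goodΨ pass end =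
    wp-forEach k3 kt kk kq
      (λ B → Good B z Ψ × Grows z A B) (Grows z)
      (λ k q m B → ∀ e → A 6 (key t k q m) ≡ suc e → Goal k q m e B)
      (λ {B} → grows-refl {z} {B}) (λ {B} {C} {D} → grows-trans {z} {B} {C} {D})
      (λ gr g e eq → mono gr (g e eq))
      (goodΨ , grows-refl {z} {A})
      (λ k q m s′ k< q< m< o k≡ q≡ m≡ (good , gr) nz →
        case used nz of λ
          { (e , eq) →
            let φ , lo , hi = entry {arrs s′} {t} {Φ} (good-same (proj₁ gr t≢z) goodΦ) k q m e m< eq
            in wp-map (λ s″ _ (good′ , gr′ , goal) →
                 (good′ , grows-trans {z} {A} {arrs s′} {arrs s″} gr gr′) , gr′ ,
                 λ e′ eq′ → subst (λ e → Goal k q m e (arrs s″))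
                   (suc-injective (trans (sym eq) (trans (proj₁ (proj₁ gr t≢z k q m)) eq′))) goal)
                 (pass k q m e s′ k< q< m< o k≡ q≡ m≡ good gr eq φ lo hi) })
      (λ k q m B (_ , gr) z e eq →
        case trans (sym (trans (proj₁ (proj₁ gr t≢z k q m)) eq)) z of λ ())
      (λ s′ o (good , gr) _ goals → end s′ o good gr
        (λ k q m e k< q< m< eq → goals k q m k< q< m< e eq))
    where
    t : ℕ
    t = regs s tr
    A : Arrs
    A = arrs s
    used : ∀ {a} → a ≢ 0 → ∃[ e ] a ≡ suc e
    used {zero} nz = contradiction refl nz
    used {suc e} nz = e , refl

-- The three table operations write to the table named by register 20 and read
-- those named by registers 33 and 43.
loadE : Expr
loadE = keyE (reg 33) (reg 30) (reg 31) (reg 32)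

joinBody glueBody glueInto copyBody copyInto closeBody closeInto : Cmd
joinBody =
    set 44 (keyE (reg 43) (reg 40) (reg 41) (reg 42))
  ⨟ set 21 (op add (reg 30) (reg 40))
  ⨟ set 22 (op add (reg 35) (op sub (arr 6 (reg 44)) (lit 1)))
  ⨟ set 23 (op add (reg 31) (reg 41))
  ⨟ set 24 (op add (reg 36) (arr 7 (reg 44)))
  ⨟ set 25 (op add (reg 37) (op add (arr 8 (reg 44)) (op mul (reg 30) (arr 9 (reg 44)))))
  ⨟ set 26 (op add (reg 38) (arr 9 (reg 44)))
  ⨟ insert
glueBody =
    set 34 loadE
  ⨟ set 35 (op sub (arr 6 (reg 34)) (lit 1))
  ⨟ set 36 (arr 7 (reg 34))
  ⨟ set 37 (arr 8 (reg 34))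
  ⨟ set 38 (arr 9 (reg 34))
  ⨟ forEach 43 40 41 42 joinBody
glueInto = forEach 33 30 31 32 glueBody
copyBody =
    set 34 loadE
  ⨟ set 21 (reg 30)
  ⨟ set 22 (op sub (arr 6 (reg 34)) (lit 1))
  ⨟ set 23 (reg 31)
  ⨟ set 24 (arr 7 (reg 34))
  ⨟ set 25 (arr 8 (reg 34))
  ⨟ set 26 (arr 9 (reg 34))
  ⨟ insert
copyInto = forEach 33 30 31 32 copyBody

closeE : Expr
closeE = op mul (op leq (reg 28) (arr 10 (reg 33)))
                (op mul (op leq (reg 35) (reg 29))
                        (op leq (op add (lit 1) (reg 29)) (op add (reg 4) (reg 35))))
closeCell : Cmd
closeCell =
    set 21 (op add (lit 1) (reg 30))
  ⨟ set 22 (reg 29)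
  ⨟ set 23 (reg 31)
  ⨟ set 24 (lit 0)
  ⨟ set 25 (op add (arr 8 (reg 34)) (op mul (reg 30) (arr 7 (reg 34))))
  ⨟ set 26 (op add (arr 9 (reg 34)) (arr 7 (reg 34)))
  ⨟ insert
closeBody =
    set 34 loadE
  ⨟ set 35 (op sub (arr 6 (reg 34)) (lit 1))
  ⨟ set 28 (op mul (op add (lit 1) (reg 30)) (reg 1))
  ⨟ set 29 (op sub (arr 10 (reg 33)) (reg 28))
  ⨟ when closeE closeCell
closeInto = forEach 33 30 31 32 closeBody

module _ (d : ℕ) where
  open Buckets d

  private
    castΦ : ∀ (Φ : Family) {k e e′ o o′ c c′ δ δ′} → e ≡ e′ → o ≡ o′ → c ≡ c′ → δ ≡ δ′ →
      Φ k e o c δ → Φ k e′ o′ c′ δ′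
    castΦ Φ refl refl refl refl φ = φ

    pred≡ : ∀ {a e} → a ≡ suc e → e ≡ a ∸ 1
    pred≡ refl = refl

  wp-joinBody : ∀ {P s} Ψ x e → let A = arrs s; z = regs s 20; k = regs s 30 in
    ⟦ keyE (reg 43) (reg 40) (reg 41) (reg 42) ⟧ s ≡ x → A 6 x ≡ suc e →
    regs s 4 ≡ suc d → Good A z Ψ →
    Ψ (k + regs s 40) (regs s 35 + e) (regs s 36 + A 7 x)
      (regs s 37 + (A 8 x + k * A 9 x)) (regs s 38 + A 9 x) →
    (regs s 31 + regs s 41) * suc d ≤ regs s 35 + e →
    regs s 35 + e < suc (suc (regs s 31 + regs s 41)) * suc d →
    (∀ s′ → Good (arrs s′) z Ψ → Grows z A (arrs s′) →
      (∃[ q ] Span (arrs s′) z (k + regs s 40) q (regs s 35 + e)) → P s′) →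
    wp joinBody P s
  wp-joinBody {P} {s} Ψ x e refl used Δ good ψ lo hi end =
    wp-set⨟ $ wp-set⨟ $ wp-set⨟ $ wp-set⨟ $ wp-set⨟ $ wp-set⨟ $ wp-set⨟ $
      wp-insert Ψ Δ
        (castΦ Ψ e≡ refl refl refl ψ)
        (subst ((regs s 31 + regs s 41) * suc d ≤_) e≡ lo)
        (subst (_< suc (suc (regs s 31 + regs s 41)) * suc d) e≡ hi)
        good
        (λ s′ _ good′ gr sp → end s′ good′ gr
          (subst (λ e → ∃[ q ] Span (arrs s′) (regs s 20) (regs s 30 + regs s 40) q e) (sym e≡) sp))
    where
    e≡ : regs s 35 + e ≡ regs s 35 + (arrs s 6 x ∸ 1)
    e≡ = cong (regs s 35 +_) (pred≡ used)

  bucket-sum : ∀ {q e q′ e′} → q * suc d ≤ e → e < suc q * suc d → q′ * suc d ≤ e′ → e′ < suc q′ * suc d →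
    (q + q′) * suc d ≤ e + e′ × e + e′ < suc (suc (q + q′)) * suc d
  bucket-sum {q} {e} {q′} {e′} lo hi lo′ hi′ =
    subst (_≤ e + e′) (sym (*-distribʳ-+ (suc d) q q′)) (+-mono-≤ lo lo′) ,
    subst (e + e′ <_)
      (trans (sym (*-distribʳ-+ (suc d) (suc q) (suc q′))) (cong (λ z → suc z * suc d) (+-suc q q′)))
      (+-mono-< hi hi′)

  wp-glueBody : ∀ {P s} Φ Ψ x e → let A = arrs s; z = regs s 20; b = regs s 43; k = regs s 30; q = regs s 31 in
    ⟦ loadE ⟧ s ≡ x → A 6 x ≡ suc e → q * suc d ≤ e → e < suc q * suc d →
    regs s 4 ≡ suc d → b ≢ z → Good A b Φ → Good A z Ψ →
    (∀ {k′ e′ o c δ} → Φ k′ e′ o c δ →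
      Ψ (k + k′) (e + e′) (A 7 x + o) (A 8 x + (c + k * δ)) (A 9 x + δ)) →
    (∀ s′ → Good (arrs s′) z Ψ → Grows z A (arrs s′) →
      (∀ k′ q′ m e′ → k′ < regs s 3 → q′ < regs s 3 → m < 2 → A 6 (key b k′ q′ m) ≡ suc e′ →
        ∃[ q″ ] Span (arrs s′) z (k + k′) q″ (e + e′)) → P s′) →
    wp glueBody P s
  wp-glueBody {P} {s} Φ Ψ x e refl used lo hi Δ b≢z goodb goodz combine end =
    wp-set⨟ $ wp-set⨟ $ wp-set⨟ $ wp-set⨟ $ wp-set⨟ $
      wp-overTable d _ _ _ _ z Φ Ψ
        (λ k′ q′ m e′ B → ∃[ q″ ] Span B z (k + k′) q″ (e + e′))
        (λ gr → map₂ (proj₂ gr _ _ _))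
        b≢z goodb goodz
        (λ { _ _ _ e′ s′ _ _ _ (o , a) refl refl refl good gr used′ φ lo′ hi′ →
          let S = regs s′
              r30 : S 30 ≡ k
              r30 = o 30 tt
              r35 : S 35 ≡ e
              r35 = trans (o 35 tt) (sym (pred≡ used))
              lohi = bucket-sum {q} {e} {S 41} {e′} lo hi lo′ hi′
          in wp-joinBody Ψ _ e′
            (trans (key-eval (reg 43) (reg 40) (reg 41) (reg 42) s′)
              (cong (λ b → key b (S 40) (S 41) (S 42)) (o 43 tt)))
            used′
            (trans (o 4 tt) Δ)
            (subst (λ z → Good (arrs s′) z Ψ) (sym (o 20 tt)) good)
            (joined Ψ r30 r35 (o 36 tt) (o 37 tt) (o 38 tt) (combine φ))
            (subst₂ (λ q e → (q + S 41) * suc d ≤ e + e′) (sym (o 31 tt)) (sym r35) (proj₁ lohi))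
            (subst₂ (λ q e → e + e′ < suc (suc (q + S 41)) * suc d) (sym (o 31 tt)) (sym r35) (proj₂ lohi))
            (λ s″ good′ gr′ sp →
              subst (λ z → Good (arrs s″) z Ψ) (o 20 tt) good′ ,
              subst (λ z → Grows z (arrs s′) (arrs s″)) (o 20 tt) gr′ ,
              subst (λ z → ∃[ q″ ] Span (arrs s″) z (k + S 40) q″ (e + e′)) (o 20 tt)
                (subst₂ (λ k e → ∃[ q″ ] Span (arrs s″) (S 20) (k + S 40) q″ (e + e′)) r30 r35 sp)) })
        (λ s′ _ good gr goals → end s′ good gr goals)
    where
    z : ℕ
    z = regs s 20
    k : ℕ
    k = regs s 30
    q : ℕ
    q = regs s 31
    joined : ∀ Ψ {k k′ e e′ o o′ c c′ δ δ′ k₁ e₁ o₁ c₁ δ₁} → k′ ≡ k → e′ ≡ e → o′ ≡ o → c′ ≡ c → δ′ ≡ δ →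
      Ψ (k + k₁) (e + e₁) (o + o₁) (c + (c₁ + k * δ₁)) (δ + δ₁) →
      Ψ (k′ + k₁) (e′ + e₁) (o′ + o₁) (c′ + (c₁ + k′ * δ₁)) (δ′ + δ₁)
    joined Ψ refl refl refl refl refl ψ = ψ

  wp-glueInto : ∀ {P s} Φ Φ′ Ψ →
    let A = arrs s; z = regs s 20; a = regs s 33; b = regs s 43; N = regs s 3 in
    regs s 4 ≡ suc d → a ≢ z → b ≢ z → Good A a Φ → Good A b Φ′ → Good A z Ψ →
    (∀ {k e o c δ k′ e′ o′ c′ δ′} → Φ k e o c δ → Φ′ k′ e′ o′ c′ δ′ →
      Ψ (k + k′) (e + e′) (o + o′) (c + (c′ + k * δ′)) (δ + δ′)) →
    (∀ s′ → Outside glueInto s s′ → Good (arrs s′) z Ψ → Grows z A (arrs s′) →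
      (∀ k q m e k′ q′ m′ e′ → k < N → q < N → m < 2 → A 6 (key a k q m) ≡ suc e →
        k′ < N → q′ < N → m′ < 2 → A 6 (key b k′ q′ m′) ≡ suc e′ →
        ∃[ q″ ] Span (arrs s′) z (k + k′) q″ (e + e′)) → P s′) →
    wp glueInto P s
  wp-glueInto {P} {s} Φ Φ′ Ψ Δ a≢z b≢z gooda goodb goodz combine end =
    wp-overTable d _ _ _ _ z Φ Ψ
      (λ k q m e B → ∀ k′ q′ m′ e′ → k′ < N → q′ < N → m′ < 2 → A 6 (key b k′ q′ m′) ≡ suc e′ →
        ∃[ q″ ] Span B z (k + k′) q″ (e + e′))
      (λ gr goal k′ q′ m′ e′ k< q< m< eq → map₂ (proj₂ gr _ _ _) (goal k′ q′ m′ e′ k< q< m< eq))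
      a≢z gooda goodz
      (λ { _ _ _ e s′ _ _ _ (o , _) refl refl refl good gr used φ lo hi →
        wp-glueBody Φ′ Ψ _ e
          (trans (key-eval (reg 33) (reg 30) (reg 31) (reg 32) s′)
            (cong (λ a → key a (regs s′ 30) (regs s′ 31) (regs s′ 32)) (o 33 tt)))
          used lo hi (trans (o 4 tt) Δ)
          (subst₂ _≢_ (sym (o 43 tt)) (sym (o 20 tt)) b≢z)
          (subst (λ b → Good (arrs s′) b Φ′) (sym (o 43 tt)) (good-same (proj₁ gr b≢z) goodb))
          (subst (λ z → Good (arrs s′) z Ψ) (sym (o 20 tt)) good)
          (combine φ)
          (λ s″ good′ gr′ goals →
            subst (λ z → Good (arrs s″) z Ψ) (o 20 tt) good′ ,
            subst (λ z → Grows z (arrs s′) (arrs s″)) (o 20 tt) gr′ ,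
            λ k′ q′ m′ e′ k< q< m< eq →
              subst (λ z → ∃[ q″ ] Span (arrs s″) z (regs s′ 30 + k′) q″ (e + e′)) (o 20 tt)
                (goals k′ q′ m′ e′
                  (subst (k′ <_) (sym (o 3 tt)) k<) (subst (q′ <_) (sym (o 3 tt)) q<) m<
                  (trans (cong (λ b → arrs s′ 6 (key b k′ q′ m′)) (o 43 tt))
                    (trans (proj₁ (proj₁ gr b≢z k′ q′ m′)) eq)))) })
      (λ s′ o good gr goals → end s′ o good gr
        (λ k q m e k′ q′ m′ e′ k< q< m< eq → goals k q m e k< q< m< eq k′ q′ m′ e′))
    where
    A : Arrs
    A = arrs s
    z : ℕ
    z = regs s 20
    b : ℕ
    b = regs s 43
    N : ℕ
    N = regs s 3

  wp-copyInto : ∀ {P s} Φ Ψ →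
    let A = arrs s; z = regs s 20; a = regs s 33; N = regs s 3 in
    regs s 4 ≡ suc d → a ≢ z → Good A a Φ → Good A z Ψ →
    (∀ {k e o c δ} → Φ k e o c δ → Ψ k e o c δ) →
    (∀ s′ → Outside copyInto s s′ → Good (arrs s′) z Ψ → Grows z A (arrs s′) →
      (∀ k q m e → k < N → q < N → m < 2 → A 6 (key a k q m) ≡ suc e →
        ∃[ q′ ] Span (arrs s′) z k q′ e) → P s′) →
    wp copyInto P s
  wp-copyInto {P} {s} Φ Ψ Δ a≢z gooda goodz incl end =
    wp-overTable d _ _ _ _ z Φ Ψ
      (λ k q m e B → ∃[ q″ ] Span B z k q″ e)
      (λ gr → map₂ (proj₂ gr _ _ _))
      a≢z gooda goodz
      (λ { _ _ _ e s′ _ _ _ (o , _) refl refl refl good gr used φ lo hi →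
        let x≡ = trans (key-eval (reg 33) (reg 30) (reg 31) (reg 32) s′)
                   (cong (λ a → key a (regs s′ 30) (regs s′ 31) (regs s′ 32)) (o 33 tt))
        in copyCell s′ _ e x≡ used (trans (o 4 tt) Δ)
          (subst (λ z → Good (arrs s′) z Ψ) (sym (o 20 tt)) good) (incl φ) lo hi
          (λ s″ good′ gr′ sp →
            subst (λ z → Good (arrs s″) z Ψ) (o 20 tt) good′ ,
            subst (λ z → Grows z (arrs s′) (arrs s″)) (o 20 tt) gr′ ,
            subst (λ z → ∃[ q″ ] Span (arrs s″) z (regs s′ 30) q″ e) (o 20 tt) sp) })
      end
    where
    A : Arrs
    A = arrs s
    z : ℕ
    z = regs s 20
    copyCell : ∀ {P} s x e → let A = arrs s; z = regs s 20; k = regs s 30; q = regs s 31 in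
      ⟦ loadE ⟧ s ≡ x → A 6 x ≡ suc e → regs s 4 ≡ suc d → Good A z Ψ →
      Ψ k e (A 7 x) (A 8 x) (A 9 x) → q * suc d ≤ e → e < suc q * suc d →
      (∀ s′ → Good (arrs s′) z Ψ → Grows z A (arrs s′) →
        (∃[ q′ ] Span (arrs s′) z k q′ e) → P s′) →
      wp copyBody P s
    copyCell s x e refl used Δ good ψ lo hi end =
      wp-set⨟ $ wp-set⨟ $ wp-set⨟ $ wp-set⨟ $ wp-set⨟ $ wp-set⨟ $ wp-set⨟ $
        wp-insert Ψ Δ (castΦ Ψ (pred≡ used) refl refl refl ψ)
          (subst (regs s 31 * suc d ≤_) (pred≡ used) lo)
          (m≤n⇒m≤o+n (suc d) (subst (_< suc (regs s 31) * suc d) (pred≡ used) hi))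
          good
          (λ s′ _ good′ gr sp → end s′ good′ gr
            (subst (λ e → ∃[ q ] Span (arrs s′) (regs s 20) (regs s 30) q e) (sym (pred≡ used)) sp))

  wp-closeInto : ∀ {P s} Φ Ψ →
    let A = arrs s; z = regs s 20; a = regs s 33; N = regs s 3; l = regs s 1; W = A 10 a in
    regs s 4 ≡ suc d → a ≢ z → Good A a Φ → Good A z Ψ →
    (∀ {k e o c δ e′} → Φ k e o c δ → W ≡ suc k * l + e′ → e ≤ e′ → e′ ≤ e + d →
      Ψ (suc k) e′ 0 (c + k * o) (δ + o)) →
    (∀ s′ → Outside closeInto s s′ → Good (arrs s′) z Ψ → Grows z A (arrs s′) →
      (∀ k q m e e′ → k < N → q < N → m < 2 → A 6 (key a k q m) ≡ suc e →
        W ≡ suc k * l + e′ → e ≤ e′ → e′ ≤ e + d →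
        ∃[ q′ ] Span (arrs s′) z (suc k) q′ e′) → P s′) →
    wp closeInto P s
  wp-closeInto {P} {s} Φ Ψ Δ a≢z gooda goodz shut end =
    wp-overTable d _ _ _ _ z Φ Ψ
      (λ k q m e B → ∀ e′ → W ≡ suc k * l + e′ → e ≤ e′ → e′ ≤ e + d → ∃[ q″ ] Span B z (suc k) q″ e′)
      (λ gr goal e′ w le le′ → map₂ (proj₂ gr _ _ _) (goal e′ w le le′))
      a≢z gooda goodz
      (λ { _ _ _ e s′ _ _ _ (o , oa) refl refl refl good gr used φ lo hi →
        let x≡ = trans (key-eval (reg 33) (reg 30) (reg 31) (reg 32) s′)
                   (cong (λ a → key a (regs s′ 30) (regs s′ 31) (regs s′ 32)) (o 33 tt))
            w≡ = trans (cong (λ f → f (regs s′ 33)) (oa 10 tt)) (cong (A 10) (o 33 tt))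
        in closeCase s′ _ e x≡ used (trans (o 4 tt) Δ)
          (subst (λ z → Good (arrs s′) z Ψ) (sym (o 20 tt)) good)
          (λ eq → shut φ (trans (sym w≡) (trans eq (cong (λ l → suc (regs s′ 30) * l + _) (o 1 tt))))) lo hi
          (λ s″ good′ gr′ sp →
            subst (λ z → Good (arrs s″) z Ψ) (o 20 tt) good′ ,
            subst (λ z → Grows z (arrs s′) (arrs s″)) (o 20 tt) gr′ ,
            λ e′ w le le′ → subst (λ z → ∃[ q″ ] Span (arrs s″) z (suc (regs s′ 30)) q″ e′) (o 20 tt)
              (sp e′ (trans w≡ (trans w (cong (λ l → suc (regs s′ 30) * l + e′) (sym (o 1 tt))))) le le′)) })
      (λ s′ o good gr goals → end s′ o good gr
        (λ k q m e e′ k< q< m< eq → goals k q m e k< q< m< eq e′))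
    where
    A : Arrs
    A = arrs s
    z : ℕ
    z = regs s 20
    l : ℕ
    l = regs s 1
    W : ℕ
    W = A 10 (regs s 33)
    closeCase : ∀ {P} s x e → let A = arrs s; z = regs s 20; k = regs s 30; q = regs s 31; W = A 10 (regs s 33) in
      ⟦ loadE ⟧ s ≡ x → A 6 x ≡ suc e → regs s 4 ≡ suc d → Good A z Ψ →
      (∀ {e′} → W ≡ suc k * regs s 1 + e′ → e ≤ e′ → e′ ≤ e + d →
        Ψ (suc k) e′ 0 (A 8 x + k * A 7 x) (A 9 x + A 7 x)) →
      q * suc d ≤ e → e < suc q * suc d →
      (∀ s′ → Good (arrs s′) z Ψ → Grows z A (arrs s′) →
        (∀ e′ → W ≡ suc k * regs s 1 + e′ → e ≤ e′ → e′ ≤ e + d →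
          ∃[ q′ ] Span (arrs s′) z (suc k) q′ e′) → P s′) →
      wp closeBody P s
    closeCase {P} s x e refl used Δ good ψ lo hi end =
      wp-set⨟ $ wp-set⨟ $ wp-set⨟ $ wp-set⨟ $ wp-when
        (λ cond →
          let c₁ , c′ = mul-true {⟦ leq ⟧ᵒ k·l V} cond
              c₂ , c₃ = mul-true {⟦ leq ⟧ᵒ (arrs s 6 x ∸ 1) (V ∸ k·l)} c′
              V≡ : V ≡ k·l + (V ∸ k·l)
              V≡ = sym (m+[n∸m]≡n (leq-true {k·l} {V} c₁))
              e≤ : e ≤ V ∸ k·l
              e≤ = subst (_≤ V ∸ k·l) (sym (pred≡ used)) (leq-true c₂)
              ≤e : V ∸ k·l ≤ e + d
              ≤e = s≤s⁻¹ (≤-trans (leq-true c₃) (≤-reflexive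
                     (trans (cong₂ _+_ Δ (sym (pred≡ used))) (cong suc (+-comm d e)))))
          in wp-set⨟ $ wp-set⨟ $ wp-set⨟ $ wp-set⨟ $ wp-set⨟ $ wp-set⨟ $
             wp-insert Ψ Δ (ψ V≡ e≤ ≤e) (≤-trans lo e≤)
               (≤-<-trans ≤e (subst (e + d <_) (+-comm (suc q * suc d) (suc d)) (+-mono-<-≤ hi (n≤1+n d))))
               good
               (λ s′ _ good′ gr sp → end s′ good′ gr λ e′ w le le′ →
                 subst (λ e′ → ∃[ q′ ] Span (arrs s′) (regs s 20) (suc k) q′ e′)
                   (+-cancelˡ-≡ k·l (V ∸ k·l) e′ (trans (sym V≡) w)) sp))
        (λ cond → end _ good (grows-refl {regs s 20} {arrs s}) λ e′ w le le′ →
          contradiction cond λ z → case mul-false {⟦ leq ⟧ᵒ k·l V} z of λ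
            { (inj₁ z) → <⇒≱ (leq-false z) (subst (k·l ≤_) (sym w) (m≤m+n k·l e′))
            ; (inj₂ z) → let e′≡ = trans (sym (m+n∸m≡n k·l e′)) (cong (_∸ k·l) (sym w)) in
               case mul-false {⟦ leq ⟧ᵒ (arrs s 6 x ∸ 1) (V ∸ k·l)} z of λ
                { (inj₁ z) → <⇒≱ (leq-false z) (subst₂ _≤_ (pred≡ used) e′≡ le)
                ; (inj₂ z) → <⇒≱ (leq-false z)
                    (subst₂ _≤_ (cong suc e′≡) (trans (cong suc (+-comm e d)) (cong₂ _+_ (sym Δ) (pred≡ used)))
                      (s≤s le′)) } })
      where
      k : ℕ
      k = regs s 30
      q : ℕ
      q = regs s 31
      V : ℕ
      V = arrs s 10 (regs s 33)
      k·l : ℕ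
      k·l = suc k * regs s 1

-- Partial partitions and their codes

module _ {A : Set} where

  unique-↭ : {xs ys : List A} → Unique xs → Unique ys →
    (∀ {v} → v ∈ xs → v ∈ ys) → (∀ {v} → v ∈ ys → v ∈ xs) → xs ↭ ys
  unique-↭ u u′ f g = ∼bag⇒↭ (unique∧set⇒bag u u′ (mk⇔ f g))

  ++-interchange : (ws xs ys zs : List A) → (ws ++ xs) ++ (ys ++ zs) ↭ (ws ++ ys) ++ (xs ++ zs)
  ++-interchange ws xs ys zs = begin
    (ws ++ xs) ++ (ys ++ zs) ≡⟨ List.++-assoc ws xs (ys ++ zs) ⟩
    ws ++ (xs ++ (ys ++ zs)) ↭⟨ ↭-++⁺ˡ ws (shifts xs ys) ⟩
    ws ++ (ys ++ (xs ++ zs)) ≡⟨ List.++-assoc ws ys (xs ++ zs) ⟨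
    (ws ++ ys) ++ (xs ++ zs) ∎
    where open PermutationReasoning

  total : (A → ℕ) → List A → ℕ
  total f xs = sum (map f xs)

  total-++ : ∀ f xs ys → total f (xs ++ ys) ≡ total f xs + total f ys
  total-++ f xs ys = trans (cong sum (map-++ f xs ys)) (sum-++ (map f xs) (map f ys))

  total-↭ : ∀ f {xs ys} → xs ↭ ys → total f xs ≡ total f ys
  total-↭ f p = sum-↭ (↭-map⁺ f p)

  total-concat : ∀ f xss → total f (concat xss) ≡ sum (map (total f) xss)
  total-concat f [] = refl
  total-concat f (xs ∷ xss) = trans (total-++ f xs (concat xss)) (cong (total f xs +_) (total-concat f xss))

  labelled : (A → ℕ) → ℕ → List (List A) → ℕ
  labelled f i []         = 0
  labelled f i (xs ∷ xss) = i * total f xs + labelled f (suc i) xss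

  labelled-shift : ∀ f i j xss →
    labelled f (i + j) xss ≡ labelled f j xss + i * total f (concat xss)
  labelled-shift f i j [] = sym (*-zeroʳ i)
  labelled-shift f i j (xs ∷ xss)
    rewrite sym (+-suc i j) | labelled-shift f i (suc j) xss | total-++ f xs (concat xss) =
      rearrange i j (total f xs) (labelled f (suc j) xss) (total f (concat xss))
    where
    rearrange : ∀ i j x y z → (i + j) * x + (y + i * z) ≡ (j * x + y) + i * (x + z)
    rearrange = solve-∀

  labelled-++ : ∀ f i xss yss →
    labelled f i (xss ++ yss) ≡ labelled f i xss + labelled f (i + length xss) yss
  labelled-++ f i [] yss = cong (λ j → labelled f j yss) (sym (+-identityʳ i))
  labelled-++ f i (xs ∷ xss) yss
    rewrite labelled-++ f (suc i) xss yss | +-suc i (length xss) =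
      sym (+-assoc (i * total f xs) (labelled f (suc i) xss) _)

module Solutions {n : ℕ} (G : Graph n) (w : Fin n → ℕ) (l d : ℕ) (pw : Fin n → ℕ) where

  Within : List (Fin n) → Fin n → Fin n → Set
  Within xs p q = p ∈ xs × q ∈ xs × Adj G p q

  Rooted : Fin n → List (Fin n) → Set
  Rooted r xs = r ∈ xs × (∀ {y} → y ∈ xs → Star (Within xs) r y)

  Hangs : Fin n → List (Fin n) → Set
  Hangs r xs = xs ≡ [] ⊎ ∃[ v ] Adj G r v × Rooted v xs

  Cluster : List (Fin n) → Set
  Cluster xs = (∃[ r ] Rooted r xs) × l ≤ total w xs × total w xs ≤ l + d

  within-⊆ : ∀ {xs ys} → (∀ {x} → x ∈ xs → x ∈ ys) → ∀ {p q} → Within xs p q → Within ys p q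
  within-⊆ incl (a , b , e) = incl a , incl b , e

  rooted-hang : ∀ {r xs ys} → Rooted r xs → Hangs r ys → Rooted r (xs ++ ys)
  rooted-hang {r} {xs} root (inj₁ refl) = subst (Rooted r) (sym (List.++-identityʳ xs)) root
  rooted-hang {r} {xs} {ys} (r∈ , conn) (inj₂ (v , adj , v∈ , conn′)) = ∈-++⁺ˡ r∈ , go
    where
    go : ∀ {y} → y ∈ xs ++ ys → Star (Within (xs ++ ys)) r y
    go y∈ with ∈-++⁻ xs y∈
    ... | inj₁ y∈ = Star.map (within-⊆ ∈-++⁺ˡ) (conn y∈)
    ... | inj₂ y∈ = (∈-++⁺ˡ r∈ , ∈-++⁺ʳ xs v∈ , adj) ◅ Star.map (within-⊆ (∈-++⁺ʳ xs)) (conn′ y∈)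

  -- A partition of U into an open cluster with property P, possibly empty, and
  -- k closed ones, together with its codes.
  record Sol (U : List (Fin n)) (P : List (Fin n) → Set) (k e o c δ : ℕ) : Set where
    field
      active   : List (Fin n)
      closed   : List (List (Fin n))
      covers   : active ++ concat closed ↭ U
      ok       : P active
      clusters : All Cluster closed
      count    : k ≡ length closed
      excess   : total w (concat closed) ≡ k * l + e
      code-o   : o ≡ total pw active
      code-c   : c ≡ labelled pw 0 closed
      code-δ   : δ ≡ total pw (concat closed)

  sol-weaken : ∀ {U U′ P P′ k e o c δ} → U ↭ U′ → (∀ {xs} → P xs → P′ xs) →
    Sol U P k e o c δ → Sol U′ P′ k e o c δ
  sol-weaken p f s = record
    { active = active ; closed = closed ; covers = ↭-trans covers p ; ok = f ok
    ; clusters = clusters ; count = count ; excess = excess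
    ; code-o = code-o ; code-c = code-c ; code-δ = code-δ }
    where open Sol s

  sol-glue : ∀ {U U′ P P′ P″} → (∀ {xs ys} → P xs → P′ ys → P″ (xs ++ ys)) →
    ∀ {k e o c δ k′ e′ o′ c′ δ′} → Sol U P k e o c δ → Sol U′ P′ k′ e′ o′ c′ δ′ →
    Sol (U ++ U′) P″ (k + k′) (e + e′) (o + o′) (c + (c′ + k * δ′)) (δ + δ′)
  sol-glue {U} {U′} f {k} {e} {k′ = k′} {e′} {c′ = c′} s s′ = record
    { active = S.active ++ S′.active
    ; closed = S.closed ++ S′.closed
    ; covers = begin
        (S.active ++ S′.active) ++ concat (S.closed ++ S′.closed)
          ≡⟨ cong ((S.active ++ S′.active) ++_) (sym cc) ⟩
        (S.active ++ S′.active) ++ (concat S.closed ++ concat S′.closed)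
          ↭⟨ ++-interchange S.active S′.active (concat S.closed) (concat S′.closed) ⟩
        (S.active ++ concat S.closed) ++ (S′.active ++ concat S′.closed)
          ↭⟨ ↭-++⁺ S.covers S′.covers ⟩
        U ++ U′ ∎
    ; ok = f S.ok S′.ok
    ; clusters = All-++⁺ S.clusters S′.clusters
    ; count = trans (cong₂ _+_ S.count S′.count) (sym (length-++ S.closed))
    ; excess = trans (cong (total w) (sym cc)) (trans (total-++ w (concat S.closed) (concat S′.closed))
        (trans (cong₂ _+_ S.excess S′.excess) (rearrange k k′ l e e′)))
    ; code-o = trans (cong₂ _+_ S.code-o S′.code-o) (sym (total-++ pw S.active S′.active))
    ; code-c = trans (cong₂ _+_ S.code-c
          (trans (cong₂ _+_ S′.code-c (cong₂ _*_ S.count S′.code-δ))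
            (sym (trans (cong (λ j → labelled pw j S′.closed) (sym (+-identityʳ (length S.closed))))
                        (labelled-shift pw (length S.closed) 0 S′.closed)))))
        (sym (labelled-++ pw 0 S.closed S′.closed))
    ; code-δ = trans (cong₂ _+_ S.code-δ S′.code-δ)
        (trans (sym (total-++ pw (concat S.closed) (concat S′.closed))) (cong (total pw) cc)) }
    where
    module S = Sol s
    module S′ = Sol s′
    open PermutationReasoning
    cc = concat-++ S.closed S′.closed
    rearrange : ∀ k k′ l e e′ → (k * l + e) + (k′ * l + e′) ≡ (k + k′) * l + (e + e′)
    rearrange = solve-∀

  sol-close : ∀ {U P k e o c δ e′} → (∀ {xs} → P xs → ∃[ r ] Rooted r xs) →
    Sol U P k e o c δ → total w U ≡ suc k * l + e′ → e ≤ e′ → e′ ≤ e + d →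
    Sol U (_≡ []) (suc k) e′ 0 (c + k * o) (δ + o)
  sol-close {U} {P} {k} {e} {o} {c} {δ} {e′} f s W≡ e≤ ≤e = record
    { active = []
    ; closed = closed ++ (active ∷ [])
    ; covers = ↭-trans (↭-reflexive cc) (↭-trans (↭-++-comm (concat closed) active) covers)
    ; ok = refl
    ; clusters = All-++⁺ clusters ((f ok , lower , upper) ∷ [])
    ; count = trans (cong suc count) (sym (trans (length-++ closed) (+-comm _ 1)))
    ; excess = trans (cong (total w) cc) (trans (total-++ w (concat closed) active)
        (trans (+-comm (total w (concat closed)) _) (trans (sym W-split) W≡)))
    ; code-o = refl
    ; code-c = trans (cong₂ _+_ code-c (trans (cong₂ _*_ count code-o) (sym (+-identityʳ _))))
        (sym (labelled-++ pw 0 closed (active ∷ [])))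
    ; code-δ = trans (cong₂ _+_ code-δ code-o)
        (trans (sym (total-++ pw (concat closed) active)) (cong (total pw) (sym cc))) }
    where
    open Sol s
    cc : concat (closed ++ (active ∷ [])) ≡ concat closed ++ active
    cc = trans (sym (concat-++ closed (active ∷ []))) (cong (concat closed ++_) (List.++-identityʳ active))
    W-split : total w U ≡ total w active + total w (concat closed)
    W-split = trans (sym (total-↭ w covers)) (total-++ w active (concat closed))
    active+e : total w active + e ≡ l + e′
    active+e = +-cancelˡ-≡ (k * l) _ _ (trans (rearrange (k * l) (total w active) e)
      (trans (cong (total w active +_) (sym excess)) (trans (sym W-split) (trans W≡ (rearrange′ (k * l) l e′)))))
      where
      rearrange : ∀ a b c → a + (b + c) ≡ b + (a + c)
      rearrange = solve-∀
      rearrange′ : ∀ a b c → b + a + c ≡ a + (b + c)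
      rearrange′ = solve-∀
    lower : l ≤ total w active
    lower = +-cancelʳ-≤ e′ l (total w active)
      (subst (_≤ total w active + e′) active+e (+-monoʳ-≤ (total w active) e≤))
    upper : total w active ≤ l + d
    upper = +-cancelʳ-≤ e (total w active) (l + d)
      (subst₂ _≤_ (sym active+e) (trans (cong (l +_) (+-comm e d)) (sym (+-assoc l d e))) (+-monoʳ-≤ l ≤e))

  clusters-≤ : ∀ {xss} → All Cluster xss → total w (concat xss) ≤ length xss * l + length xss * d
  clusters-≤ [] = z≤n
  clusters-≤ {xs ∷ xss} ((_ , _ , up) ∷ cs) = begin
    total w (concat (xs ∷ xss))        ≡⟨ total-++ w xs (concat xss) ⟩
    total w xs + total w (concat xss)  ≤⟨ +-mono-≤ up (clusters-≤ cs) ⟩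
    (l + d) + (length xss * l + length xss * d) ≡⟨ rearrange l d (length xss * l) (length xss * d) ⟩
    (l + length xss * l) + (d + length xss * d) ∎
    where
    open ≤-Reasoning
    rearrange : ∀ a b x y → (a + b) + (x + y) ≡ (a + x) + (b + y)
    rearrange = solve-∀

  sol-bound : ∀ {U P k e o c δ} → Sol U P k e o c δ → e ≤ k * d
  sol-bound {k = k} {e} s = +-cancelˡ-≤ (k * l) e (k * d)
    (subst₂ _≤_ excess (cong (λ k → k * l + k * d) (sym count)) (clusters-≤ clusters))
    where open Sol s

  sol-single : ∀ v → Sol (v ∷ []) (Rooted v) 0 0 (pw v) 0 0
  sol-single v = record
    { active = v ∷ [] ; closed = [] ; covers = ↭-refl
    ; ok = here refl , λ { (here refl) → ε }
    ; clusters = [] ; count = refl ; excess = refl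
    ; code-o = sym (+-identityʳ (pw v)) ; code-c = refl ; code-δ = refl }

  sol-empty : Sol [] (_≡ []) 0 0 0 0 0
  sol-empty = record
    { active = [] ; closed = [] ; covers = ↭-refl ; ok = refl ; clusters = [] ; count = refl
    ; excess = refl ; code-o = refl ; code-c = refl ; code-δ = refl }

-- Trimmed tables

module Hits (d : ℕ) where
  open Buckets d

  -- Whether an excess e can be completed to a valid partition is a condition
  -- of the form Near e c, so that a table may replace a set of excesses by
  -- any subset that is near the same numbers.
  Near : ℕ → ℕ → Set
  Near e c = e ≤ c × c ≤ e + d

  Hit : Arrs → ℕ → ℕ → ℕ → Set
  Hit A t k c = ∃[ q ] ∃[ e ] Span A t k q e × Near e c

  record Complete (A : Arrs) (t k e : ℕ) : Set where
    constructor complete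
    field
      hits : ∀ {c} → Near e c → Hit A t k c
  open Complete public

  Bounded : Family → Set
  Bounded Φ = ∀ {k e o c δ} → Φ k e o c δ → e ≤ k * d

  complete-grows : ∀ {A B t k e} → Grows t A B → Complete A t k e → Complete B t k e
  hits (complete-grows {A} {B} {t} {k} gr comp) near with hits comp near
  ... | q , e , sp , ne = q , e , proj₂ gr k q e sp , ne

  complete-same : ∀ {A B t k e} → SameTable B A t → Complete A t k e → Complete B t k e
  hits (complete-same {A} {B} {t} {k} same comp) near with hits comp near
  ... | q , e , sp , ne = q , e , span-same {A} {B} {t} {k} {q} {e} same sp , ne

  bucket-≤ : ∀ {k q e} → q * suc d ≤ e → e ≤ k * d → q ≤ k
  bucket-≤ {k} {q} {e} lo hi = ≮⇒≥ λ k<q → <-irrefl refl (begin-strict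
    k * d         ≤⟨ *-monoʳ-≤ k (n≤1+n d) ⟩
    k * suc d     <⟨ m<n+m (k * suc d) z<s ⟩
    suc k * suc d ≤⟨ *-monoˡ-≤ (suc d) k<q ⟩
    q * suc d     ≤⟨ lo ⟩
    e             ≤⟨ hi ⟩
    k * d         ∎)
    where open ≤-Reasoning

  hit-entry : ∀ {A t Φ k c} → Good A t Φ → Bounded Φ → Hit A t k c →
    ∃[ q ] ∃[ m ] ∃[ e ] q ≤ k × m < 2 × A 6 (key t k q m) ≡ suc e × Near e c
  hit-entry {A} {t} {Φ} {k} {c} good bd (q , e , (e₀ , e₁ , eq₀ , eq₁ , e₀≤e , e≤e₁) , e≤c , c≤)
    with good k q
  ... | inj₁ (z , _) = case trans (sym z) eq₀ of λ ()
  ... | inj₂ F with e₁ ≤? c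
  ...   | yes e₁≤c = q , 1 , e₁ ,
          bucket-≤ (Full.lo F) (bd (proj₂ (Full.min F))) , s≤s (s≤s z≤n) , eq₁ ,
          e₁≤c , ≤-trans c≤ (+-monoˡ-≤ d e≤e₁)
  ...   | no e₁≰c = q , 0 , e₀ ,
          bucket-≤ (Full.lo F) (bd (proj₂ (Full.min F))) , s≤s z≤n , eq₀ ,
          ≤-trans e₀≤e e≤c , ≤-trans (<⇒≤ (≰⇒> e₁≰c)) e₁≤e₀+d
    where
    e₁≤e₀+d : e₁ ≤ e₀ + d
    e₁≤e₀+d = s≤s⁻¹ (begin
      suc e₁           ≡⟨ cong suc (suc-injective (trans (sym eq₁) (proj₁ (Full.max F)))) ⟩
      suc (Full.e₁ F)  ≤⟨ Full.hi F ⟩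
      suc d + q * suc d ≤⟨ +-monoʳ-≤ (suc d) (Full.lo F) ⟩
      suc d + Full.e₀ F ≡⟨ cong (suc d +_) (suc-injective (trans (sym (proj₁ (Full.min F))) eq₀)) ⟩
      suc (d + e₀)     ≡⟨ cong suc (+-comm d e₀) ⟩
      suc (e₀ + d)     ∎)
      where open ≤-Reasoning

  complete-sum : ∀ {A B a b z N Φ Φ′ k e k′ e′} → Good A a Φ → Bounded Φ → Good A b Φ′ → Bounded Φ′ →
    (∀ k q m e k′ q′ m′ e′ → k < N → q < N → m < 2 → A 6 (key a k q m) ≡ suc e →
      k′ < N → q′ < N → m′ < 2 → A 6 (key b k′ q′ m′) ≡ suc e′ →
      ∃[ q″ ] Span B z (k + k′) q″ (e + e′)) →
    k < N → k′ < N → Complete A a k e → Complete A b k′ e′ → Complete B z (k + k′) (e + e′)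
  hits (complete-sum {N = N} {k = k} {e} {k′} {e′} ga ba gb bb goals k< k′< ca cb) {c} (le , le′)
    with hit-entry ga ba (hits ca {c ∸ e′}
           (m+n≤o⇒m≤o∸n e le ,
            m≤n+o⇒m∸n≤o c e′ (≤-trans le′ (≤-reflexive (swap e e′ d)))))
    where
    swap : ∀ a b c → a + b + c ≡ b + (a + c)
    swap = solve-∀
  ... | q₁ , m₁ , e₁ , q₁≤ , m₁< , eq₁ , le₁ , le₁′
    with hit-entry gb bb (hits cb {c ∸ e₁} near₂)
    where
    e′≤c : e′ ≤ c
    e′≤c = ≤-trans (m≤n+m e′ e) le
    e₁+e′≤c : e₁ + e′ ≤ c
    e₁+e′≤c = subst (e₁ + e′ ≤_) (m∸n+n≡m e′≤c) (+-monoˡ-≤ e′ le₁)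
    near₂ : Near e′ (c ∸ e₁)
    near₂ = m+n≤o⇒m≤o∸n e′ (subst (_≤ c) (+-comm e₁ e′) e₁+e′≤c) ,
      ≤-trans (∸-monoˡ-≤ e₁ (subst (_≤ e₁ + (e′ + d)) (m∸n+n≡m e′≤c)
                (≤-trans (+-monoˡ-≤ e′ le₁′) (≤-reflexive (swap e₁ d e′)))))
              (≤-reflexive (m+n∸m≡n e₁ (e′ + d)))
      where
      swap : ∀ a b c → a + b + c ≡ a + (c + b)
      swap = solve-∀
  ... | q₂ , m₂ , e₂ , q₂≤ , m₂< , eq₂ , le₂ , le₂′
    with goals k q₁ m₁ e₁ k′ q₂ m₂ e₂ k< (≤-<-trans q₁≤ k<) m₁< eq₁ k′< (≤-<-trans q₂≤ k′<) m₂< eq₂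
  ... | q″ , sp = q″ , e₁ + e₂ , sp ,
    subst₂ _≤_ (+-comm e₂ e₁) (m∸n+n≡m e₁≤c) (+-monoˡ-≤ e₁ le₂) ,
    subst₂ _≤_ (m∸n+n≡m e₁≤c) (swap e₂ d e₁) (+-monoˡ-≤ e₁ le₂′)
    where
    e₁≤c : e₁ ≤ c
    e₁≤c = ≤-trans le₁ (m∸n≤m c e′)
    swap : ∀ a b c → a + b + c ≡ c + a + b
    swap = solve-∀

  complete-copy : ∀ {A B a z N Φ k e} → Good A a Φ → Bounded Φ →
    (∀ k q m e → k < N → q < N → m < 2 → A 6 (key a k q m) ≡ suc e → ∃[ q′ ] Span B z k q′ e) →
    k < N → Complete A a k e → Complete B z k e
  hits (complete-copy ga ba goals k< ca) near with hit-entry ga ba (hits ca near)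
  ... | q₁ , m₁ , e₁ , q₁≤ , m₁< , eq₁ , near₁
    with goals _ q₁ m₁ e₁ k< (≤-<-trans q₁≤ k<) m₁< eq₁
  ... | q′ , sp = q′ , e₁ , sp , near₁

  complete-close : ∀ {A B a z N l W Φ k e e′} → Good A a Φ → Bounded Φ →
    (∀ k q m e e′ → k < N → q < N → m < 2 → A 6 (key a k q m) ≡ suc e →
      W ≡ suc k * l + e′ → e ≤ e′ → e′ ≤ e + d → ∃[ q′ ] Span B z (suc k) q′ e′) →
    k < N → W ≡ suc k * l + e′ → Near e e′ → Complete A a k e → Complete B z (suc k) e′
  hits (complete-close ga ba goals k< W≡ near ca) near′ with hit-entry ga ba (hits ca near)
  ... | q₁ , m₁ , e₁ , q₁≤ , m₁< , eq₁ , le , le′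
    with goals _ q₁ m₁ e₁ _ k< (≤-<-trans q₁≤ k<) m₁< eq₁ W≡ le le′
  ... | q′ , sp = q′ , _ , sp , near′

module Labels {n : ℕ} (G : Graph n) (w : Fin n → ℕ) (l d : ℕ) {K : ℕ}
              (P : LUPartition G w l (l + d) K) where
  open LUPartition P

  label : Fin n → Fin K
  label v = proj₁ (covering v)

  label-∈ : ∀ v → v ∈ₛ cluster (label v)
  label-∈ v = proj₂ (covering v)

  ∈-label : ∀ {v ℓ} → v ∈ₛ cluster ℓ → label v ≡ ℓ
  ∈-label {v} {ℓ} v∈ with label v ≟ᶠ ℓ
  ... | yes eq = eq
  ... | no ne  = contradiction (v , x∈p∩q⁺ (label-∈ v , v∈)) (disjoint ne)

  clusterW : Fin K → ℕ
  clusterW ℓ = clusterWeight w (cluster ℓ)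

  excessOf : Fin K → ℕ
  excessOf ℓ = clusterW ℓ ∸ l

  members : Fin K → List (Fin n)
  members ℓ = filter (_∈? cluster ℓ) (allFin n)

  ∈-members : ∀ {v ℓ} → label v ≡ ℓ → v ∈ members ℓ
  ∈-members {v} refl = ∈-filter⁺ (_∈? cluster (label v)) (∈-allFin v) (label-∈ v)

  members-∈ : ∀ {v ℓ} → v ∈ members ℓ → label v ≡ ℓ
  members-∈ {v} {ℓ} v∈ = ∈-label (proj₂ (∈-filter⁻ (_∈? cluster ℓ) {xs = allFin n} v∈))

  record Lab (U : List (Fin n)) (g : Fin K) (L : List (Fin K)) : Set where
    field
      unique : Unique L
      apart  : ∀ {ℓ} → ℓ ∈ L → ℓ ≢ g
      within : ∀ {v} → label v ∈ L → v ∈ U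
      labels : ∀ {v} → v ∈ U → label v ≡ g ⊎ label v ∈ L

  excesses : List (Fin K) → ℕ
  excesses = total excessOf

  lab-empty : ∀ g → Lab [] g []
  lab-empty g = record { unique = [] ; apart = λ () ; within = λ () ; labels = λ () }

  lab-single : ∀ v → Lab (v ∷ []) (label v) []
  lab-single v = record { unique = [] ; apart = λ () ; within = λ () ; labels = λ { (here refl) → inj₁ refl } }

  lab-glue : ∀ {U U′ g L L′} → (∀ {v} → v ∈ U → v ∈ U′ → ⊥) → Lab U g L → Lab U′ g L′ →
    Lab (U ++ U′) g (L ++ L′)
  lab-glue {U} {U′} {g} {L} {L′} disj a b = record
    { unique = Unique-++⁺ A.unique B.unique λ {ℓ} (p , q) →
        let v , v∈ = nonempty ℓ
            eq = ∈-label v∈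
        in disj (A.within (subst (_∈ L) (sym eq) p)) (B.within (subst (_∈ L′) (sym eq) q))
    ; apart = λ p → case ∈-++⁻ L p of λ { (inj₁ q) → A.apart q ; (inj₂ q) → B.apart q }
    ; within = λ p → case ∈-++⁻ L p of λ
        { (inj₁ q) → ∈-++⁺ˡ (A.within q) ; (inj₂ q) → ∈-++⁺ʳ U (B.within q) }
    ; labels = λ p → case ∈-++⁻ U p of λ
        { (inj₁ q) → case A.labels q of λ { (inj₁ e) → inj₁ e ; (inj₂ e) → inj₂ (∈-++⁺ˡ e) }
        ; (inj₂ q) → case B.labels q of λ { (inj₁ e) → inj₁ e ; (inj₂ e) → inj₂ (∈-++⁺ʳ L e) } } }
    where
    module A = Lab a
    module B = Lab b

  lab-↭ : ∀ {U U′ g L} → U ↭ U′ → Lab U g L → Lab U′ g L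
  lab-↭ p a = record { unique = unique ; apart = apart ; within = ∈-resp-↭ p ∘ within
                     ; labels = labels ∘ ∈-resp-↭ (↭-sym p) }
    where open Lab a

  lab-close : ∀ {U h z L} → Lab U h L → (∀ {v} → label v ≡ h → v ∈ U) → z ∉ U →
    Lab U (label z) (h ∷ L)
  lab-close {U} {h} {z} {L} a inside z∉ = record
    { unique = All.tabulate (λ p eq → apart p (sym eq)) ∷ unique
    ; apart = λ { (here refl) eq → z∉ (inside (sym eq))
                ; (there p) refl → z∉ (within p) }
    ; within = λ { (here eq) → inside eq ; (there p) → within p }
    ; labels = λ p → case labels p of λ { (inj₁ e) → inj₂ (here e) ; (inj₂ e) → inj₂ (there e) } }
    where open Lab a

  clusterW-split : ∀ ℓ → clusterW ℓ ≡ l + excessOf ℓ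
  clusterW-split ℓ = sym (m+[n∸m]≡n (lower ℓ))

  total-clusters : ∀ L → total clusterW L ≡ length L * l + excesses L
  total-clusters [] = refl
  total-clusters (ℓ ∷ L) rewrite total-clusters L | clusterW-split ℓ | m+n∸m≡n l (clusterW ℓ ∸ l) =
    rearrange l (clusterW ℓ ∸ l) (length L * l) (excesses L)
    where
    rearrange : ∀ a b x y → (a + b) + (x + y) ≡ (a + x) + (b + y)
    rearrange = solve-∀

  weight-split : ∀ {U h L} → Unique U → Lab U h L → (∀ {v} → label v ≡ h → v ∈ U) →
    total w U ≡ suc (length L) * l + (excessOf h + excesses L)
  weight-split {U} {h} {L} uU a inside =
    trans (total-↭ w U↭) (trans (total-concat w (map members (h ∷ L)))
      (trans (cong sum (maps (h ∷ L))) (total-clusters (h ∷ L))))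
    where
    open Lab a
    maps : ∀ L → map (total w) (map members L) ≡ map clusterW L
    maps [] = refl
    maps (ℓ ∷ L) = cong (clusterW ℓ ∷_) (maps L)
    uL : Unique (h ∷ L)
    uL = All.tabulate (λ p eq → apart p (sym eq)) ∷ unique
    all-unique : ∀ L → All Unique (map members L)
    all-unique [] = []
    all-unique (ℓ ∷ L) = Unique-filter⁺ (_∈? cluster ℓ) (allFin⁺ n) ∷ all-unique L
    U↭ : U ↭ concat (map members (h ∷ L))
    U↭ = unique-↭ uU
      (Unique-concat⁺ (all-unique (h ∷ L))
        (AllPairs-map⁺ (AllPairs.map (λ ne {v} → λ { (p , q) → ne (trans (sym (members-∈ p)) (members-∈ q)) }) uL)))
      (λ {v} p → ∈-concat⁺′ (∈-members refl)
        (∈-map⁺ members (case labels p of λ { (inj₁ e) → here e ; (inj₂ e) → there e })))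
      λ {v} p → let xs , v∈ , xs∈ = ∈-concat⁻′ (map members (h ∷ L)) p
                    ℓ , ℓ∈ , eq = ∈-map⁻ members xs∈
                    lv = members-∈ {v} {ℓ} (subst (v ∈_) eq v∈)
                in case subst (_∈ h ∷ L) (sym lv) ℓ∈ of λ
                   { (here e) → inside e ; (there e) → within e }

  excess≤d : ∀ ℓ → excessOf ℓ ≤ d
  excess≤d ℓ = ≤-trans (∸-monoˡ-≤ l (upper ℓ)) (≤-reflexive (m+n∸m≡n l d))

-- Depth-first search

data Anc (par : ℕ → ℕ) (a : ℕ) : ℕ → Set where
  here : Anc par a a
  up   : ∀ {b} → 0 < b → Anc par a (par b) → Anc par a b

anc-cong : ∀ {par par′ i a b} → (∀ {x} → 0 < x → x < i → par x < x) →
  (∀ {x} → x < i → par′ x ≡ par x) → b < i → Anc par a b → Anc par′ a b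
anc-cong par< eq b< here = here
anc-cong {par} {par′} {a = a} par< eq b< (up 0<b anc) =
  up 0<b (subst (Anc par′ a) (sym (eq b<)) (anc-cong par< eq (<-trans (par< 0<b b<) b<) anc))

module Ancestors {par : ℕ → ℕ} {i : ℕ} (par< : ∀ {x} → 0 < x → x < i → par x < x) where

  anc-≤ : ∀ {a b} → b < i → Anc par a b → a ≤ b
  anc-≤ b< here = ≤-refl
  anc-≤ b< (up 0<b anc) = ≤-trans (anc-≤ (<-trans (par< 0<b b<) b<) anc) (<⇒≤ (par< 0<b b<))

  anc-par : ∀ {a b} → Anc par a b → a ≢ b → 0 < b × Anc par a (par b)
  anc-par here ne = contradiction refl ne
  anc-par (up 0<b anc) ne = 0<b , anc

  anc-par-< : ∀ {a b} → b < i → Anc par a b → a < b → a ≤ par b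
  anc-par-< b< anc a<b with anc-par anc (<⇒≢ a<b)
  ... | 0<b , anc′ = anc-≤ (<-trans (par< 0<b b<) b<) anc′

  anc-trans : ∀ {a b c} → Anc par a b → Anc par b c → Anc par a c
  anc-trans p here = p
  anc-trans p (up 0<c q) = up 0<c (anc-trans p q)

  anc-chain : ∀ {a a′ b} → b < i → Anc par a b → Anc par a′ b → a ≤ a′ → Anc par a a′
  anc-chain b< p here a≤a′ = p
  anc-chain b< here q@(up _ _) a≤a′ with ≤-antisym a≤a′ (anc-≤ b< q)
  ... | refl = here
  anc-chain b< (up 0<b p) (up _ q) a≤a′ = anc-chain (<-trans (par< 0<b b<) b<) p q a≤a′

module DepthFirst (n : ℕ) (adj : ℕ → ℕ) where

  E : ℕ → ℕ → Set
  E x y = adj (n * x + y) ≢ 0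

  -- The first i vertices in depth-first preorder.  The vertices with an
  -- unvisited neighbour are ancestors of the vertex visited last.
  record Dfs (i : ℕ) (ord vis par : ℕ → ℕ) : Set where
    field
      ord<     : ∀ {x} → x < i → ord x < n
      ord-inj  : ∀ {x y} → x < i → y < i → ord x ≡ ord y → x ≡ y
      vis-ord  : ∀ {x} → x < i → vis (ord x) ≢ 0
      ord-vis  : ∀ {v} → vis v ≢ 0 → ∃[ x ] x < i × ord x ≡ v
      par<     : ∀ {x} → 0 < x → x < i → par x < x
      par-edge : ∀ {x} → 0 < x → x < i → E (ord (par x)) (ord x)
      edge-anc : ∀ {a b} → a < b → b < i → E (ord a) (ord b) → Anc par a b
      active   : ∀ {a v last} → a < i → v < n → vis v ≡ 0 → E (ord a) v → suc last ≡ i → Anc par a last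

  Open : ℕ → (ord vis : ℕ → ℕ) → ℕ → ℕ → Set
  Open i ord vis a v = a < i × v < n × vis v ≡ 0 × E (ord a) v

  dfs-start : 0 < n → ∀ {ord vis par} → ord 0 ≡ 0 → (∀ {v} → vis v ≢ 0 → v ≡ 0) → vis 0 ≢ 0 →
    Dfs 1 ord vis par
  dfs-start 0<n {ord} {vis} o v v0 = record
    { ord< = λ { (s≤s z≤n) → subst (_< n) (sym o) 0<n }
    ; ord-inj = λ { (s≤s z≤n) (s≤s z≤n) _ → refl }
    ; vis-ord = λ { (s≤s z≤n) → subst (λ x → vis x ≢ 0) (sym o) v0 }
    ; ord-vis = λ nz → 0 , s≤s z≤n , trans o (sym (v nz))
    ; par< = λ { (s≤s _) (s≤s ()) }
    ; par-edge = λ { (s≤s _) (s≤s ()) }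
    ; edge-anc = λ { (s≤s _) (s≤s ()) _ }
    ; active = λ { (s≤s z≤n) _ _ _ refl → here } }

  dfs-visit : ∀ {i ord vis par p v} → 0 < i → Dfs i ord vis par → Open i ord vis p v →
    (∀ {a v} → Open i ord vis a v → a ≤ p) →
    Dfs (suc i) (update ord i v) (update vis v 1) (update par i p)
  dfs-visit {suc j} {ord} {vis} {par} {p} {v} 0<i dfs (p< , v< , v0 , e) latest = record
    { ord< = λ x< → case m<1+n⇒m<n∨m≡n x< of λ
        { (inj₁ x<) → subst (_< n) (sym (ord-old x<)) (ord< x<)
        ; (inj₂ refl) → subst (_< n) (sym ord-new) v< }
    ; ord-inj = λ x< y< eq → inj (m<1+n⇒m<n∨m≡n x<) (m<1+n⇒m<n∨m≡n y<) eq
    ; vis-ord = λ x< → case m<1+n⇒m<n∨m≡n x< of λ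
        { (inj₁ x<) → subst (λ z → vis′ z ≢ 0) (sym (ord-old x<)) (vis-old (vis-ord x<))
        ; (inj₂ refl) → subst (λ z → vis′ z ≢ 0) (sym ord-new) vis-new }
    ; ord-vis = λ {z} nz → case v ≟ z of λ
        { (yes refl) → i , n<1+n i , ord-new
        ; (no ne) → let x , x< , eq = ord-vis (subst (_≢ 0) (update-other vis v 1 ne) nz)
                    in x , m<n⇒m<1+n x< , trans (ord-old x<) eq }
    ; par< = λ 0<x x< → case m<1+n⇒m<n∨m≡n x< of λ
        { (inj₁ x<) → subst (_< _) (sym (par-old x<)) (par< 0<x x<)
        ; (inj₂ refl) → subst (_< _) (sym par-new) p< }
    ; par-edge = λ 0<x x< → case m<1+n⇒m<n∨m≡n x< of λ
        { (inj₁ x<) → subst₂ E (sym (trans (cong ord′ (par-old x<)) (ord-old (<-trans (par< 0<x x<) x<))))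
                        (sym (ord-old x<)) (par-edge 0<x x<)
        ; (inj₂ refl) → subst₂ E (sym (trans (cong ord′ par-new) (ord-old p<))) (sym ord-new) e }
    ; edge-anc = λ a<b b< eab → case m<1+n⇒m<n∨m≡n b< of λ
        { (inj₁ b<) → anc-cong par< par-old b<
            (edge-anc a<b b< (subst₂ E (ord-old (<-trans a<b b<)) (ord-old b<) eab))
        ; (inj₂ refl) → to-new a<b (a<b , v< , v0 , subst₂ E (ord-old a<b) ord-new eab) }
    ; active = λ { {a} {z} a< z< z0 eaz refl → case m<1+n⇒m<n∨m≡n a< of λ
        { (inj₁ a<) → to-new a< (a< , z< , old-vis z0 , subst (λ x → E x z) (ord-old a<) eaz)
        ; (inj₂ refl) → here } } }
    where
    open Dfs dfs
    open Ancestors par<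
    i : ℕ
    i = suc j
    ord′ : ℕ → ℕ
    ord′ = update ord i v
    vis′ : ℕ → ℕ
    vis′ = update vis v 1
    ord-old : ∀ {x} → x < i → ord′ x ≡ ord x
    ord-old x< = update-other ord i v (λ eq → <⇒≢ x< (sym eq))
    par-old : ∀ {x} → x < i → update par i p x ≡ par x
    par-old x< = update-other par i p (λ eq → <⇒≢ x< (sym eq))
    ord-new : ord′ i ≡ v
    ord-new = update-same ord i v
    par-new : update par i p i ≡ p
    par-new = update-same par i p
    vis-new : vis′ v ≢ 0
    vis-new eq = case trans (sym (update-same vis v 1)) eq of λ ()
    vis-old : ∀ {z} → vis z ≢ 0 → vis′ z ≢ 0
    vis-old {z} nz with v ≟ z
    ... | yes refl = contradiction v0 nz
    ... | no ne    = subst (_≢ 0) (sym (update-other vis v 1 ne)) nz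
    old-vis : ∀ {z} → vis′ z ≡ 0 → vis z ≡ 0
    old-vis {z} eq with v ≟ z
    ... | yes refl = v0
    ... | no ne    = trans (sym (update-other vis v 1 ne)) eq
    inj : ∀ {x y} → x < i ⊎ x ≡ i → y < i ⊎ y ≡ i → ord′ x ≡ ord′ y → x ≡ y
    inj (inj₁ x<) (inj₁ y<) eq = ord-inj x< y< (trans (sym (ord-old x<)) (trans eq (ord-old y<)))
    inj (inj₁ x<) (inj₂ refl) eq =
      contradiction v0 (subst (λ z → vis z ≢ 0) (trans (sym (ord-old x<)) (trans eq ord-new)) (vis-ord x<))
    inj (inj₂ refl) (inj₁ y<) eq =
      contradiction v0 (subst (λ z → vis z ≢ 0) (trans (sym (ord-old y<)) (trans (sym eq) ord-new)) (vis-ord y<))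
    inj (inj₂ refl) (inj₂ refl) eq = refl
    to-new : ∀ {a z} → a < i → Open i ord vis a z → Anc (update par i p) a i
    to-new {a} a< opn@(_ , z< , z0 , eaz) =
      up 0<i (subst (Anc (update par i p) a) (sym par-new)
        (anc-cong par< par-old p<
          (anc-chain (n<1+n j) (active a< z< z0 eaz refl) (active p< v< v0 e refl) (latest opn))))

  unvisited : ∀ {i ord vis par} → Dfs i ord vis par → i < n → ∃[ v ] v < n × vis v ≡ 0
  unvisited {i} {ord} {vis} dfs i<n with any? {n = n} (λ v → vis (toℕ v) ≟ 0)
  ... | yes (v , eq) = toℕ v , toℕ<n v , eq
  ... | no all = contradiction i<n (≤⇒≯ (injective⇒≤ {f = f} f-inj))
    where
    at : ∀ v → ∃[ x ] x < i × ord x ≡ toℕ v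
    at v = Dfs.ord-vis dfs (λ eq → all (v , eq))
    f : Fin n → Fin i
    f v = fromℕ< (proj₁ (proj₂ (at v)))
    f-inj : ∀ {v v′} → f v ≡ f v′ → v ≡ v′
    f-inj {v} {v′} eq = toℕ-injective (trans (sym (proj₂ (proj₂ (at v))))
      (trans (cong ord (trans (sym (toℕ-fromℕ< _)) (trans (cong toℕ eq) (toℕ-fromℕ< _))))
        (proj₂ (proj₂ (at v′)))))

searchE : Expr
searchE = op mul (op leq (op add (lit 1) (reg 11)) (reg 15))
         (op mul (op leq (reg 13) (reg 11))
         (op mul (arr 1 (op add (op mul (reg 0) (arr 2 (reg 11))) (reg 12)))
                 (op equ (arr 3 (reg 12)) (lit 0))))

searchCmd searchRow search visit dfsBody dfs : Cmd
searchCmd = set 13 (reg 11) ⨟ set 14 (reg 12)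
searchRow = for 12 (reg 0) (when searchE searchCmd)
search = for 11 (reg 0) searchRow
visit = store 2 (reg 15) (reg 14) ⨟ store 3 (reg 14) (lit 1) ⨟ store 4 (reg 15) (reg 13)
dfsBody = set 15 (op sub (op sub (reg 0) (lit 1)) (reg 10)) ⨟ set 13 (lit 0) ⨟ set 14 (lit 0)
        ⨟ search ⨟ visit
dfs = store 3 (lit 0) (lit 1) ⨟ for 10 (op sub (reg 0) (lit 1)) dfsBody

module _ {n : ℕ} {adj : ℕ → ℕ} where
  open DepthFirst n adj

  wp-search : ∀ {P s i} (let ord = arrs s 2; vis = arrs s 3) →
    regs s 0 ≡ n → arrs s 1 ≡ adj → regs s 15 ≡ i → i ≤ n → regs s 13 ≡ 0 →
    (∃[ a ] ∃[ v ] Open i ord vis a v) →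
    (∀ s′ → Outside search s s′ → Open i ord vis (regs s′ 13) (regs s′ 14) →
      (∀ {a v} → Open i ord vis a v → a ≤ regs s′ 13) → P s′) →
    wp search P s
  wp-search {P} {s} {i} refl refl refl i≤n start (a , v , opn) end =
    wp-forAll Inv _≼_ (λ j s′ → ∀ v → v < n → Goal j v s′)
      (λ {s₁} {s₂} {s₃} → ≼-trans s₁ s₂ s₃) (λ {j} {s₁} {s₂} le g v v< → mono j v s₁ s₂ le (g v v<))
      (≼-refl s) (λ nz → contradiction start nz)
      (λ j s₁ j< o₁ inv₁ →
        wp-forAll Inv _≼_ (λ v s′ → Goal j v s′)
          (λ {s₁} {s₂} {s₃} → ≼-trans s₁ s₂ s₃) (λ {v} {s₁} {s₂} → mono j v s₁ s₂) (≼-refl s₁) inv₁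
          (λ v s₂ v< o₂ inv₂ → pass j v s₂ (outside-in 11 (reg 0) searchRow j o₁
               (outside-write 12 (reg 0) (when searchE searchCmd) v o₂))
               (trans (proj₁ o₂ 11 tt) (update-same (regs s₁) 11 j))
               (subst (v <_) (proj₁ o₁ 0 tt) v<) inv₂)
          (λ s′ _ inv le goals → inv , le , λ v v< → goals v (subst (v <_) (sym (proj₁ o₁ 0 tt)) v<)))
      (λ s′ o inv le goals → end s′ o
        (proj₁ (goals a (<-≤-trans (proj₁ opn) i≤n) v (proj₁ (proj₂ opn)) opn))
        (λ {a} {v} opn → proj₂ (goals a (<-≤-trans (proj₁ opn) i≤n) v (proj₁ (proj₂ opn)) opn)))
    where
    ord : ℕ → ℕ
    ord = arrs s 2
    vis : ℕ → ℕ
    vis = arrs s 3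
    Found : State → Set
    Found s′ = Open i ord vis (regs s′ 13) (regs s′ 14)
    Inv : State → Set
    Inv s′ = regs s′ 13 ≢ 0 → Found s′
    _≼_ : State → State → Set
    s₁ ≼ s₂ = Found s₁ → Found s₂ × regs s₁ 13 ≤ regs s₂ 13
    ≼-trans : ∀ s₁ s₂ s₃ → s₁ ≼ s₂ → s₂ ≼ s₃ → s₁ ≼ s₃
    ≼-trans s₁ s₂ s₃ f g x = let y , le = f x ; z , le′ = g y in z , ≤-trans le le′
    ≼-refl : ∀ s₁ → s₁ ≼ s₁
    ≼-refl s₁ x = x , ≤-refl
    Goal : ℕ → ℕ → State → Set
    Goal j v s′ = Open i ord vis j v → Found s′ × j ≤ regs s′ 13
    mono : ∀ j v s₁ s₂ → s₁ ≼ s₂ → Goal j v s₁ → Goal j v s₂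
    mono j v s₁ s₂ le g opn = let f , j≤ = g opn ; f′ , le′ = le f in f′ , ≤-trans j≤ le′
    pass : ∀ j v s₂ → Outside search s (writeReg 12 v s₂) → regs s₂ 11 ≡ j → v < n → Inv s₂ →
      wp (when searchE searchCmd) (λ s″ → Inv s″ × s₂ ≼ s″ × Goal j v s″) (writeReg 12 v s₂)
    pass j v s₂ (o , oa) refl v< inv =
      wp-when
        (λ c → let c₁ , c′ = mul-true c ; c₂ , c″ = mul-true c′ ; c₃ , c₄ = mul-true c″
                   found : Open i ord vis (regs s₂ 11) v
                   found = subst (regs s₂ 11 <_) (o 15 tt) (leq-true c₁) , v< ,
                     trans (sym (cong (λ f → f v) (oa 3 tt))) (equ-true {arrs s₂ 3 v} {0} c₄) ,
                     subst (_≢ 0) edge≡ c₃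
               in wp-seq (wp-set (wp-set ((λ _ → found) ,
                    (λ _ → found , leq-true c₂) , λ _ → found , ≤-refl))))
        (λ c → inv , (λ x → x , ≤-refl) , λ opn →
          case mul-false {⟦ leq ⟧ᵒ (suc (regs s₂ 11)) (regs s₂ 15)} c of λ
          { (inj₁ z) → contradiction (subst (regs s₂ 11 <_) (sym (o 15 tt)) (proj₁ opn)) (<⇒≱ (leq-false z))
          ; (inj₂ z) → case mul-false {⟦ leq ⟧ᵒ (regs s₂ 13) (regs s₂ 11)} z of λ
            { (inj₁ z) → inv (λ eq → <⇒≱ (leq-false z) (subst (_≤ regs s₂ 11) (sym eq) z≤n)) , <⇒≤ (leq-false z)
            ; (inj₂ z) → case mul-false {arrs s₂ 1 _} z of λ
              { (inj₁ z) → contradiction (trans (sym edge≡) z) (proj₂ (proj₂ (proj₂ opn)))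
              ; (inj₂ z) → contradiction (trans (cong (λ f → f v) (oa 3 tt)) (proj₁ (proj₂ (proj₂ opn))))
                             (equ-false {arrs s₂ 3 v} {0} z) } } })
      where
      edge≡ : arrs s₂ 1 (regs s₂ 0 * arrs s₂ 2 (regs s₂ 11) + v)
            ≡ arrs s 1 (regs s 0 * arrs s 2 (regs s₂ 11) + v)
      edge≡ = trans (cong (λ f → f (regs s₂ 0 * arrs s₂ 2 (regs s₂ 11) + v)) (oa 1 tt))
        (cong (λ x → arrs s 1 (x + v)) (cong₂ (λ x f → x * f (regs s₂ 11)) (o 0 tt) (oa 2 tt)))

  wp-dfs : ∀ {P s} → 0 < n →
    (∀ (vis : ℕ → ℕ) → vis 0 ≢ 0 → (∃[ v ] v < n × vis v ≡ 0) →
      ∃[ a ] ∃[ v ] vis a ≢ 0 × v < n × vis v ≡ 0 × E a v) →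
    regs s 0 ≡ n → arrs s 1 ≡ adj → (∀ x → arrs s 2 x ≡ 0) → (∀ x → arrs s 3 x ≡ 0) →
    (∀ s′ → Outside dfs s s′ → Dfs n (arrs s′ 2) (arrs s′ 3) (arrs s′ 4) → P s′) →
    wp dfs P s
  wp-dfs {P} {s} 0<n crossing refl refl ord0 vis0 end =
    wp-map {P = λ s′ → Dfs n (arrs s′ 2) (arrs s′ 3) (arrs s′ 4)} end
    (wp-store⨟ $
      wp-forUp Visited
        (dfs-start 0<n (ord0 0) start-vis (λ eq → case trans (sym vis-new) eq of λ ()) , vis-new)
        (λ j i s′ eq o inv → pass j i s′ eq o inv)
        (λ { s′ o (dfs , _) → subst (λ i → Dfs i (arrs s′ 2) (arrs s′ 3) (arrs s′ 4)) (m+[n∸m]≡n 0<n) dfs }))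
    where
    start-vis : ∀ {v} → update (arrs s 3) 0 1 v ≢ 0 → v ≡ 0
    start-vis {v} nz with 0 ≟ v
    ... | yes eq = sym eq
    ... | no ne  = contradiction (trans (update-other (arrs s 3) 0 1 ne) (vis0 v)) nz
    vis-new : update (arrs s 3) 0 1 0 ≡ 1
    vis-new = refl
    Visited : ℕ → State → Set
    Visited j s′ = Dfs (suc j) (arrs s′ 2) (arrs s′ 3) (arrs s′ 4) × arrs s′ 3 0 ≡ 1
    pass : ∀ j i s′ → j + suc i ≡ n ∸ 1 → Outside (for 10 (op sub (reg 0) (lit 1)) dfsBody) _ s′ → Visited j s′ →
      wp dfsBody (Visited (suc j)) (writeReg 10 i s′)
    pass j i s′ eq (o , oa) (dfs , v0) =
      wp-set⨟ $ wp-set⨟ $ wp-set⨟ $ wp-seq $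
        wp-search {i = suc j} (o 0 tt) (oa 1 tt) idx (<⇒≤ j<n) refl
          (let v₀ = unvisited dfs j<n
               a , v , va , v< , vv , e = crossing (arrs s′ 3) (λ z → case trans (sym v0) z of λ ()) v₀
               x , x< , eq = Dfs.ord-vis dfs va
           in x , v , x< , v< , vv , subst (λ a → E a v) (sym eq) e)
          (λ s″ (o″ , oa″) opn latest →
            wp-store⨟ $ wp-store⨟ $ wp-store
              (next s″ (trans (o″ 15 tt) idx) (oa″ 2 tt) (oa″ 3 tt) (oa″ 4 tt) opn latest))
      where
      n≡ : suc (n ∸ 1) ≡ n
      n≡ = m+[n∸m]≡n 0<n
      j<n : suc j < n
      j<n = subst (suc (suc j) ≤_) n≡ (s≤s (subst (suc j ≤_) eq (subst (_≤ j + suc i) (+-comm j 1) (+-monoʳ-≤ j (s≤s z≤n)))))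
      idx : (regs s′ 0 ∸ 1) ∸ i ≡ suc j
      idx = trans (cong (λ n → (n ∸ 1) ∸ i) (o 0 tt))
        (trans (cong (_∸ i) (trans (sym eq) (+-suc j i))) (m+n∸n≡m (suc j) i))
      next : ∀ s″ → regs s″ 15 ≡ suc j → arrs s″ 2 ≡ arrs s′ 2 → arrs s″ 3 ≡ arrs s′ 3 → arrs s″ 4 ≡ arrs s′ 4 →
        Open (suc j) (arrs s′ 2) (arrs s′ 3) (regs s″ 13) (regs s″ 14) →
        (∀ {a v} → Open (suc j) (arrs s′ 2) (arrs s′ 3) a v → a ≤ regs s″ 13) →
        Dfs (suc (suc j)) (update (arrs s″ 2) (regs s″ 15) (regs s″ 14))
          (update (arrs s″ 3) (regs s″ 14) 1) (update (arrs s″ 4) (regs s″ 15) (regs s″ 13)) ×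
        update (arrs s″ 3) (regs s″ 14) 1 0 ≡ 1
      next s″ e₁ e₂ e₃ e₄ opn latest rewrite e₁ | e₂ | e₃ | e₄ =
        dfs-visit z<s dfs opn latest , still
        where
        still : update (arrs s′ 3) (regs s″ 14) 1 0 ≡ 1
        still with regs s″ 14 ≟ 0
        ... | yes eq = subst (λ z → update (arrs s′ 3) z 1 0 ≡ 1) (sym eq) refl
        ... | no ne  = trans (update-other (arrs s′ 3) (regs s″ 14) 1 ne) v0

climbE raiseE coverE : Expr
climbE = op leq (op add (lit 1) (reg 17)) (reg 19)
raiseE = op leq (arr 5 (reg 19)) (reg 16)
coverE = op mul (op leq (op add (lit 1) (reg 17)) (reg 16))
                (arr 1 (op add (op mul (reg 0) (arr 2 (reg 17))) (arr 2 (reg 16))))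

climbBody climb coverBody coverRow bottoms : Cmd
climbBody = when raiseE (store 5 (reg 19) (reg 16)) ⨟ set 19 (arr 4 (reg 19))
climb = for 18 (reg 0) (when climbE climbBody)
coverBody = set 19 (reg 16) ⨟ climb
coverRow = for 17 (reg 0) (when coverE coverBody)
bottoms = for 16 (reg 0) coverRow

module Covering (n : ℕ) (Edge : ℕ → ℕ → Set) (par : ℕ → ℕ) where

  -- The edge between a and its descendant b closes a cycle through the tree
  -- edge from par x to x, or is that tree edge.
  record Cover (a b x : ℕ) : Set where
    constructor cover
    field
      a<x  : a < x
      b<n  : b < n
      anc  : Anc par x b
      edge : Edge a b

  Witnessed : (ℕ → ℕ) → Set
  Witnessed bot = ∀ x → bot x ≢ 0 → ∃[ a ] Cover a (bot x) x

  Maximal : (ℕ → ℕ) → Set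
  Maximal bot = ∀ {a b x} → Cover a b x → b ≤ bot x

module _ {n : ℕ} {adj ord par : ℕ → ℕ} (par< : ∀ {x} → 0 < x → x < n → par x < x) where
  open DepthFirst n adj
  open Ancestors par<

  Edge : ℕ → ℕ → Set
  Edge a b = E (ord a) (ord b)

  open Covering n Edge par

  _≤̇_ : (ℕ → ℕ) → (ℕ → ℕ) → Set
  f ≤̇ g = ∀ x → f x ≤ g x

  wp-climb : ∀ {P s} (let a = regs s 17; b = regs s 16) →
    regs s 0 ≡ n → arrs s 4 ≡ par → a < b → b < n → Edge a b → regs s 19 ≡ b → Witnessed (arrs s 5) →
    (∀ s′ → Outside climb s s′ → Witnessed (arrs s′ 5) → arrs s 5 ≤̇ arrs s′ 5 →
      (∀ {x} → Cover a b x → b ≤ arrs s′ 5 x) → P s′) →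
    wp climb P s
  wp-climb {P} {s} refl refl a<b b<n e cur≡ wit end =
    wp-forUp Climbed
      (subst (Anc par′ (regs s 19)) cur≡ here ,
       inj₂ (≤-reflexive (trans (+-identityʳ _) cur≡)) , wit , (λ _ → ≤-refl) ,
       λ anc _ → inj₂ (subst (Anc par′ _) (sym cur≡) anc))
      pass
      λ { s′ o (anc , stop , wit′ , le , goals) → end s′ o wit′ le λ
        { (cover a<x _ ancx _) → case goals ancx a<x of λ
          { (inj₁ done) → done
          ; (inj₂ ancx′) → contradiction (anc-≤ (≤-<-trans (anc-≤ b<n anc) b<n) ancx′)
              (<⇒≱ (≤-<-trans (case stop of λ
                { (inj₁ le) → le
                ; (inj₂ le) → contradiction (≤-trans (m≤n+m n _) le) (<⇒≱ b<n) }) a<x)) } } }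
    where
    a : ℕ
    a = regs s 17
    b : ℕ
    b = regs s 16
    par′ : ℕ → ℕ
    par′ = arrs s 4
    Climbed : ℕ → State → Set
    Climbed j s′ = Anc par′ (regs s′ 19) b × (regs s′ 19 ≤ a ⊎ regs s′ 19 + j ≤ b) ×
      Witnessed (arrs s′ 5) × arrs s 5 ≤̇ arrs s′ 5 ×
      (∀ {x} → Anc par′ x b → a < x → b ≤ arrs s′ 5 x ⊎ Anc par′ x (regs s′ 19))
    pass : ∀ j i s′ → j + suc i ≡ n → Outside climb s s′ → Climbed j s′ →
      wp (when climbE climbBody) (Climbed (suc j)) (writeReg 18 i s′)
    pass j i s′ _ (o , oa) (anc , stop , wit′ , le , goals) = wp-when
      (λ c →
        let a<cur : a < regs s′ 19
            a<cur = subst (_< regs s′ 19) (o 17 tt) (leq-true c)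
            cur<n = ≤-<-trans (anc-≤ b<n anc) b<n
            p≡ : arrs s′ 4 (regs s′ 19) ≡ par′ (regs s′ 19)
            p≡ = cong (λ f → f (regs s′ 19)) (oa 4 tt)
            0<cur = ≤-<-trans z≤n a<cur
            p< : par′ (regs s′ 19) < regs s′ 19
            p< = par< 0<cur cur<n
            anc′ : Anc par′ (par′ (regs s′ 19)) b
            anc′ = anc-trans (up 0<cur here) anc
            stop′ : par′ (regs s′ 19) ≤ a ⊎ par′ (regs s′ 19) + suc j ≤ b
            stop′ = case stop of λ
              { (inj₁ le) → contradiction le (<⇒≱ a<cur)
              ; (inj₂ le) → inj₂ (≤-trans (≤-reflexive (+-suc _ j)) (≤-trans (+-monoˡ-≤ j p<) le)) }
            higher : ∀ {x} → Anc par′ x (regs s′ 19) → x ≡ regs s′ 19 ⊎ Anc par′ x (par′ (regs s′ 19))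
            higher = λ { here → inj₁ refl ; (up _ q) → inj₂ q }
        in wp-seq (wp-when
          (λ c₁ → wp-store (wp-set
            (let cur = regs s′ 19
                 new = update (arrs s′ 5) cur (regs s′ 16)
                 new≡ : new cur ≡ b
                 new≡ = trans (update-same (arrs s′ 5) cur (regs s′ 16)) (o 16 tt)
                 old≤ : ∀ x → arrs s′ 5 x ≤ new x
                 old≤ x = case cur ≟ x of λ
                   { (yes refl) → subst (arrs s′ 5 cur ≤_) (sym (update-same (arrs s′ 5) cur (regs s′ 16))) (leq-true c₁)
                   ; (no ne) → ≤-reflexive (sym (update-other (arrs s′ 5) cur _ ne)) }
             in subst (λ p → Anc par′ p b) (sym p≡) anc′ ,
                subst (λ p → p ≤ a ⊎ p + suc j ≤ b) (sym p≡) stop′ ,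
                (λ x nz → case cur ≟ x of λ
                  { (yes refl) → a , subst (λ b → Cover a b cur) (sym new≡) (cover a<cur b<n anc e)
                  ; (no ne) → subst (λ b → ∃[ a ] Cover a b x) (sym (update-other (arrs s′ 5) cur _ ne))
                      (wit′ x (subst (_≢ 0) (update-other (arrs s′ 5) cur _ ne) nz)) }) ,
                (λ x → ≤-trans (le x) (old≤ x)) ,
                λ {x} ax a<x → case goals ax a<x of λ
                  { (inj₁ done) → inj₁ (≤-trans done (old≤ x))
                  ; (inj₂ q) → case higher q of λ
                    { (inj₁ refl) → inj₁ (≤-reflexive (sym new≡))
                    ; (inj₂ q′) → inj₂ (subst (Anc par′ x) (sym p≡) q′) } })))
          (λ c₁ → wp-set
            ( subst (λ p → Anc par′ p b) (sym p≡) anc′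
            , subst (λ p → p ≤ a ⊎ p + suc j ≤ b) (sym p≡) stop′
            , wit′ , le
            , λ {x} ax a<x → case goals ax a<x of λ
                  { (inj₁ done) → inj₁ done
                  ; (inj₂ q) → case higher q of λ
                    { (inj₁ refl) → inj₁ (<⇒≤ (subst (_< arrs s′ 5 (regs s′ 19)) (o 16 tt) (leq-false c₁)))
                    ; (inj₂ q′) → inj₂ (subst (Anc par′ x) (sym p≡) q′) } }))))
      (λ c → anc , inj₁ (≤-pred (subst (regs s′ 19 <_) (cong suc (o 17 tt)) (leq-false c))) , wit′ , le , goals)

  wp-bottoms : ∀ {P s} → regs s 0 ≡ n → arrs s 1 ≡ adj → arrs s 2 ≡ ord → arrs s 4 ≡ par →
    (∀ x → arrs s 5 x ≡ 0) →
    (∀ {a b} → a < b → b < n → Edge a b → Anc par a b) →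
    (∀ s′ → Outside bottoms s s′ → Witnessed (arrs s′ 5) → Maximal (arrs s′ 5) → P s′) →
    wp bottoms P s
  wp-bottoms {P} {s} refl refl refl refl zero₅ edge-anc end =
    wp-forAll Inv _≼_ (λ b s′ → ∀ a → a < n → Goal b a s′)
      (λ le le′ x → ≤-trans (le x) (le′ x)) (λ le g a a< {x} cv → ≤-trans (g a a< cv) (le x))
      (λ _ → ≤-refl) (λ x nz → contradiction (zero₅ x) nz)
      (λ b s₁ b<n o₁ inv₁ →
        wp-forAll Inv _≼_ (λ a s′ → Goal b a s′)
          (λ le le′ x → ≤-trans (le x) (le′ x)) (λ le g {x} cv → ≤-trans (g cv) (le x))
          (λ _ → ≤-refl) inv₁
          (λ a s₂ a<n o₂ inv₂ →
            pass b a s₂ (outside-in 16 (reg 0) coverRow b o₁ (outside-write 17 (reg 0) (when coverE coverBody) a o₂))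
              (trans (proj₁ o₂ 16 tt) (update-same (regs s₁) 16 b)) b<n inv₂)
          (λ s′ _ inv le goals → inv , le , λ a a<n → goals a (subst (a <_) (sym (proj₁ o₁ 0 tt)) a<n)))
      (λ s′ o inv le goals → end s′ o inv λ {a} {b} {x} cv →
        goals b (Cover.b<n cv) a
          (<-trans (<-≤-trans (Cover.a<x cv) (anc-≤ (Cover.b<n cv) (Cover.anc cv))) (Cover.b<n cv)) cv)
    where
    Inv : State → Set
    Inv s′ = Witnessed (arrs s′ 5)
    _≼_ : State → State → Set
    s₁ ≼ s₂ = arrs s₁ 5 ≤̇ arrs s₂ 5
    Goal : ℕ → ℕ → State → Set
    Goal b a s′ = ∀ {x} → Cover a b x → b ≤ arrs s′ 5 x
    pass : ∀ b a s₂ → Outside bottoms s (writeReg 17 a s₂) → regs s₂ 16 ≡ b → b < n → Inv s₂ →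
      wp (when coverE coverBody) (λ s″ → Inv s″ × s₂ ≼ s″ × Goal b a s″) (writeReg 17 a s₂)
    pass b a s₂ (o , oa) refl b<n inv = wp-when
      (λ c → let c₁ , c₂ = mul-true c in
        wp-set⨟ $ wp-climb (o 0 tt) (oa 4 tt) (leq-true c₁) b<n (subst (_≢ 0) edge≡ c₂) refl inv
          (λ s′ _ inv′ le goal → inv′ , le , λ {x} → goal {x}))
      (λ c → inv , (λ _ → ≤-refl) , λ {x} cv →
        case mul-false {⟦ leq ⟧ᵒ (suc a) (regs s₂ 16)} c of λ
        { (inj₁ z) → contradiction (<-≤-trans (Cover.a<x cv) (anc-≤ b<n (Cover.anc cv))) (<⇒≱ (leq-false z))
        ; (inj₂ z) → contradiction (trans (sym edge≡) z) (Cover.edge cv) })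
      where
      edge≡ : arrs s₂ 1 (regs s₂ 0 * arrs s₂ 2 a + arrs s₂ 2 (regs s₂ 16))
            ≡ arrs s 1 (regs s 0 * arrs s 2 a + arrs s 2 (regs s₂ 16))
      edge≡ rewrite oa 1 tt | oa 2 tt | o 0 tt = refl

-- Ears


-- Each vertex x > 0 lies on exactly one ear, the path that leads from bot x
-- upwards to the head of the ear.  Together with the parent of the head, the
-- top, an ear forms the cycle closed by the edge between the top and bot x, or
-- a single bridge.
record EarTree (n : ℕ) (Edge : ℕ → ℕ → Set) (par bot : ℕ → ℕ) : Set where
  open Covering n Edge par public
  field
    par<     : ∀ {x} → 0 < x → x < n → par x < x
    par-edge : ∀ {x} → 0 < x → x < n → Edge (par x) x
    edge-sym : ∀ {x y} → x < n → y < n → Edge x y → Edge y x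
    edge-irr : ∀ {x} → x < n → ¬ Edge x x
    edge-anc : ∀ {a b} → a < b → b < n → Edge a b → Anc par a b
    witness  : Witnessed bot
    maximal  : Maximal bot
    single   : ∀ {x a b a′ b′} → Cover a b x → Cover a′ b′ x → a ≢ par b → a′ ≢ par b′ → a ≡ a′ × b ≡ b′

  open Ancestors par< public

  Head : ℕ → Set
  Head h = 0 < h × h < n × bot (par h) ≢ bot h

  tree-cover : ∀ {x} → 0 < x → x < n → Cover (par x) x x
  tree-cover 0<x x<n = cover (par< 0<x x<n) x<n here (par-edge 0<x x<n)

  bot-≥ : ∀ {x} → 0 < x → x < n → x ≤ bot x
  bot-≥ 0<x x<n = maximal (tree-cover 0<x x<n)

  bot-cover : ∀ {x} → 0 < x → x < n → ∃[ a ] Cover a (bot x) x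
  bot-cover {x} 0<x x<n = witness x (λ eq → <⇒≱ 0<x (subst (x ≤_) eq (bot-≥ 0<x x<n)))

  bot-anc : ∀ {x} → 0 < x → x < n → Anc par x (bot x)
  bot-anc 0<x x<n = Cover.anc (proj₂ (bot-cover 0<x x<n))

  bot-< : ∀ {x} → 0 < x → x < n → bot x < n
  bot-< 0<x x<n = Cover.b<n (proj₂ (bot-cover 0<x x<n))

  bot-0 : bot 0 ≡ 0
  bot-0 with bot 0 ≟ 0
  ... | yes eq = eq
  ... | no nz  = case Cover.a<x (proj₂ (witness 0 nz)) of λ ()

  nontree : ∀ {a b x} → Cover a b x → x ≢ b → a ≢ par b
  nontree (cover a<x b<n anc _) ne refl =
    <⇒≱ a<x (anc-par-< b<n anc (≤∧≢⇒< (anc-≤ b<n anc) ne))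

  anc-par-anc : ∀ {a b} → b < n → Anc par a b → a < b → Anc par a (par b)
  anc-par-anc b<n anc a<b = proj₂ (anc-par anc (<⇒≢ a<b))

  mid : ∀ {y z} → 0 < y → y < n → Anc par y z → Anc par z (bot y) → bot z ≡ bot y
  mid {y} {z} 0<y y<n yz zβ with bot-cover 0<y y<n
  ... | a₀ , cv@(cover a₀<y β<n _ e) = go (y ≟ bot y) (z ≟ bot z)
    where
    y≤z : y ≤ z
    y≤z = anc-≤ (≤-<-trans (anc-≤ β<n zβ) β<n) yz
    z<n : z < n
    z<n = ≤-<-trans (anc-≤ β<n zβ) β<n
    0<z : 0 < z
    0<z = <-≤-trans 0<y y≤z
    cvz : Cover a₀ (bot y) z
    cvz = cover (<-≤-trans a₀<y y≤z) β<n zβ e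
    go : Dec (y ≡ bot y) → Dec (z ≡ bot z) → bot z ≡ bot y
    go (yes y≡β) _ = cong bot (sym (≤-antisym y≤z (subst (z ≤_) (sym y≡β) (anc-≤ β<n zβ))))
    go (no y≢β) (yes z≡) = ≤-antisym (subst (_≤ bot y) z≡ (anc-≤ β<n zβ)) (maximal cvz)
    go (no y≢β) (no z≢) = let a₁ , cv₁ = bot-cover 0<z z<n in
      sym (proj₂ (single cvz cv₁ (nontree cv y≢β) (nontree cv₁ z≢)))

  bot-bot : ∀ {x} → 0 < x → x < n → bot (bot x) ≡ bot x
  bot-bot 0<x x<n = mid 0<x x<n (bot-anc 0<x x<n) here

  head-edge : ∀ {h} → Head h → Edge (par h) (bot h)
  head-edge {h} (0<h , h<n , hd) with bot-cover 0<h h<n | h ≟ bot h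
  ... | _ | yes h≡ = subst (Edge (par h)) h≡ (par-edge 0<h h<n)
  ... | a₀ , cv@(cover a₀<h β<n anc e) | no h≢ with a₀ ≟ par h
  ...   | yes refl = e
  ...   | no ne = contradiction (sym (proj₂ (single cv′ cv₂ (nontree cv h≢) (nontree cv₂ p≢)))) hd
    where
    β : ℕ
    β = bot h
    p<h : par h < h
    p<h = par< 0<h h<n
    h≤β : h ≤ β
    h≤β = bot-≥ 0<h h<n
    a₀-anc : Anc par a₀ h
    a₀-anc = anc-chain β<n (edge-anc (<-≤-trans a₀<h h≤β) β<n e) anc (<⇒≤ a₀<h)
    a₀<p : a₀ < par h
    a₀<p = ≤∧≢⇒< (anc-par-< h<n a₀-anc a₀<h) ne
    0<p : 0 < par h
    0<p = ≤-<-trans z≤n a₀<p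
    cv′ : Cover a₀ β (par h)
    cv′ = cover a₀<p β<n (anc-trans (up 0<h here) anc) e
    cv₂ : Cover _ (bot (par h)) (par h)
    cv₂ = proj₂ (bot-cover 0<p (<-trans p<h h<n))
    p≢ : par h ≢ bot (par h)
    p≢ eq = <⇒≱ (<-≤-trans p<h h≤β) (subst (β ≤_) (sym eq) (maximal cv′))

  par-anc : ∀ {x} → 0 < x → Anc par (par x) x
  par-anc 0<x = up 0<x here

  -- Otherwise the ear would continue above its head.
  not-above : ∀ {h y} → Head h → 0 < y → y < n → bot y ≡ bot h → h ≤ y
  not-above {h} {y} (0<h , h<n , hd) 0<y y<n eq = ≮⇒≥ λ y<h →
    let y-h  = anc-chain (bot-< 0<h h<n) (subst (Anc par y) eq (bot-anc 0<y y<n)) (bot-anc 0<h h<n) (<⇒≤ y<h)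
        y-ph = anc-par-anc h<n y-h y<h
    in hd (trans (mid 0<y y<n y-ph (subst (Anc par (par h)) (sym eq)
            (anc-trans (par-anc 0<h) (bot-anc 0<h h<n)))) eq)

  head-unique : ∀ {h h′} → Head h → Head h′ → bot h ≡ bot h′ → h ≡ h′
  head-unique H@(0<h , h<n , _) H′@(0<h′ , h′<n , _) eq =
    ≤-antisym (not-above H 0<h′ h′<n (sym eq)) (not-above H′ 0<h h<n eq)

  par-in : ∀ {h y} → Head h → 0 < y → y < n → bot y ≡ bot h → y ≢ h → bot (par y) ≡ bot y
  par-in {h} {y} H 0<y y<n eq ne with bot (par y) ≟ bot y
  ... | yes same = same
  ... | no diff  = contradiction (head-unique (0<y , y<n , diff) H eq) ne

  bot-pos : ∀ {x y} → 0 < y → y < n → bot x ≡ bot y → 0 < x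
  bot-pos {zero} {y} 0<y y<n eq = contradiction (≤-trans (bot-≥ 0<y y<n) (≤-reflexive (trans (sym eq) bot-0))) (<⇒≱ 0<y)
  bot-pos {suc x} _ _ _ = z<s

  edge-inside : ∀ {y z} → 0 < z → z < y → y < n → bot z ≡ bot y → Edge z y → z ≡ par y
  edge-inside {y} {z} 0<z z<y y<n eq e with z ≟ par y
  ... | yes z≡ = z≡
  ... | no z≢ with bot-cover 0<z (<-trans z<y y<n)
  ... | a₀ , cv@(cover a₀<z β<n anc e₀) =
    contradiction (proj₁ (single cvy (cover z<y y<n here e) (nontree cv z≢β) z≢)) (<⇒≢ a₀<z)
    where
    0<y : 0 < y
    0<y = <-trans 0<z z<y
    cvy : Cover a₀ (bot z) y
    cvy = cover (<-trans a₀<z z<y) β<n (subst (Anc par y) (sym eq) (bot-anc 0<y y<n)) e₀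
    z≢β : z ≢ bot z
    z≢β z≡ = <⇒≱ z<y (subst (y ≤_) (trans (sym eq) (sym z≡)) (bot-≥ 0<y y<n))

  edge-up : ∀ {h y z} → Head h → 0 < y → y < n → bot y ≡ bot h → z < y → bot z ≢ bot h → Edge z y →
    z ≡ par h × (y ≡ h ⊎ y ≡ bot h)
  edge-up {h} {y} {z} H@(0<h , h<n , hd) 0<y y<n eq z<y out e with z ≟ par y
  ... | yes refl with y ≟ h
  ...   | yes refl = refl , inj₁ refl
  ...   | no ne    = contradiction (trans (par-in H 0<y y<n eq ne) eq) out
  edge-up {h} {y} {z} H@(0<h , h<n , hd) 0<y y<n eq z<y out e | no z≢ = z≡ , inj₂ (trans y≡β eq)
    where
    cv : Cover z y y
    cv = cover z<y y<n here e
    y≡β : y ≡ bot y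
    y≡β with y ≟ bot y
    ... | yes p = p
    ... | no ne = let a₁ , cv₁ = bot-cover 0<y y<n in proj₂ (single cv cv₁ z≢ (nontree cv₁ ne))
    h-y : Anc par h y
    h-y = subst (Anc par h) (sym (trans y≡β eq)) (bot-anc 0<h h<n)
    z-y : Anc par z y
    z-y = edge-anc z<y y<n e
    z<h : z < h
    z<h = ≰⇒> λ h≤z → out (mid 0<h h<n (anc-chain y<n h-y z-y h≤z)
            (subst (Anc par z) (trans y≡β eq) z-y))
    z-p : Anc par z (par h)
    z-p = anc-par-anc h<n (anc-chain y<n z-y h-y (<⇒≤ z<h)) z<h
    p<h : par h < h
    p<h = par< 0<h h<n
    z≡ : z ≡ par h
    z≡ with z ≟ par h
    ... | yes p = p
    ... | no ne = contradiction (trans (sym (proj₂ (single cvp cv₂ z≢ (nontree cv₂ p≢)))) (trans y≡β eq)) hd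
      where
      z<p : z < par h
      z<p = ≤∧≢⇒< (anc-≤ (<-trans p<h h<n) z-p) ne
      cvp : Cover z y (par h)
      cvp = cover z<p y<n (anc-trans (par-anc 0<h) h-y) e
      cv₂ : Cover _ (bot (par h)) (par h)
      cv₂ = proj₂ (bot-cover (≤-<-trans z≤n z<p) (<-trans p<h h<n))
      p≢ : par h ≢ bot (par h)
      p≢ eq′ = <⇒≱ (<-≤-trans p<h (anc-≤ y<n h-y)) (subst (y ≤_) (sym eq′) (maximal cvp))

  child : ∀ {y z} → z < n → Anc par y z → y < z → ∃[ w ] 0 < w × w < n × par w ≡ y × Anc par w z
  child z<n here y<z = contradiction y<z (<-irrefl refl)
  child {y} {z} z<n (up 0<z p) y<z with y ≟ par z
  ... | yes refl = z , 0<z , z<n , refl , here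
  ... | no ne with child (<-trans (par< 0<z z<n) z<n) p
                     (≤∧≢⇒< (anc-≤ (<-trans (par< 0<z z<n) z<n) p) ne)
  ...   | w , 0<w , w<n , eq , q = w , 0<w , w<n , eq , up 0<z q

  edge-down : ∀ {y z} → 0 < y → y < z → z < n → bot z ≢ bot y → Edge y z →
    ∃[ h ] Head h × y < h × bot z ≡ bot h
  edge-down {y} {z} 0<y y<z z<n out e with child z<n (edge-anc y<z z<n e) y<z
  ... | w , 0<w , w<n , refl , w-z = w , (0<w , w<n , hd) , par< 0<w w<n , bot≡
    where
    cvw : Cover (par w) z w
    cvw = cover (par< 0<w w<n) z<n w-z e
    cvz : Cover (par w) z z
    cvz = cover y<z z<n here e
    bot-w : w ≢ z → bot w ≡ z
    bot-w w≢z with bot-cover 0<w w<n | w ≟ bot w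
    ... | _ | yes w≡ = contradiction (≤-antisym (anc-≤ z<n w-z) (subst (z ≤_) (sym w≡) (maximal cvw))) w≢z
    ... | a₁ , cv₁ | no ne = sym (proj₂ (single cvw cv₁ (nontree cvw w≢z) (nontree cv₁ ne)))
    bot≡ : bot z ≡ bot w
    bot≡ with w ≟ z
    ... | yes refl = refl
    ... | no w≢z with bot-cover (<-trans 0<y y<z) z<n | z ≟ bot z
    ...   | _ | yes z≡ = trans (sym z≡) (sym (bot-w w≢z))
    ...   | a₁ , cv₁ | no z≢ =
      trans (sym (proj₂ (single cvz cv₁ (nontree cvw w≢z) (nontree cv₁ z≢)))) (sym (bot-w w≢z))
    hd : bot (par w) ≢ bot w
    hd eq with w ≟ z
    ... | yes refl = out (sym eq)
    ... | no w≢z with bot-cover 0<y (<-trans (par< 0<w w<n) w<n)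
    ...   | a₀ , cover a₀<y β<n anc e₀ =
      contradiction (proj₁ (single cv₀ cvw (nontree cv₀ (λ w≡ → w≢z (trans w≡ β≡z))) (nontree cvw w≢z)))
        (<⇒≢ a₀<y)
      where
      β≡z : bot (par w) ≡ z
      β≡z = trans eq (bot-w w≢z)
      cv₀ : Cover a₀ (bot (par w)) w
      cv₀ = cover (<-trans a₀<y (par< 0<w w<n)) β<n (subst (Anc par w) (sym eq) (bot-anc 0<w w<n)) e₀

  -- The ear with head h in the order top, bot h, …, h, top.
  record Ear (h m : ℕ) (v : ℕ → ℕ) : Set where
    field
      head   : Head h
      1≤m    : 1 ≤ m
      first  : v 0 ≡ par h
      second : v 1 ≡ bot h
      next   : ∀ {i} → 1 ≤ i → i ≤ m → v (suc i) ≡ par (v i)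
      pos    : ∀ {i} → 1 ≤ i → i ≤ m → 0 < v i
      bound  : ∀ {i} → 1 ≤ i → i ≤ m → v i < n
      inside : ∀ {i} → 1 ≤ i → i ≤ m → bot (v i) ≡ bot h
      final  : bot (v (suc m)) ≢ bot h

    last-head : v m ≡ h
    last-head = head-unique
      (pos 1≤m ≤-refl , bound 1≤m ≤-refl ,
       λ eq → final (trans (cong bot (next 1≤m ≤-refl)) (trans eq (inside 1≤m ≤-refl))))
      head (inside 1≤m ≤-refl)

    top : v (suc m) ≡ par h
    top = trans (next 1≤m ≤-refl) (cong par last-head)

    decreasing : ∀ {i j} → 1 ≤ i → i < j → j ≤ m → v j < v i
    decreasing {i} {suc j} 1≤i i<j j≤m with m<1+n⇒m<n∨m≡n i<j
    ... | inj₂ refl = subst (_< v i) (sym (next 1≤i (<⇒≤ j≤m))) (par< (pos 1≤i (<⇒≤ j≤m)) (bound 1≤i (<⇒≤ j≤m)))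
    ... | inj₁ i<j′ = <-trans
      (subst (_< v j) (sym (next 1≤j (<⇒≤ j≤m))) (par< (pos 1≤j (<⇒≤ j≤m)) (bound 1≤j (<⇒≤ j≤m))))
      (decreasing 1≤i i<j′ (<⇒≤ j≤m))
      where
      1≤j : 1 ≤ j
      1≤j = ≤-trans 1≤i (<⇒≤ i<j′)

    distinct : ∀ {i j} → 1 ≤ i → i ≤ m → 1 ≤ j → j ≤ m → v i ≡ v j → i ≡ j
    distinct {i} {j} 1≤i i≤m 1≤j j≤m eq with <-cmp i j
    ... | tri< i<j _ _ = contradiction (sym eq) (<⇒≢ (decreasing 1≤i i<j j≤m))
    ... | tri≈ _ i≡j _ = i≡j
    ... | tri> _ _ j<i = contradiction eq (<⇒≢ (decreasing 1≤j j<i i≤m))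

    not-top : ∀ {i} → 1 ≤ i → i ≤ m → v i ≢ par h
    not-top 1≤i i≤m eq = proj₂ (proj₂ head) (trans (cong bot (sym eq)) (inside 1≤i i≤m))

    everywhere : ∀ {y} → 0 < y → y < n → bot y ≡ bot h → ∃[ i ] 1 ≤ i × i ≤ m × v i ≡ y
    everywhere {y} 0<y y<n eq with go m 1≤m ≤-refl
      where
      go : ∀ i → 1 ≤ i → i ≤ m → (∃[ j ] 1 ≤ j × j ≤ m × v j ≡ y) ⊎ Anc par y (v i) × y < v i
      go (suc zero) 1≤i i≤m with y ≟ v 1
      ... | yes refl = inj₁ (1 , s≤s z≤n , i≤m , refl)
      ... | no ne = inj₂ (anc , ≤∧≢⇒< (anc-≤ (bound 1≤i i≤m) anc) ne)
        where
        anc : Anc par y (v 1)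
        anc = subst (Anc par y) (trans eq (sym second)) (bot-anc 0<y y<n)
      go (suc i@(suc _)) 1≤i i≤m with go i (s≤s z≤n) (<⇒≤ i≤m)
      ... | inj₁ found = inj₁ found
      ... | inj₂ (anc , y<) with y ≟ v (suc i)
      ...   | yes refl = inj₁ (suc i , s≤s z≤n , i≤m , refl)
      ...   | no ne = inj₂ (anc′ , ≤∧≢⇒< (anc-≤ (bound 1≤i i≤m) anc′) ne)
        where
        anc′ : Anc par y (v (suc i))
        anc′ = subst (Anc par y) (sym (next (s≤s z≤n) (<⇒≤ i≤m)))
                 (anc-par-anc (bound (s≤s z≤n) (<⇒≤ i≤m)) anc y<)
    ... | inj₁ found = found
    ... | inj₂ (_ , y<) = contradiction (subst (y <_) last-head y<) (≤⇒≯ (not-above head 0<y y<n eq))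

    adjacent : ∀ {i} → i ≤ m → Edge (v i) (v (suc i))
    adjacent {zero} _ = subst₂ Edge (sym first) (sym second) (head-edge head)
    adjacent {suc i} i≤m = edge-sym (subst (_< n) (sym (next (s≤s z≤n) i≤m)) (<-trans p< v<)) v<
      (subst (λ x → Edge x (v (suc i))) (sym (next (s≤s z≤n) i≤m)) (par-edge (pos (s≤s z≤n) i≤m) v<))
      where
      v< : v (suc i) < n
      v< = bound (s≤s z≤n) i≤m
      p< : par (v (suc i)) < v (suc i)
      p< = par< (pos (s≤s z≤n) i≤m) v<

    neighbours : ∀ {i z} → i < m → z < n → Edge (v (suc i)) z →
      z ≡ v i ⊎ z ≡ v (suc (suc i)) ⊎ ∃[ h′ ] Head h′ × h < h′ × bot z ≡ bot h′
    neighbours {i} {z} i<m z<n e with bot z ≟ bot h | <-cmp z (v (suc i))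
    ... | _ | tri≈ _ refl _ = contradiction e (edge-irr z<n)
    ... | yes inz | tri< z<y _ _ = inj₂ (inj₁ (trans
      (edge-inside 0<z z<y y<n (trans inz (sym (inside (s≤s z≤n) i<m))) (edge-sym y<n z<n e))
      (sym (next (s≤s z≤n) i<m))))
      where
      y<n : v (suc i) < n
      y<n = bound (s≤s z≤n) i<m
      0<z : 0 < z
      0<z = bot-pos (proj₁ head) (proj₁ (proj₂ head)) inz
    ... | yes inz | tri> _ _ y<z = case everywhere (<-trans (pos (s≤s z≤n) i<m) y<z) z<n inz of λ
      { (j , 1≤j , j≤m , refl) → inj₁ (back j 1≤j j≤m
          (edge-inside (pos (s≤s z≤n) i<m) y<z z<n (trans (inside (s≤s z≤n) i<m) (sym inz)) e)) }
      where
      back : ∀ j → 1 ≤ j → j ≤ m → v (suc i) ≡ par (v j) → v j ≡ v i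
      back j 1≤j j≤m eq with m≤n⇒m<n∨m≡n j≤m
      ... | inj₁ j<m = cong v (sym (suc-injective (distinct (s≤s z≤n) i<m (s≤s z≤n) j<m (trans eq (sym (next 1≤j j≤m))))))
      ... | inj₂ refl = contradiction (trans eq (cong par last-head)) (not-top (s≤s z≤n) i<m)
    ... | no out | tri< z<y _ _
      with edge-up head (pos (s≤s z≤n) i<m) (bound (s≤s z≤n) i<m) (inside (s≤s z≤n) i<m) z<y out
             (edge-sym (bound (s≤s z≤n) i<m) z<n e)
    ...   | z≡ , inj₁ y≡h = inj₂ (inj₁ (trans z≡ (trans (cong par (sym y≡h)) (sym (next (s≤s z≤n) i<m)))))
    ...   | z≡ , inj₂ y≡β = inj₁ (trans z≡ (trans (sym first)
              (cong v (sym (suc-injective (distinct (s≤s z≤n) i<m (s≤s z≤n) 1≤m (trans y≡β (sym second))))))))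
    neighbours {i} {z} i<m z<n e | no out | tri> _ _ y<z
      with edge-down (pos (s≤s z≤n) i<m) y<z z<n (λ eq → out (trans eq (inside (s≤s z≤n) i<m))) e
    ... | h′ , H′ , y<h′ , eq = inj₂ (inj₂ (h′ , H′ ,
      ≤-<-trans (not-above head (pos (s≤s z≤n) i<m) (bound (s≤s z≤n) i<m) (inside (s≤s z≤n) i<m)) y<h′ , eq))

-- Cycles closed by back edges

module Input {n : ℕ} .{{_ : NonZero n}} (G : Graph n) (w : Fin n → ℕ) where

  adjacency : ℕ → ℕ
  adjacency = inputArrs G w 1

  open DepthFirst n adjacency public

  padded-toℕ : ∀ {m} (f : Fin m → ℕ) x → padded f (toℕ x) ≡ f x
  padded-toℕ {m} f x with toℕ x <? m
  ... | yes x< = cong f (fromℕ<-toℕ x x<)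
  ... | no x≮  = contradiction (toℕ<n x) x≮

  adjacency-at : ∀ x y → adjacency (n * toℕ x + toℕ y) ≡ bit (edge G x y)
  adjacency-at x y = begin
    adjacency (n * toℕ x + toℕ y)               ≡⟨ cong adjacency (sym (toℕ-combine x y)) ⟩
    adjacency (toℕ (combine x y))               ≡⟨ padded-toℕ (bit ∘ uncurry (edge G) ∘ remQuot {n} n) (combine x y) ⟩
    bit (uncurry (edge G) (remQuot {n} n (combine x y))) ≡⟨ cong (bit ∘ uncurry (edge G)) (remQuot-combine x y) ⟩
    bit (edge G x y)                            ∎
    where open ≡-Reasoning

  bit-T : ∀ {b} → bit b ≢ 0 → T b
  bit-T {true}  _  = tt
  bit-T {false} nz = nz refl

  T-bit : ∀ {b} → T b → bit b ≢ 0
  T-bit {true} _ ()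

  adj-E : ∀ {x y} → Adj G x y → E (toℕ x) (toℕ y)
  adj-E {x} {y} e = subst (_≢ 0) (sym (adjacency-at x y)) (T-bit e)

  E-adj : ∀ {x y} → E (toℕ x) (toℕ y) → Adj G x y
  E-adj {x} {y} e = bit-T (subst (_≢ 0) (adjacency-at x y) e)

  0<n : 0 < n
  0<n = >-nonZero⁻¹ n

  crossing : Connected G → ∀ (vis : ℕ → ℕ) → vis 0 ≢ 0 → (∃[ v ] v < n × vis v ≡ 0) →
    ∃[ a ] ∃[ v ] vis a ≢ 0 × v < n × vis v ≡ 0 × E a v
  crossing conn vis v0 (v , v<n , vv) =
    go (subst (λ z → vis z ≢ 0) (sym (toℕ-fromℕ< 0<n)) v0)
       (subst (λ z → vis z ≡ 0) (sym (toℕ-fromℕ< v<n)) vv)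
       (conn {fromℕ< 0<n} {fromℕ< v<n} ∈⊤ ∈⊤)
    where
    go : ∀ {x y} → vis (toℕ x) ≢ 0 → vis (toℕ y) ≡ 0 → Star (InducedAdj G allV) x y →
      ∃[ a ] ∃[ v ] vis a ≢ 0 × v < n × vis v ≡ 0 × E a v
    go vx vy ε = contradiction vy vx
    go {x} vx vy (_◅_ {j = z} (_ , _ , e) path) with vis (toℕ z) ≟ 0
    ... | yes vz = toℕ x , toℕ z , vx , toℕ<n z , vz , adj-E e
    ... | no vz  = go vz vy path

  module Indexed {ord vis par : ℕ → ℕ} (preorder : Dfs n ord vis par) where
    open Dfs preorder public
    open Ancestors par<

    vtx : ℕ → Fin n
    vtx x = ord x mod n

    toℕ-vtx : ∀ {x} → x < n → toℕ (vtx x) ≡ ord x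
    toℕ-vtx {x} x<n = trans (toℕ-fromℕ< (m%n<n (ord x) n)) (m<n⇒m%n≡m (ord< x<n))

    vtx-injective : ∀ {x y} → x < n → y < n → vtx x ≡ vtx y → x ≡ y
    vtx-injective x<n y<n eq =
      ord-inj x<n y<n (trans (sym (toℕ-vtx x<n)) (trans (cong toℕ eq) (toℕ-vtx y<n)))

    IEdge : ℕ → ℕ → Set
    IEdge a b = E (ord a) (ord b)

    edge-adj : ∀ {a b} → a < n → b < n → IEdge a b → Adj G (vtx a) (vtx b)
    edge-adj a<n b<n e = E-adj (subst₂ E (sym (toℕ-vtx a<n)) (sym (toℕ-vtx b<n)) e)

    adj-edge : ∀ {a b} → a < n → b < n → Adj G (vtx a) (vtx b) → IEdge a b
    adj-edge a<n b<n e = subst₂ E (toℕ-vtx a<n) (toℕ-vtx b<n) (adj-E e)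

    vtx-surjective : ∀ v → ∃[ x ] x < n × vtx x ≡ v
    vtx-surjective v with vis (toℕ v) ≟ 0
    ... | no nz = let x , x<n , eq = ord-vis nz in
      x , x<n , toℕ-injective (trans (toℕ-vtx x<n) eq)
    ... | yes z = contradiction (injective⇒≤ {f = f} f-inj) (<⇒≱ (n<1+n n))
      where
      at : Fin (suc n) → Fin n
      at fzero    = v
      at (fsuc x) = vtx (toℕ x)
      f : Fin (suc n) → Fin n
      f = at
      clash : ∀ x → v ≢ vtx (toℕ x)
      clash x eq = vis-ord (toℕ<n x) (trans (cong vis (trans (sym (toℕ-vtx (toℕ<n x))) (cong toℕ (sym eq)))) z)
      f-inj : ∀ {x y} → f x ≡ f y → x ≡ y
      f-inj {fzero} {fzero} eq = refl
      f-inj {fzero} {fsuc y} eq = contradiction eq (clash y)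
      f-inj {fsuc x} {fzero} eq = contradiction (sym eq) (clash x)
      f-inj {fsuc x} {fsuc y} eq = cong fsuc (toℕ-injective (vtx-injective (toℕ<n x) (toℕ<n y) eq))

    climbs : ℕ → ℕ → ℕ
    climbs zero    b = b
    climbs (suc i) b = par (climbs i b)

    climbs-par : ∀ i b → climbs i (par b) ≡ par (climbs i b)
    climbs-par zero    b = refl
    climbs-par (suc i) b = cong par (climbs-par i b)

    depth : ∀ {a b} → Anc par a b → ∃[ k ] climbs k b ≡ a × (∀ {i} → i < k → 0 < climbs i b)
    depth here = 0 , refl , λ ()
    depth {a} {b} (up 0<b anc) with depth anc
    ... | k , eq , pos = suc k , trans (sym (climbs-par k b)) eq , λ
      { {zero} _ → 0<b ; {suc i} (s≤s i<k) → subst (0 <_) (climbs-par i b) (pos i<k) }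

    module Path {a b : ℕ} (b<n : b < n) (anc : Anc par a b) where

      len : ℕ
      len = proj₁ (depth anc)

      end≡ : climbs len b ≡ a
      end≡ = proj₁ (proj₂ (depth anc))

      pos : ∀ {i} → i < len → 0 < climbs i b
      pos = proj₂ (proj₂ (depth anc))

      below : ∀ {i} → i ≤ len → climbs i b < n
      below {zero} _ = b<n
      below {suc i} i< = <-trans (par< (pos i<) (below (<⇒≤ i<))) (below (<⇒≤ i<))

      falls : ∀ {i j} → i < j → j ≤ len → climbs j b < climbs i b
      falls {i} {suc j} i<j j≤ with m<1+n⇒m<n∨m≡n i<j
      ... | inj₂ refl = par< (pos j≤) (below (<⇒≤ j≤))
      ... | inj₁ i<j′ = <-trans (par< (pos j≤) (below (<⇒≤ j≤))) (falls i<j′ (<⇒≤ j≤))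

      climbs-injective : ∀ {i j} → i ≤ len → j ≤ len → climbs i b ≡ climbs j b → i ≡ j
      climbs-injective {i} {j} i≤ j≤ eq with <-cmp i j
      ... | tri< i<j _ _ = contradiction (sym eq) (<⇒≢ (falls i<j j≤))
      ... | tri≈ _ i≡j _ = i≡j
      ... | tri> _ _ j<i = contradiction eq (<⇒≢ (falls j<i i≤))

      meets : ∀ {x} → a < x → Anc par x b → ∃[ i ] i < len × climbs i b ≡ x
      meets {x} a<x x-b with depth x-b
      ... | i , eq , pos′ with i <? len
      ...   | yes i< = i , i< , eq
      ...   | no i≮ = contradiction (subst₂ _≤_ eq end≡ (lower i (≮⇒≥ i≮) ≤-refl)) (<⇒≱ a<x)
        where
        below′ : ∀ {j} → j ≤ i → climbs j b < n
        below′ {zero} _ = b<n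
        below′ {suc j} j< = <-trans (par< (pos′ j<) (below′ (<⇒≤ j<))) (below′ (<⇒≤ j<))
        lower : ∀ j → len ≤ j → j ≤ i → climbs j b ≤ climbs len b
        lower j len≤ j≤ with m≤n⇒m<n∨m≡n len≤
        ... | inj₂ refl = ≤-refl
        lower (suc j) len≤ j< | inj₁ (s≤s len≤j) =
          ≤-trans (<⇒≤ (par< (pos′ j<) (below′ (<⇒≤ j<)))) (lower j len≤j (<⇒≤ j<))

      module _ (a<b : a < b) (e : IEdge a b) (nt : a ≢ par b) where

        len≥2 : len ≥ 2
        len≥2 with len in eq
        ... | zero = contradiction (trans (sym (subst (λ k → climbs k b ≡ a) eq end≡)) refl) (<⇒≢ a<b)
        ... | suc zero = contradiction (sym (subst (λ k → climbs k b ≡ a) eq end≡)) nt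
        ... | suc (suc _) = s≤s (s≤s z≤n)

        vertices : Fin (suc len) → Fin n
        vertices i = vtx (climbs (toℕ i) b)

        linked : ∀ {x y} → Consecutive vertices x y → Adj G x y
        linked (step i) = Graph.symmetric G (edge-adj (below i<) (subst (_< n) (cong (λ j → climbs j b) (sym i≡)) (below (<⇒≤ i<)))
            (subst (λ z → IEdge (par z) z′) (cong (λ j → climbs j b) i≡) (par-edge′)))
          where
          i< : toℕ i < len
          i< = toℕ<n i
          i≡ : toℕ (inject₁ i) ≡ toℕ i
          i≡ = toℕ-inject₁ i
          z′ : ℕ
          z′ = climbs (toℕ (inject₁ i)) b
          par-edge′ : IEdge (par z′) z′
          par-edge′ = par-edge (subst (0 <_) (cong (λ j → climbs j b) (sym i≡)) (pos i<))
                               (subst (_< n) (cong (λ j → climbs j b) (sym i≡)) (below (<⇒≤ i<)))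
        linked close = subst (λ z → Adj G (vtx z) (vtx b))
          (sym (trans (cong (λ j → climbs j b) (toℕ-fromℕ len)) end≡))
          (edge-adj (<-trans a<b b<n) b<n e)

        cycle : SimpleCycle G
        cycle = record
          { last = len ; last≥2 = len≥2 ; vertex = vertices
          ; injective = λ {i} {j} eq → toℕ-injective (climbs-injective (toℕ≤pred[n] i) (toℕ≤pred[n] j)
              (vtx-injective (below (toℕ≤pred[n] i)) (below (toℕ≤pred[n] j)) eq))
          ; adjacent = linked }

        back-edge : SimpleCycle.CycleEdge cycle (vtx a) (vtx b)
        back-edge = fwd (subst (λ z → Consecutive vertices (vtx z) (vtx b))
          (trans (cong (λ j → climbs j b) (toℕ-fromℕ len)) end≡) close)

        on-cycle : ∀ {i} → i ≤ len → SimpleCycle._OnCycle cycle (vtx (climbs i b))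
        on-cycle i≤ = fromℕ< (s≤s i≤) , cong (λ j → vtx (climbs j b)) (toℕ-fromℕ< (s≤s i≤))

        consecutive : ∀ {x y} → Consecutive vertices x y →
          (∃[ z ] 0 < z × z < n × x ≡ vtx z × y ≡ vtx (par z)) ⊎ x ≡ vtx a × y ≡ vtx b
        consecutive (step i) = inj₁ (climbs (toℕ i) b , pos (toℕ<n i) , below (<⇒≤ (toℕ<n i)) ,
          cong (λ j → vtx (climbs j b)) (toℕ-inject₁ i) , refl)
        consecutive close = inj₂ (cong vtx (trans (cong (λ j → climbs j b) (toℕ-fromℕ len)) end≡) , refl)

    open Covering n IEdge par

    module _ {x a b a′ b′ : ℕ} (cv : Cover a b x) (cv′ : Cover a′ b′ x) (nt : a ≢ par b) (nt′ : a′ ≢ par b′) where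
      private
        module C = Cover cv
        module C′ = Cover cv′
        x≤b : x ≤ b
        x≤b = anc-≤ C.b<n C.anc
        x≤b′ : x ≤ b′
        x≤b′ = anc-≤ C′.b<n C′.anc
        a<b : a < b
        a<b = <-≤-trans C.a<x x≤b
        a′<b′ : a′ < b′
        a′<b′ = <-≤-trans C′.a<x x≤b′
        module D = Path C.b<n (edge-anc a<b C.b<n C.edge)
        module D′ = Path C′.b<n (edge-anc a′<b′ C′.b<n C′.edge)
        cyc : SimpleCycle G
        cyc = D.cycle a<b C.edge nt
        cyc′ : SimpleCycle G
        cyc′ = D′.cycle a′<b′ C′.edge nt′

      same-ends : SameCycle cyc cyc′ → a ≡ a′ × b ≡ b′
      same-ends same with Equivalence.to (same (vtx a) (vtx b)) (D.back-edge a<b C.edge nt)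
      ... | fwd c = case D′.consecutive a′<b′ C′.edge nt′ c of λ
        { (inj₁ (z , 0<z , z<n , p , q)) →
            contradiction (par< 0<z z<n)
              (<-asym (subst₂ _<_ (vtx-injective (<-trans a<b C.b<n) z<n p)
                (vtx-injective C.b<n (<-trans (par< 0<z z<n) z<n) q) a<b))
        ; (inj₂ (p , q)) → vtx-injective (<-trans a<b C.b<n) (<-trans a′<b′ C′.b<n) p ,
                           vtx-injective C.b<n C′.b<n q }
      ... | bwd c = case D′.consecutive a′<b′ C′.edge nt′ c of λ
        { (inj₁ (z , 0<z , z<n , p , q)) → contradiction
            (trans (vtx-injective (<-trans a<b C.b<n) (<-trans (par< 0<z z<n) z<n) q)
              (cong par (sym (vtx-injective C.b<n z<n p)))) nt
        ; (inj₂ (p , q)) → contradiction a′<b′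
            (<-asym (subst₂ _<_ (vtx-injective (<-trans a<b C.b<n) C′.b<n q)
              (vtx-injective C.b<n (<-trans a′<b′ C′.b<n) p) a<b)) }

      cactus-single : IsCactus G → a ≡ a′ × b ≡ b′
      cactus-single (_ , cactus) = decidable-stable (a ≟ a′ ×-dec b ≟ b′) λ ne →
        let i , i< , eq = D.meets C.a<x C.anc
            j , j< , eq′ = D′.meets C′.a<x C′.anc
            x>0 : 0 < x
            x>0 = ≤-<-trans z≤n C.a<x
            x<n : x < n
            x<n = ≤-<-trans x≤b C.b<n
            same = cactus cyc cyc′ (λ same → ne (same-ends same))
              (subst (λ z → SimpleCycle._OnCycle cyc (vtx z)) eq (D.on-cycle a<b C.edge nt (<⇒≤ i<)))
              (subst (λ z → SimpleCycle._OnCycle cyc′ (vtx z)) eq′ (D′.on-cycle a′<b′ C′.edge nt′ (<⇒≤ j<)))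
              (subst (λ z → SimpleCycle._OnCycle cyc (vtx (par z))) eq (D.on-cycle a<b C.edge nt i<))
              (subst (λ z → SimpleCycle._OnCycle cyc′ (vtx (par z))) eq′ (D′.on-cycle a′<b′ C′.edge nt′ j<))
        in <⇒≢ (par< x>0 x<n) (vtx-injective (<-trans (par< x>0 x<n) x<n) x<n (sym same))

    earTree : ∀ {bot} → Witnessed bot → Maximal bot →
      (∀ {x a b a′ b′} → Cover a b x → Cover a′ b′ x → a ≢ par b → a′ ≢ par b′ → a ≡ a′ × b ≡ b′) →
      EarTree n IEdge par bot
    earTree wit max single = record
      { par< = par<
      ; par-edge = par-edge
      ; edge-sym = λ x<n y<n e → adj-edge y<n x<n (Graph.symmetric G (edge-adj x<n y<n e))
      ; edge-irr = λ x<n e → Graph.irreflexive G _ (edge-adj x<n x<n e)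
      ; edge-anc = edge-anc
      ; witness = wit ; maximal = max ; single = single }

    cactus-earTree : IsCactus G → ∀ {bot} → Witnessed bot → Maximal bot → EarTree n IEdge par bot
    cactus-earTree cac wit max = earTree wit max λ cv cv′ nt nt′ → cactus-single cv cv′ nt nt′ cac

    tree-cover-only : ¬ SimpleCycle G → ∀ {x a b} → Cover a b x → a ≡ par b
    tree-cover-only acyclic {x} {a} {b} (cover a<x b<n anc e) with a ≟ par b
    ... | yes eq = eq
    ... | no nt  = contradiction (Path.cycle b<n (edge-anc a<b b<n e) a<b e nt) acyclic
      where
      a<b : a < b
      a<b = <-≤-trans a<x (anc-≤ b<n anc)

    tree-earTree : ¬ SimpleCycle G → ∀ {bot} → Witnessed bot → Maximal bot →
      EarTree n IEdge par bot × (∀ {x} → x < n → bot x ≡ x)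
    tree-earTree acyclic {bot} wit max = tree , bot≡
      where
      tree : EarTree n IEdge par bot
      tree = earTree wit max λ cv _ nt _ → contradiction (tree-cover-only acyclic cv) nt
      bot≡ : ∀ {x} → x < n → bot x ≡ x
      bot≡ {zero} _ = EarTree.bot-0 tree
      bot≡ {suc x} x<n with suc x ≟ bot (suc x)
      ... | yes eq = sym eq
      ... | no ne = let a , cv = EarTree.bot-cover tree z<s x<n in
        contradiction (tree-cover-only acyclic cv) (EarTree.nontree tree cv ne)

-- Contraction of ears

module Stages {n : ℕ} .{{_ : NonZero n}} (G : Graph n) (w : Fin n → ℕ)
              {ord vis par bot : ℕ → ℕ}
              (preorder : DepthFirst.Dfs n (Input.adjacency G w) n ord vis par)
              (tree : EarTree n (λ a b → DepthFirst.E n (Input.adjacency G w) (ord a) (ord b)) par bot) where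

  open Input G w using (module Indexed)
  open Indexed preorder using (vtx; vtx-injective; edge-adj; adj-edge; vtx-surjective; IEdge)
  open EarTree tree

  -- The ears whose heads are at least i have been contracted into their tops,
  -- and ρ v is the vertex into which v has been contracted.
  Live : ℕ → ℕ → Set
  Live i y = ∀ h → i ≤ h → Head h → bot y ≢ bot h

  record Stage (i : ℕ) (ρ : Fin n → ℕ) : Set where
    field
      ρ<    : ∀ v → ρ v < n
      live  : ∀ v → Live i (ρ v)
      root  : ∀ {y} → y < n → Live i y → ρ (vtx y) ≡ y
      cross : ∀ {p q} → Adj G p q → ρ p ≢ ρ q → p ≡ vtx (ρ p) × q ≡ vtx (ρ q)

  piece : (Fin n → ℕ) → ℕ → List (Fin n)
  piece ρ y = filter (λ v → ρ v ≟ y) (allFin n)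

  ∈-piece : ∀ {ρ v y} → ρ v ≡ y → v ∈ piece ρ y
  ∈-piece {ρ} {v} {y} eq = ∈-filter⁺ (λ v → ρ v ≟ y) (∈-allFin v) eq

  piece-∈ : ∀ {ρ v y} → v ∈ piece ρ y → ρ v ≡ y
  piece-∈ {ρ} {v} {y} p = proj₂ (∈-filter⁻ (λ v → ρ v ≟ y) {xs = allFin n} p)

  piece-unique : ∀ ρ y → Unique (piece ρ y)
  piece-unique ρ y = Unique-filter⁺ (λ v → ρ v ≟ y) (allFin⁺ n)

  stage-start : ∀ {i} → n ≤ i → ∃[ ρ ] Stage i ρ × (∀ {y} → y < n → piece ρ y ↭ vtx y ∷ [])
  stage-start {i} n≤i = ρ , record
    { ρ< = ρ<
    ; live = λ v h i≤h H → contradiction (proj₁ (proj₂ H)) (≤⇒≯ (≤-trans n≤i i≤h))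
    ; root = λ y<n _ → root y<n
    ; cross = λ _ _ → sym (vtx-ρ _) , sym (vtx-ρ _) }
    , λ {y} y<n → unique-↭ (piece-unique ρ y) ([] ∷ [])
        (λ {v} p → here (trans (sym (vtx-ρ v)) (cong vtx (piece-∈ p))))
        λ { (here refl) → ∈-piece (root y<n) }
    where
    ρ : Fin n → ℕ
    ρ v = proj₁ (vtx-surjective v)
    ρ< : ∀ v → ρ v < n
    ρ< v = proj₁ (proj₂ (vtx-surjective v))
    vtx-ρ : ∀ v → vtx (ρ v) ≡ v
    vtx-ρ v = proj₂ (proj₂ (vtx-surjective v))
    root : ∀ {y} → y < n → ρ (vtx y) ≡ y
    root y<n = vtx-injective (ρ< _) y<n (vtx-ρ _)

  stage-skip : ∀ {h ρ} → ¬ Head h → Stage (suc h) ρ → Stage h ρ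
  stage-skip ¬H st = record
    { ρ< = ρ< ; cross = cross
    ; live = λ v h′ h≤h′ H′ → live v h′ (≤∧≢⇒< h≤h′ λ { refl → ¬H H′ }) H′
    ; root = λ y<n lv → root y<n (λ h′ h<h′ → lv h′ (<⇒≤ h<h′)) }
    where open Stage st

  live-suc : ∀ {h y} → Live h y → Live (suc h) y
  live-suc lv h′ h<h′ = lv h′ (<⇒≤ h<h′)

  has-head : ∀ y → 0 < y → y < n → ∃[ h ] Head h × bot y ≡ bot h
  has-head y 0<y y<n = go y y ≤-refl 0<y y<n
    where
    go : ∀ k y → y ≤ k → 0 < y → y < n → ∃[ h ] Head h × bot y ≡ bot h
    go k y y≤k 0<y y<n with bot (par y) ≟ bot y
    ... | no ne = y , (0<y , y<n , ne) , refl
    go zero y y≤k 0<y y<n | yes eq = contradiction y≤k (<⇒≱ 0<y)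
    go (suc k) y y≤k 0<y y<n | yes eq =
      let p< = par< 0<y y<n
          h , H , eq′ = go k (par y) (≤-pred (≤-trans p< y≤k)) (bot-pos 0<y y<n eq) (<-trans p< y<n)
      in h , H , trans (sym eq) eq′

  live-0 : ∀ {y i} → i ≤ 1 → y < n → Live i y → y ≡ 0
  live-0 {zero} _ _ _ = refl
  live-0 {suc y} i≤1 y<n lv =
    let h , H , eq = has-head (suc y) z<s y<n
    in contradiction eq (lv h (≤-trans i≤1 (proj₁ H)) H)

  module Contract {h m : ℕ} {v : ℕ → ℕ} {ρ : Fin n → ℕ} (ear : Ear h m v) (st : Stage (suc h) ρ) where
    open Ear ear
    open Stage st

    0<h : 0 < h
    0<h = proj₁ head
    h<n : h < n
    h<n = proj₁ (proj₂ head)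

    ρ′ : Fin n → ℕ
    ρ′ p = if does (bot (ρ p) ≟ bot h) then par h else ρ p

    ρ′-in : ∀ {p} → bot (ρ p) ≡ bot h → ρ′ p ≡ par h
    ρ′-in {p} eq rewrite dec-true (bot (ρ p) ≟ bot h) eq = refl

    ρ′-out : ∀ {p} → bot (ρ p) ≢ bot h → ρ′ p ≡ ρ p
    ρ′-out {p} ne rewrite dec-false (bot (ρ p) ≟ bot h) ne = refl

    top< : par h < n
    top< = <-trans (par< 0<h h<n) h<n

    top-live : Live h (par h)
    top-live h′ h≤h′ H′ eq with m≤n⇒m<n∨m≡n h≤h′
    ... | inj₂ refl = proj₂ (proj₂ H′) eq
    ... | inj₁ h<h′ = contradiction
      (not-above H′ (bot-pos (proj₁ H′) (proj₁ (proj₂ H′)) eq) top< eq)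
      (<⇒≱ (<-trans (par< 0<h h<n) h<h′))

    ear-live : ∀ {y} → bot y ≡ bot h → Live (suc h) y
    ear-live eq h′ h<h′ H′ eq′ = <⇒≢ h<h′ (head-unique head H′ (trans (sym eq) eq′))

    leaves : ∀ {p q} → Adj G p q → bot (ρ p) ≡ bot h → bot (ρ q) ≢ bot h → ρ q ≡ par h
    leaves {p} {q} e inp outq with cross e (λ eq → outq (trans (cong bot (sym eq)) inp))
    ... | p≡ , q≡ with everywhere (bot-pos 0<h h<n inp) (ρ< p) inp
    ... | suc i , _ , i<m , vi≡ with neighbours i<m (ρ< q)
          (subst (λ x → IEdge x (ρ q)) (sym vi≡) (adj-edge (ρ< p) (ρ< q) (subst₂ (Adj G) p≡ q≡ e)))
    ... | inj₂ (inj₂ (h′ , H′ , h<h′ , eq)) = contradiction eq (live q h′ h<h′ H′)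
    leaves {p} {q} e inp outq | _ | suc zero , _ , i<m , vi≡ | inj₁ z≡ = trans z≡ first
    leaves {p} {q} e inp outq | _ | suc (suc i) , _ , i<m , vi≡ | inj₁ z≡ =
      contradiction (trans (cong bot z≡) (inside (s≤s z≤n) (<⇒≤ i<m))) outq
    leaves {p} {q} e inp outq | _ | suc i , _ , i<m , vi≡ | inj₂ (inj₁ z≡) with m≤n⇒m<n∨m≡n i<m
    ... | inj₁ i<m′ = contradiction (trans (cong bot z≡) (inside (s≤s z≤n) i<m′)) outq
    ... | inj₂ refl = trans z≡ top

    contracted : Stage h ρ′
    contracted = record
      { ρ< = λ p → case bot (ρ p) ≟ bot h of λ
          { (yes eq) → subst (_< n) (sym (ρ′-in eq)) top<
          ; (no ne) → subst (_< n) (sym (ρ′-out ne)) (ρ< p) }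
      ; live = λ p → case bot (ρ p) ≟ bot h of λ
          { (yes eq) → subst (Live h) (sym (ρ′-in eq)) top-live
          ; (no ne) → subst (Live h) (sym (ρ′-out ne)) λ h′ h≤h′ H′ eq → case m≤n⇒m<n∨m≡n h≤h′ of λ
              { (inj₁ h<h′) → live p h′ h<h′ H′ eq ; (inj₂ refl) → ne eq } }
      ; root = λ {y} y<n lv →
          let r = root y<n (live-suc {h} {y} lv)
          in trans (ρ′-out (λ eq → lv h ≤-refl head (trans (cong bot (sym r)) eq))) r
      ; cross = λ {p} {q} e ne → crossing e ne (bot (ρ p) ≟ bot h) (bot (ρ q) ≟ bot h) }
      where
      crossing : ∀ {p q} → Adj G p q → ρ′ p ≢ ρ′ q → Dec (bot (ρ p) ≡ bot h) → Dec (bot (ρ q) ≡ bot h) →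
        p ≡ vtx (ρ′ p) × q ≡ vtx (ρ′ q)
      crossing e ne (yes inp) (yes inq) = contradiction (trans (ρ′-in inp) (sym (ρ′-in inq))) ne
      crossing e ne (yes inp) (no outq) =
        contradiction (trans (ρ′-in inp) (sym (trans (ρ′-out outq) (leaves e inp outq)))) ne
      crossing e ne (no outp) (yes inq) = contradiction
        (trans (trans (ρ′-out outp) (leaves (Graph.symmetric G e) inq outp)) (sym (ρ′-in inq))) ne
      crossing e ne (no outp) (no outq) =
        let p≡ , q≡ = cross e (λ eq → ne (trans (ρ′-out outp) (trans eq (sym (ρ′-out outq)))))
        in trans p≡ (cong vtx (sym (ρ′-out outp))) , trans q≡ (cong vtx (sym (ρ′-out outq)))

    piece-other : ∀ {y} → y ≢ par h → bot y ≢ bot h → piece ρ y ↭ piece ρ′ y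
    piece-other {y} ne out = unique-↭ (piece-unique ρ y) (piece-unique ρ′ y)
      (λ {p} p∈ → let eq = piece-∈ p∈ in
        ∈-piece (trans (ρ′-out (λ z → out (trans (cong bot (sym eq)) z))) eq))
      (λ {p} p∈ → let eq = piece-∈ p∈ in ∈-piece (case bot (ρ p) ≟ bot h of λ
        { (yes i) → contradiction (trans (sym eq) (ρ′-in i)) ne
        ; (no o) → trans (sym (ρ′-out o)) eq }))

    -- One side of the cycle after the removal of the edge between c 0 and c 1.
    record Side (T : ℕ) (c : ℕ → ℕ) : Set where
      field
        on-ear : ∀ {j} → 1 ≤ j → j ≤ T → ∃[ i ] 1 ≤ i × i ≤ m × c j ≡ v i
        inj    : ∀ {i j} → 1 ≤ i → i ≤ T → 1 ≤ j → j ≤ T → c i ≡ c j → i ≡ j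
        link   : ∀ {j} → 1 ≤ j → j ≤ T → IEdge (c (suc j)) (c j)
        ends   : c (suc T) ≡ par h
        around : ∀ {j z} → 1 ≤ j → j ≤ T → z < n → Live (suc h) z → IEdge (c j) z →
                 z ≡ c (j ∸ 1) ⊎ z ≡ c (suc j)

      c-bot : ∀ {j} → 1 ≤ j → j ≤ T → bot (c j) ≡ bot h
      c-bot 1≤j j≤T with on-ear 1≤j j≤T
      ... | i , 1≤i , i≤m , eq = trans (cong bot eq) (inside 1≤i i≤m)

      c-bound : ∀ {j} → 1 ≤ j → j ≤ suc T → c j < n
      c-bound {j} 1≤j j≤ with m≤n⇒m<n∨m≡n j≤
      ... | inj₂ refl = subst (_< n) (sym ends) top<
      ... | inj₁ (s≤s j≤T) with on-ear 1≤j j≤T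
      ...   | i , 1≤i , i≤m , eq = subst (_< n) (sym eq) (bound 1≤i i≤m)

      c-live : ∀ {j} → 1 ≤ j → j ≤ suc T → Live (suc h) (c j)
      c-live {j} 1≤j j≤ with m≤n⇒m<n∨m≡n j≤
      ... | inj₂ refl = subst (Live (suc h)) (sym ends) (live-suc {h} {par h} top-live)
      ... | inj₁ (s≤s j≤T) = ear-live (c-bot 1≤j j≤T)

      side : ℕ → List (Fin n)
      side zero    = []
      side (suc j) = piece ρ (c (suc j)) ++ side j

      ∈-side : ∀ {j p} → j ≤ T → p ∈ side j → ∃[ i ] 1 ≤ i × i ≤ j × ρ p ≡ c i
      ∈-side {suc j} j≤T p∈ with ∈-++⁻ (piece ρ (c (suc j))) p∈
      ... | inj₁ q = suc j , s≤s z≤n , ≤-refl , piece-∈ q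
      ... | inj₂ q with ∈-side (<⇒≤ j≤T) q
      ...   | i , 1≤i , i≤j , eq = i , 1≤i , m≤n⇒m≤1+n i≤j , eq

      side-∈ : ∀ {i j p} → 1 ≤ i → i ≤ j → ρ p ≡ c i → p ∈ side j
      side-∈ {i} {zero} 1≤i i≤j eq = contradiction 1≤i (≤⇒≯ i≤j)
      side-∈ {i} {suc j} 1≤i i≤j eq with m≤n⇒m<n∨m≡n i≤j
      ... | inj₂ refl = ∈-++⁺ˡ (∈-piece eq)
      ... | inj₁ (s≤s i≤j′) = ∈-++⁺ʳ (piece ρ (c (suc j))) (side-∈ 1≤i i≤j′ eq)

      c-distinct : ∀ {i j} → 1 ≤ i → i < j → j ≤ suc T → c i ≢ c j
      c-distinct {i} {j} 1≤i i<j j≤ eq with m≤n⇒m<n∨m≡n j≤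
      ... | inj₁ (s≤s j≤T) = <⇒≢ i<j (inj 1≤i (≤-trans (<⇒≤ i<j) j≤T) (≤-trans 1≤i (<⇒≤ i<j)) j≤T eq)
      ... | inj₂ refl = proj₂ (proj₂ head)
        (trans (cong bot (sym (trans eq ends))) (c-bot 1≤i (≤-pred i<j)))

      next∉ : ∀ {j p} → j ≤ T → ρ p ≡ c (suc j) → p ∉ side j
      next∉ j≤T eq p∈ with ∈-side j≤T p∈
      ... | i , 1≤i , i≤j , eq′ = c-distinct 1≤i (s≤s i≤j) (s≤s j≤T) (trans (sym eq′) eq)

      side-unique : ∀ {j} → j ≤ T → Unique (side j)
      side-unique {zero} _ = []
      side-unique {suc j} j≤T = Unique-++⁺ (piece-unique ρ _) (side-unique (<⇒≤ j≤T))
        λ (p , q) → next∉ (<⇒≤ j≤T) (piece-∈ p) q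

      root-c : ∀ {j} → 1 ≤ j → j ≤ suc T → ρ (vtx (c j)) ≡ c j
      root-c 1≤j j≤ = root (c-bound 1≤j j≤) (c-live 1≤j j≤)

    module Cut {l d K : ℕ} (P : LUPartition G w l (l + d) K) where
      open Labels G w l d P

      -- The partition stays connected after the removal of the r-th edge.
      Removable : ℕ → Set
      Removable r = label (vtx (v r)) ≢ label (vtx (v (suc r)))
                  ⊎ (∀ i → i ≤ suc m → label (vtx (v i)) ≡ label (vtx (v 0)))

      removable : ∃[ r ] r ≤ m × Removable r
      removable = case go m ≤-refl of λ
        { (inj₁ (r , r≤m , ne)) → r , r≤m , inj₁ ne
        ; (inj₂ same) → 0 , z≤n , inj₂ same }
        where
        go : ∀ i → i ≤ m → (∃[ r ] r ≤ m × label (vtx (v r)) ≢ label (vtx (v (suc r))))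
          ⊎ (∀ j → j ≤ suc i → label (vtx (v j)) ≡ label (vtx (v 0)))
        go i i≤m with label (vtx (v i)) ≟ᶠ label (vtx (v (suc i)))
        ... | no ne = inj₁ (i , i≤m , ne)
        go zero i≤m | yes eq = inj₂ λ
          { zero _ → refl ; (suc zero) _ → sym eq ; (suc (suc j)) (s≤s ()) }
        go (suc i) i≤m | yes eq with go i (<⇒≤ i≤m)
        ... | inj₁ x = inj₁ x
        ... | inj₂ same = inj₂ λ j j≤ → case m≤n⇒m<n∨m≡n j≤ of λ
          { (inj₁ (s≤s j≤′)) → same j j≤′
          ; (inj₂ refl) → trans (sym eq) (same (suc i) ≤-refl) }

      module _ {T : ℕ} {c : ℕ → ℕ} (sd : Side T c)
               (cut : label (vtx (c 0)) ≢ label (vtx (c 1)) ⊎ (∀ i → i ≤ suc T → label (vtx (c i)) ≡ label (vtx (c 0))))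
               where
        open Side sd

        cluster-inside : ∀ {j} → 1 ≤ j → j ≤ T → label (vtx (c j)) ≢ label (vtx (c (suc j))) →
          ∀ {q} → label q ≡ label (vtx (c j)) → q ∈ side j
        cluster-inside {j} 1≤j j≤T ne {q} eq =
          walk (side-∈ 1≤j ≤-refl (root-c 1≤j (m≤n⇒m≤1+n j≤T))) refl
            (LUPartition.connected P (label (vtx (c j))) (label-∈ (vtx (c j)))
              (subst (λ ℓ → q ∈ₛ LUPartition.cluster P ℓ) eq (label-∈ q)))
          where
          stay : ∀ {p q} → p ∈ side j → label p ≡ label (vtx (c j)) → Adj G p q → label q ≡ label (vtx (c j)) → q ∈ side j
          stay {p} {q} p∈ lp e lq with ρ p ≟ ρ q | ∈-side j≤T p∈
          ... | yes same | i , 1≤i , i≤j , ρp = side-∈ 1≤i i≤j (trans (sym same) ρp)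
          ... | no diff | i , 1≤i , i≤j , ρp with cross e diff
          ...   | p≡ , q≡ with around 1≤i (≤-trans i≤j j≤T) (ρ< q) (live q)
                  (subst (λ x → IEdge x (ρ q)) ρp (adj-edge (ρ< p) (ρ< q) (subst₂ (Adj G) p≡ q≡ e)))
          ...     | inj₂ z≡ with m≤n⇒m<n∨m≡n i≤j
          ...       | inj₁ i<j = side-∈ (s≤s z≤n) i<j z≡
          ...       | inj₂ refl = contradiction (sym (trans (cong label (trans (cong vtx (sym z≡)) (sym q≡))) lq)) ne
          stay {p} {q} p∈ lp e lq | no diff | suc zero , 1≤i , i≤j , ρp | p≡ , q≡ | inj₁ z≡ = case cut of λ
            { (inj₁ ne₀) → contradiction
                (trans (cong label (trans (cong vtx (sym z≡)) (sym q≡)))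
                  (trans lq (trans (sym lp) (cong label (trans p≡ (cong vtx ρp)))))) ne₀
            ; (inj₂ same) → contradiction (trans (same j (m≤n⇒m≤1+n j≤T)) (sym (same (suc j) (s≤s j≤T)))) ne }
          stay {p} {q} p∈ lp e lq | no diff | suc (suc i) , 1≤i , i≤j , ρp | p≡ , q≡ | inj₁ z≡ =
            side-∈ (s≤s z≤n) (<⇒≤ i≤j) z≡
          walk : ∀ {p q} → p ∈ side j → label p ≡ label (vtx (c j)) →
            Star (InducedAdj G (LUPartition.cluster P (label (vtx (c j))))) p q → q ∈ side j
          walk p∈ lp ε = p∈
          walk p∈ lp ((_ , q∈ , e) ◅ path) = walk (stay p∈ lp e (∈-label q∈)) (∈-label q∈) path

    sideA : ∀ {r} → r ≤ m → Side r (λ j → v (suc r ∸ j))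
    sideA {r} r≤m = record
      { on-ear = λ {j} 1≤j j≤r → suc r ∸ j , m<n⇒0<n∸m (s≤s j≤r) , ≤-trans (≤r 1≤j) r≤m , refl
      ; inj = λ {i} {j} 1≤i i≤r 1≤j j≤r eq → ∸-cancelˡ-≡ (m≤n⇒m≤1+n i≤r) (m≤n⇒m≤1+n j≤r)
          (distinct (m<n⇒0<n∸m (s≤s i≤r)) (≤-trans (≤r 1≤i) r≤m) (m<n⇒0<n∸m (s≤s j≤r)) (≤-trans (≤r 1≤j) r≤m) eq)
      ; link = λ {j} 1≤j j≤r → subst (λ x → IEdge (v (r ∸ j)) (v x)) (sym (+-∸-assoc 1 j≤r))
          (adjacent (≤-trans (m∸n≤m r j) r≤m))
      ; ends = trans (cong v (n∸n≡0 r)) first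
      ; around = λ {j} {z} 1≤j j≤r z<n lv e → case neighbours (≤-trans (s≤s (≤-reflexive refl)) (suc≤ 1≤j j≤r)) z<n
            (subst (λ x → IEdge (v x) z) (+-∸-assoc 1 j≤r) e) of λ
          { (inj₁ eq) → inj₂ eq
          ; (inj₂ (inj₁ eq)) → inj₁ (trans eq (cong v (shift′ 1≤j j≤r)))
          ; (inj₂ (inj₂ (h′ , H′ , h<h′ , eq))) → contradiction eq (lv h′ h<h′ H′) } }
      where
      ≤r : ∀ {j} → 1 ≤ j → suc r ∸ j ≤ r
      ≤r {suc j} _ = m∸n≤m r j
      suc≤ : ∀ {j} → 1 ≤ j → j ≤ r → suc (r ∸ j) ≤ m
      suc≤ {j} 1≤j j≤r = ≤-trans (subst (_≤ r) (+-∸-assoc 1 j≤r) (≤r 1≤j)) r≤m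
      shift′ : ∀ {j} → 1 ≤ j → j ≤ r → suc (suc (r ∸ j)) ≡ suc r ∸ (j ∸ 1)
      shift′ {suc j} _ j<r = trans (cong suc (sym (+-∸-assoc 1 j<r))) (sym (+-∸-assoc 1 (<⇒≤ j<r)))

    sideB : ∀ {r} → r ≤ m → Side (m ∸ r) (λ j → v (r + j))
    sideB {r} r≤m = record
      { on-ear = λ {j} 1≤j j≤ → r + j , ≤-trans 1≤j (m≤n+m j r) , ≤m j≤ , refl
      ; inj = λ {i} {j} 1≤i i≤ 1≤j j≤ eq → +-cancelˡ-≡ r i j
          (distinct (≤-trans 1≤i (m≤n+m i r)) (≤m i≤) (≤-trans 1≤j (m≤n+m j r)) (≤m j≤) eq)
      ; link = λ {j} 1≤j j≤ → subst (λ x → IEdge (v x) (v (r + j))) (sym (+-suc r j))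
          (edge-sym′ 1≤j j≤)
      ; ends = trans (cong v (trans (+-suc r (m ∸ r)) (cong suc (m+[n∸m]≡n r≤m)))) top
      ; around = λ { {suc j} {z} 1≤j j≤ z<n lv e → case neighbours (≤-trans (≤-reflexive (sym (+-suc r j))) (≤m j≤)) z<n
            (subst (λ x → IEdge (v x) z) (+-suc r j) e) of λ
          { (inj₁ eq) → inj₁ eq
          ; (inj₂ (inj₁ eq)) → inj₂ (trans eq (cong v (sym (trans (+-suc r (suc j)) (cong suc (+-suc r j))))))
          ; (inj₂ (inj₂ (h′ , H′ , h<h′ , eq))) → contradiction eq (lv h′ h<h′ H′) } } }
      where
      ≤m : ∀ {j} → j ≤ m ∸ r → r + j ≤ m
      ≤m {j} j≤ = subst (r + j ≤_) (m+[n∸m]≡n r≤m) (+-monoʳ-≤ r j≤)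
      edge-sym′ : ∀ {j} → 1 ≤ j → j ≤ m ∸ r → IEdge (v (suc (r + j))) (v (r + j))
      edge-sym′ {j} 1≤j j≤ = edge-sym (bound 1≤ (≤m j≤)) v< (adjacent (≤m j≤))
        where
        1≤ : 1 ≤ r + j
        1≤ = ≤-trans 1≤j (m≤n+m j r)
        v< : v (suc (r + j)) < n
        v< = subst (_< n) (sym (next 1≤ (≤m j≤)))
               (<-trans (par< (pos 1≤ (≤m j≤)) (bound 1≤ (≤m j≤))) (bound 1≤ (≤m j≤)))

    module TwoSides {r : ℕ} (r≤m : r ≤ m) where
      module A = Side (sideA r≤m)
      module B = Side (sideB r≤m)

      top∉A : ∀ {p} → p ∈ piece ρ (par h) → p ∉ A.side r
      top∉A p∈ = A.next∉ ≤-refl (trans (piece-∈ p∈) (sym A.ends))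

      top∉B : ∀ {p} → p ∈ piece ρ (par h) → p ∉ B.side (m ∸ r)
      top∉B p∈ = B.next∉ ≤-refl (trans (piece-∈ p∈) (sym B.ends))

      A∉B : ∀ {p} → p ∈ A.side r → p ∉ B.side (m ∸ r)
      A∉B p∈ p∈′ with A.∈-side ≤-refl p∈ | B.∈-side ≤-refl p∈′
      ... | i , 1≤i , i≤r , eq | j , 1≤j , j≤ , eq′ =
        <⇒≢ (≤-<-trans (≤r 1≤i) (m<m+n r 1≤j))
          (distinct (m<n⇒0<n∸m (s≤s i≤r)) (≤-trans (≤r 1≤i) r≤m) (≤-trans 1≤j (m≤n+m j r))
            (subst (r + j ≤_) (m+[n∸m]≡n r≤m) (+-monoʳ-≤ r j≤)) (trans (sym eq) eq′))
        where
        ≤r : ∀ {i} → 1 ≤ i → suc r ∸ i ≤ r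
        ≤r {suc i} _ = m∸n≤m r i

      rest∉B : ∀ {p} → p ∈ piece ρ (par h) ++ A.side r → p ∉ B.side (m ∸ r)
      rest∉B p∈ q = case ∈-++⁻ (piece ρ (par h)) p∈ of λ { (inj₁ p) → top∉B p q ; (inj₂ p) → A∉B p q }

      piece-top : (piece ρ (par h) ++ A.side r) ++ B.side (m ∸ r) ↭ piece ρ′ (par h)
      piece-top = unique-↭ u (piece-unique ρ′ (par h)) into from
        where
        u : Unique ((piece ρ (par h) ++ A.side r) ++ B.side (m ∸ r))
        u = Unique-++⁺ (Unique-++⁺ (piece-unique ρ _) (A.side-unique ≤-refl) λ (p , q) → top∉A p q)
          (B.side-unique ≤-refl) λ (p , q) → rest∉B p q
        into : ∀ {p} → p ∈ (piece ρ (par h) ++ A.side r) ++ B.side (m ∸ r) → p ∈ piece ρ′ (par h)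
        into p∈ with ∈-++⁻ (piece ρ (par h) ++ A.side r) p∈
        ... | inj₂ q = let i , 1≤i , i≤ , eq = B.∈-side ≤-refl q in
          ∈-piece (ρ′-in (trans (cong bot eq) (B.c-bot 1≤i i≤)))
        ... | inj₁ q with ∈-++⁻ (piece ρ (par h)) q
        ...   | inj₁ q = ∈-piece (trans (ρ′-out (λ eq → proj₂ (proj₂ head) (trans (cong bot (sym (piece-∈ q))) eq))) (piece-∈ q))
        ...   | inj₂ q = let i , 1≤i , i≤ , eq = A.∈-side ≤-refl q in
          ∈-piece (ρ′-in (trans (cong bot eq) (A.c-bot 1≤i i≤)))
        from : ∀ {p} → p ∈ piece ρ′ (par h) → p ∈ (piece ρ (par h) ++ A.side r) ++ B.side (m ∸ r)
        from {p} p∈ with bot (ρ p) ≟ bot h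
        ... | no out = ∈-++⁺ˡ (∈-++⁺ˡ (∈-piece (trans (sym (ρ′-out out)) (piece-∈ p∈))))
        ... | yes inp with everywhere (bot-pos 0<h h<n inp) (ρ< p) inp
        ...   | i , 1≤i , i≤m , eq with i ≤? r
        ...     | yes i≤r = ∈-++⁺ˡ (∈-++⁺ʳ (piece ρ (par h)) (A.side-∈ {suc r ∸ i}
                    (m<n⇒0<n∸m (s≤s i≤r)) (∸-monoʳ-≤ (suc r) 1≤i)
                    (trans (sym eq) (cong v (sym (m∸[m∸n]≡n (m≤n⇒m≤1+n i≤r)))))))
        ...     | no i≰r = ∈-++⁺ʳ (piece ρ (par h) ++ A.side r) (B.side-∈ {i ∸ r}
                    (m<n⇒0<n∸m (≰⇒> i≰r)) (∸-monoˡ-≤ r i≤m)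
                    (trans (sym eq) (cong v (sym (m+[n∸m]≡n (<⇒≤ (≰⇒> i≰r)))))))

newTable : ℕ → Cmd
newTable z = set z (reg 5) ⨟ set 5 (op add (lit 1) (reg 5))

-- Attaches the table register 59, which describes what hangs below the vertex
-- in register 58, to the table of that vertex.
link : Cmd
link = newTable 20
     ⨟ set 33 (arr 11 (reg 58))
     ⨟ set 43 (reg 59)
     ⨟ store 10 (reg 20) (op add (arr 10 (reg 33)) (arr 10 (reg 43)))
     ⨟ glueInto
     ⨟ set 33 (reg 20)
     ⨟ newTable 20
     ⨟ store 10 (reg 20) (arr 10 (reg 33))
     ⨟ (copyInto ⨟ closeInto)
     ⨟ set 59 (reg 20)

module Tables {n : ℕ} (G : Graph n) (w : Fin n → ℕ) (l d : ℕ) (pw : Fin n → ℕ) where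
  open Buckets d
  open Hits d
  open Solutions G w l d pw
  open Labels G w l d public

  Partition : ℕ → Set
  Partition = LUPartition G w l (l + d)

  Fresh : State → Set
  Fresh s = ∀ t → regs s 5 ≤ t → ∀ k q m → arrs s 6 (key t k q m) ≡ 0

  Consts : State → Set
  Consts s = regs s 1 ≡ l × regs s 3 ≡ suc n × regs s 4 ≡ suc d

  -- Tables are never changed once they are complete.
  record Kept (s s′ : State) : Set where
    constructor keeps
    field
      count≤ : regs s 5 ≤ regs s′ 5
      old    : ∀ {t} → t < regs s 5 → SameTable (arrs s′) (arrs s) t × arrs s′ 10 t ≡ arrs s 10 t

  kept-eq : ∀ {s s′} → regs s 5 ≡ regs s′ 5 → arrs s′ ≡ arrs s → Kept s s′
  kept-eq {s} e refl = keeps (≤-reflexive e) λ _ → (λ _ _ _ → sameCell-refl {arrs s}) , refl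

  kept-trans : ∀ {s s′ s″} → Kept s s′ → Kept s′ s″ → Kept s s″
  kept-trans {s} {s′} {s″} (keeps le f) (keeps le′ f′) = keeps (≤-trans le le′) λ t< →
    let same , eq = f t< ; same′ , eq′ = f′ (<-≤-trans t< le)
    in (λ k q m → sameCell-trans {arrs s} {arrs s′} {arrs s″} (same′ k q m) (same k q m)) , trans eq′ eq

  Condition : Set₁
  Condition = ∀ {K} → Partition K → Set

  Completes : Arrs → ℕ → List (Fin n) → ∀ {K} → Partition K → Fin n → Set
  Completes A t U P g = ∃[ L ] Lab P U (label P g) L × Complete A t (length L) (excesses P L)

  record Table (s : State) (t : ℕ) (U : List (Fin n)) (Ok : List (Fin n) → Set)
               (Cond : Condition) (g : Fin n) : Set where
    field
      t<     : t < regs s 5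
      weight : arrs s 10 t ≡ total w U
      good   : Good (arrs s) t (Sol U Ok)
      compl  : ∀ {K} (P : Partition K) → Cond P → Completes (arrs s) t U P g

  table-same : ∀ {s s′ t U Ok} {Cond : Condition} {g} → regs s 5 ≤ regs s′ 5 →
    SameTable (arrs s′) (arrs s) t → arrs s′ 10 t ≡ arrs s 10 t → Table s t U Ok Cond g → Table s′ t U Ok Cond g
  table-same {s} {s′} le same eq tb = record
    { t< = <-≤-trans t< le
    ; weight = trans eq weight
    ; good = good-same same good
    ; compl = λ P c → let L , lab , cm = compl P c in L , lab , complete-same {arrs s} {arrs s′} same cm }
    where open Table tb

  table-kept : ∀ {s s′ t U Ok} {Cond : Condition} {g} → Kept s s′ → Table s t U Ok Cond g → Table s′ t U Ok Cond g
  table-kept (keeps le old) tb = table-same le (proj₁ (old (Table.t< tb))) (proj₂ (old (Table.t< tb))) tb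

  table-↭ : ∀ {s t U U′ Ok} {Cond : Condition} {g} → U ↭ U′ → Table s t U Ok Cond g → Table s t U′ Ok Cond g
  table-↭ {s} {t} {U} {U′} {Ok} p tb = record
    { t< = t<
    ; weight = trans weight (total-↭ w p)
    ; good = good-map (arrs s) t (sol-weaken p (λ z → z)) good
    ; compl = λ P c → let L , lab , cm = compl P c in L , lab-↭ P p lab , cm }
    where
    open Table tb
    good-map : ∀ A t → (∀ {k e o c δ} → Sol U Ok k e o c δ → Sol U′ Ok k e o c δ) →
      Good A t (Sol U Ok) → Good A t (Sol U′ Ok)
    good-map A t f good k q with good k q
    ... | inj₁ z = inj₁ z
    ... | inj₂ F = inj₂ record
      { min = proj₁ (Full.min F) , f (proj₂ (Full.min F))
      ; max = proj₁ (Full.max F) , f (proj₂ (Full.max F))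
      ; lo = Full.lo F ; mid = Full.mid F ; hi = Full.hi F }

  good-fresh : ∀ {A t} Φ → (∀ k q m → A 6 (key t k q m) ≡ 0) → Good A t Φ
  good-fresh Φ z k q = inj₁ (z k q 0 , z k q 1)

  unique-length : ∀ {K} {L : List (Fin K)} → Unique L → length L ≤ K
  unique-length {K} {L} u = ≤-trans
    (≤-reflexive (↭-length (unique-↭ u (Unique-filter⁺ (_∈ₗ? L) (allFin⁺ K))
      (λ p → ∈-filter⁺ (_∈ₗ? L) (∈-allFin _) p)
      (λ p → proj₂ (∈-filter⁻ (_∈ₗ? L) {xs = allFin K} p)))))
    (≤-trans (length-filter (_∈ₗ? L) (allFin K)) (≤-reflexive (length-tabulate _)))
    where open DecMembership _≟ᶠ_ using () renaming (_∈?_ to _∈ₗ?_)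

  clusters≤n : ∀ {K} → Partition K → K ≤ n
  clusters≤n P = injective⇒≤ {f = λ ℓ → proj₁ (LUPartition.nonempty P ℓ)}
    λ {ℓ} {ℓ′} eq → trans (sym (∈-label P (proj₂ (LUPartition.nonempty P ℓ))))
      (trans (cong (label P) eq) (∈-label P (proj₂ (LUPartition.nonempty P ℓ′))))

  lab-length : ∀ {K} (P : Partition K) {U g L} → Lab P U g L → length L < suc n
  lab-length P lab = s≤s (≤-trans (unique-length (Lab.unique lab)) (clusters≤n P))

  sol-bounded : ∀ U Ok → Bounded (Sol U Ok)
  sol-bounded U Ok = sol-bound

  module _ {U U′ : List (Fin n)} {Ok Ok′ Ok″ : List (Fin n) → Set} (join : ∀ {xs ys} → Ok xs → Ok′ ys → Ok″ (xs ++ ys))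
           (disj : ∀ {v} → v ∈ U → v ∈ U′ → ⊥) where

    wp-join : ∀ {P s} {Cond Cond′ : Condition} {g V} (let z = regs s 20) → Consts s →
      Table s (regs s 33) U Ok Cond g → Table s (regs s 43) U′ Ok′ Cond′ g →
      regs s 33 ≢ z → regs s 43 ≢ z → U ++ U′ ↭ V → Good (arrs s) z (Sol V Ok″) →
      (∀ s′ → Outside glueInto s s′ → Good (arrs s′) z (Sol V Ok″) → Grows z (arrs s) (arrs s′) →
        (∀ {K} (P : Partition K) → Cond P → Cond′ P → Completes (arrs s′) z V P g) → P s′) →
      wp glueInto P s
    wp-join {P} {s} {Cond} {Cond′} {g} {V} (_ , N , Δ) a b a≢ b≢ perm goodz end =
      wp-glueInto d (Sol U Ok) (Sol U′ Ok′) (Sol V Ok″) Δ a≢ b≢ A.good B.good goodz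
        (λ x y → sol-weaken perm (λ z → z) (sol-glue join x y))
        (λ s′ o good gr goals → end s′ o good gr λ Q c c′ →
          let L , lab , cm = A.compl Q c
              L′ , lab′ , cm′ = B.compl Q c′
          in L ++ L′ , lab-↭ Q perm (lab-glue Q disj lab lab′) ,
             subst₂ (Complete (arrs s′) (regs s 20)) (sym (length-++ L)) (sym (total-++ (excessOf Q) L L′))
               (complete-sum A.good (sol-bounded U Ok) B.good (sol-bounded U′ Ok′) goals
                 (subst (length L <_) (sym N) (lab-length Q lab))
                 (subst (length L′ <_) (sym N) (lab-length Q lab′)) cm cm′))
      where
      module A = Table a
      module B = Table b

  wp-lift : ∀ {P s} {Cond : Condition} {U y z} (let x = regs s 20) → Consts s →
    Table s (regs s 33) U (Rooted y) Cond y → regs s 33 ≢ x →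
    Unique U → Adj G z y → z ∉ U →
    (∀ {K} (Q : Partition K) → Cond Q → label Q y ≢ label Q z → ∀ {v} → label Q v ≡ label Q y → v ∈ U) →
    Good (arrs s) x (Sol U (Hangs z)) →
    (∀ s′ → Outside (copyInto ⨟ closeInto) s s′ → Good (arrs s′) x (Sol U (Hangs z)) → Grows x (arrs s) (arrs s′) →
      (∀ {K} (Q : Partition K) → Cond Q → Completes (arrs s′) x U Q z) → P s′) →
    wp (copyInto ⨟ closeInto) P s
  wp-lift {P} {s} {Cond} {U} {y} {z} (L≡ , N≡ , Δ) tb a≢x uU adj z∉ inside goodx end =
    wp-map {P = λ s′ → Good (arrs s′) x (Sol U (Hangs z)) × Grows x (arrs s) (arrs s′)
                × (∀ {K} (Q : Partition K) → Cond Q → Completes (arrs s′) x U Q z)}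
      (λ s′ o (good , gr , comp) → end s′ o good gr comp)
    (wp-seq (wp-copyInto d (Sol U (Rooted y)) (Sol U (Hangs z)) Δ a≢x T.good goodx
      (sol-weaken ↭-refl (λ r → inj₂ (y , adj , r)))
      λ s₁ (o , oa) good₁ gr₁ copied →
        wp-closeInto d (Sol U (Rooted y)) (Sol U (Hangs z)) (trans (o 4 tt) Δ)
          (subst₂ _≢_ (sym (o 33 tt)) (sym (o 20 tt)) a≢x)
          (subst (λ t → Good (arrs s₁) t (Sol U (Rooted y))) (sym (o 33 tt)) (good-same (proj₁ gr₁ a≢x) T.good))
          (subst (λ t → Good (arrs s₁) t (Sol U (Hangs z))) (sym (o 20 tt)) good₁)
          (λ {k} {e′ = e′} sol W≡ le le′ → sol-weaken ↭-refl inj₁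
            (sol-close (λ r → y , r) sol
              (trans (trans (sym T.weight) (sym (weight≡ s₁ o oa))) (trans W≡ (cong (λ l → suc k * l + e′) (trans (o 1 tt) L≡)))) le le′))
          (λ s₂ (o₂ , _) good₂ gr₂ closed →
            subst (λ t → Good (arrs s₂) t (Sol U (Hangs z))) (o 20 tt) good₂ ,
            grows-trans {x} {arrs s} {arrs s₁} {arrs s₂} gr₁ (subst (λ t → Grows t (arrs s₁) (arrs s₂)) (o 20 tt) gr₂) ,
            λ {K} Q c → lifted Q c s₁ s₂ o oa good₁ gr₁ copied
              (subst (λ t → Grows t (arrs s₁) (arrs s₂)) (o 20 tt) gr₂)
              (λ k q m e e′ k< q< m< eq W≡ le le′ →
                subst (λ t → ∃[ q′ ] Span (arrs s₂) t (suc k) q′ e′) (o 20 tt)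
                  (closed k q m e e′ (subst (k <_) (sym (o 3 tt)) k<) (subst (q <_) (sym (o 3 tt)) q<) m<
                    (trans (cong (λ t → arrs s₁ 6 (key t k q m)) (o 33 tt)) (trans (proj₁ (proj₁ gr₁ a≢x k q m)) eq))
                    (trans (weight≡ s₁ o oa) (trans W≡ (cong (λ l → suc k * l + e′) (sym (o 1 tt))))) le le′)))))
    where
    module T = Table tb
    x : ℕ
    x = regs s 20
    weight≡ : ∀ s₁ → (∀ x → T (keepsReg x copyInto) → regs s₁ x ≡ regs s x) →
      (∀ a → T (keepsArr a copyInto) → arrs s₁ a ≡ arrs s a) → arrs s₁ 10 (regs s₁ 33) ≡ arrs s 10 (regs s 33)
    weight≡ s₁ o oa = trans (cong (λ f → f (regs s₁ 33)) (oa 10 tt)) (cong (arrs s 10) (o 33 tt))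
    lifted : ∀ {K} (Q : Partition K) → Cond Q → ∀ s₁ s₂ →
      (∀ x → T (keepsReg x copyInto) → regs s₁ x ≡ regs s x) →
      (∀ a → T (keepsArr a copyInto) → arrs s₁ a ≡ arrs s a) →
      Good (arrs s₁) x (Sol U (Hangs z)) → Grows x (arrs s) (arrs s₁) →
      (∀ k q m e → k < regs s 3 → q < regs s 3 → m < 2 → arrs s 6 (key (regs s 33) k q m) ≡ suc e →
        ∃[ q′ ] Span (arrs s₁) x k q′ e) →
      Grows x (arrs s₁) (arrs s₂) →
      (∀ k q m e e′ → k < regs s 3 → q < regs s 3 → m < 2 → arrs s 6 (key (regs s 33) k q m) ≡ suc e →
        arrs s 10 (regs s 33) ≡ suc k * regs s 1 + e′ → e ≤ e′ → e′ ≤ e + d →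
        ∃[ q′ ] Span (arrs s₂) x (suc k) q′ e′) →
      Completes (arrs s₂) x U Q z
    lifted Q c s₁ s₂ o oa good₁ gr₁ copied gr₂ closed with T.compl Q c | label Q y ≟ᶠ label Q z
    ... | L , lab , cm | yes eq = L , subst (λ g → Lab Q U g L) eq lab ,
      complete-grows {arrs s₁} {arrs s₂} gr₂
        (complete-copy T.good (sol-bounded U (Rooted y)) copied
          (subst (length L <_) (sym N≡) (lab-length Q lab)) cm)
    ... | L , lab , cm | no ne = label Q y ∷ L , lab-close Q lab (inside Q c ne) z∉ ,
      complete-close T.good (sol-bounded U (Rooted y)) closed
        (subst (length L <_) (sym N≡) (lab-length Q lab))
        (trans T.weight (trans (weight-split Q uU lab (inside Q c ne))
          (cong (λ l → suc (length L) * l + (excessOf Q (label Q y) + excesses Q L)) (sym L≡))))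
        (m≤n+m (excesses Q L) (excessOf Q (label Q y)) ,
         ≤-trans (+-monoˡ-≤ (excesses Q L) (excess≤d Q (label Q y))) (≤-reflexive (+-comm d (excesses Q L))))
        cm

  wp-new : ∀ {z c P s} → wp c P (writeReg 5 (suc (regs (writeReg z (regs s 5) s) 5)) (writeReg z (regs s 5) s)) →
    wp (newTable z ⨟ c) P s
  wp-new p = wp-seq (wp-set⨟ (wp-set p))

  kept-write : ∀ {s s₁ s₂ z v} → Kept s s₁ → regs s₁ 5 ≤ regs s₂ 5 → regs s 5 ≤ z →
    arrs s₂ ≡ update (arrs s₁) 10 (update (arrs s₁ 10) z v) → Kept s s₂
  kept-write {s} {s₁} {s₂} {z} {v} (keeps le old) le′ z≥ refl = keeps (≤-trans le le′) λ t< →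
    proj₁ (old t<) ,
    trans (update-other (arrs s₁ 10) z v (λ z≡ → <⇒≱ t< (subst (regs s 5 ≤_) z≡ z≥))) (proj₂ (old t<))

  kept-store : ∀ {s s′ z v} → regs s 5 ≤ regs s′ 5 → regs s 5 ≤ z →
    arrs s′ ≡ update (arrs s) 10 (update (arrs s 10) z v) → Kept s s′
  kept-store {s} {v = v} = kept-write {v = v} (kept-eq {s} {s} refl refl)

  kept-grows : ∀ {s s₁ s₂ z} → Kept s s₁ → regs s 5 ≤ z → Grows z (arrs s₁) (arrs s₂) →
    regs s₂ 5 ≡ regs s₁ 5 → arrs s₂ 10 ≡ arrs s₁ 10 → Kept s s₂
  kept-grows {s} {s₁} {s₂} (keeps le f) z≥ gr e₅ e₁₀ = keeps (subst (regs s 5 ≤_) (sym e₅) le) λ {t} t< →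
    let same , eq = f t<
    in (λ k q m → sameCell-trans {arrs s} {arrs s₁} {arrs s₂}
         (proj₁ gr (λ t≡ → <⇒≱ t< (subst (regs s 5 ≤_) (sym t≡) z≥)) k q m) (same k q m)) ,
       trans (cong (λ g → g t) e₁₀) eq

  wp-link : ∀ {P s} {Cond : Condition} {y z U U′} → Consts s → Fresh s →
    Table s (arrs s 11 (regs s 58)) U (Rooted y) (λ _ → Unit) y →
    Table s (regs s 59) U′ (Hangs y) Cond y →
    (∀ {v} → v ∈ U → v ∈ U′ → ⊥) → Unique (U ++ U′) → Adj G z y → z ∉ U ++ U′ →
    (∀ {K} (Q : Partition K) → Cond Q → label Q y ≢ label Q z → ∀ {v} → label Q v ≡ label Q y → v ∈ U ++ U′) →
    (∀ s′ → Outside link s s′ → Fresh s′ → Kept s s′ → regs s 5 ≤ regs s′ 59 →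
      Table s′ (regs s′ 59) (U ++ U′) (Hangs z) Cond z → P s′) →
    wp link P s
  wp-link {P} {s} {Cond} {y} {z} {U} {U′} consts@(c1 , c3 , c4) fresh a b disj u adj z∉ inside end =
    wp-map {P = λ s′ → Fresh s′ × Kept s s′ × regs s 5 ≤ regs s′ 59 × Table s′ (regs s′ 59) (U ++ U′) (Hangs z) Cond z}
      (λ { s′ o (fr , kept , le , tb) → end s′ o fr kept le tb })
      (wp-new $ wp-set⨟ $ wp-set⨟ $ wp-store⨟ $ wp-seq $
        wp-join rooted-hang disj {s = s₁} {Cond = λ _ → Unit} {Cond′ = Cond} {g = y} {V = U ++ U′}
          (c1 , c3 , c4) (table-kept k₁ a) (table-kept k₁ b)
          (<⇒≢ (Table.t< a)) (<⇒≢ (Table.t< b)) ↭-refl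
          (good-fresh (Sol (U ++ U′) (Rooted y)) (fresh _ ≤-refl))
          λ s₂ (o₂ , oa₂) good₂ gr₂ comp₂ →
            let k₂ : Kept s s₂
                k₂ = kept-grows k₁ ≤-refl gr₂ (o₂ 5 tt) (oa₂ 10 tt)
                w₂ : arrs s₂ 10 t₁ ≡ total w (U ++ U′)
                w₂ = trans (cong (λ g → g t₁) (oa₂ 10 tt))
                  (trans (update-same (arrs s 10) t₁ _)
                    (trans (cong₂ _+_ (Table.weight a) (Table.weight b)) (sym (total-++ w U U′))))
                tb₂ : Table s₂ t₁ (U ++ U′) (Rooted y) Cond y
                tb₂ = record { t< = subst (t₁ <_) (sym (o₂ 5 tt)) (n<1+n t₁) ; weight = w₂ ; good = good₂
                             ; compl = λ Q c → comp₂ Q tt c }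
                fr₂ : Fresh s₂
                fr₂ t t≥ k q m = trans (proj₁ (proj₁ gr₂ (λ t≡ → <⇒≢ (subst (_≤ t) (o₂ 5 tt) t≥) (sym t≡)) k q m))
                  (fresh t (<⇒≤ (subst (_≤ t) (o₂ 5 tt) t≥)) k q m)
            in wp-set⨟ $ wp-new $ wp-store⨟ $ wp-seq $
               second s₂ (trans (o₂ 20 tt) refl) (trans (o₂ 1 tt) c1 , trans (o₂ 3 tt) c3 , trans (o₂ 4 tt) c4) fr₂ k₂ tb₂)
    where
    t₁ : ℕ
    t₁ = regs s 5
    s₁ : State
    s₁ = writeArr 10 t₁ (arrs s 10 (arrs s 11 (regs s 58)) + arrs s 10 (regs s 59))
      (writeReg 43 (regs s 59) (writeReg 33 (arrs s 11 (regs s 58)) (writeReg 5 (suc t₁) (writeReg 20 t₁ s))))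
    k₁ : Kept s s₁
    k₁ = kept-store {v = arrs s 10 (arrs s 11 (regs s 58)) + arrs s 10 (regs s 59)} (n≤1+n t₁) ≤-refl refl
    second : ∀ s₂ → regs s₂ 20 ≡ t₁ → Consts s₂ → Fresh s₂ → Kept s s₂ → Table s₂ t₁ (U ++ U′) (Rooted y) Cond y →
      let t₂ = regs s₂ 5
          s₃ = writeReg 5 (suc t₂) (writeReg 20 t₂ (writeReg 33 (regs s₂ 20) s₂))
      in wp (copyInto ⨟ closeInto) (wp (set 59 (reg 20)) (λ s′ → Fresh s′ × Kept s s′ × regs s 5 ≤ regs s′ 59 × Table s′ (regs s′ 59) (U ++ U′) (Hangs z) Cond z))
           (writeArr 10 t₂ (arrs s₂ 10 (regs s₂ 20)) s₃)
    second s₂ eq consts₂ fr₂ k₂ tb₂ =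
      wp-lift {s = s₃} {Cond = Cond} {U = U ++ U′} {y = y} {z = z} consts₂
        (subst (λ t → Table s₃ t (U ++ U′) (Rooted y) Cond y) (sym eq) (table-kept k₃ tb₂))
        (subst (_≢ t₂) (sym eq) (<⇒≢ (Table.t< tb₂))) u adj z∉ inside
        (good-fresh (Sol (U ++ U′) (Hangs z)) (fr₂ _ ≤-refl))
        λ s₄ (o₄ , oa₄) good₄ gr₄ comp₄ → wp-set
          ( (λ t t≥ k q m → trans (proj₁ (proj₁ gr₄ (λ t≡ → <⇒≢ (subst (_≤ t) (o₄ 5 tt) t≥) (sym t≡)) k q m))
               (fr₂ t (<⇒≤ (subst (_≤ t) (o₄ 5 tt) t≥)) k q m))
          , kept-trans k₂ (kept-grows k₃ ≤-refl gr₄ (o₄ 5 tt) (oa₄ 10 tt))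
          , subst (regs s 5 ≤_) (sym (o₄ 20 tt)) (Kept.count≤ k₂)
          , subst (λ t → Table (writeReg 59 (regs s₄ 20) s₄) t (U ++ U′) (Hangs z) Cond z) (sym (o₄ 20 tt)) record
              { t< = subst (t₂ <_) (sym (o₄ 5 tt)) (n<1+n t₂)
              ; weight = trans (cong (λ g → g t₂) (oa₄ 10 tt))
                  (trans (update-same (arrs s₂ 10) t₂ _) (trans (cong (arrs s₂ 10) eq) (Table.weight tb₂)))
              ; good = good₄
              ; compl = λ Q c → comp₄ Q c } )
      where
      t₂ : ℕ
      t₂ = regs s₂ 5
      s₃ : State
      s₃ = writeArr 10 t₂ (arrs s₂ 10 (regs s₂ 20)) (writeReg 5 (suc t₂) (writeReg 20 t₂ (writeReg 33 (regs s₂ 20) s₂)))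
      k₃ : Kept s₂ s₃
      k₃ = kept-store {v = arrs s₂ 10 (regs s₂ 20)} (n≤1+n t₂) ≤-refl refl

chain : Expr → Expr → Cmd
chain idx count = for 57 count (set 58 (arr 13 idx) ⨟ link)

sideACmd sideBCmd joinSides removalBody buildStep buildEar earBody : Cmd
sideACmd = chain (op add (lit 1) (reg 57)) (reg 56)
sideBCmd = chain (op sub (reg 54) (reg 57)) (op sub (reg 54) (reg 56))
joinSides =
    newTable 61
  ⨟ set 20 (reg 61)
  ⨟ set 33 (arr 11 (arr 13 (lit 0)))
  ⨟ set 43 (reg 60)
  ⨟ store 10 (reg 20) (op add (arr 10 (reg 33)) (arr 10 (reg 43)))
  ⨟ glueInto
  ⨟ set 20 (reg 62)
  ⨟ set 33 (reg 61)
  ⨟ set 43 (reg 59)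
  ⨟ store 10 (reg 20) (op add (arr 10 (reg 33)) (arr 10 (reg 43)))
  ⨟ glueInto
removalBody =
    set 59 (reg 64)
  ⨟ sideACmd
  ⨟ set 60 (reg 59)
  ⨟ set 59 (reg 64)
  ⨟ sideBCmd
  ⨟ joinSides
onEarE : Expr
onEarE = op equ (arr 5 (reg 53)) (reg 52)
buildStep = set 54 (op add (lit 1) (reg 54)) ⨟ store 13 (reg 54) (reg 53) ⨟ set 53 (arr 4 (reg 53))
buildEar =
    set 52 (arr 5 (reg 50))
  ⨟ set 53 (reg 52)
  ⨟ set 54 (lit 0)
  ⨟ store 13 (lit 0) (arr 4 (reg 50))
  ⨟ for 55 (reg 0) (when onEarE buildStep)
  ⨟ store 13 (op add (lit 1) (reg 54)) (reg 53)
earBody =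
    buildEar
  ⨟ newTable 62
  ⨟ for 56 (op add (lit 1) (reg 54)) removalBody
  ⨟ store 11 (arr 13 (lit 0)) (reg 62)

module EarStep {n : ℕ} .{{_ : NonZero n}} (G : Graph n) (w : Fin n → ℕ) (l d : ℕ) (pw : Fin n → ℕ)
              {ord vis par bot : ℕ → ℕ}
              (preorder : DepthFirst.Dfs n (Input.adjacency G w) n ord vis par)
              (tree : EarTree n (λ a b → DepthFirst.E n (Input.adjacency G w) (ord a) (ord b)) par bot) where

  open Buckets d
  open Hits d
  open Solutions G w l d pw
  open Tables G w l d pw
  open Input G w using (module Indexed)
  open Indexed preorder using (vtx; edge-adj)
  open EarTree tree
  open Stages G w preorder tree

  Always : Condition
  Always _ = Unit

  VertexTables : State → ℕ → (Fin n → ℕ) → Set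
  VertexTables s i ρ = ∀ y → y < n → Live i y →
    Table s (arrs s 11 y) (piece ρ y) (Rooted (vtx y)) Always (vtx y)

  UnitTable : State → ℕ → Set
  UnitTable s t = t < regs s 5 × arrs s 10 t ≡ 0 × Good (arrs s) t (Sol [] (_≡ [])) × Complete (arrs s) t 0 0

  unit-kept : ∀ {s s′ t} → Kept s s′ → UnitTable s t → UnitTable s′ t
  unit-kept {s} {s′} (keeps le old) (t< , w0 , good , cm) =
    <-≤-trans t< le , trans (proj₂ (old t<)) w0 , good-same (proj₁ (old t<)) good ,
    complete-same {arrs s} {arrs s′} (proj₁ (old t<)) cm

  unit-table : ∀ {s t z} {Cond : Condition} → UnitTable s t → Table s t [] (Hangs z) Cond z
  unit-table {s} {t} {z} (t< , w0 , good , cm) = record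
    { t< = t< ; weight = w0
    ; good = λ k q → case good k q of λ
        { (inj₁ e) → inj₁ e
        ; (inj₂ F) → inj₂ record
            { min = proj₁ (Full.min F) , sol-weaken ↭-refl inj₁ (proj₂ (Full.min F))
            ; max = proj₁ (Full.max F) , sol-weaken ↭-refl inj₁ (proj₂ (Full.max F))
            ; lo = Full.lo F ; mid = Full.mid F ; hi = Full.hi F } }
    ; compl = λ P _ → [] , lab-empty P _ , cm }

  vertexTables-kept : ∀ {s s′ i ρ} → Kept s s′ → arrs s′ 11 ≡ arrs s 11 → VertexTables s i ρ → VertexTables s′ i ρ
  vertexTables-kept {s} {s′} {i} {ρ} kept e₁₁ tabs y y<n lv =
    subst (λ t → Table s′ t (piece ρ y) (Rooted (vtx y)) Always (vtx y)) (cong (λ f → f y) (sym e₁₁))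
      (table-kept kept (tabs y y<n lv))

  wp-joinSides : ∀ {P s s₀ U UA UB V g} {CA CB : Condition} {z} (let a = arrs s 11 (arrs s 13 0)) →
    regs s 62 ≡ z → Consts s → Fresh s → Kept s₀ s → regs s₀ 5 ≤ z → z < regs s 5 →
    Table s a U (Rooted g) Always g → a ≢ z →
    Table s (regs s 60) UA (Hangs g) CA g → Table s (regs s 59) UB (Hangs g) CB g → regs s 59 ≢ z →
    (∀ {v} → v ∈ U → v ∈ UA → ⊥) → (∀ {v} → v ∈ U ++ UA → v ∈ UB → ⊥) → (U ++ UA) ++ UB ↭ V →
    Good (arrs s) z (Sol V (Rooted g)) →
    (∀ s′ → Fresh s′ → Kept s₀ s′ → z < regs s′ 5 → Good (arrs s′) z (Sol V (Rooted g)) →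
      (∀ k q e → Span (arrs s) z k q e → Span (arrs s′) z k q e) → arrs s′ 10 z ≡ total w V →
      (∀ {K} (Q : Partition K) → CA Q → CB Q → Completes (arrs s′) z V Q g) → P s′) →
    wp joinSides P s
  wp-joinSides {P} {s} {s₀} {U} {UA} {UB} {V} {g} {CA} {CB} refl (c1 , c3 , c4) fresh kept z≥ z< ta a≢z tA tB B≢z disj disj′ perm goodz end =
    wp-new $ wp-set⨟ $ wp-set⨟ $ wp-set⨟ $ wp-store⨟ $ wp-seq $
      wp-join rooted-hang disj {s = s₁} {Cond = Always} {Cond′ = CA} {g = g} {V = U ++ UA}
        (c1 , c3 , c4) (table-kept k₁ ta) (table-kept k₁ tA) (<⇒≢ (Table.t< ta)) (<⇒≢ (Table.t< tA)) ↭-refl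
        (good-fresh (Sol (U ++ UA) (Rooted g)) (fresh _ ≤-refl))
        λ s₂ (o , oa) good₂ gr₂ comp₂ →
          let k₂ : Kept s s₂
              k₂ = kept-grows k₁ ≤-refl gr₂ (o 5 tt) (oa 10 tt)
              tb₂ : Table s₂ t₁ (U ++ UA) (Rooted g) CA g
              tb₂ = record
                { t< = subst (t₁ <_) (sym (o 5 tt)) (n<1+n t₁)
                ; weight = trans (cong (λ g → g t₁) (oa 10 tt)) (trans (update-same (arrs s 10) t₁ _)
                    (trans (cong₂ _+_ (Table.weight ta) (Table.weight tA)) (sym (total-++ w U UA))))
                ; good = good₂ ; compl = λ Q c → comp₂ Q tt c }
          in wp-set⨟ $ wp-set⨟ $ wp-set⨟ $ wp-store⨟ $
             second s₂ (o 62 tt) (o 61 tt) (o 59 tt) (trans (o 1 tt) c1 , trans (o 3 tt) c3 , trans (o 4 tt) c4)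
               (λ t t≥ k q m → trans (proj₁ (proj₁ gr₂ (λ t≡ → <⇒≢ (subst (_≤ t) (o 5 tt) t≥) (sym t≡)) k q m))
                  (fresh t (<⇒≤ (subst (_≤ t) (o 5 tt) t≥)) k q m))
               k₂ tb₂ (proj₁ gr₂ (<⇒≢ z<))
    where
    z : ℕ
    z = regs s 62
    a : ℕ
    a = arrs s 11 (arrs s 13 0)
    t₁ : ℕ
    t₁ = regs s 5
    s₁ : State
    s₁ = writeArr 10 t₁ (arrs s 10 a + arrs s 10 (regs s 60))
      (writeReg 43 (regs s 60) (writeReg 33 a (writeReg 20 t₁ (writeReg 5 (suc t₁) (writeReg 61 t₁ s)))))
    k₁ : Kept s s₁
    k₁ = kept-store {v = arrs s 10 a + arrs s 10 (regs s 60)} (n≤1+n t₁) ≤-refl refl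
    second : ∀ s₂ → regs s₂ 62 ≡ z → regs s₂ 61 ≡ t₁ → regs s₂ 59 ≡ regs s 59 → Consts s₂ → Fresh s₂ → Kept s s₂ →
      Table s₂ t₁ (U ++ UA) (Rooted g) CA g → SameTable (arrs s₂) (arrs s) z →
      wp glueInto P
        (writeArr 10 (regs s₂ 62) (arrs s₂ 10 (regs s₂ 61) + arrs s₂ 10 (regs s₂ 59))
          (writeReg 43 (regs s₂ 59) (writeReg 33 (regs s₂ 61) (writeReg 20 (regs s₂ 62) s₂))))
    second s₂ e₆₂ e₆₁ e₅₉ consts₂ fr₂ k₂ tb₂ same-z =
      wp-join rooted-hang disj′ {s = s₃} {Cond = CA} {Cond′ = CB} {g = g} {V = V} consts₂
        (subst (λ t → Table s₃ t (U ++ UA) (Rooted g) CA g) (sym e₆₁) (to-s₃ (λ eq → <⇒≢ z< (sym eq)) tb₂))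
        (subst (λ t → Table s₃ t UB (Hangs g) CB g) (sym e₅₉) (to-s₃ B≢z (table-kept k₂ tB)))
        (subst₂ _≢_ (sym e₆₁) (sym e₆₂) (λ eq → <⇒≢ z< (sym eq)))
        (subst₂ _≢_ (sym e₅₉) (sym e₆₂) B≢z) perm
        (subst (λ t → Good (arrs s₃) t (Sol V (Rooted g))) (sym e₆₂)
          (good-same {arrs s} {arrs s₃} (λ k q m → same-z k q m) goodz))
        λ s₄ (o , oa) good₄ gr₄ comp₄ →
          let gr : Grows z (arrs s₂) (arrs s₄)
              gr = subst (λ t → Grows t (arrs s₂) (arrs s₄)) e₆₂ gr₄
              z<₄ : z < regs s₄ 5
              z<₄ = subst (z <_) (sym (o 5 tt)) (<-≤-trans z< (Kept.count≤ k₂))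
          in end s₄
            (λ t t≥ k q m → let t≥₂ = subst (_≤ t) (o 5 tt) t≥ in
               trans (proj₁ (proj₁ gr (λ t≡ → <⇒≢ (<-≤-trans z< (≤-trans (Kept.count≤ k₂) t≥₂)) (sym t≡)) k q m)) (fr₂ t t≥₂ k q m))
            (kept-grows {s₁ = s₃} (kept-write {s₁ = s₂} {s₂ = s₃} {v = v₂} (kept-trans kept k₂) ≤-refl (subst (regs s₀ 5 ≤_) (sym e₆₂) z≥) refl) z≥ gr (o 5 tt) (oa 10 tt))
            z<₄
            (subst (λ t → Good (arrs s₄) t (Sol V (Rooted g))) e₆₂ good₄)
            (λ k q e sp → proj₂ gr k q e (span-same {arrs s} {arrs s₂} {z} {k} {q} {e} same-z sp))
            (trans (cong (λ f → f z) (oa 10 tt)) (trans (cong (λ t → arrs s₃ 10 t) (sym e₆₂))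
              (trans (update-same (arrs s₂ 10) (regs s₂ 62) v₂)
                (trans (cong₂ _+_ (trans (cong (arrs s₂ 10) e₆₁) (Table.weight tb₂))
                                  (trans (cong (arrs s₂ 10) e₅₉) (Table.weight (table-kept k₂ tB))))
                  (trans (sym (total-++ w (U ++ UA) UB)) (total-↭ w perm))))))
            (λ Q cA cB → subst (λ t → Completes (arrs s₄) t V Q g) e₆₂ (comp₄ Q cA cB))
      where
      v₂ : ℕ
      v₂ = arrs s₂ 10 (regs s₂ 61) + arrs s₂ 10 (regs s₂ 59)
      s₃ : State
      s₃ = writeArr 10 (regs s₂ 62) v₂ (writeReg 43 (regs s₂ 59) (writeReg 33 (regs s₂ 61) (writeReg 20 (regs s₂ 62) s₂)))
      to-s₃ : ∀ {t U Ok} {Cond : Condition} → t ≢ z → Table s₂ t U Ok Cond g → Table s₃ t U Ok Cond g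
      to-s₃ {t} t≢z = table-same ≤-refl (λ _ _ _ → sameCell-refl {arrs s₂})
        (update-other (arrs s₂ 10) (regs s₂ 62) v₂ (λ eq → t≢z (trans (sym eq) e₆₂)))

  module Ears {h m : ℕ} {v : ℕ → ℕ} {ρ : Fin n → ℕ} (ear : Ear h m v) (st : Stage (suc h) ρ) where
    open Contract ear st

    CutAt : ℕ → (ℕ → ℕ) → Condition
    CutAt τ c Q = label Q (vtx (c 0)) ≢ label Q (vtx (c 1))
                ⊎ (∀ i → i ≤ suc τ → label Q (vtx (c i)) ≡ label Q (vtx (c 0)))

    wp-chain : ∀ {idx count P s τ c} (sd : Side τ c) (let open Side sd hiding (link)) →
      ⟦ count ⟧ s ≡ τ →
      (∀ j i s′ → j + suc i ≡ τ → Outside (chain idx count) s s′ → arrs s 13 (⟦ idx ⟧ (writeReg 57 i s′)) ≡ c (suc j)) →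
      Consts s → Fresh s → VertexTables s (suc h) ρ →
      Table s (regs s 59) [] (Hangs (vtx (c 1))) (CutAt τ c) (vtx (c 1)) → ∀ {z} → z < regs s 5 → regs s 59 ≢ z →
      (∀ s′ → Outside (chain idx count) s s′ → Fresh s′ → Kept s s′ → regs s′ 59 ≢ z →
        Table s′ (regs s′ 59) (side τ) (Hangs (vtx (c (suc τ)))) (CutAt τ c) (vtx (c (suc τ))) → P s′) →
      wp (chain idx count) P s
    wp-chain {idx} {count} {P} {s} {τ} {c} sd count≡ idx≡ (c1 , c3 , c4) fresh tabs start {z} z< z≢ end =
      wp-forUp Linked
        (fresh , kept-eq refl refl , z≢ , table-kept (kept-eq refl refl) start)
        (λ j i s′ eq o inv → pass j i s′ (trans eq count≡) o inv)
        λ s′ o (fr , kept , ne , tb) → end s′ o fr kept ne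
          (subst (λ j → Table s′ (regs s′ 59) (side j) (Hangs (vtx (c (suc j)))) (CutAt τ c) (vtx (c (suc j)))) count≡ tb)
      where
      open Side sd hiding (link)
      Linked : ℕ → State → Set
      Linked j s′ = Fresh s′ × Kept s s′ × regs s′ 59 ≢ z ×
        Table s′ (regs s′ 59) (side j) (Hangs (vtx (c (suc j)))) (CutAt τ c) (vtx (c (suc j)))
      pass : ∀ j i s′ → j + suc i ≡ τ → Outside (chain idx count) s s′ → Linked j s′ →
        wp (set 58 (arr 13 idx) ⨟ link) (Linked (suc j)) (writeReg 57 i s′)
      pass j i s′ eq o@(or , oa) (fr , kept , ne , tb) = wp-set⨟ $
        wp-link {s = s₁} {Cond = CutAt τ c} {y = y} {z = vtx (c (suc (suc j)))}
          (trans (or 1 tt) c1 , trans (or 3 tt) c3 , trans (or 4 tt) c4) fr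
          (subst (λ t → Table s₁ t (piece ρ (c (suc j))) (Rooted y) Always y)
            (trans (cong (arrs s 11) (sym val≡)) (cong (λ f → f val) (sym (oa 11 tt))))
            (table-kept (kept-trans kept (kept-eq refl refl))
              (tabs (c (suc j)) (c-bound (s≤s z≤n) (m≤n⇒m≤1+n j<τ)) (c-live (s≤s z≤n) (m≤n⇒m≤1+n j<τ)))))
          (table-kept (kept-eq refl refl) tb)
          (λ p q → next∉ (<⇒≤ j<τ) (piece-∈ p) q)
          (side-unique j<τ)
          (edge-adj (c-bound (s≤s z≤n) (s≤s j<τ)) (c-bound (s≤s z≤n) (m≤n⇒m≤1+n j<τ)) (Side.link sd (s≤s z≤n) j<τ))
          (next∉ j<τ (root-c (s≤s z≤n) (s≤s j<τ)))
          (λ Q cut diff same → Cut.cluster-inside Q sd cut (s≤s z≤n) j<τ diff same)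
          λ s″ o″ fr″ kept″ le tb″ → fr″ , kept-trans kept (kept-trans (kept-eq refl refl) kept″) ,
            (λ eq → <⇒≱ z< (≤-trans (Kept.count≤ kept) (subst (regs s′ 5 ≤_) eq le))) , tb″
        where
        j<τ : suc j ≤ τ
        j<τ = subst (suc j ≤_) (trans (sym (+-suc j i)) eq) (s≤s (m≤m+n j i))
        y : Fin n
        y = vtx (c (suc j))
        val : ℕ
        val = arrs s′ 13 (⟦ idx ⟧ (writeReg 57 i s′))
        s₁ : State
        s₁ = writeReg 58 val (writeReg 57 i s′)
        val≡ : val ≡ c (suc j)
        val≡ = trans (cong (λ f → f (⟦ idx ⟧ (writeReg 57 i s′))) (oa 13 tt)) (idx≡ j i s′ eq o)

    top : Fin n
    top = vtx (par h)

    module Removal {r : ℕ} (r≤m : r ≤ m) where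
      open TwoSides r≤m

      cutA : ∀ {K} (Q : Partition K) → Cut.Removable Q r → CutAt r (λ j → v (suc r ∸ j)) Q
      cutA Q (inj₁ ne)   = inj₁ (ne ∘ sym)
      cutA Q (inj₂ same) = inj₂ λ i i≤ →
        trans (same _ (≤-trans (m∸n≤m (suc r) i) (s≤s r≤m))) (sym (same (suc r) (s≤s r≤m)))

      cutB : ∀ {K} (Q : Partition K) → Cut.Removable Q r → CutAt (m ∸ r) (λ j → v (r + j)) Q
      cutB Q (inj₁ ne)   = inj₁ (subst₂ (λ i j → label Q (vtx (v i)) ≢ label Q (vtx (v j)))
        (sym (+-identityʳ r)) (sym (trans (+-suc r 0) (cong suc (+-identityʳ r)))) ne)
      cutB Q (inj₂ same) = inj₂ λ i i≤ →
        trans (same _ (≤-trans (+-monoʳ-≤ r i≤) (≤-reflexive (trans (+-suc r (m ∸ r)) (cong suc (m+[n∸m]≡n r≤m))))))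
          (sym (same _ (≤-trans (≤-reflexive (+-identityʳ r)) (m≤n⇒m≤1+n r≤m))))

      wp-removal : ∀ {P s s₀ z} → regs s 62 ≡ z →
        regs s 56 ≡ r → regs s 54 ≡ m → arrs s 13 ≡ v → Consts s → Fresh s → Kept s₀ s → regs s₀ 5 ≤ z → z < regs s 5 →
        UnitTable s (regs s 64) → regs s 64 ≢ z → VertexTables s (suc h) ρ → arrs s 11 (par h) ≢ z →
        Good (arrs s) z (Sol (piece ρ′ (par h)) (Rooted top)) →
        (∀ s′ → Fresh s′ → Kept s₀ s′ → z < regs s′ 5 → Good (arrs s′) z (Sol (piece ρ′ (par h)) (Rooted top)) →
          (∀ k q e → Span (arrs s) z k q e → Span (arrs s′) z k q e) → arrs s′ 10 z ≡ total w (piece ρ′ (par h)) →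
          (∀ {K} (Q : Partition K) → Cut.Removable Q r → Completes (arrs s′) z (piece ρ′ (par h)) Q top) → P s′) →
        wp removalBody P s
      wp-removal {P} {s} {s₀} refl e₅₆ e₅₄ e₁₃ (c1 , c3 , c4) fresh kept z≥ z< unit unit≢ tabs top≢ goodz end =
        wp-set⨟ $ wp-seq $
        wp-chain {s = writeReg 59 (regs s 64) s} (sideA r≤m) e₅₆
          (λ j i s′ eq _ → trans (cong (λ f → f (suc i)) e₁₃)
             (cong v (sym (trans (cong (_∸ j) (sym eq)) (m+n∸m≡n j (suc i))))))
          (c1 , c3 , c4) fresh
          (vertexTables-kept {i = suc h} {ρ = ρ} (kept-eq refl refl) refl tabs)
          (unit-table (unit-kept {s} {writeReg 59 (regs s 64) s} (kept-eq refl refl) unit)) {z = z} z< unit≢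
          λ s₂ (o₂ , oa₂) fr₂ k₂ ne₂ tA →
            let s₃ : State
                s₃ = writeReg 59 (regs s₂ 64) (writeReg 60 (regs s₂ 59) s₂)
                k₃ : Kept s s₃
                k₃ = kept-trans (kept-trans (kept-eq refl refl) k₂) (kept-eq refl refl)
            in wp-set⨟ $ wp-set⨟ $ wp-seq $
            wp-chain {s = s₃} (sideB r≤m) (cong₂ _∸_ (trans (o₂ 54 tt) e₅₄) (trans (o₂ 56 tt) e₅₆))
              (λ j i s′ eq (o′ , _) → trans (cong₂ (λ f x → f (x ∸ i)) (trans (oa₂ 13 tt) e₁₃)
                   (trans (o′ 54 tt) (trans (o₂ 54 tt) e₅₄)))
                 (cong v (position i j eq)))
              (trans (o₂ 1 tt) c1 , trans (o₂ 3 tt) c3 , trans (o₂ 4 tt) c4) fr₂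
              (vertexTables-kept {i = suc h} {ρ = ρ} k₃ (oa₂ 11 tt) tabs)
              (subst (λ t → Table s₃ t [] _ _ _) (sym (o₂ 64 tt)) (unit-table (unit-kept k₃ unit)))
              {z = z} (<-≤-trans z< (Kept.count≤ k₂)) (λ eq → unit≢ (trans (sym (o₂ 64 tt)) eq))
              λ s₄ (o₄ , oa₄) fr₄ k₄ ne₄ tB →
                let k₅ : Kept s s₄
                    k₅ = kept-trans k₃ k₄
                    z≡ : regs s₄ 62 ≡ z
                    z≡ = trans (o₄ 62 tt) (o₂ 62 tt)
                    a≡ : arrs s₄ 11 (arrs s₄ 13 0) ≡ arrs s 11 (par h)
                    a≡ = trans (cong₂ (λ f g → f (g 0)) (trans (oa₄ 11 tt) (oa₂ 11 tt))
                           (trans (oa₄ 13 tt) (trans (oa₂ 13 tt) e₁₃))) (cong (arrs s 11) (Ear.first ear))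
                in joined s₄ z≡ a≡ (trans (o₄ 1 tt) (trans (o₂ 1 tt) c1) , trans (o₄ 3 tt) (trans (o₂ 3 tt) c3) , trans (o₄ 4 tt) (trans (o₂ 4 tt) c4))
                     fr₄ k₅
                     (subst (λ t → Table s₄ t (A.side r) (Hangs (vtx (v (suc r ∸ suc r)))) (CutAt r (λ j → v (suc r ∸ j))) (vtx (v (suc r ∸ suc r))))
                        (sym (o₄ 60 tt)) (table-kept (kept-trans (kept-eq refl refl) k₄) tA))
                     tB ne₄
        where
        z : ℕ
        z = regs s 62
        position : ∀ i j → j + suc i ≡ m ∸ r → m ∸ i ≡ r + suc j
        position i j eq = begin
          m ∸ i                   ≡⟨ cong (_∸ i) (sym (m+[n∸m]≡n r≤m)) ⟩
          r + (m ∸ r) ∸ i         ≡⟨ cong (λ x → r + x ∸ i) (sym eq) ⟩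
          r + (j + suc i) ∸ i     ≡⟨ cong (_∸ i) (rearrange r i j) ⟩
          (r + suc j) + i ∸ i     ≡⟨ m+n∸n≡m (r + suc j) i ⟩
          r + suc j               ∎
          where
          open ≡-Reasoning
          rearrange : ∀ r i j → r + (j + suc i) ≡ (r + suc j) + i
          rearrange = solve-∀
        joined : ∀ s₄ → regs s₄ 62 ≡ z → arrs s₄ 11 (arrs s₄ 13 0) ≡ arrs s 11 (par h) → Consts s₄ → Fresh s₄ → Kept s s₄ →
          Table s₄ (regs s₄ 60) (A.side r) (Hangs (vtx (v (suc r ∸ suc r)))) (CutAt r (λ j → v (suc r ∸ j))) (vtx (v (suc r ∸ suc r))) →
          Table s₄ (regs s₄ 59) (B.side (m ∸ r)) (Hangs (vtx (v (r + suc (m ∸ r))))) (CutAt (m ∸ r) (λ j → v (r + j))) (vtx (v (r + suc (m ∸ r)))) →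
          regs s₄ 59 ≢ z → wp joinSides P s₄
        joined s₄ z≡ a≡ consts fr k tA tB ne =
          wp-joinSides {s₀ = s₀} {g = top} {CA = CutAt r (λ j → v (suc r ∸ j))} {CB = CutAt (m ∸ r) (λ j → v (r + j))}
            z≡ consts fr (kept-trans kept k) z≥ (<-≤-trans z< (Kept.count≤ k))
            (subst (λ t → Table s₄ t (piece ρ (par h)) (Rooted top) Always top) (sym a≡)
              (table-kept k (tabs (par h) top< (live-suc {h} {par h} top-live))))
            (λ eq → top≢ (trans (sym a≡) eq))
            (subst (λ x → Table s₄ (regs s₄ 60) (A.side r) (Hangs (vtx x)) (CutAt r (λ j → v (suc r ∸ j))) (vtx x)) A.ends tA)
            (subst (λ x → Table s₄ (regs s₄ 59) (B.side (m ∸ r)) (Hangs (vtx x)) (CutAt (m ∸ r) (λ j → v (r + j))) (vtx x)) B.ends tB)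
            ne top∉A rest∉B piece-top
            (good-same (proj₁ (Kept.old k z<)) goodz)
            λ s′ fr′ kept′ z<′ good′ mono w′ comp′ →
              end s′ fr′ kept′ z<′ good′
                (λ k′ q e sp → mono k′ q e (span-same {arrs s} {arrs s₄} {z} {k′} {q} {e} (proj₁ (Kept.old k z<)) sp)) w′
                (λ Q rem → comp′ Q (cutA Q rem) (cutB Q rem))

module EarWalk {n : ℕ} {Edge : ℕ → ℕ → Set} {par bot : ℕ → ℕ} (tree : EarTree n Edge par bot) where
  open EarTree tree

  record Walk (h m : ℕ) (v : ℕ → ℕ) (cur : ℕ) : Set where
    field
      first  : v 0 ≡ par h
      second : 1 ≤ m → v 1 ≡ bot h
      cur-0  : m ≡ 0 → cur ≡ bot h
      cur-≥1 : 1 ≤ m → cur ≡ par (v m)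
      next   : ∀ {i} → 1 ≤ i → i < m → v (suc i) ≡ par (v i)
      pos    : ∀ {i} → 1 ≤ i → i ≤ m → 0 < v i
      bound  : ∀ {i} → 1 ≤ i → i ≤ m → v i < n
      inside : ∀ {i} → 1 ≤ i → i ≤ m → bot (v i) ≡ bot h

  module _ {h m : ℕ} {v : ℕ → ℕ} {cur : ℕ} (walk : Walk h m v cur) where
    open Walk walk
    private
      v′ : ℕ → ℕ
      v′ = update v (suc m) cur
      new : v′ (suc m) ≡ cur
      new = update-same v (suc m) cur
      old : ∀ {i} → i ≤ m → v′ i ≡ v i
      old i≤m = update-other v (suc m) cur (λ eq → <⇒≢ (s≤s i≤m) (sym eq))
      next′ : ∀ {i} → 1 ≤ i → i ≤ m → v′ (suc i) ≡ par (v′ i)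
      next′ {i} 1≤i i≤m with m≤n⇒m<n∨m≡n i≤m
      ... | inj₁ i<m = trans (old i<m) (trans (next 1≤i i<m) (cong par (sym (old i≤m))))
      ... | inj₂ refl = trans new (trans (cur-≥1 1≤i) (cong par (sym (old i≤m))))
      second′ : v′ 1 ≡ bot h
      second′ with m≤n⇒m<n∨m≡n (z≤n {m})
      ... | inj₁ 1≤m = trans (old 1≤m) (second 1≤m)
      ... | inj₂ refl = trans new (cur-0 refl)

    walk-step : 0 < cur → cur < n → bot cur ≡ bot h → Walk h (suc m) v′ (par cur)
    walk-step 0<cur cur<n eq = record
      { first = trans (old z≤n) first
      ; second = λ _ → second′
      ; cur-0 = λ ()
      ; cur-≥1 = λ _ → cong par (sym new)
      ; next = λ 1≤i i<m → next′ 1≤i (≤-pred i<m)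
      ; pos = λ 1≤i i≤ → case m≤n⇒m<n∨m≡n i≤ of λ
          { (inj₁ (s≤s i≤m)) → subst (0 <_) (sym (old i≤m)) (pos 1≤i i≤m)
          ; (inj₂ refl) → subst (0 <_) (sym new) 0<cur }
      ; bound = λ 1≤i i≤ → case m≤n⇒m<n∨m≡n i≤ of λ
          { (inj₁ (s≤s i≤m)) → subst (_< n) (sym (old i≤m)) (bound 1≤i i≤m)
          ; (inj₂ refl) → subst (_< n) (sym new) cur<n }
      ; inside = λ 1≤i i≤ → case m≤n⇒m<n∨m≡n i≤ of λ
          { (inj₁ (s≤s i≤m)) → trans (cong bot (old i≤m)) (inside 1≤i i≤m)
          ; (inj₂ refl) → trans (cong bot new) eq } }

    walk-end : Head h → bot cur ≢ bot h → Ear h m v′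
    walk-end head@(0<h , h<n , _) ne = record
      { head = head ; 1≤m = 1≤m
      ; first = trans (old z≤n) first ; second = second′
      ; next = next′
      ; pos = λ 1≤i i≤m → subst (0 <_) (sym (old i≤m)) (pos 1≤i i≤m)
      ; bound = λ 1≤i i≤m → subst (_< n) (sym (old i≤m)) (bound 1≤i i≤m)
      ; inside = λ 1≤i i≤m → trans (cong bot (old i≤m)) (inside 1≤i i≤m)
      ; final = λ eq → ne (trans (cong bot (sym new)) eq) }
      where
      1≤m : 1 ≤ m
      1≤m with m≤n⇒m<n∨m≡n (z≤n {m})
      ... | inj₁ 1≤m = 1≤m
      ... | inj₂ refl = contradiction (trans (cong bot (cur-0 refl)) (bot-bot 0<h h<n)) ne

  wp-buildEar : ∀ {P s h} → regs s 0 ≡ n → arrs s 4 ≡ par → arrs s 5 ≡ bot → regs s 50 ≡ h → Head h →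
    (∀ s′ → Outside buildEar s s′ → Ear h (regs s′ 54) (arrs s′ 13) → P s′) →
    wp buildEar P s
  wp-buildEar {P} {s} {h} e₀ e₄ e₅ e₅₀ head@(0<h , h<n , _) end =
    wp-map {P = λ s′ → Ear h (regs s′ 54) (arrs s′ 13)} end
    (wp-set⨟ $ wp-set⨟ $ wp-set⨟ $ wp-store⨟ $ wp-seq $
     wp-forUp Walked
       (record
         { first = cong₂ (λ f x → f x) e₄ e₅₀
         ; second = λ () ; cur-0 = λ _ → start ; cur-≥1 = λ ()
         ; next = λ _ () ; pos = λ { (s≤s _) () } ; bound = λ { (s≤s _) () } ; inside = λ { (s≤s _) () } }
       , inj₂ (≤-reflexive (trans (+-identityʳ _) start)))
       pass
       λ { s′ (o , oa) (walk , stop) → wp-store (walk-end walk head (case stop of λ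
           { (inj₁ ne) → ne
           ; (inj₂ le) → contradiction (≤-trans (≤-reflexive (sym e₀)) (≤-trans (m≤n+m _ _) le))
               (<⇒≱ (bot-< 0<h h<n)) })) })
    where
    start : arrs s 5 (regs s 50) ≡ bot h
    start = cong₂ (λ f x → f x) e₅ e₅₀
    Walked : ℕ → State → Set
    Walked j s′ = Walk h (regs s′ 54) (arrs s′ 13) (regs s′ 53) ×
      (bot (regs s′ 53) ≢ bot h ⊎ regs s′ 53 + j ≤ bot h)
    pass : ∀ j i s′ → j + suc i ≡ regs s 0 → Outside (for 55 (reg 0) (when onEarE buildStep)) _ s′ → Walked j s′ →
      wp (when onEarE buildStep) (Walked (suc j)) (writeReg 55 i s′)
    pass j i s′ _ (o , oa) (walk , stop) = wp-when
      (λ c →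
        let cur = regs s′ 53
            on : bot cur ≡ bot h
            on = trans (cong (λ f → f cur) (trans (sym e₅) (sym (oa 5 tt)))) (trans (equ-true c) (trans (o 52 tt) start))
            le : cur + j ≤ bot h
            le = case stop of λ { (inj₁ ne) → contradiction on ne ; (inj₂ le) → le }
            0<cur = bot-pos 0<h h<n on
            cur<n = ≤-<-trans (≤-trans (m≤m+n cur j) le) (bot-< 0<h h<n)
            par≡ : arrs s′ 4 cur ≡ par cur
            par≡ = cong (λ f → f cur) (trans (oa 4 tt) e₄)
        in wp-set⨟ $ wp-store⨟ $ wp-set
             (subst (λ p → Walk h (suc (regs s′ 54)) (update (arrs s′ 13) (suc (regs s′ 54)) cur) p × (bot p ≢ bot h ⊎ p + suc j ≤ bot h))
               (sym par≡)
               (walk-step walk 0<cur cur<n on ,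
                inj₂ (≤-trans (≤-reflexive (+-suc _ j)) (≤-trans (+-monoˡ-≤ j (par< 0<cur cur<n)) le)))))
      (λ c → walk , inj₁ (λ eq → equ-false {arrs s′ 5 (regs s′ 53)} {regs s′ 52} c
        (trans (cong (λ f → f (regs s′ 53)) (trans (oa 5 tt) e₅)) (trans eq (sym (trans (o 52 tt) start))))))

module EarContraction {n : ℕ} .{{_ : NonZero n}} (G : Graph n) (w : Fin n → ℕ) (l d : ℕ) (pw : Fin n → ℕ)
              {ord vis par bot : ℕ → ℕ}
              (preorder : DepthFirst.Dfs n (Input.adjacency G w) n ord vis par)
              (tree : EarTree n (λ a b → DepthFirst.E n (Input.adjacency G w) (ord a) (ord b)) par bot) where

  open Buckets d
  open Hits d
  open Solutions G w l d pw
  open Tables G w l d pw public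
  open Input G w using (module Indexed)
  open Indexed preorder using (vtx; edge-adj)
  open EarTree tree
  open EarWalk tree
  open Stages G w preorder tree
  open EarStep G w l d pw preorder tree public

  StageState : State → ℕ → (Fin n → ℕ) → Set
  StageState s i ρ = Consts s × regs s 0 ≡ n × arrs s 4 ≡ par × arrs s 5 ≡ bot
    × Fresh s × UnitTable s (regs s 64) × VertexTables s i ρ

  module _ {h m : ℕ} {v : ℕ → ℕ} {ρ : Fin n → ℕ} (ear : Ear h m v) (st : Stage (suc h) ρ) where
    open Contract ear st
    open Ears ear st

    private
      V : List (Fin n)
      V = piece ρ′ (par h)

    wp-removals : ∀ {P s s₀} (let z = regs s 62) →
      Consts s → regs s 54 ≡ m → arrs s 13 ≡ v → Fresh s → UnitTable s₀ (regs s 64) → VertexTables s₀ (suc h) ρ →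
      arrs s 11 ≡ arrs s₀ 11 → Kept s₀ s → regs s₀ 5 ≤ z → z < regs s 5 → Good (arrs s) z (Sol V (Rooted top)) →
      (∀ s′ → Outside (for 56 (op add (lit 1) (reg 54)) removalBody) s s′ → Fresh s′ → Kept s₀ s′ →
        Table s′ z V (Rooted top) Always top → P s′) →
      wp (for 56 (op add (lit 1) (reg 54)) removalBody) P s
    wp-removals {P} {s} {s₀} (c1 , c3 , c4) e₅₄ e₁₃ fresh unit tabs e₁₁ kept z≥ z< goodz end =
      wp-forAll Inv _≼_ Goal
        (λ (a , b) (a′ , b′) → (λ k q e sp → a′ k q e (a k q e sp)) , b′ ∘ b)
        (λ { {r} {s₁} {s₂} (sp , wt) (w≡ , comp) → wt w≡ , λ Q rem → completes-later s₁ s₂ sp (comp Q rem) })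
        ((λ _ _ _ sp → sp) , λ z → z) (fresh , kept-trans kept (kept-eq refl refl) , z< , goodz)
        pass
        λ { s′ o (fr , kept′ , z<′ , good) _ goals → end s′ o fr kept′ record
          { t< = z<′
          ; weight = proj₁ (goals 0 z<s)
          ; good = good
          ; compl = λ Q _ → let r , r≤m , rem = Cut.removable Q in
              proj₂ (goals r (s≤s (subst (r ≤_) (sym e₅₄) r≤m))) Q rem } }
      where
      z : ℕ
      z = regs s 62
      Inv : State → Set
      Inv s′ = Fresh s′ × Kept s₀ s′ × z < regs s′ 5 × Good (arrs s′) z (Sol V (Rooted top))
      _≼_ : State → State → Set
      s₁ ≼ s₂ = (∀ k q e → Span (arrs s₁) z k q e → Span (arrs s₂) z k q e)
              × (arrs s₁ 10 z ≡ total w V → arrs s₂ 10 z ≡ total w V)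
      Goal : ℕ → State → Set
      Goal r s′ = arrs s′ 10 z ≡ total w V
        × (∀ {K} (Q : Partition K) → Cut.Removable Q r → Completes (arrs s′) z V Q top)
      completes-later : ∀ s₁ s₂ → (∀ k q e → Span (arrs s₁) z k q e → Span (arrs s₂) z k q e) →
        ∀ {K} {Q : Partition K} → Completes (arrs s₁) z V Q top → Completes (arrs s₂) z V Q top
      completes-later s₁ s₂ sp (L , lab , cm) = L , lab , complete λ near →
        let q , e , x , ne = hits cm near in q , e , sp _ q e x , ne
      pass : ∀ r s′ → r < suc (regs s 54) → Outside (for 56 (op add (lit 1) (reg 54)) removalBody) s s′ → Inv s′ →
        wp removalBody (λ s″ → Inv s″ × s′ ≼ s″ × Goal r s″) (writeReg 56 r s′)
      pass r s′ (s≤s r≤) (o , oa) (fr , kept′ , z<′ , good) =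
        Removal.wp-removal (subst (r ≤_) e₅₄ r≤) {s = writeReg 56 r s′} {s₀ = s₀} {z = z} (o 62 tt)
          refl (trans (o 54 tt) e₅₄) (trans (oa 13 tt) e₁₃)
          (trans (o 1 tt) c1 , trans (o 3 tt) c3 , trans (o 4 tt) c4) fr
          kept″ z≥ z<′
          (subst (UnitTable (writeReg 56 r s′)) (sym (o 64 tt)) (unit-kept kept″ unit))
          (λ eq → <⇒≱ (proj₁ unit) (subst (regs s₀ 5 ≤_) (trans (sym eq) (o 64 tt)) z≥))
          (vertexTables-kept {i = suc h} {ρ = ρ} kept″ (trans (oa 11 tt) e₁₁) tabs)
          (λ eq → <⇒≱ (Table.t< (tabs (par h) top< (live-suc {h} {par h} top-live)))
            (subst (regs s₀ 5 ≤_) (trans (sym eq) (cong (λ f → f (par h)) (trans (oa 11 tt) e₁₁))) z≥))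
          good
          λ s″ fr″ kept‴ z<″ good″ mono w≡ comp → (fr″ , kept‴ , z<″ , good″) , (mono , λ _ → w≡) , w≡ , comp
        where
        kept″ : Kept s₀ (writeReg 56 r s′)
        kept″ = kept-trans kept′ (kept-eq refl refl)

  wp-earBody : ∀ {P s h ρ} → Stage (suc h) ρ → StageState s (suc h) ρ → regs s 50 ≡ h → Head h →
    (∀ s′ m v ρ′ → Ear h m v → regs s′ 54 ≡ m → Stage h ρ′ → StageState s′ h ρ′ → P s′) →
    wp earBody P s
  wp-earBody {P} {s} {h} {ρ} st ((c1 , c3 , c4) , e₀ , e₄ , e₅ , fresh , unit , tabs) e₅₀ head end =
    wp-seq $ wp-buildEar {s = s} e₀ e₄ e₅ e₅₀ head λ s₁ (o₁ , oa₁) ear →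
      let open Contract ear st
          k₁ : Kept s s₁
          k₁ = keeps (≤-reflexive (sym (o₁ 5 tt))) λ {t} _ →
            (λ k q m → cong (λ f → f (key t k q m)) (oa₁ 6 tt) , cong (λ f → f (key t k q m)) (oa₁ 7 tt) ,
                       cong (λ f → f (key t k q m)) (oa₁ 8 tt) , cong (λ f → f (key t k q m)) (oa₁ 9 tt)) ,
            cong (λ f → f t) (oa₁ 10 tt)
          fr₁ : Fresh s₁
          fr₁ = λ t t≥ k q m → trans (cong (λ f → f (key t k q m)) (oa₁ 6 tt)) (fresh t (subst (_≤ t) (o₁ 5 tt) t≥) k q m)
          z = regs s₁ 5
          unit₁ : UnitTable s₁ (regs s₁ 64)
          unit₁ = subst (UnitTable s₁) (sym (o₁ 64 tt)) (unit-kept k₁ unit)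
          tabs₁ : VertexTables s₁ (suc h) ρ
          tabs₁ = vertexTables-kept {i = suc h} {ρ = ρ} k₁ (oa₁ 11 tt) tabs
      in wp-new $ wp-seq $
         wp-removals ear st {s = writeReg 5 (suc z) (writeReg 62 z s₁)} {s₀ = s₁}
           (trans (o₁ 1 tt) c1 , trans (o₁ 3 tt) c3 , trans (o₁ 4 tt) c4) refl refl
           (λ t t≥ → fr₁ t (<⇒≤ t≥)) unit₁ tabs₁ refl
           (keeps (n≤1+n z) λ _ → (λ _ _ _ → sameCell-refl {arrs s₁}) , refl) ≤-refl (n<1+n z)
           (good-fresh (Sol (piece ρ′ (par h)) (Rooted (vtx (par h)))) (fr₁ z ≤-refl))
           λ s₂ (o₂ , oa₂) fr₂ k₂ tb → wp-store
             (finish s₁ s₂ ear (o₂ 54 tt) (trans (oa₂ 11 tt) refl) (trans (cong (λ f → f 0) (oa₂ 13 tt)) (Ear.first ear)) (o₂ 62 tt)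
               (trans (o₂ 1 tt) (trans (o₁ 1 tt) c1) , trans (o₂ 3 tt) (trans (o₁ 3 tt) c3) , trans (o₂ 4 tt) (trans (o₁ 4 tt) c4))
               (trans (o₂ 0 tt) (trans (o₁ 0 tt) e₀)) (trans (oa₂ 4 tt) (trans (oa₁ 4 tt) e₄)) (trans (oa₂ 5 tt) (trans (oa₁ 5 tt) e₅))
               (o₂ 64 tt) fr₂ k₂ unit₁ tabs₁ tb)
    where
    finish : ∀ s₁ s₂ {m v} (ear : Ear h m v) (let open Contract ear st; z = regs s₁ 5) → regs s₂ 54 ≡ m →
      arrs s₂ 11 ≡ arrs s₁ 11 → arrs s₂ 13 0 ≡ par h → regs s₂ 62 ≡ z → Consts s₂ → regs s₂ 0 ≡ n → arrs s₂ 4 ≡ par → arrs s₂ 5 ≡ bot →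
      regs s₂ 64 ≡ regs s₁ 64 → Fresh s₂ → Kept s₁ s₂ → UnitTable s₁ (regs s₁ 64) → VertexTables s₁ (suc h) ρ →
      Table s₂ z (piece ρ′ (par h)) (Rooted (vtx (par h))) Always (vtx (par h)) →
      P (writeArr 11 (arrs s₂ 13 0) (regs s₂ 62) s₂)
    finish s₁ s₂ {m} {v} ear e₅₄ e₁₁ e₁₃ e₆₂ consts e₀ e₄ e₅ e₆₄ fr k unit₁ tabs₁ tb =
      end s₃ m v ρ′ ear e₅₄ contracted
        (consts , e₀ , e₄ , e₅ , fr ,
         subst (UnitTable s₃) (sym e₆₄) (unit-kept k₃ unit₁) , tabs₃)
      where
      open Contract ear st
      s₃ : State
      s₃ = writeArr 11 (arrs s₂ 13 0) (regs s₂ 62) s₂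
      k₂₃ : Kept s₂ s₃
      k₂₃ = keeps ≤-refl λ _ → (λ _ _ _ → sameCell-refl {arrs s₂}) , refl
      k₃ : Kept s₁ s₃
      k₃ = kept-trans k k₂₃
      tabs₃ : VertexTables s₃ h ρ′
      tabs₃ y y<n lv with y ≟ par h
      ... | yes refl = subst (λ t → Table s₃ t (piece ρ′ (par h)) (Rooted (vtx (par h))) Always (vtx (par h)))
        (sym (trans (cong (λ x → update (arrs s₂ 11) x (regs s₂ 62) (par h)) e₁₃)
          (trans (update-same (arrs s₂ 11) (par h) (regs s₂ 62)) e₆₂))) (table-kept k₂₃ tb)
      ... | no ne = subst (λ t → Table s₃ t (piece ρ′ y) (Rooted (vtx y)) Always (vtx y))
        (sym (trans (update-other (arrs s₂ 11) (arrs s₂ 13 0) (regs s₂ 62) (λ eq → ne (trans (sym eq) e₁₃)))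
          (cong (λ f → f y) e₁₁)))
        (table-↭ (piece-other ne (lv h ≤-refl head)) (table-kept k₃ (tabs₁ y y<n (live-suc {h} {y} lv))))

opaque
  unfolding wp

  wpt : Cmd → (ℕ → State → Set) → State → Set
  wpt c Q s = Q (time c s) (exec c s)

  wpt-run : ∀ {c Q s} → wpt c Q s → Q (time c s) (exec c s)
  wpt-run p = p

  wpt-seq : ∀ {c c′ Q s} → wpt c (λ t s′ → wpt c′ (λ t′ → Q (t + t′)) s′) s → wpt (c ⨟ c′) Q s
  wpt-seq p = p

  wpt-when : ∀ {e c Q s} → (⟦ e ⟧ s ≢ 0 → wpt c (λ t → Q (1 + cost e + t)) s) →
    (⟦ e ⟧ s ≡ 0 → Q (2 + cost e) s) → wpt (when e c) Q s
  wpt-when {e} {c} {Q} {s} y n with ⟦ e ⟧ s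
  ... | zero  = subst (λ t → Q t s) (+-comm 1 (1 + cost e)) (n refl)
  ... | suc _ = y λ ()

  wpt-bound : ∀ {c Q s} {P : State → Set} (C : State → Set) (f : State → ℕ) →
    (C (exec c s) → time c s ≤ f (exec c s)) → wp c P s →
    (∀ s′ t → P s′ → (C s′ → t ≤ f s′) → Q t s′) → wpt c Q s
  wpt-bound C f b p end = end _ _ p b

  wpt-for : ∀ {r e c s} (A K : ℕ) (I : ℕ → ℕ → State → Set) u →
    I (⟦ e ⟧ s) u (writeReg r (⟦ e ⟧ s) s) →
    (∀ i u s′ → i < ⟦ e ⟧ s → Outside (for r e c) s s′ → I (suc i) u s′ →
     wpt c (λ t s″ → ∃[ u′ ] I i u′ s″ × t + K * u ≤ A + K * u′) (writeReg r i s′)) →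
    wpt (for r e c) (λ t s″ → ∃[ u′ ] I 0 u′ s″ × t + K * u ≤ 3 + cost e + ⟦ e ⟧ s * (6 + A) + K * u′) s
  wpt-for {r} {e} {c} {s} A K I u start pass = for-time r e c A K I s u start pass

  wpt-map : ∀ {c Q Q′ s} → (∀ t s′ → Outside c s s′ → Q t s′ → Q′ t s′) → wpt c Q s → wpt c Q′ s
  wpt-map {c} {s = s} f p = f _ _ (outside c s) p

wpt-static : ∀ {c P Q s} N .{{_ : NonZero N}} → T (static c) → regs s 0 ≤ N → regs s 3 ≤ N → wp c P s →
  (∀ s′ t → P s′ → t ≤ coeff c * N ^ degree c → Q t s′) → wpt c Q s
wpt-static {c} {s = s} N st p q w end =
  wpt-bound (λ _ → Unit) (λ _ → coeff c * N ^ degree c) (λ _ → static-time N c s st p q) w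
    (λ s′ t x le → end s′ t x (le tt))

powerBody powers unitCmd leafBody leaves headsCmd : Cmd
powerBody = store 12 (op sub (op sub (reg 0) (lit 1)) (reg 9)) (reg 8) ⨟ set 8 (op mul (reg 8) (reg 3))
powers = set 8 (lit 1) ⨟ for 9 (reg 0) powerBody
unitCmd = newTable 64 ⨟ set 20 (reg 64) ⨟ set 21 (lit 0) ⨟ set 22 (lit 0) ⨟ set 23 (lit 0)
        ⨟ set 24 (lit 0) ⨟ set 25 (lit 0) ⨟ set 26 (lit 0) ⨟ insert
leafBody = newTable 20 ⨟ store 11 (reg 50) (reg 20) ⨟ store 10 (reg 20) (arr 0 (arr 2 (reg 50)))
         ⨟ set 21 (lit 0) ⨟ set 22 (lit 0) ⨟ set 23 (lit 0)
         ⨟ set 24 (arr 12 (arr 2 (reg 50))) ⨟ set 25 (lit 0) ⨟ set 26 (lit 0) ⨟ insert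
leaves = for 50 (reg 0) leafBody
headE : Expr
headE = op mul (reg 50) (op equ (op equ (arr 5 (arr 4 (reg 50))) (arr 5 (reg 50))) (lit 0))
headsCmd = for 50 (reg 0) (when headE earBody)

wp-powers : ∀ {P s n} → regs s 0 ≡ n → regs s 3 ≡ suc n →
  (∀ s′ → Outside powers s s′ → (∀ x → x < n → arrs s′ 12 x ≡ suc n ^ x) → P s′) → wp powers P s
wp-powers {P} {s} {n} refl e₃ end =
  wp-map {P = λ s′ → ∀ x → x < n → arrs s′ 12 x ≡ suc n ^ x} end
  (wp-set⨟ $ wp-forUp Powered (refl , λ x ()) pass (λ s′ _ (_ , f) x x< → f x x<))
  where
  Powered : ℕ → State → Set
  Powered j s′ = regs s′ 8 ≡ suc n ^ j × (∀ x → x < j → arrs s′ 12 x ≡ suc n ^ x)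
  pass : ∀ j i s′ → j + suc i ≡ n → Outside (for 9 (reg 0) powerBody) (writeReg 8 1 s) s′ → Powered j s′ →
    wp powerBody (Powered (suc j)) (writeReg 9 i s′)
  pass j i s′ eq (o , _) (e₈ , f) = wp-store⨟ $ wp-set
    ( trans (cong₂ _*_ e₈ (trans (o 3 tt) e₃)) (*-comm (suc n ^ j) (suc n))
    , λ x x< → subst (λ k → update (arrs s′ 12) k (regs s′ 8) x ≡ suc n ^ x) (sym k≡) (case m<1+n⇒m<n∨m≡n x< of λ
        { (inj₁ x<j) → trans (update-other (arrs s′ 12) j (regs s′ 8) (λ eq → <⇒≢ x<j (sym eq))) (f x x<j)
        ; (inj₂ refl) → trans (update-same (arrs s′ 12) j (regs s′ 8)) e₈ }))
    where
    k≡ : regs s′ 0 ∸ 1 ∸ i ≡ j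
    k≡ = trans (cong (λ x → x ∸ 1 ∸ i) (trans (o 0 tt) (trans (sym eq) (+-suc j i)))) (m+n∸n≡m j i)

module Main {n : ℕ} .{{_ : NonZero n}} (G : Graph n) (w : Fin n → ℕ) (l d : ℕ)
            {ord vis par bot : ℕ → ℕ}
            (preorder : DepthFirst.Dfs n (Input.adjacency G w) n ord vis par)
            (tree : EarTree n (λ a b → DepthFirst.E n (Input.adjacency G w) (ord a) (ord b)) par bot) where

  pw : Fin n → ℕ
  pw v = suc n ^ toℕ v

  open Buckets d
  open Hits d
  open Solutions G w l d pw
  open Input G w using (module Indexed; padded-toℕ)
  open Indexed preorder using (vtx; toℕ-vtx; ord<; vtx-injective)
  open EarTree tree
  open Stages G w preorder tree
  open EarContraction G w l d pw preorder tree public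

  wp-unitCmd : ∀ {P s} → Consts s → Fresh s → (∀ x → arrs s 10 x ≡ 0) →
    (∀ s′ → Outside unitCmd s s′ → Fresh s′ → UnitTable s′ (regs s′ 64) → P s′) → wp unitCmd P s
  wp-unitCmd {P} {s} (_ , _ , c4) fresh zero₁₀ end =
    wp-map {P = λ s′ → Fresh s′ × UnitTable s′ (regs s′ 64)} (λ { s′ o (fr , u) → end s′ o fr u })
    (wp-new $ wp-set⨟ $ wp-set⨟ $ wp-set⨟ $ wp-set⨟ $ wp-set⨟ $ wp-set⨟ $ wp-set⨟ $
      wp-insert (Sol [] (_≡ [])) c4 sol-empty z≤n z<s
        (good-fresh (Sol [] (_≡ [])) (fresh _ ≤-refl))
        λ s′ (o , oa) good gr (q , sp) →
          (λ t t≥ k q m → trans (proj₁ (proj₁ gr (λ t≡ → <⇒≢ (subst (_≤ t) (o 5 tt) t≥) (sym t≡)) k q m))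
             (fresh t (<⇒≤ (subst (_≤ t) (o 5 tt) t≥)) k q m)) ,
          subst (UnitTable s′) (sym (o 64 tt))
            ( subst (regs s 5 <_) (sym (o 5 tt)) (n<1+n (regs s 5))
            , trans (cong (λ f → f (regs s 5)) (oa 10 tt)) (zero₁₀ (regs s 5))
            , good , complete λ near → q , 0 , sp , near))

  wp-leaves : ∀ {P s} → Consts s → regs s 0 ≡ n → Fresh s → UnitTable s (regs s 64) →
    arrs s 0 ≡ padded w → arrs s 2 ≡ ord → (∀ x → x < n → arrs s 12 x ≡ suc n ^ x) →
    (∀ s′ → Outside leaves s s′ → Fresh s′ → UnitTable s′ (regs s′ 64) →
      (∀ y → y < n → Table s′ (arrs s′ 11 y) (vtx y ∷ []) (Rooted (vtx y)) Always (vtx y)) → P s′) →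
    wp leaves P s
  wp-leaves {P} {s} (c1 , c3 , c4) e₀ fresh unit e-w e-ord pows end =
    wp-for I
      (fresh , unit-kept {s} {writeReg 50 (regs s 0) s} (kept-eq refl refl) unit , λ y n≤y y<n → contradiction n≤y (<⇒≱ (subst (y <_) (sym e₀) y<n)))
      pass
      (λ s′ o (fr , u , tabs) → end s′ o fr u (λ y → tabs y z≤n))
    where
    I : ℕ → State → Set
    I i s′ = Fresh s′ × UnitTable s′ (regs s′ 64) ×
      (∀ y → i ≤ y → y < n → Table s′ (arrs s′ 11 y) (vtx y ∷ []) (Rooted (vtx y)) Always (vtx y))
    pass : ∀ i s′ → i < regs s 0 → Outside leaves s s′ → I (suc i) s′ → wp leafBody (I i) (writeReg 50 i s′)
    pass i s′ i<₀ (o , oa) (fr , u , tabs) =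
      wp-new $ wp-store⨟ $ wp-store⨟ $ wp-set⨟ $ wp-set⨟ $ wp-set⨟ $ wp-set⨟ $ wp-set⨟ $ wp-set⨟ $
        wp-insert Φ (trans (o 4 tt) c4)
          (subst (λ c → Φ 0 0 c 0 0) (sym code≡) (sol-single (vtx i))) z≤n z<s
          (good-fresh Φ (fr _ ≤-refl))
          λ s″ (o″ , oa″) good gr (q , sp) →
            finish s″ (o″ 5 tt) (o″ 64 tt) (oa″ 10 tt) (oa″ 11 tt) good gr q sp
      where
      i<n : i < n
      i<n = subst (i <_) e₀ i<₀
      Φ : Family
      Φ = Sol (vtx i ∷ []) (Rooted (vtx i))
      z : ℕ
      z = regs s′ 5
      code≡ : arrs s′ 12 (arrs s′ 2 i) ≡ pw (vtx i)
      code≡ = trans (cong₂ (λ f g → f (g i)) (oa 12 tt) (trans (oa 2 tt) e-ord))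
        (trans (pows (ord i) (ord< i<n)) (cong (suc n ^_) (sym (toℕ-vtx i<n))))
      W : ℕ
      W = arrs s′ 0 (arrs s′ 2 i)
      W≡ : W ≡ w (vtx i)
      W≡ = trans (cong₂ (λ f g → f (g i)) (trans (oa 0 tt) e-w) (trans (oa 2 tt) e-ord))
        (trans (cong (padded w) (sym (toℕ-vtx i<n))) (padded-toℕ w (vtx i)))
      finish : ∀ s″ → regs s″ 5 ≡ suc z → regs s″ 64 ≡ regs s′ 64 → arrs s″ 10 ≡ update (arrs s′ 10) z W →
        arrs s″ 11 ≡ update (arrs s′ 11) i z → Good (arrs s″) z Φ → Grows z (arrs s′) (arrs s″) →
        ∀ q → Span (arrs s″) z 0 q 0 → I i s″
      finish s″ e₅ e₆₄ e₁₀ e₁₁ good gr q sp =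
        (λ t t≥ k q m → trans (proj₁ (proj₁ gr (λ t≡ → <⇒≢ (subst (_≤ t) e₅ t≥) (sym t≡)) k q m))
           (fr t (<⇒≤ (subst (_≤ t) e₅ t≥)) k q m)) ,
        subst (UnitTable s″) (sym e₆₄) (unit-kept k₂ u) ,
        λ y i≤y y<n → case m≤n⇒m<n∨m≡n i≤y of λ
          { (inj₁ i<y) → subst (λ t → Table s″ t (vtx y ∷ []) (Rooted (vtx y)) Always (vtx y))
              (sym (trans (cong (λ f → f y) e₁₁) (update-other (arrs s′ 11) i z (<⇒≢ i<y))))
              (table-kept k₂ (tabs y i<y y<n))
          ; (inj₂ refl) → subst (λ t → Table s″ t (vtx i ∷ []) (Rooted (vtx i)) Always (vtx i))
              (sym (trans (cong (λ f → f i) e₁₁) (update-same (arrs s′ 11) i z)))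
              record
                { t< = subst (z <_) (sym e₅) (n<1+n z)
                ; weight = trans (cong (λ f → f z) e₁₀) (trans (update-same (arrs s′ 10) z W)
                    (trans W≡ (sym (+-identityʳ (w (vtx i))))))
                ; good = good
                ; compl = λ Q _ → [] , lab-single Q (vtx i) , complete λ near → q , 0 , sp , near } }
        where
        k₂ : Kept s′ s″
        k₂ = keeps (subst (z ≤_) (sym e₅) (n≤1+n z)) λ {t} t< →
          proj₁ gr (<⇒≢ t<) ,
          trans (cong (λ f → f t) e₁₀) (update-other (arrs s′ 10) z W (λ eq → <⇒≢ t< (sym eq)))

-- Running time

wpt-time : ∀ {c Q s} b → time c s ≤ b → (∀ s′ t → Outside c s s′ → t ≤ b → Q t s′) → wpt c Q s
wpt-time {c} {Q} {s} b le end =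
  wpt-bound {P = λ s′ → Outside c s s′} (λ _ → Unit) (λ _ → b) (λ _ → le)
    (exec-wp c (Outside c s) s (outside c s)) (λ s′ t o f → end s′ t o (f tt))

opaque
  sealed : ℕ → ℕ
  sealed k = k

  sealed-≡ : ∀ k → k ≡ sealed k
  sealed-≡ k = refl

rate : Cmd → ℕ
rate c = sealed (coeff c)

idxA idxB : Expr
idxA = op add (lit 1) (reg 57)
idxB = op sub (reg 54) (reg 57)

linkA linkB : Cmd
linkA = set 58 (arr 13 idxA) ⨟ link
linkB = set 58 (arr 13 idxB) ⨟ link

linkCoeff removalCoeff earCoeff headsCoeff : ℕ
linkCoeff    = 6 + (rate linkA + rate linkB)
removalCoeff = 30 + linkCoeff + rate joinSides
earCoeff     = rate buildEar + 20 + removalCoeff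
headsCoeff   = 4 + (7 + cost headE + (6 + earCoeff)) + (6 + removalCoeff)

module Costs (N : ℕ) .{{_ : NonZero N}} where

  Small : State → Set
  Small s = regs s 0 ≤ N × regs s 3 ≤ N

  static-rate : ∀ c s → T (static c) → Small s → time c s ≤ rate c * N ^ degree c
  static-rate c s st (p , q) =
    subst (λ k → time c s ≤ k * N ^ degree c) (sealed-≡ (coeff c)) (static-time N c s st p q)

  wpt-static′ : ∀ {c Q s} → T (static c) → Small s →
    (∀ s′ t → Outside c s s′ → t ≤ rate c * N ^ degree c → Q t s′) → wpt c Q s
  wpt-static′ {c} {s = s} st small end = wpt-time _ (static-rate c s st small) end

  time-chain : ∀ idx count s → T (static (set 58 (arr 13 idx) ⨟ link)) → Small s →
    time (chain idx count) s ≤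
      3 + cost count + ⟦ count ⟧ s * (6 + rate (set 58 (arr 13 idx) ⨟ link) * N ^ 4)
  time-chain idx count s st (p , q) =
    for-time-const 57 count (set 58 (arr 13 idx) ⨟ link) _ s λ i s′ _ (o , _) →
      static-rate (set 58 (arr 13 idx) ⨟ link) (writeReg 57 i s′) st
        (subst (_≤ N) (sym (o 0 tt)) p , subst (_≤ N) (sym (o 3 tt)) q)

  removalTime : ℕ → ℕ
  removalTime m = 30 + (m * (linkCoeff * N ^ 4) + rate joinSides * N ^ 4)

  time-removal : ∀ s → Small s → regs s 56 ≤ regs s 54 → time removalBody s ≤ removalTime (regs s 54)
  time-removal s small@(p , q) r≤m = wpt-run {c = removalBody} {Q = λ t _ → t ≤ removalTime m} $
    wpt-seq $ wpt-time 2 ≤-refl λ s₁ t₁ (o₁ , _) le₁ →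
    wpt-seq $ wpt-time _ (time-chain idxA (reg 56) s₁ tt
        (subst (_≤ N) (sym (o₁ 0 tt)) p , subst (_≤ N) (sym (o₁ 3 tt)) q)) λ s₂ t₂ (o₂ , _) le₂ →
    wpt-seq $ wpt-time 2 ≤-refl λ s₃ t₃ (o₃ , _) le₃ →
    wpt-seq $ wpt-time 2 ≤-refl λ s₄ t₄ (o₄ , _) le₄ →
    let e : ∀ x → T (keepsReg x removalBody) → T (keepsReg x sideACmd) → T (keepsReg x (set 59 (reg 64))) → T (keepsReg x (set 60 (reg 59))) → regs s₄ x ≡ regs s x
        e x _ k k′ k″ = trans (o₄ x k′) (trans (o₃ x k″) (trans (o₂ x k) (o₁ x k′)))
        small₄ : Small s₄
        small₄ = subst (_≤ N) (sym (e 0 tt tt tt tt)) p , subst (_≤ N) (sym (e 3 tt tt tt tt)) q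
    in
    wpt-seq $ wpt-time _ (time-chain idxB (op sub (reg 54) (reg 56)) s₄ tt small₄) λ s₅ t₅ (o₅ , _) le₅ →
    wpt-static′ tt (subst (_≤ N) (sym (o₅ 0 tt)) (proj₁ small₄) , subst (_≤ N) (sym (o₅ 3 tt)) (proj₂ small₄)) λ s₆ t₆ _ le₆ →
    gather le₁
      (subst (λ r → t₂ ≤ 4 + r * (6 + gA)) (o₁ 56 tt) le₂) le₃ le₄
      (subst₂ (λ m r → t₅ ≤ 6 + (m ∸ r) * (6 + gB)) (e 54 tt tt tt tt) (e 56 tt tt tt tt) le₅) le₆
    where
    m : ℕ
    m = regs s 54
    r : ℕ
    r = regs s 56
    gA : ℕ
    gA = rate linkA * N ^ 4
    gB : ℕ
    gB = rate linkB * N ^ 4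
    gather : ∀ {t₁ t₂ t₃ t₄ t₅ t₆ j} → t₁ ≤ 2 → t₂ ≤ 4 + r * (6 + gA) → t₃ ≤ 2 → t₄ ≤ 2 →
      t₅ ≤ 6 + (m ∸ r) * (6 + gB) → t₆ ≤ j →
      t₁ + (t₂ + (t₃ + (t₄ + (t₅ + t₆)))) ≤ 30 + (m * (linkCoeff * N ^ 4) + j)
    gather {j = j} le₁ le₂ le₃ le₄ le₅ le₆ = begin
      _ ≤⟨ +-mono-≤ le₁ (+-mono-≤ le₂ (+-mono-≤ le₃ (+-mono-≤ le₄ (+-mono-≤ le₅ le₆)))) ⟩
      2 + (4 + r * (6 + gA) + (2 + (2 + (6 + (m ∸ r) * (6 + gB) + j))))
        ≡⟨ rearrange (r * (6 + gA)) ((m ∸ r) * (6 + gB)) j ⟩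
      16 + (r * (6 + gA) + (m ∸ r) * (6 + gB) + j)
        ≤⟨ +-mono-≤ {16} {30} (m≤m+n 16 14) (+-monoˡ-≤ j (+-mono-≤ (*-monoʳ-≤ r leA) (*-monoʳ-≤ (m ∸ r) leB))) ⟩
      30 + (r * (linkCoeff * N ^ 4) + (m ∸ r) * (linkCoeff * N ^ 4) + j)
        ≡⟨ cong (λ x → 30 + (x + j)) (sym (*-distribʳ-+ (linkCoeff * N ^ 4) r (m ∸ r))) ⟩
      30 + ((r + (m ∸ r)) * (linkCoeff * N ^ 4) + j)
        ≡⟨ cong (λ x → 30 + (x * (linkCoeff * N ^ 4) + j)) (m+[n∸m]≡n r≤m) ⟩
      30 + (m * (linkCoeff * N ^ 4) + j) ∎
      where
      open ≤-Reasoning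
      rearrange : ∀ a b c → 2 + (4 + a + (2 + (2 + (6 + b + c)))) ≡ 16 + (a + b + c)
      rearrange = solve-∀
      six : ∀ a b → 6 + a * N ^ 4 ≤ (6 + (a + b)) * N ^ 4
      six a b = ≤-trans (+-mono-≤ (scale N 6 4) (*-monoˡ-≤ (N ^ 4) (m≤m+n a b)))
        (≤-reflexive (sym (*-distribʳ-+ (N ^ 4) 6 (a + b))))
      leA : 6 + gA ≤ linkCoeff * N ^ 4
      leA = six (rate linkA) (rate linkB)
      leB : 6 + gB ≤ linkCoeff * N ^ 4
      leB = ≤-trans (six (rate linkB) (rate linkA))
        (≤-reflexive (cong (λ x → (6 + x) * N ^ 4) (+-comm (rate linkB) (rate linkA))))

  earTime : ℕ → ℕ
  earTime m = rate buildEar * N ^ 1 + (6 + (6 + suc m * (6 + removalTime m) + 5))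

  wpt-ear : ∀ s → Small s → wpt earBody (λ t s′ → t ≤ earTime (regs s′ 54)) s
  wpt-ear s (p , q) =
    wpt-seq $ wpt-static′ tt (p , q) λ s₁ t₁ (o₁ , _) le₁ →
    wpt-seq $ wpt-time 6 ≤-refl λ s₂ t₂ (o₂ , _) le₂ →
    let small₂ : Small s₂
        small₂ = subst (_≤ N) (sym (trans (o₂ 0 tt) (o₁ 0 tt))) p , subst (_≤ N) (sym (trans (o₂ 3 tt) (o₁ 3 tt))) q
    in wpt-seq $ wpt-time _ (for-time-const 56 (op add (lit 1) (reg 54)) removalBody (removalTime (regs s₂ 54)) s₂
        λ i s′ i< (o , _) → subst (λ m → time removalBody (writeReg 56 i s′) ≤ removalTime m) (o 54 tt)
          (time-removal (writeReg 56 i s′)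
            (subst (_≤ N) (sym (o 0 tt)) (proj₁ small₂) , subst (_≤ N) (sym (o 3 tt)) (proj₂ small₂))
            (subst (i ≤_) (sym (o 54 tt)) (≤-pred i<)))) λ s₃ t₃ (o₃ , _) le₃ →
    wpt-time 5 (m≤m+n 4 1) λ s₄ t₄ (o₄ , _) le₄ →
      subst (λ m → t₁ + (t₂ + (t₃ + t₄)) ≤ earTime m) (sym (trans (o₄ 54 tt) (o₃ 54 tt)))
        (+-mono-≤ le₁ (+-mono-≤ le₂ (+-mono-≤ le₃ le₄)))

  module Amortised {M : ℕ} (1≤M : 1 ≤ M) where

    Y : ℕ
    Y = M * N ^ 4

    N⁴≤Y : N ^ 4 ≤ Y
    N⁴≤Y = subst (_≤ Y) (*-identityˡ (N ^ 4)) (*-monoˡ-≤ (N ^ 4) 1≤M)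

    1≤Y : 1 ≤ Y
    1≤Y = ≤-trans (pow≥1 N 4) N⁴≤Y

    atY : ∀ a → a ≤ a * Y
    atY a = subst (_≤ a * Y) (*-identityʳ a) (*-monoʳ-≤ a 1≤Y)

    removal≤ : ∀ {m} → m ≤ M → 6 + removalTime m ≤ (6 + removalCoeff) * Y
    removal≤ {m} m≤M = begin
      36 + (m * (linkCoeff * N ^ 4) + rate joinSides * N ^ 4)
        ≤⟨ +-mono-≤ (atY 36) (+-mono-≤ (*-monoˡ-≤ (linkCoeff * N ^ 4) m≤M) (*-monoʳ-≤ (rate joinSides) N⁴≤Y)) ⟩
      36 * Y + (M * (linkCoeff * N ^ 4) + rate joinSides * Y)
        ≡⟨ cong (λ x → 36 * Y + (x + rate joinSides * Y)) (swap M linkCoeff (N ^ 4)) ⟩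
      36 * Y + (linkCoeff * Y + rate joinSides * Y)
        ≡⟨ collect linkCoeff (rate joinSides) Y ⟩
      (6 + (30 + linkCoeff + rate joinSides)) * Y ∎
      where
      open ≤-Reasoning
      swap : ∀ a b c → a * (b * c) ≡ b * (a * c)
      swap = solve-∀
      collect : ∀ a b y → 36 * y + (a * y + b * y) ≡ (6 + (30 + a + b)) * y
      collect = solve-∀

    ear≤ : ∀ {m} → m ≤ M → earTime m ≤ (6 + earCoeff) * Y + m * ((6 + removalCoeff) * Y)
    ear≤ {m} m≤M = begin
      rate buildEar * N ^ 1 + (6 + (6 + suc m * (6 + removalTime m) + 5))
        ≤⟨ +-mono-≤ (*-monoʳ-≤ (rate buildEar) (≤-trans (^-monoʳ-≤ N (s≤s (z≤n {3}))) N⁴≤Y))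
             (+-monoʳ-≤ 6 (+-monoˡ-≤ 5 (+-monoʳ-≤ 6 (*-monoʳ-≤ (suc m) (removal≤ m≤M))))) ⟩
      rate buildEar * Y + (6 + (6 + suc m * ((6 + removalCoeff) * Y) + 5))
        ≡⟨ expand (rate buildEar * Y) m ((6 + removalCoeff) * Y) ⟩
      17 + (rate buildEar * Y + (6 + removalCoeff) * Y) + m * ((6 + removalCoeff) * Y)
        ≤⟨ +-monoˡ-≤ (m * ((6 + removalCoeff) * Y)) (+-monoˡ-≤ (rate buildEar * Y + (6 + removalCoeff) * Y) (≤-trans (atY 17) (*-monoˡ-≤ Y (m≤m+n 17 3)))) ⟩
      20 * Y + (rate buildEar * Y + (6 + removalCoeff) * Y) + m * ((6 + removalCoeff) * Y)
        ≡⟨ cong (_+ m * ((6 + removalCoeff) * Y)) (collect (rate buildEar) removalCoeff Y) ⟩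
      (6 + (rate buildEar + 20 + removalCoeff)) * Y + m * ((6 + removalCoeff) * Y) ∎
      where
      open ≤-Reasoning
      expand : ∀ a m k → a + (6 + (6 + suc m * k + 5)) ≡ 17 + (a + k) + m * k
      expand = solve-∀
      collect : ∀ a b y → 20 * y + (a * y + (6 + b) * y) ≡ (6 + (a + 20 + b)) * y
      collect = solve-∀

module HeadsLoop {n : ℕ} .{{_ : NonZero n}} (G : Graph n) (w : Fin n → ℕ) (l d : ℕ)
            {ord vis par bot : ℕ → ℕ}
            (preorder : DepthFirst.Dfs n (Input.adjacency G w) n ord vis par)
            (tree : EarTree n (λ a b → DepthFirst.E n (Input.adjacency G w) (ord a) (ord b)) par bot)
            {M : ℕ} (1≤M : 1 ≤ M) (ear≤M : ∀ {h m v} → EarTree.Ear tree h m v → m ≤ M) where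

  open Main G w l d preorder tree public
  open Input G w using (module Indexed)
  open Indexed preorder using (vtx; vtx-injective)
  open EarTree tree
  open Stages G w preorder tree
  open Costs (suc n)
  open Amortised 1≤M

  stageState-kept : ∀ {s s′ i ρ} → regs s′ 1 ≡ regs s 1 → regs s′ 3 ≡ regs s 3 → regs s′ 4 ≡ regs s 4 →
    regs s′ 0 ≡ regs s 0 → regs s′ 5 ≡ regs s 5 → regs s′ 64 ≡ regs s 64 → arrs s′ ≡ arrs s →
    StageState s i ρ → StageState s′ i ρ
  stageState-kept {s} {s′} {i} {ρ} e₁ e₃ e₄ e₀ e₅ e₆₄ refl ((c1 , c3 , c4) , a , b , c , fr , unit , tabs) =
    (trans e₁ c1 , trans e₃ c3 , trans e₄ c4) , trans e₀ a , b , c ,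
    (λ t t≥ → fr t (subst (_≤ t) e₅ t≥)) ,
    subst (UnitTable s′) (sym e₆₄) (unit-kept {s} {s′} kept unit) ,
    vertexTables-kept {s} {s′} {i} {ρ} kept refl tabs
    where
    kept : Kept s s′
    kept = kept-eq (sym e₅) refl

  stageState-suc : ∀ {s i ρ} → StageState s (suc i) ρ → StageState s i ρ
  stageState-suc {i = i} (a , b , c , e , f , g , tabs) =
    a , b , c , e , f , g , λ y y<n lv → tabs y y<n (live-suc {i} {y} lv)

  -- Distinct ears are disjoint, so that the lengths of all ears add up to at
  -- most n.
  Visited : ℕ → List (Fin n) → Set
  Visited i us = Unique us × (∀ {p} → p ∈ us → ∃[ h ] i ≤ h × Head h × ∃[ y ] y < n × p ≡ vtx y × bot y ≡ bot h)

  visited-suc : ∀ {i us} → Visited (suc i) us → Visited i us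
  visited-suc (u , f) = u , λ p∈ → let h , i<h , rest = f p∈ in h , <⇒≤ i<h , rest

  module _ {h m : ℕ} {v : ℕ → ℕ} (ear : Ear h m v) where
    open Ear ear

    earList : ℕ → List (Fin n)
    earList zero    = []
    earList (suc i) = vtx (v (suc i)) ∷ earList i

    ∈-earList : ∀ {j p} → p ∈ earList j → ∃[ i ] 1 ≤ i × i ≤ j × p ≡ vtx (v i)
    ∈-earList {suc j} (here eq) = suc j , s≤s z≤n , ≤-refl , eq
    ∈-earList {suc j} (there p∈) with ∈-earList p∈
    ... | i , 1≤i , i≤j , eq = i , 1≤i , m≤n⇒m≤1+n i≤j , eq

    earList-length : ∀ j → length (earList j) ≡ j
    earList-length zero    = refl
    earList-length (suc j) = cong suc (earList-length j)

    earList-unique : ∀ {j} → j ≤ m → Unique (earList j)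
    earList-unique {zero} _ = []
    earList-unique {suc j} j<m = All.tabulate (λ p∈ eq → let i , 1≤i , i≤j , eq′ = ∈-earList p∈ in
        <⇒≢ (s≤s i≤j) (distinct 1≤i (≤-trans i≤j (<⇒≤ j<m)) (s≤s z≤n) j<m
          (vtx-injective (bound 1≤i (≤-trans i≤j (<⇒≤ j<m))) (bound (s≤s z≤n) j<m) (trans (sym eq′) (sym eq)))))
      ∷ earList-unique (<⇒≤ j<m)

    visit-ear : ∀ {us} → Visited (suc h) us → Visited h (earList m ++ us)
    visit-ear {us} (u , f) = Unique-++⁺ (earList-unique ≤-refl) u apart , λ p∈ → case ∈-++⁻ (earList m) p∈ of λ
        { (inj₁ q) → let i , 1≤i , i≤m , eq = ∈-earList q in
            h , ≤-refl , head , v i , bound 1≤i i≤m , eq , inside 1≤i i≤m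
        ; (inj₂ q) → let h′ , h<h′ , rest = f q in h′ , <⇒≤ h<h′ , rest }
      where
      apart : ∀ {p} → p ∈ earList m × p ∈ us → ⊥
      apart (p , q) with ∈-earList p | f q
      ... | i , 1≤i , i≤m , eq | h′ , h<h′ , H′ , y , y<n , eq′ , bot≡ =
        <⇒≢ h<h′ (head-unique head H′ (trans (sym (inside 1≤i i≤m))
          (trans (cong bot (vtx-injective (bound 1≤i i≤m) y<n (trans (sym eq) eq′))) bot≡)))

  private
    A K : ℕ
    A = (1 + cost headE) + (6 + earCoeff) * Y
    K = (6 + removalCoeff) * Y

    I : ℕ → ℕ → State → Set
    I i u s = ∃[ ρ ] Stage i ρ × StageState s i ρ × ∃[ us ] length us ≡ u × Visited i us

  wpt-heads : ∀ {s ρ} → Stage n ρ → StageState s n ρ →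
    wpt headsCmd (λ t s′ → (∃[ ρ ] Stage 0 ρ × StageState s′ 0 ρ) × t ≤ headsCoeff * (suc n * Y)) s
  wpt-heads {s} {ρ} st stst@(_ , e₀ , _) =
    wpt-map (λ { t s′ _ (u′ , (ρ′ , st′ , stst′ , us , len , uniq , _) , le) → (ρ′ , st′ , stst′) ,
        budget (subst (_≤ n) len (unique-length uniq))
          (≤-trans (≤-reflexive (trans (sym (+-identityʳ t)) (cong (t +_) (sym (*-zeroʳ K)))))
            (subst (λ x → t + K * 0 ≤ 4 + x * (6 + A) + K * u′) e₀ le)) })
      (wpt-for A K I 0
        (subst (λ i → I i 0 (writeReg 50 (regs s 0) s)) (sym e₀)
          (ρ , st , stageState-kept {s} {writeReg 50 (regs s 0) s} {n} {ρ} refl refl refl refl refl refl refl stst , [] , refl , [] , λ ()))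
        pass)
    where
    budget : ∀ {t u} → u ≤ n → t ≤ 4 + n * (6 + A) + K * u → t ≤ headsCoeff * (suc n * Y)
    budget {t} {u} u≤n le = begin
      t ≤⟨ le ⟩
      4 + n * (6 + A) + K * u
        ≤⟨ +-mono-≤ (+-mono-≤ four (*-mono-≤ (n≤1+n n) a≤)) (*-monoʳ-≤ K (≤-trans u≤n (n≤1+n n))) ⟩
      4 * (suc n * Y) + suc n * ((7 + cost headE + (6 + earCoeff)) * Y) + (6 + removalCoeff) * Y * suc n
        ≡⟨ collect 4 (7 + cost headE + (6 + earCoeff)) (6 + removalCoeff) (suc n) Y ⟩
      headsCoeff * (suc n * Y) ∎
      where
      open ≤-Reasoning
      collect : ∀ a b c x y → a * (x * y) + x * (b * y) + c * y * x ≡ (a + b + c) * (x * y)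
      collect = solve-∀
      four : 4 ≤ 4 * (suc n * Y)
      four = *-monoʳ-≤ 4 (*-mono-≤ (s≤s (z≤n {n})) 1≤Y)
      a≤ : 6 + A ≤ (7 + cost headE + (6 + earCoeff)) * Y
      a≤ = begin
        6 + ((1 + cost headE) + (6 + earCoeff) * Y) ≡⟨⟩
        (7 + cost headE) + (6 + earCoeff) * Y ≤⟨ +-monoˡ-≤ ((6 + earCoeff) * Y) (atY (7 + cost headE)) ⟩
        (7 + cost headE) * Y + (6 + earCoeff) * Y ≡⟨ *-distribʳ-+ Y (7 + cost headE) (6 + earCoeff) ⟨
        (7 + cost headE + (6 + earCoeff)) * Y ∎
    pass : ∀ i u s′ → i < regs s 0 → Outside headsCmd s s′ → I (suc i) u s′ →
      wpt (when headE earBody) (λ t s″ → ∃[ u′ ] I i u′ s″ × t + K * u ≤ A + K * u′) (writeReg 50 i s′)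
    pass i u s′ i< (o , oa) (ρ , st , stst@((c1 , c3 , c4) , e₀′ , e₄ , e₅ , _) , us , refl , vis) = wpt-when
      (λ c → let c₁ , c₂ = mul-true {i} c
                 head : Head i
                 head = n≢0⇒n>0 c₁ , subst (i <_) e₀ i< ,
                   λ eq → equ-true-zero c₂ (trans (cong₂ (λ f g → f (g i)) e₅ e₄) (trans eq (cong (λ f → f i) (sym e₅))))
             in wpt-bound (λ _ → Unit) (λ s″ → earTime (regs s″ 54))
                  (λ _ → wpt-run (wpt-ear (writeReg 50 i s′)
                    (≤-trans (≤-reflexive e₀′) (n≤1+n n) , ≤-reflexive c3)))
                  (wp-earBody {P = λ s″ → ∃[ m ] Σ (ℕ → ℕ) λ v → ∃[ ρ′ ] Ear i m v × regs s″ 54 ≡ m × Stage i ρ′ × StageState s″ i ρ′}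
                    st (stageState-kept {s′} {writeReg 50 i s′} {suc i} {ρ} refl refl refl refl refl refl refl stst) refl head
                    (λ s″ m v ρ′ ear e st′ stst′ → m , v , ρ′ , ear , e , st′ , stst′))
                  λ { s″ t (m , v , ρ′ , ear , e , st′ , stst′) le →
                    m + length us ,
                    (ρ′ , st′ , stst′ , earList ear m ++ us ,
                      trans (length-++ (earList ear m)) (cong (_+ length us) (earList-length ear m)) , visit-ear ear vis) ,
                    charge (≤-trans (le tt) (subst (λ x → earTime x ≤ (6 + earCoeff) * Y + m * K) {x = m} {y = regs s″ 54} (sym e) (ear≤ {m} (ear≤M ear)))) })
      (λ c → let ¬H : ¬ Head i
                 ¬H = λ { (0<i , i<n , ne) → case mul-false {i} c of λ
                   { (inj₁ z) → <⇒≢ 0<i (sym z)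
                   ; (inj₂ z) → ne (trans (cong₂ (λ f g → f (g i)) (sym e₅) (sym e₄))
                       (trans (equ-false-zero z) (cong (λ f → f i) e₅))) } }
             in length us , (ρ , stage-skip ¬H st ,
                  stageState-suc {writeReg 50 i s′} {i} {ρ} (stageState-kept {s′} {writeReg 50 i s′} {suc i} {ρ} refl refl refl refl refl refl refl stst) ,
                  us , refl , visited-suc vis) ,
                +-monoˡ-≤ (K * length us) (≤-trans (≤-reflexive (+-comm 1 (1 + cost headE)))
                  (+-monoʳ-≤ (1 + cost headE) (*-mono-≤ (s≤s (z≤n {5 + earCoeff})) 1≤Y))))
      where
      equ-true-zero : ∀ {a b} → ⟦ equ ⟧ᵒ (⟦ equ ⟧ᵒ a b) 0 ≢ 0 → a ≢ b
      equ-true-zero {a} {b} p = equ-false {a} {b} (equ-true {⟦ equ ⟧ᵒ a b} {0} p)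
      equ-false-zero : ∀ {a b} → ⟦ equ ⟧ᵒ (⟦ equ ⟧ᵒ a b) 0 ≡ 0 → a ≡ b
      equ-false-zero {a} {b} p = equ-true {a} {b} (equ-false {⟦ equ ⟧ᵒ a b} {0} p)
      charge : ∀ {t m} → t ≤ (6 + earCoeff) * Y + m * K → 1 + cost headE + t + K * length us ≤ A + K * (m + length us)
      charge {t} {m} le = begin
        1 + cost headE + t + K * length us
          ≤⟨ +-monoˡ-≤ (K * length us) (+-monoʳ-≤ (1 + cost headE) le) ⟩
        1 + cost headE + ((6 + earCoeff) * Y + m * K) + K * length us
          ≡⟨ rearrange (1 + cost headE) ((6 + earCoeff) * Y) m K (length us) ⟩
        A + K * (m + length us) ∎
        where
        open ≤-Reasoning
        rearrange : ∀ a b m k u → a + (b + m * k) + k * u ≡ a + b + k * (m + u)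
        rearrange = solve-∀

betterE : Objective → Expr
betterE MinNum = op add (op equ (arr 14 (lit 0)) (lit 0)) (op leq (reg 30) (arr 14 (lit 0)))
betterE MaxNum = op leq (arr 14 (lit 0)) (reg 30)

recordBest finalClose digitStep digitLoop decodeBody decode : Cmd
recordBest = store 14 (lit 0) (reg 30) ⨟ store 14 (lit 1) (arr 8 loadE)
finalClose = newTable 65 ⨟ set 20 (reg 65) ⨟ set 33 (arr 11 (lit 0)) ⨟ closeInto
digitStep  = set 7 (op sub (reg 7) (reg 67)) ⨟ set 66 (op add (lit 1) (reg 66))
digitLoop  = for 68 (reg 0) (when (op leq (reg 67) (reg 7)) digitStep)
decodeBody = set 66 (lit 0) ⨟ set 67 (arr 12 (reg 9)) ⨟ digitLoop ⨟ store 0 (reg 9) (reg 66)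
decode     = set 7 (arr 14 (lit 1)) ⨟ for 9 (reg 0) decodeBody

scan : Objective → Cmd
scan obj = set 33 (reg 65) ⨟ forEach 33 30 31 32 (when (betterE obj) recordBest)

better-true : ∀ obj s → ⟦ betterE obj ⟧ s ≢ 0 → arrs s 14 0 ≢ 0 → AtLeastAsGood obj (regs s 30) (arrs s 14 0)
better-true MinNum s c nz = case add-true {⟦ equ ⟧ᵒ (arrs s 14 0) 0} c of λ
  { (inj₁ z) → contradiction (equ-true {arrs s 14 0} {0} z) nz ; (inj₂ le) → leq-true le }
better-true MaxNum s c nz = leq-true c

better-false : ∀ obj s → ⟦ betterE obj ⟧ s ≡ 0 → arrs s 14 0 ≢ 0 × AtLeastAsGood obj (arrs s 14 0) (regs s 30)
better-false MinNum s c = let a , b = add-false {⟦ equ ⟧ᵒ (arrs s 14 0) 0} c in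
  equ-false {arrs s 14 0} {0} a , <⇒≤ (leq-false b)
better-false MaxNum s c = (λ z → <⇒≱ (leq-false c) (subst (_≤ regs s 30) (sym z) z≤n)) , <⇒≤ (leq-false c)

good-refl : ∀ obj {k} → AtLeastAsGood obj k k
good-refl MinNum = ≤-refl
good-refl MaxNum = ≤-refl

good-trans : ∀ obj {a b c} → AtLeastAsGood obj a b → AtLeastAsGood obj b c → AtLeastAsGood obj a c
good-trans MinNum p q = ≤-trans p q
good-trans MaxNum p q = ≤-trans q p

module _ (d : ℕ) (obj : Objective) where
  open Buckets d

  wp-scan : ∀ {P s} Φ → Good (arrs s) (regs s 65) Φ → (∀ {k e o c δ} → Φ k e o c δ → k ≢ 0) → arrs s 14 0 ≡ 0 →
    (∀ s′ → Outside (scan obj) s s′ → let best = arrs s′ 14 0 in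
      (best ≢ 0 → ∃[ e ] ∃[ o ] ∃[ δ ] Φ best e o (arrs s′ 14 1) δ) →
      (∀ k q m e → k < regs s 3 → q < regs s 3 → m < 2 → arrs s 6 (key (regs s 65) k q m) ≡ suc e →
        best ≢ 0 × AtLeastAsGood obj best k) → P s′) →
    wp (scan obj) P s
  wp-scan {P} {s} Φ good pos zero₁₄ end =
    wp-map {P = λ s′ → Inv (arrs s′) × (∀ k q m → k < regs s 3 → q < regs s 3 → m < 2 → Goal k q m (arrs s′))}
      (λ { s′ o ((_ , inv) , goals) → end s′ o inv λ k q m e k< q< m< eq → goals k q m k< q< m< (λ z → case trans (sym eq) z of λ ()) })
    (wp-set⨟ $ wp-forEach tt tt tt tt Inv _≼_ Goal
      (λ nz → nz , good-refl obj)
      (λ f g nz → let nz′ , r = f nz ; nz″ , r′ = g nz′ in nz″ , good-trans obj r′ r)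
      (λ le goal nz → let z , r = goal nz ; z′ , r′ = le z in z′ , good-trans obj r′ r)
      (refl , λ nz → contradiction zero₁₄ nz)
      pass
      (λ k q m A (e₆ , _) z nz → contradiction (trans (cong (λ f → f (key F k q m)) (sym e₆)) z) nz)
      (λ s′ _ inv _ goals → inv , goals))
    where
    F : ℕ
    F = regs s 65
    Inv : Arrs → Set
    Inv A = A 6 ≡ arrs s 6 × (A 14 0 ≢ 0 → ∃[ e ] ∃[ o ] ∃[ δ ] Φ (A 14 0) e o (A 14 1) δ)
    _≼_ : Arrs → Arrs → Set
    A ≼ B = A 14 0 ≢ 0 → B 14 0 ≢ 0 × AtLeastAsGood obj (B 14 0) (A 14 0)
    Goal : ℕ → ℕ → ℕ → Arrs → Set
    Goal k q m A = arrs s 6 (key F k q m) ≢ 0 → A 14 0 ≢ 0 × AtLeastAsGood obj (A 14 0) k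
    used : ∀ {a} → a ≢ 0 → ∃[ e ] a ≡ suc e
    used {zero} nz = contradiction refl nz
    used {suc e} nz = e , refl
    pass : ∀ k q m s′ → k < regs s 3 → q < regs s 3 → m < 2 →
      Outside (forEach 33 30 31 32 (when (betterE obj) recordBest)) (writeReg 33 F s) s′ →
      regs s′ 30 ≡ k → regs s′ 31 ≡ q → regs s′ 32 ≡ m → Inv (arrs s′) → arrs s′ 6 (key F k q m) ≢ 0 →
      wp (when (betterE obj) recordBest) (λ s″ → Inv (arrs s″) × arrs s′ ≼ arrs s″ × Goal k q m (arrs s″)) s′
    pass k q m s′ _ _ m< (o , oa) refl refl refl (e₆ , inv) nz = wp-when
      (λ c →
        let x = key F (regs s′ 30) (regs s′ 31) (regs s′ 32)
            e , eq = used nz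
            φ = proj₁ (entry d {arrs s} {F} {Φ} good (regs s′ 30) (regs s′ 31) (regs s′ 32) e m<
                        (trans (cong (λ f → f x) (sym e₆)) eq))
            x≡ : ⟦ loadE ⟧ (writeArr 14 0 (regs s′ 30) s′) ≡ x
            x≡ = trans (key-eval (reg 33) (reg 30) (reg 31) (reg 32) (writeArr 14 0 (regs s′ 30) s′))
                   (cong (λ a → key a (regs s′ 30) (regs s′ 31) (regs s′ 32)) (o 33 tt))
            code≡ : arrs s 8 x ≡ arrs s′ 8 (⟦ loadE ⟧ (writeArr 14 0 (regs s′ 30) s′))
            code≡ = trans (cong (λ f → f x) (sym (oa 8 tt))) (cong (arrs s′ 8) (sym x≡))
        in wp-store⨟ $ wp-store
             ( (e₆ , λ _ → e , arrs s 7 x , arrs s 9 x , subst (λ c → Φ (regs s′ 30) e (arrs s 7 x) c (arrs s 9 x)) code≡ φ)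
             , (λ nz′ → pos φ , better-true obj s′ c nz′)
             , (λ _ → pos φ , good-refl obj)))
      (λ c → (e₆ , inv) , (λ nz′ → nz′ , good-refl obj) , λ _ → better-false obj s′ c)

value : ℕ → ℕ → (ℕ → ℕ) → ℕ
value B zero    D = 0
value B (suc v) D = value B v D + B ^ v * D v

value-< : ∀ B v D → (∀ x → x < v → D x < B) → value B v D < B ^ v
value-< B zero D _ = z<s
value-< B (suc v) D D< = begin-strict
  value B v D + B ^ v * D v <⟨ +-monoˡ-< (B ^ v * D v) (value-< B v D (λ x x< → D< x (m<n⇒m<1+n x<))) ⟩
  B ^ v + B ^ v * D v       ≡⟨ *-suc (B ^ v) (D v) ⟨
  B ^ v * suc (D v)         ≤⟨ *-monoʳ-≤ (B ^ v) (D< v (n<1+n v)) ⟩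
  B ^ v * B                 ≡⟨ *-comm (B ^ v) B ⟩
  B ^ suc v                 ∎
  where open ≤-Reasoning

wp-decode : ∀ {P s n} D → regs s 0 ≡ n → (∀ x → x < n → arrs s 12 x ≡ suc n ^ x) → (∀ x → x < n → D x ≤ n) →
  arrs s 14 1 ≡ value (suc n) n D →
  (∀ s′ → Outside decode s s′ → (∀ x → x < n → arrs s′ 0 x ≡ D x) → P s′) → wp decode P s
wp-decode {P} {s} {n} D refl pows D≤ code end =
  wp-map {P = λ s′ → ∀ x → x < n → arrs s′ 0 x ≡ D x} end
  (wp-set⨟ $ wp-for Decoded (code , λ x n≤x x<n → contradiction n≤x (<⇒≱ x<n)) pass
     λ s′ _ (_ , f) x → f x z≤n)
  where
  B : ℕ
  B = suc n
  Decoded : ℕ → State → Set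
  Decoded i s′ = regs s′ 7 ≡ value B i D × (∀ x → i ≤ x → x < n → arrs s′ 0 x ≡ D x)
  pass : ∀ i s′ → i < n → Outside (for 9 (reg 0) decodeBody) (writeReg 7 (arrs s 14 1) s) s′ → Decoded (suc i) s′ →
    wp decodeBody (Decoded i) (writeReg 9 i s′)
  pass i s′ i<n (o , oa) (e₇ , done) = wp-set⨟ $ wp-set⨟ $ wp-seq $
    wp-for Digit
      (D i , e₇ , refl , ≤-trans (D≤ i i<n) (≤-reflexive (sym (o 0 tt))))
      digit
      λ { s″ (o″ , oa″) (zero , e₇′ , e₆₆ , _) → wp-store
        ( trans e₇′ (trans (cong (R +_) (*-zeroʳ p)) (+-identityʳ R))
        , λ x i≤x x<n → subst₂ (λ k f → update f k (regs s″ 66) x ≡ D x) (sym (o″ 9 tt)) (sym (oa″ 0 tt))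
            (case m≤n⇒m<n∨m≡n i≤x of λ
              { (inj₁ i<x) → trans (update-other (arrs s′ 0) i (regs s″ 66) (<⇒≢ i<x)) (done x i<x x<n)
              ; (inj₂ refl) → trans (update-same (arrs s′ 0) i (regs s″ 66)) (trans (sym (+-identityʳ _)) e₆₆) }))
        ; s″ _ (suc x , _ , _ , ()) }
    where
    p : ℕ
    p = B ^ i
    p≡ : arrs s′ 12 i ≡ p
    p≡ = trans (cong (λ f → f i) (oa 12 tt)) (pows i i<n)
    R : ℕ
    R = value B i D
    R<p : R < p
    R<p = value-< B i D (λ x x<i → s≤s (D≤ x (<-trans x<i i<n)))
    Digit : ℕ → State → Set
    Digit j s″ = ∃[ x ] regs s″ 7 ≡ R + p * x × regs s″ 66 + x ≡ D i × x ≤ j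
    s₁ : State
    s₁ = writeReg 67 (arrs s′ 12 i) (writeReg 66 0 (writeReg 9 i s′))
    digit : ∀ j s″ → j < regs s′ 0 → Outside digitLoop s₁ s″ → Digit (suc j) s″ →
      wp (when (op leq (reg 67) (reg 7)) digitStep) (Digit j) (writeReg 68 j s″)
    digit j s″ _ (o″ , _) (x , e₇′ , e₆₆ , x≤) = wp-when
      (λ c → let p≤ : p ≤ R + p * x
                 p≤ = subst₂ _≤_ (trans (o″ 67 tt) p≡) e₇′ (leq-true c)
             in wp-set⨟ $ wp-set (taken x e₇′ e₆₆ x≤ p≤))
      (λ c → left x e₇′ e₆₆ x≤ (subst₂ _<_ e₇′ (trans (o″ 67 tt) p≡) (leq-false c)))
      where
      taken : ∀ x → regs s″ 7 ≡ R + p * x → regs s″ 66 + x ≡ D i → x ≤ suc j → p ≤ R + p * x →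
        ∃[ x ] regs s″ 7 ∸ regs s″ 67 ≡ R + p * x × suc (regs s″ 66) + x ≡ D i × x ≤ j
      taken zero _ _ _ p≤ = contradiction (≤-trans p≤ (≤-reflexive (trans (cong (R +_) (*-zeroʳ p)) (+-identityʳ R)))) (<⇒≱ R<p)
      taken (suc x) e₇′ e₆₆ (s≤s x≤) _ = x ,
        trans (cong₂ _∸_ e₇′ (trans (o″ 67 tt) p≡))
          (trans (cong (_∸ p) (rearrange R p x)) (m+n∸m≡n p (R + p * x))) ,
        trans (sym (+-suc (regs s″ 66) x)) e₆₆ , x≤
        where
        rearrange : ∀ r p x → r + p * suc x ≡ p + (r + p * x)
        rearrange = solve-∀
      left : ∀ x → regs s″ 7 ≡ R + p * x → regs s″ 66 + x ≡ D i → x ≤ suc j → R + p * x < p →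
        Digit j (writeReg 68 j s″)
      left zero e₇′ e₆₆ _ _ = 0 , e₇′ , e₆₆ , z≤n
      left (suc x) e₇′ _ _ <p = contradiction <p (≤⇒≯ (≤-trans (m≤m*n p (suc x)) (m≤n+m (p * suc x) R)))

-- From a code to a partition

below : ℕ → (ℕ → ℕ) → ℕ
below zero    f = 0
below (suc n) f = below n f + f n

below-suc : ∀ n f → below (suc n) f ≡ f 0 + below n (f ∘ suc)
below-suc zero f = sym (+-identityʳ (f 0))
below-suc (suc n) f = trans (cong (_+ f (suc n)) (below-suc n f)) (+-assoc (f 0) (below n (f ∘ suc)) (f (suc n)))

sum-below : ∀ n f → sum (tabulate {n = n} (f ∘ toℕ)) ≡ below n f
sum-below zero f = refl
sum-below (suc n) f = trans (cong (f 0 +_) (sum-below n (f ∘ suc))) (sym (below-suc n f))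

total-below : ∀ n f → total (f ∘ toℕ) (allFin n) ≡ below n f
total-below n f = trans (cong sum (map-tabulate {n = n} (λ x → x) (f ∘ toℕ))) (sum-below n f)

value-below : ∀ B n D → value B n D ≡ below n (λ x → B ^ x * D x)
value-below B zero D = refl
value-below B (suc n) D = cong (_+ B ^ n * D n) (value-below B n D)

module _ {A : Set} where

  ∈-concat-lookup : ∀ {v : A} (xss : List (List A)) → v ∈ concat xss → ∃[ i ] v ∈ lookup xss i
  ∈-concat-lookup (xs ∷ xss) v∈ with ∈-++⁻ xs v∈
  ... | inj₁ p = fzero , p
  ... | inj₂ p = let i , q = ∈-concat-lookup xss p in fsuc i , q

  lookup-∈-concat : ∀ {v : A} (xss : List (List A)) i → v ∈ lookup xss i → v ∈ concat xss
  lookup-∈-concat (xs ∷ xss) fzero    p = ∈-++⁺ˡ p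
  lookup-∈-concat (xs ∷ xss) (fsuc i) p = ∈-++⁺ʳ xs (lookup-∈-concat xss i p)

  unique-++⁻ : ∀ (xs : List A) {ys} → Unique (xs ++ ys) → Unique xs × Unique ys × (∀ {v} → v ∈ xs → v ∉ ys)
  unique-++⁻ [] u = [] , u , λ ()
  unique-++⁻ (x ∷ xs) (x∉ ∷ u) with unique-++⁻ xs u
  ... | u₁ , u₂ , disj = All.tabulate (λ p → All.lookup x∉ (∈-++⁺ˡ p)) ∷ u₁ , u₂ , λ
    { (here refl) q → All.lookup x∉ (∈-++⁺ʳ xs q) refl ; (there p) q → disj p q }

  lookup-unique : ∀ (xss : List (List A)) → Unique (concat xss) → ∀ i → Unique (lookup xss i)
  lookup-unique (xs ∷ xss) u fzero    = proj₁ (unique-++⁻ xs u)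
  lookup-unique (xs ∷ xss) u (fsuc i) = lookup-unique xss (proj₁ (proj₂ (unique-++⁻ xs u))) i

  lookup-disjoint : ∀ {v : A} (xss : List (List A)) → Unique (concat xss) → ∀ i j →
    v ∈ lookup xss i → v ∈ lookup xss j → i ≡ j
  lookup-disjoint (xs ∷ xss) u fzero fzero p q = refl
  lookup-disjoint (xs ∷ xss) u fzero (fsuc j) p q =
    contradiction (lookup-∈-concat xss j q) (proj₂ (proj₂ (unique-++⁻ xs u)) p)
  lookup-disjoint (xs ∷ xss) u (fsuc i) fzero p q =
    contradiction (lookup-∈-concat xss i p) (proj₂ (proj₂ (unique-++⁻ xs u)) q)
  lookup-disjoint (xs ∷ xss) u (fsuc i) (fsuc j) p q =
    cong fsuc (lookup-disjoint xss (proj₁ (proj₂ (unique-++⁻ xs u))) i j p q)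

  labelled-total : ∀ (f g : A → ℕ) j xss → (∀ i {x} → x ∈ lookup xss i → g x ≡ j + toℕ i) →
    labelled f j xss ≡ total (λ x → f x * g x) (concat xss)
  labelled-total f g j [] _ = refl
  labelled-total f g j (xs ∷ xss) h = trans
    (cong₂ _+_ (constant xs (λ p → trans (h fzero p) (+-identityʳ j)))
      (labelled-total f g (suc j) xss (λ i p → trans (h (fsuc i) p) (+-suc j (toℕ i)))))
    (sym (total-++ (λ x → f x * g x) xs (concat xss)))
    where
    constant : ∀ xs → (∀ {x} → x ∈ xs → g x ≡ j) → j * total f xs ≡ total (λ x → f x * g x) xs
    constant [] _ = *-zeroʳ j
    constant (x ∷ xs) h = trans (*-distribˡ-+ j (f x) (total f xs))
      (cong₂ _+_ (trans (*-comm j (f x)) (cong (f x *_) (sym (h (here refl))))) (constant xs (h ∘ there)))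

module Build {n : ℕ} (G : Graph n) (w : Fin n → ℕ) (l d : ℕ) (pw : Fin n → ℕ) where
  open Solutions G w l d pw
  open DecMembership (_≟ᶠ_ {n}) using () renaming (_∈?_ to _∈ₗ?_)

  subset : List (Fin n) → Subset n
  subset xs = Vec.tabulate (λ v → does (v ∈ₗ? xs))

  subset-∈ : ∀ {xs v} → v ∈ₛ subset xs → v ∈ xs
  subset-∈ {xs} {v} p with v ∈ₗ? xs | trans (sym (Vec.lookup∘tabulate (λ v → does (v ∈ₗ? xs)) v)) (Vec.[]=⇒lookup p)
  ... | yes q | _  = q
  ... | no _  | ()

  ∈-subset : ∀ {xs v} → v ∈ xs → v ∈ₛ subset xs
  ∈-subset {xs} {v} p = Vec.lookup⇒[]= v (subset xs)
    (trans (Vec.lookup∘tabulate (λ v → does (v ∈ₗ? xs)) v) (dec-true (v ∈ₗ? xs) p))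

  rooted-connected : ∀ {r xs} → Rooted r xs → InducesConnected G (subset xs)
  rooted-connected {r} {xs} (_ , conn) {x} {y} x∈ y∈ =
    Star.reverse back (to (conn (subset-∈ x∈))) ◅◅ to (conn (subset-∈ y∈))
    where
    to : ∀ {p q} → Star (Within xs) p q → Star (InducedAdj G (subset xs)) p q
    to = Star.map λ (p , q , e) → ∈-subset p , ∈-subset q , e
    back : ∀ {p q} → InducedAdj G (subset xs) p q → InducedAdj G (subset xs) q p
    back (p , q , e) = q , p , Graph.symmetric G e

  subset-weight : ∀ {xs} → Unique xs → clusterWeight w (subset xs) ≡ total w xs
  subset-weight {xs} u = total-↭ w (unique-↭ (Unique-filter⁺ (_∈? subset xs) (allFin⁺ n)) u
    (λ p → subset-∈ (proj₂ (∈-filter⁻ (_∈? subset xs) {xs = allFin n} p)))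
    (λ p → ∈-filter⁺ (_∈? subset xs) (∈-allFin _) (∈-subset p)))

  module _ {k e o c δ : ℕ} (s : Sol (allFin n) (_≡ []) k e o c δ) where
    open Sol s

    concat-↭ : concat closed ↭ allFin n
    concat-↭ = subst (λ xs → xs ++ concat closed ↭ allFin n) ok covers

    concat-unique : Unique (concat closed)
    concat-unique = unique-resp concat-↭ (allFin⁺ n)
      where
      unique-resp : ∀ {xs ys : List (Fin n)} → xs ↭ ys → Unique ys → Unique xs
      unique-resp p u = Permutationₛ.Unique-resp-↭ (setoid (Fin n)) (↭⇒↭ₛ (↭-sym p)) u

    cluster-at : ∀ i → Cluster (lookup closed i)
    cluster-at i = All.lookup clusters (∈-lookup i)

    position-of : ∀ v → ∃[ i ] v ∈ lookup closed i
    position-of v = ∈-concat-lookup closed (∈-resp-↭ (↭-sym concat-↭) (∈-allFin v))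

    partition : LUPartition G w l (l + d) (length closed)
    partition = record
      { cluster   = λ i → subset (lookup closed i)
      ; nonempty  = λ i → let (r , r∈ , _) , _ = cluster-at i in r , ∈-subset r∈
      ; disjoint  = λ {i} {j} i≢j (v , v∈) → let p , q = x∈p∩q⁻ (subset (lookup closed i)) (subset (lookup closed j)) v∈
                    in i≢j (lookup-disjoint closed concat-unique i j (subset-∈ p) (subset-∈ q))
      ; covering  = λ v → let i , p = position-of v in i , ∈-subset p
      ; connected = λ i → let (r , root) , _ = cluster-at i in rooted-connected root
      ; lower     = λ i → subst (l ≤_) (sym (subset-weight (lookup-unique closed concat-unique i))) (proj₁ (proj₂ (cluster-at i)))
      ; upper     = λ i → subst (_≤ l + d) (sym (subset-weight (lookup-unique closed concat-unique i))) (proj₂ (proj₂ (cluster-at i))) }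

    digit : Fin n → ℕ
    digit v = toℕ (proj₁ (position-of v))

    digit-cluster : ∀ v i → v ∈ₛ LUPartition.cluster partition i → digit v ≡ toℕ i
    digit-cluster v i v∈ = cong toℕ
      (lookup-disjoint closed concat-unique _ i (proj₂ (position-of v)) (subset-∈ v∈))

    code-digits : c ≡ total (λ v → pw v * digit v) (allFin n)
    code-digits = trans code-c (trans
      (labelled-total pw digit 0 closed (λ i p → cong toℕ (lookup-disjoint closed concat-unique _ i (proj₂ (position-of _)) p)))
      (total-↭ (λ v → pw v * digit v) concat-↭))

opaque
  unfolding wpt

  wpt-set : ∀ {r e Q s} → Q (1 + cost e) (writeReg r (⟦ e ⟧ s) s) → wpt (set r e) Q s
  wpt-set q = q

  wpt-compile : ∀ {c Q s} → T (wellFormed c) → wpt c Q s →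
    ∃[ t ] ∃[ s′ ] ⟨ compile c , s ⟩⇓⟨ t , s′ ⟩ × Q t s′
  wpt-compile {c} {s = s} wf q = time c s , exec c s , compile-correct c s wf , q

-- Register 3 holds n + 1, register 4 u − l + 1, register 5 the number of the
-- first unused table and register 64 that of the table of the empty graph.
-- Arrays 2, 4 and 5 hold the preorder, the parents and the map bot, array 10
-- the weights of the parts of the graph that the tables describe, array 11 the
-- table of each vertex, array 12 the powers of n + 1 and array 13 an ear.
main : Objective → Cmd
main obj =
    set 3 (op add (lit 1) (reg 0))
  ⨟ set 4 (op add (lit 1) (op sub (reg 2) (reg 1)))
  ⨟ dfs
  ⨟ bottoms
  ⨟ powers
  ⨟ unitCmd
  ⨟ leaves
  ⨟ headsCmd
  ⨟ finalClose
  ⨟ scan obj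
  ⨟ decode
  ⨟ set 0 (arr 14 (lit 0))

module Finish {n : ℕ} .{{_ : NonZero n}} (G : Graph n) (w : Fin n → ℕ) (l d : ℕ)
            {ord vis par bot : ℕ → ℕ}
            (preorder : DepthFirst.Dfs n (Input.adjacency G w) n ord vis par)
            (tree : EarTree n (λ a b → DepthFirst.E n (Input.adjacency G w) (ord a) (ord b)) par bot) where

  open Main G w l d preorder tree
  open Buckets d
  open Hits d
  open Solutions G w l d pw
  open Input G w using (module Indexed; 0<n)
  open Indexed preorder using (vtx)
  open Stages G w preorder tree

  Closed : Family
  Closed k e o c δ = Sol (allFin n) (_≡ []) k e o c δ × k ≢ 0

  clusters-count : ∀ {K} (Q : Partition K) {g L} → Lab Q (allFin n) g L → suc (length L) ≡ K
  clusters-count {K} Q {g} {L} lab = trans (↭-length (unique-↭ u (allFin⁺ K) (λ _ → ∈-allFin _) all))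
      (length-tabulate (λ x → x))
    where
    open Lab Q lab
    u : Unique (g ∷ L)
    u = All.tabulate (λ p eq → apart p (sym eq)) ∷ unique
    all : ∀ {ℓ} → ℓ ∈ allFin K → ℓ ∈ g ∷ L
    all {ℓ} _ = let v , v∈ = LUPartition.nonempty Q ℓ ; eq = ∈-label Q v∈ in
      case labels (∈-allFin v) of λ
        { (inj₁ e) → here (trans (sym eq) e) ; (inj₂ e) → there (subst (_∈ L) eq e) }

  wp-finalClose : ∀ {P s ρ} → Stage 0 ρ → StageState s 0 ρ →
    (∀ s′ → Outside finalClose s s′ → Good (arrs s′) (regs s′ 65) Closed →
      (∀ {K} → Partition K → ∃[ q ] ∃[ m ] ∃[ e ]
        K < suc n × q < suc n × m < 2 × arrs s′ 6 (key (regs s′ 65) K q m) ≡ suc e) → P s′) →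
    wp finalClose P s
  wp-finalClose {P} {s} {ρ} st ((c1 , c3 , c4) , _ , _ , _ , fresh , _ , tabs) end =
    wp-map {P = λ s′ → Good (arrs s′) (regs s′ 65) Closed ×
        (∀ {K} → Partition K → ∃[ q ] ∃[ m ] ∃[ e ]
          K < suc n × q < suc n × m < 2 × arrs s′ 6 (key (regs s′ 65) K q m) ≡ suc e)}
      (λ { s′ o (good , comp) → end s′ o good comp })
    (wp-new $ wp-set⨟ $ wp-set⨟ $
      wp-closeInto d (Sol (allFin n) (Rooted root)) Closed c4 (<⇒≢ R.t<) R.good
        (good-fresh Closed (fresh z ≤-refl))
        (λ {k} {e′ = e′} sol W≡ le le′ →
          sol-close (λ r → root , r) sol (trans (sym R.weight) (trans W≡ (cong (λ l → suc k * l + e′) c1))) le le′ , λ ())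
        λ s′ (o , oa) good gr goals →
          subst (λ t → Good (arrs s′) t Closed) (sym (o 65 tt)) good ,
          λ {K} Q → subst (λ t → ∃[ q ] ∃[ m ] ∃[ e ] K < suc n × q < suc n × m < 2 × arrs s′ 6 (key t K q m) ≡ suc e)
            (sym (o 65 tt)) (found s′ good goals Q))
    where
    root : Fin n
    root = vtx 0
    z : ℕ
    z = regs s 5
    all-root : ∀ v → ρ v ≡ 0
    all-root v = live-0 {ρ v} z≤n (Stage.ρ< st v) (Stage.live st v)
    piece-all : piece ρ 0 ↭ allFin n
    piece-all = unique-↭ (piece-unique ρ 0) (allFin⁺ n) (λ _ → ∈-allFin _) (λ {v} _ → ∈-piece (all-root v))
    0-live : Live 0 0
    0-live h _ (0<h , h<n , _) eq = <⇒≱ 0<h (≤-trans (EarTree.bot-≥ tree 0<h h<n) (≤-reflexive (trans (sym eq) (EarTree.bot-0 tree))))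
    tb : Table s (arrs s 11 0) (allFin n) (Rooted root) Always root
    tb = table-↭ piece-all (tabs 0 0<n 0-live)
    module R = Table tb
    found : ∀ s′ → Good (arrs s′) z Closed →
      (∀ k q m e e′ → k < regs s 3 → q < regs s 3 → m < 2 → arrs s 6 (key (arrs s 11 0) k q m) ≡ suc e →
        arrs s 10 (arrs s 11 0) ≡ suc k * regs s 1 + e′ → e ≤ e′ → e′ ≤ e + d → ∃[ q′ ] Span (arrs s′) z (suc k) q′ e′) →
      ∀ {K} → Partition K → ∃[ q ] ∃[ m ] ∃[ e ] K < suc n × q < suc n × m < 2 × arrs s′ 6 (key z K q m) ≡ suc e
    found s′ good goals {K} Q = read (hit-entry {Φ = Closed} good (λ φ → sol-bound (proj₁ φ))
        (hits (shut (R.compl Q tt)) (≤-refl , m≤m+n _ d)))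
      where
      h : Fin K
      h = label Q root
      bonus : Completes (arrs s) (arrs s 11 0) (allFin n) Q root → ℕ
      bonus (L , _) = excessOf Q h + excesses Q L
      shut : (comp : Completes (arrs s) (arrs s 11 0) (allFin n) Q root) → Complete (arrs s′) z K (bonus comp)
      shut (L , lab , cm) = subst (λ k → Complete (arrs s′) z k (excessOf Q h + excesses Q L)) (clusters-count Q lab)
        (complete-close R.good (sol-bounded (allFin n) (Rooted root)) goals
          (subst (length L <_) (sym c3) (lab-length Q lab))
          (trans R.weight (trans (weight-split Q (allFin⁺ n) lab (λ _ → ∈-allFin _))
            (cong (λ l → suc (length L) * l + (excessOf Q h + excesses Q L)) (sym c1))))
          (m≤n+m (excesses Q L) (excessOf Q h) ,
           ≤-trans (+-monoˡ-≤ (excesses Q L) (excess≤d Q h)) (≤-reflexive (+-comm d (excesses Q L))))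
          cm)
      read : ∀ {c} → (∃[ q ] ∃[ m ] ∃[ e ] q ≤ K × m < 2 × arrs s′ 6 (key z K q m) ≡ suc e × Near e c) →
        ∃[ q ] ∃[ m ] ∃[ e ] K < suc n × q < suc n × m < 2 × arrs s′ 6 (key z K q m) ≡ suc e
      read (q , m , e , q≤ , m< , eq , _) =
        q , m , e , s≤s (clusters≤n Q) , s≤s (≤-trans q≤ (clusters≤n Q)) , m< , eq

  module _ (obj : Objective) where

    ending : Cmd
    ending = set 0 (arr 14 (lit 0))

    -- Cells 0 and 1 of array 14 hold the best number of clusters, 0 if there is
    -- no partition, and the code of a partition with that many clusters.
    Answer : State → Set
    Answer s = let best = arrs s 14 0 in
        (best ≢ 0 → ∃[ e ] ∃[ o ] ∃[ δ ] Sol (allFin n) (_≡ []) best e o (arrs s 14 1) δ)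
      × (∀ {K} → Partition K → best ≢ 0 × AtLeastAsGood obj best K)

    wp-answer : ∀ {P s} → regs s 0 ≡ n → (∀ x → x < n → arrs s 12 x ≡ suc n ^ x) → Answer s →
      (∀ s′ → CorrectOutput obj G w l (l + d) (writeReg 0 (arrs s′ 14 0) s′) → P s′) → wp decode P s
    wp-answer {P} {s} e₀ pows (sound , optimal) end with arrs s 14 0 ≟ 0
    ... | yes z = wp-map (λ { s′ _ (_ , oa) → end s′ (inj₂
            ((λ Q → proj₁ (optimal Q) z) , trans (cong (λ f → f 0) (oa 14 tt)) z)) })
          (exec-wp decode (Outside decode s) s (outside decode s))
    ... | no nz = let e , o , δ , sol = sound nz in
      solved sol
      where
      module _ {e o δ : ℕ} (sol : Sol (allFin n) (_≡ []) (arrs s 14 0) e o (arrs s 14 1) δ) where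
        open Build G w l d pw
        open Sol sol using (closed; count)
        D : ℕ → ℕ
        D = padded (digit sol)
        D-at : ∀ v → D (toℕ v) ≡ digit sol v
        D-at = Input.padded-toℕ G w (digit sol)
        D≤ : ∀ x → x < n → D x ≤ n
        D≤ x x<n = subst (λ x → D x ≤ n) (toℕ-fromℕ< x<n)
          (≤-trans (≤-reflexive (D-at (fromℕ< x<n)))
            (≤-trans (<⇒≤ (toℕ<n (proj₁ (position-of sol (fromℕ< x<n))))) (clusters≤n (partition sol))))
        code≡ : arrs s 14 1 ≡ value (suc n) n D
        code≡ = trans (code-digits sol) (trans
          (cong sum (map-cong (λ v → cong (pw v *_) (sym (D-at v))) (allFin n)))
          (trans (total-below n (λ x → suc n ^ x * D x)) (sym (value-below (suc n) n D))))
        solved : wp decode P s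
        solved = wp-decode D e₀ pows D≤ code≡ λ s′ (_ , oa) labels → end s′ (inj₁
          (length closed , partition sol ,
            (trans (cong (λ f → f 0) (oa 14 tt)) count ,
             λ v i v∈ → trans (labels (toℕ v) (toℕ<n v)) (trans (D-at v) (digit-cluster sol v i v∈))) ,
            λ {K} Q → subst (λ k → AtLeastAsGood obj k K) count (proj₂ (optimal Q))))

    wpt-finish : ∀ {s ρ M} (let N = suc n; X = N * (M * N ^ 4)) → 1 ≤ M → Stage 0 ρ → StageState s 0 ρ →
      (∀ x → x < n → arrs s 12 x ≡ suc n ^ x) → arrs s 14 0 ≡ 0 →
      (∀ c → degree c ≤ 4 → coeff c * N ^ degree c ≤ rate c * X) →
      wpt (finalClose ⨟ scan obj ⨟ decode ⨟ ending)
        (λ t s′ → t ≤ rate finalClose * X + (rate (scan obj) * X + (rate decode * X + 3)) × CorrectOutput obj G w l (l + d) s′) s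
    wpt-finish {s} {ρ} {M} 1≤M st stst@((c1 , c3 , c4) , e₀ , _) pows zero₁₄ scale = 
      wpt-seq $ wpt-static (suc n) tt small0 small3
        (wp-finalClose {P = λ s′ → Outside finalClose s s′ × Good (arrs s′) (regs s′ 65) Closed ×
            (∀ {K} → Partition K → ∃[ q ] ∃[ m ] ∃[ e ]
              K < suc n × q < suc n × m < 2 × arrs s′ 6 (key (regs s′ 65) K q m) ≡ suc e)} st stst
          (λ s′ o good comp → o , good , comp))
        λ { s₁ t₁ ((o₁ , oa₁) , good₁ , comp₁) le₁ →
      wpt-seq $ wpt-static (suc n) (scan-static obj) (subst (_≤ suc n) (sym (o₁ 0 tt)) small0) (subst (_≤ suc n) (sym (o₁ 3 tt)) small3)
        (wp-scan d obj {P = λ s₂ → Outside (scan obj) s₁ s₂ × Answer s₂} Closed good₁ proj₂ (trans (cong (λ f → f 0) (oa₁ 14 tt)) zero₁₄)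
          λ s₂ o sound best → o ,
            (λ nz → let e , o , δ , φ , _ = sound nz in e , o , δ , φ) ,
            λ {K} Q → let q , m , e , K< , q< , m< , eq = comp₁ Q
                          n≡ = sym (trans (o₁ 3 tt) c3)
                      in best K q m e (subst (K <_) n≡ K<) (subst (q <_) n≡ q<) m< eq)
        λ { s₂ t₂ (o₂ , answer) le₂ →
      let e₀₂ : regs s₂ 0 ≡ n
          e₀₂ = trans (scan-reg0 obj s₁ s₂ o₂) (trans (o₁ 0 tt) e₀)
      in
      wpt-seq $ wpt-static (suc n) tt (≤-trans (≤-reflexive e₀₂) (n≤1+n n))
          (subst (_≤ suc n) (sym (trans (scan-reg3 obj s₁ s₂ o₂) (o₁ 3 tt))) small3)
        (wp-answer {P = λ s₃ → CorrectOutput obj G w l (l + d) (writeReg 0 (arrs s₃ 14 0) s₃)} e₀₂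
          (λ x x< → trans (cong (λ f → f x) (trans (scan-arr12 obj s₁ s₂ o₂) (oa₁ 12 tt))) (pows x x<))
          answer (λ s₃ out → out))
        λ s₃ t₃ out le₃ → wpt-set
          ( +-mono-≤ (≤-trans le₁ (scale finalClose (s≤s (s≤s z≤n)))) (+-mono-≤ (≤-trans le₂ (scan≤ obj))
              (+-monoˡ-≤ 3 (≤-trans le₃ (scale decode (s≤s (s≤s z≤n))))))
          , out) } }
      where
      small0 : regs s 0 ≤ suc n
      small0 = ≤-trans (≤-reflexive e₀) (n≤1+n n)
      small3 : regs s 3 ≤ suc n
      small3 = ≤-reflexive c3
      scan-static : ∀ obj → T (static (scan obj))
      scan-static MinNum = tt
      scan-static MaxNum = tt
      scan≤ : ∀ obj → coeff (scan obj) * suc n ^ degree (scan obj) ≤ rate (scan obj) * (suc n * (M * suc n ^ 4))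
      scan≤ MinNum = scale (scan MinNum) (s≤s (s≤s z≤n))
      scan≤ MaxNum = scale (scan MaxNum) (s≤s (s≤s z≤n))
      scan-reg0 : ∀ obj s₁ s₂ → Outside (scan obj) s₁ s₂ → regs s₂ 0 ≡ regs s₁ 0
      scan-reg0 MinNum _ _ (o , _) = o 0 tt
      scan-reg0 MaxNum _ _ (o , _) = o 0 tt
      scan-reg3 : ∀ obj s₁ s₂ → Outside (scan obj) s₁ s₂ → regs s₂ 3 ≡ regs s₁ 3
      scan-reg3 MinNum _ _ (o , _) = o 3 tt
      scan-reg3 MaxNum _ _ (o , _) = o 3 tt
      scan-arr12 : ∀ obj s₁ s₂ → Outside (scan obj) s₁ s₂ → arrs s₂ 12 ≡ arrs s₁ 12
      scan-arr12 MinNum _ _ (_ , oa) = oa 12 tt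
      scan-arr12 MaxNum _ _ (_ , oa) = oa 12 tt

restTime : Objective → ℕ → ℕ
restTime obj X = rate finalClose * X + (rate (scan obj) * X + (rate decode * X + 3))

mainTime : Objective → ℕ → ℕ
mainTime obj X = 4 + (6 + (rate dfs * X + (rate bottoms * X + (rate powers * X + (rate unitCmd * X
  + (rate leaves * X + (sealed headsCoeff * X + restTime obj X)))))))

mainCoeff : Objective → ℕ
mainCoeff obj = 13 + (rate dfs + (rate bottoms + (rate powers + (rate unitCmd + (rate leaves
  + (sealed headsCoeff + (rate finalClose + (rate (scan obj) + rate decode))))))))

mainTime-≤ : ∀ obj {X} → 1 ≤ X → mainTime obj X ≤ mainCoeff obj * X
mainTime-≤ obj {X} 1≤X = begin
  mainTime obj X
    ≡⟨ expand (rate dfs * X) (rate bottoms * X) (rate powers * X) (rate unitCmd * X) (rate leaves * X)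
         (sealed headsCoeff * X) (rate finalClose * X) (rate (scan obj) * X) (rate decode * X) ⟩
  13 + (rate dfs * X + (rate bottoms * X + (rate powers * X + (rate unitCmd * X + (rate leaves * X
    + (sealed headsCoeff * X + (rate finalClose * X + (rate (scan obj) * X + rate decode * X))))))))
    ≤⟨ +-monoˡ-≤ _ (subst (_≤ 13 * X) (*-identityʳ 13) (*-monoʳ-≤ 13 1≤X)) ⟩
  13 * X + (rate dfs * X + (rate bottoms * X + (rate powers * X + (rate unitCmd * X + (rate leaves * X
    + (sealed headsCoeff * X + (rate finalClose * X + (rate (scan obj) * X + rate decode * X))))))))
    ≡⟨ collect (rate dfs) (rate bottoms) (rate powers) (rate unitCmd) (rate leaves)
         (sealed headsCoeff) (rate finalClose) (rate (scan obj)) (rate decode) X ⟩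
  mainCoeff obj * X ∎
  where
  open ≤-Reasoning
  expand : ∀ a b c d e f g h i →
    4 + (6 + (a + (b + (c + (d + (e + (f + (g + (h + (i + 3))))))))))
      ≡ 13 + (a + (b + (c + (d + (e + (f + (g + (h + i))))))))
  expand = solve-∀
  collect : ∀ a b c d e f g h i x →
    13 * x + (a * x + (b * x + (c * x + (d * x + (e * x + (f * x + (g * x + (h * x + i * x))))))))
      ≡ (13 + (a + (b + (c + (d + (e + (f + (g + (h + i))))))))) * x
  collect = solve-∀

Ears≤ : ∀ {n} .{{_ : NonZero n}} → Graph n → (Fin n → ℕ) → ℕ → Set
Ears≤ {n} G w M = ∀ {ord vis par bot}
  (preorder : DepthFirst.Dfs n (Input.adjacency G w) n ord vis par)
  (let IEdge = λ a b → DepthFirst.E n (Input.adjacency G w) (ord a) (ord b)) →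
  Covering.Witnessed n IEdge par bot → Covering.Maximal n IEdge par bot →
  Σ (EarTree n IEdge par bot) λ tree → ∀ {h m v} → EarTree.Ear tree h m v → m ≤ M

module Solve {n : ℕ} .{{_ : NonZero n}} (G : Graph n) (w : Fin n → ℕ) (l d : ℕ) (obj : Objective)
             (conn : Connected G) {M : ℕ} (1≤M : 1 ≤ M) (ears : Ears≤ G w M) where

  open Input G w using (adjacency; crossing; 0<n; module Indexed)

  N : ℕ
  N = suc n

  X : ℕ
  X = N * (M * N ^ 4)

  N⁴≤X : N ^ 4 ≤ X
  N⁴≤X = ≤-trans (Costs.Amortised.N⁴≤Y N 1≤M)
    (subst (_≤ X) (*-identityˡ (M * N ^ 4)) (*-monoˡ-≤ (M * N ^ 4) (s≤s (z≤n {n}))))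

  1≤X : 1 ≤ X
  1≤X = ≤-trans (pow≥1 N 4) N⁴≤X

  fits : ∀ c → degree c ≤ 4 → coeff c * N ^ degree c ≤ rate c * X
  fits c deg = subst (λ k → coeff c * N ^ degree c ≤ k * X) (sealed-≡ (coeff c))
    (*-monoʳ-≤ (coeff c) (≤-trans (^-monoʳ-≤ N deg) N⁴≤X))

  start : State
  start = input G w l (l + d)

  begun : State
  begun = writeReg 4 (suc ((l + d) ∸ l)) (writeReg 3 (suc n) start)

  Result : ℕ → State → Set
  Result t s = t ≤ mainTime obj X × CorrectOutput obj G w l (l + d) s

  record Unchanged (s s′ : State) : Set where
    constructor unchanged
    field
      reg-0  : regs s′ 0 ≡ regs s 0
      reg-1  : regs s′ 1 ≡ regs s 1
      reg-3  : regs s′ 3 ≡ regs s 3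
      reg-4  : regs s′ 4 ≡ regs s 4
      arr-14 : arrs s′ 14 ≡ arrs s 14
  open Unchanged

  later : ∀ {s s′ s″} → Unchanged s s′ → Unchanged s′ s″ → Unchanged s s″
  later (unchanged a b c e f) (unchanged a′ b′ c′ e′ f′) =
    unchanged (trans a′ a) (trans b′ b) (trans c′ c) (trans e′ e) (trans f′ f)

  small : ∀ {s} → Unchanged begun s → regs s 0 ≤ N × regs s 3 ≤ N
  small un = ≤-trans (≤-reflexive (reg-0 un)) (n≤1+n n) , ≤-reflexive (reg-3 un)

  module _ {ord vis par bot : ℕ → ℕ} (preorder : DepthFirst.Dfs n adjacency n ord vis par)
           (tree : EarTree n (λ a b → DepthFirst.E n adjacency (ord a) (ord b)) par bot)
           (ear≤M : ∀ {h m v} → EarTree.Ear tree h m v → m ≤ M) where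
    open HeadsLoop G w l d preorder tree 1≤M ear≤M
    open Stages G w preorder tree using (Stage; stage-start)
    open Finish G w l d preorder tree using (wpt-finish)

    consts : ∀ {s} → Unchanged begun s → Consts s
    consts un = reg-1 un , reg-3 un , trans (reg-4 un) (cong suc (m+n∸m≡n l d))

    dynamic : ∀ {s} → Unchanged begun s → arrs s 0 ≡ padded w → arrs s 2 ≡ ord → arrs s 4 ≡ par → arrs s 5 ≡ bot →
      regs s 5 ≡ 0 → (∀ x → arrs s 6 x ≡ 0) → (∀ x → arrs s 10 x ≡ 0) →
      wpt (powers ⨟ unitCmd ⨟ leaves ⨟ headsCmd ⨟ finalClose ⨟ scan obj ⨟ decode ⨟ set 0 (arr 14 (lit 0)))
        (λ t s′ → t ≤ rate powers * X + (rate unitCmd * X + (rate leaves * X + (sealed headsCoeff * X + restTime obj X)))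
                × CorrectOutput obj G w l (l + d) s′) s
    dynamic {s} un e-w e-ord e-par e-bot e₅ zero₆ zero₁₀ =
      wpt-seq $ wpt-static N tt (proj₁ (small un)) (proj₂ (small un))
        (wp-powers {P = λ s′ → Outside powers s s′ × (∀ x → x < n → arrs s′ 12 x ≡ suc n ^ x)}
          (reg-0 un) (reg-3 un) λ s′ o f → o , f)
        λ { s₁ t₁ ((o₁ , oa₁) , pows₁) le₁ →
      let un₁ : Unchanged begun s₁
          un₁ = later un (unchanged (o₁ 0 tt) (o₁ 1 tt) (o₁ 3 tt) (o₁ 4 tt) (oa₁ 14 tt))
          fresh₁ : Fresh s₁
          fresh₁ = λ t _ k q m → trans (cong (λ f → f (key t k q m)) (oa₁ 6 tt)) (zero₆ (key t k q m))
      in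
      wpt-seq $ wpt-static N tt (proj₁ (small un₁)) (proj₂ (small un₁))
        (wp-unitCmd {P = λ s′ → Outside unitCmd s₁ s′ × Fresh s′ × UnitTable s′ (regs s′ 64)} (consts un₁) fresh₁
          (λ x → trans (cong (λ f → f x) (oa₁ 10 tt)) (zero₁₀ x)) λ s′ o fr u → o , fr , u)
        λ { s₂ t₂ ((o₂ , oa₂) , fresh₂ , unit₂) le₂ →
      let un₂ : Unchanged begun s₂
          un₂ = later un₁ (unchanged (o₂ 0 tt) (o₂ 1 tt) (o₂ 3 tt) (o₂ 4 tt) (oa₂ 14 tt))
          pows₂ : ∀ x → x < n → arrs s₂ 12 x ≡ suc n ^ x
          pows₂ x x< = trans (cong (λ f → f x) (oa₂ 12 tt)) (pows₁ x x<)
      in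
      wpt-seq $ wpt-static N tt (proj₁ (small un₂)) (proj₂ (small un₂))
        (wp-leaves {P = λ s′ → Outside leaves s₂ s′ × Fresh s′ × UnitTable s′ (regs s′ 64) × (∀ y → y < n → _)}
          (consts un₂) (reg-0 un₂) fresh₂ unit₂
          (trans (oa₂ 0 tt) (trans (oa₁ 0 tt) e-w)) (trans (oa₂ 2 tt) (trans (oa₁ 2 tt) e-ord)) pows₂
          λ s′ o fr u tabs → o , fr , u , tabs)
        λ { s₃ t₃ ((o₃ , oa₃) , fresh₃ , unit₃ , tabs₃) le₃ →
      let un₃ : Unchanged begun s₃
          un₃ = later un₂ (unchanged (o₃ 0 tt) (o₃ 1 tt) (o₃ 3 tt) (o₃ 4 tt) (oa₃ 14 tt))
          pows₃ : ∀ x → x < n → arrs s₃ 12 x ≡ suc n ^ x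
          pows₃ x x< = trans (cong (λ f → f x) (oa₃ 12 tt)) (pows₂ x x<)
          ρ , st , leaf = stage-start {n} ≤-refl
      in
      wpt-seq $ wpt-map (λ { t₄ s₄ (o₄ , oa₄) ((ρ′ , st′ , state′) , le₄) →
        wpt-map (λ { t₅ s₅ _ (le₅ , out) →
            +-mono-≤ (≤-trans le₁ (fits powers (s≤s z≤n))) (+-mono-≤ (≤-trans le₂ (fits unitCmd z≤n))
              (+-mono-≤ (≤-trans le₃ (fits leaves (s≤s z≤n)))
                (+-mono-≤ (subst (λ k → t₄ ≤ k * X) (sealed-≡ headsCoeff) le₄) le₅))) , out })
          (wpt-finish obj 1≤M st′ state′
            (λ x x< → trans (cong (λ f → f x) (oa₄ 12 tt)) (pows₃ x x<))
            (trans (cong (λ f → f 0) (trans (oa₄ 14 tt) (arr-14 un₃))) refl)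
            fits) })
        (wpt-heads st
          ( consts un₃ , reg-0 un₃ , trans (oa₃ 4 tt) (trans (oa₂ 4 tt) (trans (oa₁ 4 tt) e-par))
          , trans (oa₃ 5 tt) (trans (oa₂ 5 tt) (trans (oa₁ 5 tt) e-bot))
          , fresh₃ , unit₃ , λ y y<n _ → table-↭ (↭-sym (leaf y<n)) (tabs₃ y y<n))) } } }

  correct : wpt (main obj) Result start
  correct =
    wpt-seq $ wpt-set $ wpt-seq $ wpt-set $
    wpt-seq $ wpt-static N tt (n≤1+n n) ≤-refl
      (wp-dfs {n} {adjacency} {P = λ s′ → Outside dfs begun s′ × DepthFirst.Dfs n adjacency n (arrs s′ 2) (arrs s′ 3) (arrs s′ 4)}
        0<n (crossing conn) refl refl (λ _ → refl) (λ _ → refl) λ s′ o preorder → o , preorder)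
      λ { s₁ t₁ ((o₁ , oa₁) , preorder) le₁ →
    let un₁ : Unchanged begun s₁
        un₁ = unchanged (o₁ 0 tt) (o₁ 1 tt) (o₁ 3 tt) (o₁ 4 tt) (oa₁ 14 tt)
        open DepthFirst.Dfs preorder using (par<; edge-anc)
    in
    wpt-seq $ wpt-static N tt (proj₁ (small un₁)) (proj₂ (small un₁))
      (wp-bottoms par< {P = λ s′ → Outside bottoms s₁ s′ ×
          Covering.Witnessed n (λ a b → DepthFirst.E n adjacency (arrs s₁ 2 a) (arrs s₁ 2 b)) (arrs s₁ 4) (arrs s′ 5) ×
          Covering.Maximal n (λ a b → DepthFirst.E n adjacency (arrs s₁ 2 a) (arrs s₁ 2 b)) (arrs s₁ 4) (arrs s′ 5)}
        (o₁ 0 tt) (oa₁ 1 tt) refl refl (λ x → cong (λ f → f x) (oa₁ 5 tt)) edge-anc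
        λ s′ o wit max → o , wit , λ {a} {b} {x} → max {a} {b} {x})
      λ { s₂ t₂ ((o₂ , oa₂) , wit , max) le₂ →
    let tree , ear≤M = ears preorder wit max in
    wpt-map (λ { t₃ s₃ _ (le₃ , out) →
        +-monoʳ-≤ 4 (+-monoʳ-≤ 6 (+-mono-≤ (≤-trans le₁ (fits dfs (s≤s (s≤s (s≤s z≤n)))))
          (+-mono-≤ (≤-trans le₂ (fits bottoms (s≤s (s≤s (s≤s z≤n))))) le₃))) , out })
      (dynamic preorder tree ear≤M
        (later un₁ (unchanged (o₂ 0 tt) (o₂ 1 tt) (o₂ 3 tt) (o₂ 4 tt) (oa₂ 14 tt)))
        (trans (oa₂ 0 tt) (oa₁ 0 tt)) (oa₂ 2 tt) (oa₂ 4 tt) refl (trans (o₂ 5 tt) (o₁ 5 tt))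
        (λ x → cong (λ f → f x) (trans (oa₂ 6 tt) (oa₁ 6 tt)))
        (λ x → cong (λ f → f x) (trans (oa₂ 10 tt) (oa₁ 10 tt)))) } }

main-wellFormed : ∀ obj → T (wellFormed (main obj))
main-wellFormed MinNum = tt
main-wellFormed MaxNum = tt

solves : ∀ obj {n} .{{_ : NonZero n}} (G : Graph n) (w : Fin n → ℕ) {l u} → l ≤ u → Connected G →
  ∀ {M} → 1 ≤ M → Ears≤ G w M →
  SolvesWithin obj (compile (main obj)) G w l u (mainCoeff obj * (suc n * (M * suc n ^ 4)))
solves obj {n} G w {l} {u} l≤u conn {M} 1≤M ears =
  subst (λ u → SolvesWithin obj (compile (main obj)) G w l u (mainCoeff obj * S.X)) (m+[n∸m]≡n l≤u)
    (let t , s , run , le , out = wpt-compile (main-wellFormed obj) S.correct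
     in t , s , run , ≤-trans le (mainTime-≤ obj S.1≤X) , out)
  where
  module S = Solve G w l (u ∸ l) obj conn 1≤M ears

tree-ears : ∀ {n} .{{_ : NonZero n}} (G : Graph n) (w : Fin n → ℕ) → ¬ SimpleCycle G → Ears≤ G w 1
tree-ears {n} G w acyclic preorder wit max = tree , λ ear → short ear
  where
  facts = Input.Indexed.tree-earTree G w preorder acyclic wit max
  tree = proj₁ facts
  short : ∀ {h m v} → EarTree.Ear tree h m v → m ≤ 1
  short {h} {m} {v} ear = ≮⇒≥ λ 2≤m →
    case distinct (s≤s z≤n) (<⇒≤ 2≤m) (s≤s z≤n) 2≤m
      (trans (sym (proj₂ facts (bound (s≤s z≤n) (<⇒≤ 2≤m)))) (trans (trans (inside (s≤s z≤n) (<⇒≤ 2≤m)) (sym (inside (s≤s z≤n) 2≤m)))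
        (proj₂ facts (bound (s≤s z≤n) 2≤m)))) of λ ()
    where open EarTree.Ear ear

cactus-ears : ∀ {n} .{{_ : NonZero n}} (G : Graph n) (w : Fin n → ℕ) → IsCactus G → Ears≤ G w n
cactus-ears {n} G w cac preorder wit max = tree , λ ear → bounded-length ear
  where
  tree = Input.Indexed.cactus-earTree G w preorder cac wit max
  bounded-length : ∀ {h m v} → EarTree.Ear tree h m v → m ≤ n
  bounded-length {h} {m} {v} ear = ≤-pred (begin-strict
    m             <⟨ m<n+m m (pos 1≤m ≤-refl) ⟩
    v m + m       ≤⟨ falls m 1≤m ≤-refl ⟩
    v 1 + 1       ≡⟨ +-comm (v 1) 1 ⟩
    suc (v 1)     ≤⟨ bound ≤-refl 1≤m ⟩
    n             <⟨ n<1+n n ⟩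
    suc n         ∎)
    where
    open EarTree.Ear ear
    open ≤-Reasoning
    falls : ∀ i → 1 ≤ i → i ≤ m → v i + i ≤ v 1 + 1
    falls (suc zero) _ _ = ≤-refl
    falls (suc (suc i)) _ i≤m = ≤-trans (≤-reflexive (+-suc (v (suc (suc i))) (suc i)))
      (≤-trans (+-monoˡ-≤ (suc i) (decreasing (s≤s z≤n) (n<1+n (suc i)) i≤m)) (falls (suc i) (s≤s z≤n) (<⇒≤ i≤m)))

^-distribʳ-* : ∀ k a b → (a * b) ^ k ≡ a ^ k * b ^ k
^-distribʳ-* zero    a b = refl
^-distribʳ-* (suc k) a b = trans (cong (a * b *_) (^-distribʳ-* k a b)) (interchange a b (a ^ k) (b ^ k))
  where
  interchange : ∀ a b x y → a * b * (x * y) ≡ a * x * (b * y)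
  interchange = solve-∀

suc-pow-≤ : ∀ n .{{_ : NonZero n}} k → suc n ^ k ≤ 2 ^ k * n ^ k
suc-pow-≤ n k = ≤-trans (^-monoˡ-≤ k (≤-trans (+-monoˡ-≤ n (>-nonZero⁻¹ n)) (≤-reflexive (cong (n +_) (sym (+-identityʳ n))))))
  (≤-reflexive (^-distribʳ-* k 2 n))

degree-bound : ∀ c n .{{_ : NonZero n}} k {x} → x ≤ suc n ^ k → c * x ≤ (c * 2 ^ k) * n ^ k
degree-bound c n k x≤ = ≤-trans (*-monoʳ-≤ c (≤-trans x≤ (suc-pow-≤ n k))) (≤-reflexive (sym (*-assoc c (2 ^ k) (n ^ k))))

within-bound : ∀ {obj p n} {G : Graph n} {w l u b b′} → b ≤ b′ → SolvesWithin obj p G w l u b → SolvesWithin obj p G w l u b′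
within-bound b≤ (t , s , run , le , out) = t , s , run , ≤-trans le b≤ , out

tree-solvable : ∀ obj → SolvableInTime obj IsTree 5
tree-solvable obj = compile (main obj) , mainCoeff obj * 2 ^ 5 , λ n G w l u l≤u (conn , acyclic) →
  within-bound {obj} {compile (main obj)} {n} {G} {w} {l} {u}
    (degree-bound (mainCoeff obj) n 5 (*-monoʳ-≤ (suc n) (≤-reflexive (*-identityˡ (suc n ^ 4)))))
    (solves obj G w l≤u conn ≤-refl (tree-ears G w acyclic))

cactus-solvable : ∀ obj → SolvableInTime obj IsCactus 6
cactus-solvable obj = compile (main obj) , mainCoeff obj * 2 ^ 6 , λ n G w l u l≤u cac →
  within-bound {obj} {compile (main obj)} {n} {G} {w} {l} {u}
    (degree-bound (mainCoeff obj) n 6 (*-monoʳ-≤ (suc n) (*-monoˡ-≤ (suc n ^ 4) (n≤1+n n))))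
    (solves obj G w l≤u (proj₁ cac) (>-nonZero⁻¹ n) (cactus-ears G w cac))

theorem4 : (SolvableInTime MinNum IsTree 5 × SolvableInTime MaxNum IsTree 5)
         × (SolvableInTime MinNum IsCactus 6 × SolvableInTime MaxNum IsCactus 6)
theorem4 = (tree-solvable MinNum , tree-solvable MaxNum) , (cactus-solvable MinNum , cactus-solvable MaxNum)
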